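{- For every $k\ge1$, $\ell\ge 1$ and $\mu\in\mathrm{Par}^k_\ell$, the $k$-Schur function $s^{(k)}_\mu(x;t)$ equals the Catalan function $\mathfrak{s}^{(k)}_\mu(x;t)=H(\Delta^k(\mu);\mu)$.
   Context: $\Lambda$ is the ring of symmetric functions over $\mathbb{Q}(t)$ in $x=(x_1,x_2,\dots)$; $h_d$ are complete homogeneous symmetric functions ($h_0=1$, $h_d=0$ for $d<0$). For $\gamma\in\mathbb Z^\ell$, $s_\gamma:=\det(h_{\gamma_i+j-i})_{1\le i,j\le \ell}$. Let $\Delta^+_\ell=\{(i,j):1\le i<j\le\ell\}$. For $\Psi\subset\Delta^+_\ell$ and $\gamma\in\mathbb Z^\ell$, $H(\Psi;\gamma)$ is obtained by expanding $\prod_{(i,j)\in\Psi}(1-tz_i/z_j)^{ -1}z^\gamma$ as a power series in $t$ and applying coefficientwise the linear map $z^\beta\mapsto s_\beta$. $\mathrm{Par}^k_\ell=\{\mu\in\mathbb Z^\ell:k\ge\mu_1\ge\dots\ge\mu_\ell\ge0\}$; $\mathrm{Par}^k$ is the set of partitions with largest part $\le k$; partitions are identified with themselves padded by zeros. $\Delta^k(\mu)=\{(i,j)\in\Delta^+_\ell: k-\mu_i+i<j\}$. Hook length of a box (English notation): number of boxes below it in its column plus those weakly to its right in its row. A $(k+1)$-core is a partition with no box of hook length $k+1$; $\mathfrak p(\kappa)$ has $r$-th part equal to the number of boxes in row $r$ of $\kappa$ with hook length $\le k$, a bijection from $(k+1)$-cores to $\mathrm{Par}^k$. A strong cover $\tau\Rightarrow\kappa$: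 $(k+1)$-cores with $\tau\subset\kappa$, $|\mathfrak p(\tau)|+1=|\mathfrak p(\kappa)|$; a strong marked cover $\tau\xRightarrow{r}\kappa$ adds a positive integer $r$ equal to the smallest row index of some connected component of $\kappa/\tau$; its spin is $c(h-1)+N$ with $c$ the number of components of $\kappa/\tau$, $h$ the common number of rows of each component, $N$ the number of components entirely in rows $>r$. For $\eta\in\mathbb Z^\infty_{\ge0}$, $m=|\eta|<\infty$, a strong marked tableau of weight $\eta$ is a chain $\kappa^{(0)}\xRightarrow{r_1}\cdots\xRightarrow{r_m}\kappa^{(m)}$ of strong marked covers with $r_{v_i+1}\ge\dots\ge r_{v_i+\eta_i}$ for all $i$ ($v_i=\eta_1+\dots+\eta_{i-1}$); its spin is the sum of spins of its covers; $\mathrm{SMT}^k_\eta(\mu)$ is the set of those with $\mathfrak p(\kappa^{(m)})=\mu$. The $k$-Schur function is $s^{(k)}_\mu(x;t)=\sum_{\eta\in\mathbb Z^\infty_{\ge0},\,|\eta|=|\mu|}\sum_{T\in\mathrm{SMT}^k_\eta(\mu)}t^{\mathrm{spin}(T)}x^\eta$. -}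

module Defs where

open import Data.Bool using (Bool; true; false; _∧_; _∨_; not; if_then_else_)
open import Data.Nat as ℕ using (ℕ; zero; suc; _+_; _*_; _∸_; _≤_; _<_; _≥_; _≡ᵇ_; _≤ᵇ_; _<ᵇ_; _⊓_; _⊔_)
open import Data.Integer as ℤ using (ℤ; +_; -[1+_])
open import Data.Nat.ListAction using (sum)
open import Data.Bool.ListAction using (all; any)
open import Data.List using (List; []; _∷_; length; map; concatMap; upTo; foldr; applyUpTo; filterᵇ; take; drop; tabulate; cartesianProduct; allFin)
open import Data.List.Relation.Unary.Linked using (Linked)
open import Data.List.Relation.Unary.All using (All)
open import Data.List.Relation.Unary.Any using (Any)
open import Data.List.Relation.Unary.Unique.Propositional using (Unique)
open import Data.List.Membership.Propositional using (_∈_)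
open import Data.Fin as Fin using (Fin; toℕ; punchIn)
open import Data.Product using (Σ; _×_; _,_; proj₁; proj₂)
open import Data.Unit using (⊤)
open import Function.Bundles using (_⇔_)
open import Relation.Nullary.Decidable using (⌊_⌋)
open import Relation.Binary.PropositionalEquality using (_≡_; _≢_)

-- Partitions and (k+1)-cores.
-- A partition is a list of positive, weakly decreasing parts (no trailing
-- zeros, so every partition has a unique representation).  Rows and
-- columns are 1-based; `part λ r` is the r-th part (0 if r = 0 or r > ℓ(λ)),
-- i.e. λ is identified with its zero padding.

part : List ℕ → ℕ → ℕ
part []       r             = 0
part (x ∷ xs) zero          = 0
part (x ∷ xs) (suc zero)    = x
part (x ∷ xs) (suc (suc r)) = part xs (suc r)

IsPartition : List ℕ → Set
IsPartition λ′ = Linked _≥_ λ′ × All (0 <_) λ′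

colLen : List ℕ → ℕ → ℕ
colLen λ′ c = length (filterᵇ (λ x → c ≤ᵇ x) λ′)

hook : List ℕ → ℕ → ℕ → ℕ
hook λ′ r c = (colLen λ′ c ∸ r) + (suc (part λ′ r) ∸ c)

IsCore : ℕ → List ℕ → Set
IsCore k κ = IsPartition κ ×
  ((r c : ℕ) → 1 ≤ r → 1 ≤ c → c ≤ part κ r → hook κ r c ≢ suc k)

pRow : ℕ → List ℕ → ℕ → ℕ
pRow k κ r = length (filterᵇ (λ c → hook κ r c ≤ᵇ k) (map suc (upTo (part κ r))))

𝔭 : ℕ → List ℕ → List ℕ
𝔭 k κ = applyUpTo (λ i → pRow k κ (suc i)) (length κ)

StrongCover : ℕ → List ℕ → List ℕ → Set
StrongCover k τ κ = IsCore k τ × IsCore k κ ×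
  ((r : ℕ) → part τ r ≤ part κ r) × (sum (𝔭 k τ) + 1 ≡ sum (𝔭 k κ))

Box : Set
Box = ℕ × ℕ   -- (row, column), 1-based

skewBoxes : List ℕ → List ℕ → List Box
skewBoxes τ κ = concatMap (λ i → map (λ j → (suc i , part τ (suc i) + suc j))
                                     (upTo (part κ (suc i) ∸ part τ (suc i))))
                          (upTo (length κ))

eqBox : Box → Box → Bool
eqBox (r , c) (r′ , c′) = (r ≡ᵇ r′) ∧ (c ≡ᵇ c′)

adjacent : Box → Box → Bool
adjacent (r , c) (r′ , c′) =
  ((r ≡ᵇ r′) ∧ ((suc c ≡ᵇ c′) ∨ (suc c′ ≡ᵇ c))) ∨
  ((c ≡ᵇ c′) ∧ ((suc r ≡ᵇ r′) ∨ (suc r′ ≡ᵇ r)))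

grow : List Box → List Box → List Box
grow B S = filterᵇ (λ x → any (λ y → eqBox x y ∨ adjacent x y) S) B

iter : {A : Set} → ℕ → (A → A) → A → A
iter zero    f a = a
iter (suc n) f a = iter n f (f a)

component : List Box → Box → List Box
component B b = iter (length B) (grow B) (b ∷ [])

lexLeq : Box → Box → Bool
lexLeq (r , c) (r′ , c′) = (r <ᵇ r′) ∨ ((r ≡ᵇ r′) ∧ (c ≤ᵇ c′))

-- the connected components of B, each listed once (via its lex-least box)
components : List Box → List (List Box)
components B = map (component B)
  (filterᵇ (λ b → all (lexLeq b) (component B b)) B)

topRow : List Box → ℕ
topRow []            = 0
topRow ((r , _) ∷ S) = foldr _⊓_ r (map proj₁ S)

bottomRow : List Box → ℕ
bottomRow []            = 0
bottomRow ((r , _) ∷ S) = foldr _⊔_ r (map proj₁ S)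

height : List Box → ℕ
height S = suc (bottomRow S) ∸ topRow S

heightAt : ℕ → List (List Box) → ℕ
heightAt r []       = 0
heightAt r (S ∷ Cs) = if topRow S ≡ᵇ r then height S else heightAt r Cs

MarkedCover : ℕ → List ℕ → ℕ → List ℕ → Set
MarkedCover k τ r κ = StrongCover k τ κ × 1 ≤ r ×
  Any (λ S → topRow S ≡ r) (components (skewBoxes τ κ))

coverSpin : List ℕ → ℕ → List ℕ → ℕ
coverSpin τ r κ =
  let Cs = components (skewBoxes τ κ) in
  length Cs * (heightAt r Cs ∸ 1) + length (filterᵇ (λ S → r <ᵇ topRow S) Cs)

-- Strong marked tableaux: κ⁽⁰⁾ together with the list of steps (rᵢ , κ⁽ⁱ⁾).

Chain : Set
Chain = List ℕ × List (ℕ × List ℕ)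

ChainOK : ℕ → List ℕ → List (ℕ × List ℕ) → Set
ChainOK k κ []              = IsCore k κ
ChainOK k κ ((r , κ′) ∷ st) = MarkedCover k κ r κ′ × ChainOK k κ′ st

final : List ℕ → List (ℕ × List ℕ) → List ℕ
final κ []              = κ
final κ ((r , κ′) ∷ st) = final κ′ st

chainSpin : List ℕ → List (ℕ × List ℕ) → ℕ
chainSpin κ []              = 0
chainSpin κ ((r , κ′) ∷ st) = coverSpin κ r κ′ + chainSpin κ′ st

BlocksOK : List ℕ → List ℕ → Set
BlocksOK []      ms = ⊤
BlocksOK (e ∷ η) ms = Linked _≥_ (take e ms) × BlocksOK η (drop e ms)

IsSMT : ℕ → List ℕ → List ℕ → Chain → Set
IsSMT k η μ (κ₀ , st) = ChainOK k κ₀ st × length st ≡ sum η ×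
  BlocksOK η (map proj₁ st) × ((r : ℕ) → part (𝔭 k (final κ₀ st)) r ≡ part μ r)

spin : Chain → ℕ
spin (κ₀ , st) = chainSpin κ₀ st

-- the strong marked tableaux contributing to the coefficient of x^η t^d
-- in s^{(k)}_μ(x;t) (only η with |η| = |μ| occur in the definition)
KSchurTerm : ℕ → List ℕ → List ℕ → ℕ → Chain → Set
KSchurTerm k μ η d T = sum η ≡ sum μ × IsSMT k η μ T × spin T ≡ d

HasCard : {A : Set} → (A → Set) → ℕ → Set
HasCard {A} P n = Σ (List A) λ L → Unique L × ((x : A) → (x ∈ L) ⇔ P x) × length L ≡ n

-- Symmetric functions, represented by their monomial coefficients:
-- a map sending η (exponent vector of x^η, finite support) to ℤ.

Ser : Set
Ser = List ℕ → ℤ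

oneS : Ser
oneS η = if all (λ e → e ≡ᵇ 0) η then + 1 else + 0

zeroS : Ser
zeroS η = + 0

_⊕_ : Ser → Ser → Ser
(f ⊕ g) η = f η ℤ.+ g η

scaleS : ℤ → Ser → Ser
scaleS a f η = a ℤ.* f η

sumℤ : List ℤ → ℤ
sumℤ = foldr ℤ._+_ (+ 0)

splits : List ℕ → List (List ℕ × List ℕ)
splits []      = ([] , []) ∷ []
splits (n ∷ η) = concatMap (λ a → map (λ p → (a ∷ proj₁ p , (n ∸ a) ∷ proj₂ p)) (splits η))
                           (upTo (suc n))

_⊛_ : Ser → Ser → Ser
(f ⊛ g) η = sumℤ (map (λ p → f (proj₁ p) ℤ.* g (proj₂ p)) (splits η))

hS : ℤ → Ser
hS (+ n)    η = if sum η ≡ᵇ n then + 1 else + 0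
hS -[1+ _ ] η = + 0

altSign : ℕ → ℤ
altSign zero          = + 1
altSign (suc zero)    = ℤ.- (+ 1)
altSign (suc (suc n)) = altSign n

sumFin : (n : ℕ) → (Fin n → Ser) → Ser
sumFin zero    f = zeroS
sumFin (suc n) f = f Fin.zero ⊕ sumFin n (λ j → f (Fin.suc j))

det : (n : ℕ) → (Fin n → Fin n → Ser) → Ser
det zero    M = oneS
det (suc n) M = sumFin (suc n) λ j →
  scaleS (altSign (toℕ j)) (M Fin.zero j ⊛ det n (λ i j′ → M (Fin.suc i) (punchIn j j′)))

schur : (ℓ : ℕ) → (Fin ℓ → ℤ) → Ser
schur ℓ γ = det ℓ (λ i j → hS ((γ i ℤ.+ + toℕ j) ℤ.- + toℕ i))

-- exponent vectors β appearing with t^d in ∏_{(i,j)∈Ψ} (1 - t zᵢ/zⱼ)^{-1},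
-- with multiplicity (one entry per tuple of exponents (n_{ij}) with Σ n = d)
rootVec : {ℓ : ℕ} → ℕ → Fin ℓ → Fin ℓ → Fin ℓ → ℤ
rootVec n i j x = (if ⌊ x Fin.≟ i ⌋ then + n else + 0) ℤ.- (if ⌊ x Fin.≟ j ⌋ then + n else + 0)

shifts : {ℓ : ℕ} → List (Fin ℓ × Fin ℓ) → ℕ → List (Fin ℓ → ℤ)
shifts []              zero    = (λ _ → + 0) ∷ []
shifts []              (suc d) = []
shifts ((i , j) ∷ Ψ) d =
  concatMap (λ n → map (λ v x → v x ℤ.+ rootVec n i j x) (shifts Ψ (d ∸ n))) (upTo (suc d))

catalanCoeff : (ℓ : ℕ) → List (Fin ℓ × Fin ℓ) → (Fin ℓ → ℤ) → ℕ → List ℕ → ℤ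
catalanCoeff ℓ Ψ γ d η = sumℤ (map (λ δ → schur ℓ (λ x → γ x ℤ.+ δ x) η) (shifts Ψ d))

-- Δ^k(μ) = {(i,j) : 1 ≤ i < j ≤ ℓ, k - μᵢ + i < j} (0-based indices here,
-- the condition is invariant under the shift)
Δk : (k ℓ : ℕ) → (Fin ℓ → ℕ) → List (Fin ℓ × Fin ℓ)
Δk k ℓ μ = filterᵇ (λ p → (toℕ (proj₁ p) <ᵇ toℕ (proj₂ p)) ∧
                           (((k ∸ μ (proj₁ p)) + toℕ (proj₁ p)) <ᵇ toℕ (proj₂ p)))
                   (cartesianProduct (allFin ℓ) (allFin ℓ))

IsParKℓ : (k ℓ : ℕ) → (Fin ℓ → ℕ) → Set
IsParKℓ k ℓ μ = ((i : Fin ℓ) → μ i ≤ k) × ((i j : Fin ℓ) → toℕ i ≤ toℕ j → μ j ≤ μ i)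

-- A core κ with at most ℓ rows is encoded by σ r = k + 1 + r − 𝔭(κ)ᵣ (rows from 0), the first column of row r of the
-- root ideal Δᵏ(𝔭(κ)); on beads, σ steps to the next bead of the same runner. Both sides of the identity satisfy the
-- same recursion, which removes one box of the weight at a time and ends in the empty core.
-- Tableaux: by Lascoux's description every strong cover of κ removes equal ribbons whose top rows y, σ⁻¹ y, σ⁻² y, ...
-- exhaust the part above y of a runner, so the covers with mark in row z are indexed by the rows y = σʲ z that are
-- removable, and height, number of components and j give the spin.
-- Catalan functions: the coefficient of the last variable, to the power m, lowers the rows of the weight by m boxes.
-- It is encoded by an additional "ghost" row whose roots (ℓ , z), z = 0, 1, ..., are removed one after the other. Each
-- removal leaves terms in which one row y of the orbit z, σ z, σ² z, ... has lost its first root and a box. Straightening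
-- along the runner of y shows that such a term is 0, or a power of t times the Catalan function of the smaller core,
-- according to whether y is removable; the power of t is the spin of the cover.

module Submission where

-- The offsets `σ` make ribbons, root ideals and weights linear data. Removing t + 1 ribbons of m +
-- 1 rows adds 1 to `σ` on rows y, ..., y + m and subtracts 1 on m rows above all the ribbons;
-- whatever happens on the levels in between cancels. Straightening produces the same change, one
-- level of the runner at a time. Its intermediate stages are in general not strictly increasing and
-- do not come from cores, so the Catalan side `𝕋` is defined for every function `σ : ℕ → ℕ`. A
-- straightening step exchanges two adjacent indices, which is legitimate only if no other row, the
-- ghost included, has its first root in the second of the two columns. The ghost keeps clear
-- because only rows on its own orbit ever lose a box. Every ghost root brings a factor t that has
-- no counterpart in the spin. It is carried along as t ^ M, where M is the number of boxes the
-- ghost still has to remove, and cancelled when the ghost is exchanged for a variable.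

-- Linear inequalities over the natural numbers by Farkas certificates.

module Linear where
  open import Data.Nat using (ℕ; zero; suc; _+_; _*_; _≤_; z≤n; _≤ᵇ_)
  open import Data.Nat.Properties
  open import Data.List using (List; []; _∷_)
  open import Data.Bool using (Bool; true; T; _∧_)
  open import Data.Unit using (tt)
  open import Data.Empty using (⊥)
  open import Data.Product using (_×_; _,_; proj₁; proj₂)
  open import Relation.Binary.PropositionalEquality
  open import Data.Nat.Solver using (module +-*-Solver)

  infixl 6 _⊹_
  data Lx : Set where
    𝕧 𝕔 : ℕ → Lx
    1+  : Lx → Lx
    _⊹_ : Lx → Lx → Lx

  private
    at : List ℕ → ℕ → ℕ
    at []      _       = 0
    at (x ∷ ρ) zero    = x
    at (x ∷ ρ) (suc i) = at ρ i

    ev : List ℕ → Lx → ℕ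
    ev ρ (𝕧 i)   = at ρ i
    ev ρ (𝕔 n)   = n
    ev ρ (1+ e)  = suc (ev ρ e)
    ev ρ (e ⊹ f) = ev ρ e + ev ρ f

  -- Each fact is used as `a ≤ b`, and `fact k` counts `k` times. `:≥` also puts `a` on the small
  -- side and `b` on the large side, but takes an equation proved in the opposite direction, which
  -- saves a `sym`.
  data Fact (ρ : List ℕ) : Set where
    fact : (k : ℕ) (a b : Lx) → ev ρ a ≤ ev ρ b → Fact ρ
    :≤   : (a b : Lx) → ev ρ a ≤ ev ρ b → Fact ρ
    :≡   : (a b : Lx) → ev ρ a ≡ ev ρ b → Fact ρ
    :≥   : (a b : Lx) → ev ρ b ≡ ev ρ a → Fact ρ

  data Equation (ρ : List ℕ) : Set where
    :≡ : (a b : Lx) → ev ρ a ≡ ev ρ b → Equation ρ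
    :≥ : (a b : Lx) → ev ρ b ≡ ev ρ a → Equation ρ

  private
    -- A normal form lists the constant term and then the coefficients.
    addN : List ℕ → List ℕ → List ℕ
    addN []       ys       = ys
    addN (x ∷ xs) []       = x ∷ xs
    addN (x ∷ xs) (y ∷ ys) = x + y ∷ addN xs ys

    unitN : ℕ → List ℕ
    unitN zero    = 1 ∷ []
    unitN (suc i) = 0 ∷ unitN i

    scaleN : ℕ → List ℕ → List ℕ
    scaleN zero    xs = []
    scaleN (suc k) xs = addN xs (scaleN k xs)

    nf : Lx → List ℕ
    nf (𝕧 i)   = 0 ∷ unitN i
    nf (𝕔 n)   = n ∷ []
    nf (1+ e)  = addN (1 ∷ []) (nf e)
    nf (e ⊹ f) = addN (nf e) (nf f)

    dot : List ℕ → List ℕ → ℕ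
    dot ρ       []       = 0
    dot []      (k ∷ ks) = 0
    dot (x ∷ ρ) (k ∷ ks) = k * x + dot ρ ks

    evN : List ℕ → List ℕ → ℕ
    evN ρ ks = dot (1 ∷ ρ) ks

    leN : List ℕ → List ℕ → Bool
    leN []       ys       = true
    leN (x ∷ xs) []       = (x ≤ᵇ 0) ∧ leN xs []
    leN (x ∷ xs) (y ∷ ys) = (x ≤ᵇ y) ∧ leN xs ys

    lefts rights : {ρ : List ℕ} → List (Fact ρ) → List ℕ
    lefts  []                  = []
    lefts  (fact k a b _ ∷ fs) = addN (scaleN k (nf a)) (lefts fs)
    lefts  (:≤ a b _ ∷ fs)     = addN (nf a) (lefts fs)
    lefts  (:≡ a b _ ∷ fs)     = addN (nf a) (lefts fs)
    lefts  (:≥ a b _ ∷ fs)     = addN (nf a) (lefts fs)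
    rights []                  = []
    rights (fact k a b _ ∷ fs) = addN (scaleN k (nf b)) (rights fs)
    rights (:≤ a b _ ∷ fs)     = addN (nf b) (rights fs)
    rights (:≡ a b _ ∷ fs)     = addN (nf b) (rights fs)
    rights (:≥ a b _ ∷ fs)     = addN (nf b) (rights fs)

    T∧ : ∀ {a b} → T (a ∧ b) → T a × T b
    T∧ {true} {true} _ = tt , tt

    interchange : ∀ k l x p q → (k + l) * x + (p + q) ≡ (k * x + p) + (l * x + q)
    interchange = solve 5 (λ k l x p q → (k :+ l) :* x :+ (p :+ q) := (k :* x :+ p) :+ (l :* x :+ q)) refl
      where open +-*-Solver

    dot-addN : ∀ ρ ks ls → dot ρ (addN ks ls) ≡ dot ρ ks + dot ρ ls
    dot-addN ρ       []       ls       = refl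
    dot-addN ρ       (k ∷ ks) []       = sym (+-identityʳ _)
    dot-addN []      (k ∷ ks) (l ∷ ls) = refl
    dot-addN (x ∷ ρ) (k ∷ ks) (l ∷ ls) =
      trans (cong ((k + l) * x +_) (dot-addN ρ ks ls)) (interchange k l x (dot ρ ks) (dot ρ ls))

    dot-unitN : ∀ ρ i → dot ρ (unitN i) ≡ at ρ i
    dot-unitN []      zero    = refl
    dot-unitN []      (suc i) = refl
    dot-unitN (x ∷ ρ) zero    = trans (+-identityʳ (1 * x)) (+-identityʳ x)
    dot-unitN (x ∷ ρ) (suc i) = dot-unitN ρ i

    -- Atoms take values in ℕ, so comparing coefficients one by one is sound; a missing coefficient
    -- counts as 0.
    dot-leN : ∀ ρ ks ls → T (leN ks ls) → dot ρ ks ≤ dot ρ ls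
    dot-leN ρ       []           ls       _ = z≤n
    dot-leN []      (k ∷ ks)     ls       _ = z≤n
    dot-leN (x ∷ ρ) (zero ∷ ks)  []       p = dot-leN ρ ks [] p
    dot-leN (x ∷ ρ) (k ∷ ks)     (l ∷ ls) p =
      +-mono-≤ (*-monoˡ-≤ x (≤ᵇ⇒≤ k l (proj₁ (T∧ {k ≤ᵇ l} p)))) (dot-leN ρ ks ls (proj₂ (T∧ {k ≤ᵇ l} p)))

    evN-nf : ∀ ρ e → evN ρ (nf e) ≡ ev ρ e
    evN-nf ρ (𝕧 i)   = dot-unitN ρ i
    evN-nf ρ (𝕔 n)   = trans (+-identityʳ (n * 1)) (*-identityʳ n)
    evN-nf ρ (1+ e)  = trans (dot-addN (1 ∷ ρ) (1 ∷ []) (nf e)) (cong suc (evN-nf ρ e))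
    evN-nf ρ (e ⊹ f) = trans (dot-addN (1 ∷ ρ) (nf e) (nf f)) (cong₂ _+_ (evN-nf ρ e) (evN-nf ρ f))

    scaleN-mono : ∀ ρ k ks ls → evN ρ ks ≤ evN ρ ls → evN ρ (scaleN k ks) ≤ evN ρ (scaleN k ls)
    scaleN-mono ρ zero    ks ls p = z≤n
    scaleN-mono ρ (suc k) ks ls p
      rewrite dot-addN (1 ∷ ρ) ks (scaleN k ks) | dot-addN (1 ∷ ρ) ls (scaleN k ls) =
      +-mono-≤ p (scaleN-mono ρ k ks ls p)

    facts-sound : ∀ ρ (fs : List (Fact ρ)) → evN ρ (lefts fs) ≤ evN ρ (rights fs)
    facts-sound ρ []                  = z≤n
    facts-sound ρ (fact k a b p ∷ fs)
      rewrite dot-addN (1 ∷ ρ) (scaleN k (nf a)) (lefts fs) | dot-addN (1 ∷ ρ) (scaleN k (nf b)) (rights fs) =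
      +-mono-≤ (scaleN-mono ρ k (nf a) (nf b) (subst₂ _≤_ (sym (evN-nf ρ a)) (sym (evN-nf ρ b)) p)) (facts-sound ρ fs)
    facts-sound ρ (:≤ a b p ∷ fs)
      rewrite dot-addN (1 ∷ ρ) (nf a) (lefts fs) | dot-addN (1 ∷ ρ) (nf b) (rights fs) =
      +-mono-≤ (subst₂ _≤_ (sym (evN-nf ρ a)) (sym (evN-nf ρ b)) p) (facts-sound ρ fs)
    facts-sound ρ (:≡ a b p ∷ fs)
      rewrite dot-addN (1 ∷ ρ) (nf a) (lefts fs) | dot-addN (1 ∷ ρ) (nf b) (rights fs) =
      +-mono-≤ (subst₂ _≤_ (sym (evN-nf ρ a)) (sym (evN-nf ρ b)) (≤-reflexive p)) (facts-sound ρ fs)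
    facts-sound ρ (:≥ a b p ∷ fs)
      rewrite dot-addN (1 ∷ ρ) (nf a) (lefts fs) | dot-addN (1 ∷ ρ) (nf b) (rights fs) =
      +-mono-≤ (subst₂ _≤_ (sym (evN-nf ρ a)) (sym (evN-nf ρ b)) (≤-reflexive (sym p))) (facts-sound ρ fs)

  pattern #0 = 𝕔 0
  pattern #1 = 𝕔 1
  pattern v0 = 𝕧 0
  pattern v1 = 𝕧 1
  pattern v2 = 𝕧 2
  pattern v3 = 𝕧 3
  pattern v4 = 𝕧 4
  pattern v5 = 𝕧 5
  pattern v6 = 𝕧 6
  pattern v7 = 𝕧 7
  pattern v8 = 𝕧 8
  pattern v9 = 𝕧 9
  pattern v10 = 𝕧 10
  pattern v11 = 𝕧 11
  pattern v12 = 𝕧 12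
  pattern v13 = 𝕧 13
  pattern v14 = 𝕧 14

  private
    -- The test avoids subtraction: the left sides of the facts add up to at most their right sides,
    -- so `a + rights ≤ b + lefts` yields `a ≤ b` after cancelling. It is a closed Boolean, so its
    -- proof can stay implicit.
    Implies : {ρ : List ℕ} → Lx → Lx → List (Fact ρ) → Set
    Implies a b fs = T (leN (addN (nf a) (rights fs)) (addN (nf b) (lefts fs)))

    lin-sound : (ρ : List ℕ) (a b : Lx) (fs : List (Fact ρ)) → {_ : Implies a b fs} → ev ρ a ≤ ev ρ b
    lin-sound ρ a b fs {ok} = +-cancelʳ-≤ (evN ρ (rights fs)) (ev ρ a) (ev ρ b) (≤-trans
      (subst₂ _≤_ (trans (dot-addN (1 ∷ ρ) (nf a) (rights fs)) (cong (_+ evN ρ (rights fs)) (evN-nf ρ a)))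
        (trans (dot-addN (1 ∷ ρ) (nf b) (lefts fs)) (cong (_+ evN ρ (lefts fs)) (evN-nf ρ b)))
        (dot-leN (1 ∷ ρ) (addN (nf a) (rights fs)) (addN (nf b) (lefts fs)) ok))
      (+-monoʳ-≤ (ev ρ b) (facts-sound ρ fs)))

    -- An equation is proved as two inequalities; the second one reads the same list of equations
    -- backwards.
    ups downs : ∀ {ρ} → List (Equation ρ) → List (Fact ρ)
    ups   []              = []
    ups   (:≡ a b p ∷ es) = :≡ a b p ∷ ups es
    ups   (:≥ a b p ∷ es) = :≥ a b p ∷ ups es
    downs []              = []
    downs (:≡ a b p ∷ es) = :≥ b a p ∷ downs es
    downs (:≥ a b p ∷ es) = :≡ b a p ∷ downs es

  -- Farkas certificates: the goal follows by adding up the (weighted) facts. The atom v i is the i-th entry of ρ.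
  abstract
    lin : (ρ : List ℕ) (a b : Lx) (fs : List (Fact ρ)) → {_ : Implies a b fs} → ev ρ a ≤ ev ρ b
    lin ρ a b fs {ok} = lin-sound ρ a b fs {ok}

    lin⊥ : (ρ : List ℕ) (fs : List (Fact ρ)) → {_ : Implies #1 #0 fs} → ⊥
    lin⊥ ρ fs {ok} = 1+n≰n (lin-sound ρ #1 #0 fs {ok})

    lin≡ : (ρ : List ℕ) (a b : Lx) (es : List (Equation ρ)) → {_ : Implies a b (ups es)} → {_ : Implies b a (downs es)} → ev ρ a ≡ ev ρ b
    lin≡ ρ a b es {ok} {ok′} = ≤-antisym (lin-sound ρ a b (ups es) {ok}) (lin-sound ρ b a (downs es) {ok′})

module Row where
  open import Defs
  open import Data.Nat using (ℕ; suc)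
  open import Data.List using (List)

  -- Rows are indexed from 0 in the proof.
  row : List ℕ → ℕ → ℕ
  row κ r = part κ (suc r)

-- Cores and admissible offset functions.

module Core where
  open import Defs
  open Row
  open Linear
  open import Data.Bool using (Bool; true; false; if_then_else_)
  open import Data.Bool.Properties using (T-≡)
  open import Data.Nat using (ℕ; zero; suc; _+_; _∸_; _≤_; _<_; _≥_; z≤n; s≤s; _≤ᵇ_; pred)
  open import Data.Nat.Properties
  open import Data.List using (List; []; _∷_; length; applyUpTo; filterᵇ)
  open import Data.List.Properties using (map-upTo)
  open import Data.List.Relation.Unary.Linked as Linked using (Linked; []; [-]; _∷_)
  open import Data.List.Relation.Unary.All using (All; []; _∷_)
  open import Data.Product using (_×_; _,_; proj₁; proj₂; ∃)
  open import Data.Sum using (_⊎_; inj₁; inj₂; [_,_]′)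
  open import Data.Empty using (⊥; ⊥-elim)
  open import Function using (_∘_)
  open import Function.Bundles using (Equivalence)
  open import Relation.Binary.PropositionalEquality

  ≤ᵇ-true : ∀ {a b} → a ≤ b → (a ≤ᵇ b) ≡ true
  ≤ᵇ-true p = Equivalence.to T-≡ (≤⇒≤ᵇ p)

  ≤ᵇ-false : ∀ {a b} → b < a → (a ≤ᵇ b) ≡ false
  ≤ᵇ-false {a} {b} q with a ≤ᵇ b in eq
  ... | false = refl
  ... | true  = ⊥-elim (<⇒≱ q (≤ᵇ⇒≤ a b (Equivalence.from T-≡ eq)))

  ≤ᵇ-true⁻ : ∀ {a b} → (a ≤ᵇ b) ≡ true → a ≤ b
  ≤ᵇ-true⁻ {a} {b} e = ≤ᵇ⇒≤ a b (Equivalence.from T-≡ e)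

  ≤ᵇ-false⁻ : ∀ {a b} → (a ≤ᵇ b) ≡ false → b < a
  ≤ᵇ-false⁻ {a} {b} e with ≤-<-connex a b
  ... | inj₂ q = q
  ... | inj₁ p with () ← trans (sym (≤ᵇ-true p)) e

  antitone : (f : ℕ → ℕ) → (∀ r → f (suc r) ≤ f r) → ∀ {a b} → a ≤ b → f b ≤ f a
  antitone f d {a} {b} p with m≤n⇒∃[o]m+o≡n p
  ... | o , refl = go o
    where
    go : ∀ o → f (a + o) ≤ f a
    go zero    = ≤-reflexive (cong f (+-identityʳ a))
    go (suc o) = ≤-trans (≤-reflexive (cong f (+-suc a o))) (≤-trans (d (a + o)) (go o))

  row-antitone-suc : ∀ {κ} → Linked _≥_ κ → ∀ r → row κ (suc r) ≤ row κ r
  row-antitone-suc []       r       = z≤n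
  row-antitone-suc [-]      r       = z≤n
  row-antitone-suc (p ∷ ps) zero    = p
  row-antitone-suc (p ∷ ps) (suc r) = row-antitone-suc ps r

  row-antitone : ∀ {κ} → IsPartition κ → ∀ {a b} → a ≤ b → row κ b ≤ row κ a
  row-antitone {κ} P = antitone (row κ) (row-antitone-suc (proj₁ P))

  row-≥length : ∀ κ {r} → length κ ≤ r → row κ r ≡ 0
  row-≥length []      p       = refl
  row-≥length (x ∷ κ) (s≤s p) = row-≥length κ p

  row-<length : ∀ {κ} → All (0 <_) κ → ∀ {r} → r < length κ → 0 < row κ r
  row-<length (p ∷ ps) {zero}  q       = p
  row-<length (p ∷ ps) {suc r} (s≤s q) = row-<length ps q

  row-ext : ∀ {κ κ′} → All (0 <_) κ → All (0 <_) κ′ → (∀ r → row κ r ≡ row κ′ r) → κ ≡ κ′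
  row-ext []       []       e = refl
  row-ext []       (q ∷ qs) e = ⊥-elim (<⇒≢ q (e 0))
  row-ext (p ∷ ps) []       e = ⊥-elim (<⇒≢ p (sym (e 0)))
  row-ext (p ∷ ps) (q ∷ qs) e = cong₂ _∷_ (e 0) (row-ext ps qs (e ∘ suc))

  tail-partition : ∀ {x κ} → IsPartition (x ∷ κ) → IsPartition κ
  tail-partition (l , p ∷ ps) = Linked.tail l , ps

  colLen-zero : ∀ {x κ} → Linked _≥_ (x ∷ κ) → ∀ {c} → x < c → colLen κ c ≡ 0
  colLen-zero [-] q = refl
  colLen-zero {x} {y ∷ κ} (p ∷ ps) {c} q rewrite ≤ᵇ-false {c} {y} (≤-<-trans p q) =
    colLen-zero ps (≤-<-trans p q)

  colLen-> : ∀ {κ} → IsPartition κ → ∀ {r c} → 1 ≤ c → c ≤ row κ r → r < colLen κ c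
  colLen-> {[]}    P {r} q p = ⊥-elim (<⇒≱ q p)
  colLen-> {x ∷ κ} P {r} {c} q p
    rewrite ≤ᵇ-true {c} {x} (≤-trans p (row-antitone P {0} {r} z≤n)) with r
  ... | zero   = s≤s z≤n
  ... | suc r′ = s≤s (colLen-> (tail-partition P) q p)

  colLen-<⁻ : ∀ {κ} → IsPartition κ → ∀ {r c} → r < colLen κ c → c ≤ row κ r
  colLen-<⁻ {x ∷ κ} P {r} {c} p with ≤-<-connex c x
  ... | inj₂ q rewrite ≤ᵇ-false {c} {x} q | colLen-zero (proj₁ P) q with () ← p
  ... | inj₁ q rewrite ≤ᵇ-true {c} {x} q with r | p
  ...   | zero   | _      = q
  ...   | suc r′ | s≤s p′ = colLen-<⁻ (tail-partition P) p′

  count : (ℕ → Bool) → ℕ → ℕ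
  count Q zero    = 0
  count Q (suc N) = (if Q 0 then 1 else 0) + count (Q ∘ suc) N

  length-filter-applyUpTo : {A : Set} (P : A → Bool) (f : ℕ → A) (N : ℕ) →
    length (filterᵇ P (applyUpTo f N)) ≡ count (P ∘ f) N
  length-filter-applyUpTo P f zero = refl
  length-filter-applyUpTo P f (suc N) with P (f 0)
  ... | true  = cong suc (length-filter-applyUpTo P (f ∘ suc) N)
  ... | false = length-filter-applyUpTo P (f ∘ suc) N

  count-threshold : ∀ Q a m → (∀ {i} → i < a → Q i ≡ false) → (∀ {i} → a ≤ i → i < a + m → Q i ≡ true) →
    count Q (a + m) ≡ m
  count-threshold Q zero    zero    lo hi = refl
  count-threshold Q zero    (suc m) lo hi rewrite hi {0} z≤n (s≤s z≤n) =
    cong suc (count-threshold (Q ∘ suc) 0 m (λ ()) (λ _ q → hi z≤n (s≤s q)))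
  count-threshold Q (suc a) m       lo hi rewrite lo {0} (s≤s z≤n) =
    count-threshold (Q ∘ suc) a m (λ p → lo (s≤s p)) (λ p q → hi (s≤s p) (s≤s q))

  Threshold : (ℕ → Bool) → ℕ → Set
  Threshold Q N = ∃ λ a → a + count Q N ≡ N × (∀ {i} → i < a → Q i ≡ false) × (∀ {i} → a ≤ i → i < N → Q i ≡ true)

  threshold : ∀ Q N → (∀ {i j} → i ≤ j → Q i ≡ true → Q j ≡ true) → Threshold Q N
  threshold Q zero mono = 0 , refl , (λ ()) , λ _ ()
  threshold Q (suc N) mono with Q 0 in eq
  ... | true = 0 , cong suc (count-threshold (Q ∘ suc) 0 N (λ ()) (λ _ _ → mono z≤n eq)) , (λ ()) , λ _ _ → mono z≤n eq
  ... | false with threshold (Q ∘ suc) N (λ p → mono (s≤s p))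
  ...   | a , e , lo , hi = suc a , cong suc e , lo′ , λ { (s≤s p) (s≤s q) → hi p q }
    where
    lo′ : ∀ {i} → i < suc a → Q i ≡ false
    lo′ {zero}  _       = eq
    lo′ {suc i} (s≤s p) = lo p

  small : ℕ → List ℕ → ℕ → ℕ → Bool
  small k κ r i = hook κ (suc r) (suc i) ≤ᵇ k

  pRow-count : ∀ k κ r → pRow k κ (suc r) ≡ count (small k κ r) (row κ r)
  pRow-count k κ r = trans
    (cong (λ xs → length (filterᵇ (λ c → hook κ (suc r) c ≤ᵇ k) xs)) (map-upTo suc (row κ r)))
    (length-filter-applyUpTo (λ c → hook κ (suc r) c ≤ᵇ k) suc (row κ r))

  -- σ r is the first column of row r of the root ideal Δᵏ(μ): μ r = suc k + r - σ r.
  record Adm (k ℓ : ℕ) (σ : ℕ → ℕ) : Set where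
    field
      mono : ∀ r → σ r < σ (suc r)
      lo   : ∀ r → r < σ r
      hi   : ∀ r → σ r ≤ suc k + r
      tail : ∀ {r} → ℓ ≤ r → σ r ≡ suc k + r

  -- By `rec` row `r` exceeds row `σ r` by `suc k + r - σ r` boxes: the boxes of row `r` with hook
  -- length at most `k` are those beyond the end of row `σ r`. As `r < σ r`, this determines the
  -- shape from the bottom up.
  record CoreOf (k ℓ : ℕ) (κ : List ℕ) (σ : ℕ → ℕ) : Set where
    field
      partition : IsPartition κ
      adm       : Adm k ℓ σ
      rec       : ∀ r → row κ r + σ r ≡ suc k + r + row κ (σ r)
    open Adm adm public

  colLen-antitone : ∀ {κ} → IsPartition κ → ∀ {c d} → 1 ≤ c → c ≤ d → colLen κ d ≤ colLen κ c
  colLen-antitone P 1≤c c≤d = ≮⇒≥ λ q → <-irrefl refl (colLen-> P 1≤c (≤-trans c≤d (colLen-<⁻ P q)))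

  hook-antitone : ∀ {κ} → IsPartition κ → ∀ r {c d} → 1 ≤ c → c ≤ d → hook κ r d ≤ hook κ r c
  hook-antitone {κ} P r 1≤c c≤d =
    +-mono-≤ (∸-monoˡ-≤ r (colLen-antitone P 1≤c c≤d)) (∸-monoʳ-≤ (suc (part κ r)) c≤d)

  hook-def : ∀ κ r c → hook κ (suc r) c ≡ (colLen κ c ∸ suc r) + (suc (row κ r) ∸ c)
  hook-def κ r c = refl

  -- Hooks shrink weakly along a row, so those of length at most `k` form its end; `a` counts the
  -- others.
  split-row : ∀ {k κ} → IsPartition κ → ∀ r → ∃ λ a → a + pRow k κ (suc r) ≡ row κ r ×
    (∀ {i} → i < a → k < hook κ (suc r) (suc i)) ×
    (∀ {i} → a ≤ i → i < row κ r → hook κ (suc r) (suc i) ≤ k)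
  split-row {k} {κ} P r
    with a , e , lo , hi ← threshold (small k κ r) (row κ r)
           (λ p e → ≤ᵇ-true (≤-trans (hook-antitone P (suc r) (s≤s z≤n) (s≤s p)) (≤ᵇ-true⁻ e))) =
    a , trans (cong (a +_) (pRow-count k κ r)) e , (λ p → ≤ᵇ-false⁻ (lo p)) , λ p q → ≤ᵇ-true⁻ (hi p q)

  module _ {k κ} (C : IsCore k κ) where
    private
      P = proj₁ C

    -- The first box with hook length at most `k`, if there is one, has `pRow` boxes weakly to its
    -- right, all counted by its hook.
    pRow≤k : ∀ r → pRow k κ (suc r) ≤ k
    pRow≤k r = go (split-row {k} P r)
      where
      go : _ → pRow k κ (suc r) ≤ k
      go (a , e , lo , hi) = [ (λ p → (lin (pRow k κ (suc r) ∷ k ∷ a ∷ row κ r ∷ []) v0 v1 (:≡ (v2 ⊹ v0) v3 e ∷ :≤ v3 v2 p ∷ []))) , (λ p → (lin (pRow k κ (suc r) ∷ k ∷ hook κ (suc r) (suc a) ∷ row κ r ∸ a ∷ colLen κ (suc a) ∸ suc r ∷ row κ r ∷ a ∷ []) v0 v1 (:≤ v2 v1 (hi ≤-refl p) ∷ :≥ (v4 ⊹ v3) v2 (hook-def κ r (suc a)) ∷ :≤ v5 (v6 ⊹ v3) (m≤n+m∸n (row κ r) a) ∷ :≡ (v6 ⊹ v0) v5 e ∷ []))) ]′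
        (≤-<-connex (row κ r) a)

    -- Here the core condition enters. The last box with hook length above `k` has hook length at
    -- least `k + 2`, since `k + 1` is excluded, and this forces its column to reach row `q`. If row
    -- `q` were longer, the column of the next box would reach it too, and that hook would exceed
    -- `k`.
    row-jump : ∀ r {q} → q + pRow k κ (suc r) ≡ suc k + r → row κ r ≡ pRow k κ (suc r) + row κ q
    row-jump r {q} qe = go (split-row {k} P r)
      where
      r<q : suc r ≤ q
      r<q = lin (r ∷ q ∷ pRow k κ (suc r) ∷ k ∷ []) (1+ v0) v1 (:≤ v2 v3 (pRow≤k r) ∷ :≥ (1+ v3 ⊹ v0) (v1 ⊹ v2) qe ∷ [])
      go : _ → row κ r ≡ pRow k κ (suc r) + row κ q
      go (a , e , lo , hi) = (≤-antisym (lin (row κ r ∷ row κ q ∷ pRow k κ (suc r) ∷ a ∷ []) v0 (v2 ⊹ v1) (:≤ v3 v1 (row-≥ a e lo) ∷ :≥ v0 (v3 ⊹ v2) e ∷ [])) (lin (row κ q ∷ pRow k κ (suc r) ∷ row κ r ∷ a ∷ []) (v1 ⊹ v0) v2 (:≤ v0 v3 row-≤ ∷ :≡ (v3 ⊹ v1) v2 e ∷ [])))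
        where
        row-≤ : row κ q ≤ a
        row-≤ = ≮⇒≥ λ p →
          let cl   = colLen-> P {q} (s≤s z≤n) p
              sum≡ = m∸n+n≡m {colLen κ (suc a)} {suc r} (≤-trans r<q (<⇒≤ cl))
          in (lin⊥ (row κ r ∸ a ∷ colLen κ (suc a) ∸ suc r ∷ hook κ (suc r) (suc a) ∷ q ∷ colLen κ (suc a) ∷ r ∷ row κ r ∷ a ∷ k ∷ pRow k κ (suc r) ∷ []) (:≥ (v1 ⊹ v0) v2 (hook-def κ r (suc a)) ∷ :≤ (1+ v3) v4 cl ∷ :≥ v4 (v1 ⊹ 1+ v5) sum≡ ∷ :≤ v6 (v7 ⊹ v0) (m≤n+m∸n (row κ r) a) ∷ :≤ v2 v8 (hi ≤-refl (≤-trans p (row-antitone P (<⇒≤ r<q)))) ∷ :≡ (v7 ⊹ v9) v6 e ∷ :≥ (1+ v8 ⊹ v5) (v3 ⊹ v9) qe ∷ []))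
        row-≥ : ∀ a → a + pRow k κ (suc r) ≡ row κ r → (∀ {i} → i < a → k < hook κ (suc r) (suc i)) → a ≤ row κ q
        row-≥ zero    e lo = z≤n
        row-≥ (suc a) e lo = colLen-<⁻ P (lin (q ∷ colLen κ (suc a) ∷ k ∷ hook κ (suc r) (suc a) ∷ row κ r ∸ a ∷ colLen κ (suc a) ∸ suc r ∷ a ∷ row κ r ∷ r ∷ pRow k κ (suc r) ∷ []) (1+ v0) v1 (:≤ (1+ (1+ v2)) v3 k<h ∷ :≡ v3 (v5 ⊹ v4) (hook-def κ r (suc a)) ∷ :≡ (v4 ⊹ v6) v7 (m∸n+n≡m (<⇒≤ a<row)) ∷ :≡ (v5 ⊹ 1+ v8) v1 (m∸n+n≡m (colLen-> P {r} (s≤s z≤n) a<row)) ∷ :≡ (v0 ⊹ v9) (1+ v2 ⊹ v8) qe ∷ :≥ v7 (1+ v6 ⊹ v9) e ∷ []))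
          where
          a<row : suc a ≤ row κ r
          a<row = lin (a ∷ row κ r ∷ pRow k κ (suc r) ∷ []) (1+ v0) v1 (:≡ (1+ v0 ⊹ v2) v1 e ∷ [])
          k<h : suc k < hook κ (suc r) (suc a)
          k<h = ≤∧≢⇒< (lo ≤-refl) (proj₂ C (suc r) (suc a) (s≤s z≤n) (s≤s z≤n) a<row ∘ sym)

  module _ {k ℓ κ} (C : IsCore k κ) (len : length κ ≤ ℓ)
    (σ : ℕ → ℕ) (σ-pRow : ∀ r → σ r + pRow k κ (suc r) ≡ suc k + r) where
    private
      P = proj₁ C

      rec′ : ∀ r → row κ r + σ r ≡ suc k + r + row κ (σ r)
      rec′ r = lin≡ (σ r ∷ row κ r ∷ row κ (σ r) ∷ r ∷ k ∷ pRow k κ (suc r) ∷ []) (v1 ⊹ v0) (1+ v4 ⊹ v3 ⊹ v2) (:≡ (v0 ⊹ v5) (1+ v4 ⊹ v3) (σ-pRow r) ∷ :≡ v1 (v5 ⊹ v2) (row-jump C r (σ-pRow r)) ∷ [])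

      mono′ : ∀ r → σ r < σ (suc r)
      mono′ r = ≰⇒> λ p → lin⊥ (σ (suc r) ∷ σ r ∷ row κ r ∷ row κ (σ r) ∷ r ∷ k ∷ row κ (σ (suc r)) ∷ row κ (suc r) ∷ []) (:≤ v0 v1 p ∷ :≡ (v2 ⊹ v1) (1+ v5 ⊹ v4 ⊹ v3) (rec′ r) ∷ :≥ (1+ v5 ⊹ 1+ v4 ⊹ v6) (v7 ⊹ v0) (rec′ (suc r)) ∷ :≤ v3 v6 (row-antitone P p) ∷ :≤ v7 v2 (row-antitone-suc (proj₁ P) r) ∷ [])

    core-CoreOf′ : CoreOf k ℓ κ (σ)
    core-CoreOf′ = record
      { partition = P
      ; adm = record
        { mono = mono′
        ; lo   = λ r → lin (r ∷ σ r ∷ pRow k κ (suc r) ∷ k ∷ []) (1+ v0) v1 (:≤ v2 v3 (pRow≤k C r) ∷ :≥ (1+ v3 ⊹ v0) (v1 ⊹ v2) (σ-pRow r) ∷ [])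
        ; hi   = λ r → lin (σ r ∷ r ∷ k ∷ pRow k κ (suc r) ∷ []) v0 (1+ v2 ⊹ v1) (:≡ (v0 ⊹ v3) (1+ v2 ⊹ v1) (σ-pRow r) ∷ [])
        ; tail = λ {r} p → (≤-antisym (lin (σ r ∷ r ∷ k ∷ pRow k κ (suc r) ∷ []) v0 (1+ v2 ⊹ v1) (:≡ (v0 ⊹ v3) (1+ v2 ⊹ v1) (σ-pRow r) ∷ [])) (lin (r ∷ k ∷ σ r ∷ pRow k κ (suc r) ∷ row κ (σ r) ∷ row κ r ∷ []) (1+ v1 ⊹ v0) v2 (:≥ (1+ v1 ⊹ v0) (v2 ⊹ v3) (σ-pRow r) ∷ :≥ (v3 ⊹ v4) v5 (row-jump C r (σ-pRow r)) ∷ :≡ v5 #0 (row-≥length κ (≤-trans len p)) ∷ [])))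
        }
      ; rec = rec′
      }

  core-CoreOf : ∀ {k ℓ κ} → IsCore k κ → length κ ≤ ℓ → ∃ (CoreOf k ℓ κ)
  core-CoreOf {k} {ℓ} {κ} C len = (λ r → suc k + r ∸ pRow k κ (suc r)) , core-CoreOf′ C len _
    λ r → m∸n+n≡m {suc k + r} {pRow k κ (suc r)} (≤-trans (pRow≤k C r) (m≤n⇒m≤1+n (m≤m+n k r)))

  module _ {k ℓ κ σ} (C : CoreOf k ℓ κ σ) where
    open CoreOf C

    private
      hook-inner : ∀ r {c} → 1 ≤ c → c ≤ row κ (σ r) → suc k < hook κ (suc r) c
      hook-inner r {c} 1≤c p = lin (k ∷ hook κ (suc r) c ∷ suc (row κ r) ∸ c ∷ colLen κ c ∸ suc r ∷ colLen κ c ∷ r ∷ row κ r ∷ c ∷ σ r ∷ row κ (σ r) ∷ []) (1+ (1+ v0)) v1 (:≥ (v3 ⊹ v2) v1 (hook-def κ r c) ∷ :≤ v4 (1+ v5 ⊹ v3) (m≤n+m∸n (colLen κ c) (suc r)) ∷ :≤ (1+ v6) (v7 ⊹ v2) (m≤n+m∸n (suc (row κ r)) c) ∷ :≤ (1+ v8) v4 cl ∷ :≥ (1+ v0 ⊹ v5 ⊹ v9) (v6 ⊹ v8) (rec r) ∷ :≤ v7 v9 p ∷ [])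
        where
        cl : σ r < colLen κ c
        cl = colLen-> partition 1≤c p

      hook-outer : ∀ r {c} → row κ (σ r) < c → c ≤ row κ r → hook κ (suc r) c ≤ k
      hook-outer r {c} p q = lin (hook κ (suc r) c ∷ k ∷ suc (row κ r) ∸ c ∷ colLen κ c ∸ suc r ∷ σ r ∸ suc r ∷ r ∷ σ r ∷ c ∷ row κ r ∷ row κ (σ r) ∷ []) v0 v1 (:≡ v0 (v3 ⊹ v2) (hook-def κ r c) ∷ :≤ v3 v4 (∸-monoˡ-≤ (suc r) cl) ∷ :≡ (v4 ⊹ 1+ v5) v6 (m∸n+n≡m (lo r)) ∷ :≡ (v2 ⊹ v7) (1+ v8) (m∸n+n≡m {suc (row κ r)} {c} (m≤n⇒m≤1+n q)) ∷ :≡ (v8 ⊹ v6) (1+ v1 ⊹ v5 ⊹ v9) (rec r) ∷ :≤ (1+ v9) v7 p ∷ [])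
        where
        cl : colLen κ c ≤ σ r
        cl = ≮⇒≥ λ z → <⇒≱ p (colLen-<⁻ partition z)

      dichotomy : ∀ r c → c ≤ row κ (σ r) ⊎ row κ (σ r) < c
      dichotomy r c = ≤-<-connex c (row κ (σ r))

    -- A column of row `r` either reaches row `σ r`, and then the hook exceeds `k + 1`, or stops
    -- above it, and then the hook is at most `k`.
    CoreOf-core : IsCore k κ
    CoreOf-core = partition , λ { (suc r) c _ 1≤c p e → case r c 1≤c p e (dichotomy r c) }
      where
      case : ∀ r c → 1 ≤ c → c ≤ row κ r → hook κ (suc r) c ≡ suc k → _ → ⊥
      case r c 1≤c p e (inj₁ q) = <⇒≢ (hook-inner r 1≤c q) (sym e)
      case r c 1≤c p e (inj₂ q) = <⇒≱ (≤-reflexive (sym e)) (hook-outer r q p)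

    pRow-CoreOf : ∀ r → pRow k κ (suc r) + σ r ≡ suc k + r
    pRow-CoreOf r with m≤n⇒∃[o]m+o≡n {row κ (σ r)} {row κ r} (row-antitone partition (<⇒≤ (lo r)))
    ... | m , e = concl pm
      where
      concl : pRow k κ (suc r) ≡ m → pRow k κ (suc r) + σ r ≡ suc k + r
      concl pm = lin≡ (σ r ∷ pRow k κ (suc r) ∷ r ∷ k ∷ row κ r ∷ row κ (σ r) ∷ m ∷ []) (v1 ⊹ v0) (1+ v3 ⊹ v2) (:≡ (v4 ⊹ v0) (1+ v3 ⊹ v2 ⊹ v5) (rec r) ∷ :≡ (v5 ⊹ v6) v4 e ∷ :≡ v1 v6 pm ∷ [])
      pm : pRow k κ (suc r) ≡ m
      pm = trans (pRow-count k κ r) (trans (cong (count (small k κ r)) (sym e))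
        (count-threshold (small k κ r) (row κ (σ r)) m
          (λ p → ≤ᵇ-false (<-trans (n<1+n k) (hook-inner r (s≤s z≤n) p)))
          (λ p q → ≤ᵇ-true (hook-outer r (s≤s p) (≤-trans q (≤-reflexive e))))))

    -- For `r ≥ ℓ` the recursion reads `row κ r ≡ row κ (σ r)` with `σ r > r`, so the row equals one
    -- beyond the end of the list.
    row-≥ℓ : ∀ {r} → ℓ ≤ r → row κ r ≡ 0
    row-≥ℓ {r} p = go (length κ) (m≤m+n (length κ) r) p
      where
      go : ∀ f {r} → length κ ≤ f + r → ℓ ≤ r → row κ r ≡ 0
      go zero    q p = row-≥length κ q
      go (suc f) {r} q p = lin≡ (row κ r ∷ σ r ∷ row κ (σ r) ∷ r ∷ k ∷ []) v0 #0 (:≡ (v0 ⊹ v1) (1+ v4 ⊹ v3 ⊹ v2) (rec r) ∷ :≥ (1+ v4 ⊹ v3) v1 (tail p) ∷ :≡ v2 #0 (go f {σ r} (lin (length κ ∷ σ r ∷ f ∷ r ∷ []) v0 (v2 ⊹ v1) (:≤ (1+ v3) v1 (lo r) ∷ :≤ v0 (1+ v2 ⊹ v3) q ∷ [])) (lin (ℓ ∷ σ r ∷ r ∷ []) v0 v1 (:≤ (1+ v2) v1 (lo r) ∷ :≤ v0 v2 p ∷ []))) ∷ [])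

    length≤ℓ : length κ ≤ ℓ
    length≤ℓ = ≮⇒≥ λ p → <⇒≢ (row-<length (proj₂ partition) p) (sym (row-≥ℓ ≤-refl))

  CoreOf-unique : ∀ {k ℓ κ κ′ σ} → CoreOf k ℓ κ σ → CoreOf k ℓ κ′ σ → κ ≡ κ′
  CoreOf-unique {k} {ℓ} {κ} {κ′} {σ} C C′ =
    row-ext (proj₂ (CoreOf.partition C)) (proj₂ (CoreOf.partition C′)) λ r → go ℓ (m≤m+n ℓ r)
    where
    go : ∀ f {r} → ℓ ≤ f + r → row κ r ≡ row κ′ r
    go zero    p = trans (row-≥ℓ C p) (sym (row-≥ℓ C′ p))
    go (suc f) {r} p = lin≡ (row κ r ∷ row κ′ r ∷ σ r ∷ row κ (σ r) ∷ r ∷ k ∷ row κ′ (σ r) ∷ []) v0 v1 (:≡ (v0 ⊹ v2) (1+ v5 ⊹ v4 ⊹ v3) (CoreOf.rec C r) ∷ :≥ (1+ v5 ⊹ v4 ⊹ v6) (v1 ⊹ v2) (CoreOf.rec C′ r) ∷ :≡ v3 v6 (go f {σ r} (lin (ℓ ∷ σ r ∷ f ∷ r ∷ []) v0 (v2 ⊹ v1) (:≤ (1+ v3) v1 (CoreOf.lo C r) ∷ :≤ v0 (1+ v2 ⊹ v3) p ∷ []))) ∷ [])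

  CoreOf-injective : ∀ {k ℓ ℓ′ κ σ σ′} → CoreOf k ℓ κ σ → CoreOf k ℓ′ κ σ′ → ∀ r → σ r ≡ σ′ r
  CoreOf-injective {k} {ℓ} {ℓ′} {κ} {σ} {σ′} C C′ r = lin≡ (σ r ∷ σ′ r ∷ pRow k κ (suc r) ∷ r ∷ k ∷ []) v0 v1 (:≡ (v2 ⊹ v0) (1+ v4 ⊹ v3) (pRow-CoreOf C r) ∷ :≥ (1+ v4 ⊹ v3) (v2 ⊹ v1) (pRow-CoreOf C′ r) ∷ [])

  -- Lists for partitions contain no zeros. The new first part is at least `row xs 0`, so if it is 0
  -- nothing follows.
  cons⁺ : ℕ → List ℕ → List ℕ
  cons⁺ zero    xs = []
  cons⁺ (suc x) xs = suc x ∷ xs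

  cons⁺-partition : ∀ {x xs} → IsPartition xs → row xs 0 ≤ x → IsPartition (cons⁺ x xs)
  cons⁺-partition {zero}  P p = [] , []
  cons⁺-partition {suc x} {[]}     (l , q) p = [-] , s≤s z≤n ∷ []
  cons⁺-partition {suc x} {y ∷ xs} (l , q) p = p ∷ l , s≤s z≤n ∷ q

  row-cons⁺-zero : ∀ x xs → row (cons⁺ x xs) 0 ≡ x
  row-cons⁺-zero zero    xs = refl
  row-cons⁺-zero (suc x) xs = refl

  row-cons⁺-suc : ∀ {x xs} → IsPartition xs → row xs 0 ≤ x → ∀ r → row (cons⁺ x xs) (suc r) ≡ row xs r
  row-cons⁺-suc {zero}  P p r = sym (n≤0⇒n≡0 (≤-trans (row-antitone P {0} {r} z≤n) p))
  row-cons⁺-suc {suc x} P p r = refl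

  suc-pred-Adm : ∀ {k ℓ σ} → Adm k ℓ σ → ∀ r → suc (pred (σ r)) ≡ σ r
  suc-pred-Adm {σ = σ} A r with σ r | Adm.lo A r
  ... | suc q | _ = refl

  Adm-suc : ∀ {k ℓ σ} → Adm k (suc ℓ) σ → Adm k ℓ (λ r → pred (σ (suc r)))
  Adm-suc {k} {ℓ} {σ} A = record
    { mono = λ r → lin (pred (σ (suc r)) ∷ pred (σ (suc (suc r))) ∷ σ (suc r) ∷ σ (suc (suc r)) ∷ []) (1+ v0) v1 (:≡ (1+ v0) v2 (sp r) ∷ :≥ v3 (1+ v1) (sp (suc r)) ∷ :≤ (1+ v2) v3 (mono (suc r)) ∷ [])
    ; lo   = λ r → lin (r ∷ pred (σ (suc r)) ∷ σ (suc r) ∷ []) (1+ v0) v1 (:≥ v2 (1+ v1) (sp r) ∷ :≤ (1+ (1+ v0)) v2 (lo (suc r)) ∷ [])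
    ; hi   = λ r → lin (pred (σ (suc r)) ∷ r ∷ k ∷ σ (suc r) ∷ []) v0 (1+ v2 ⊹ v1) (:≡ (1+ v0) v3 (sp r) ∷ :≤ v3 (1+ v2 ⊹ 1+ v1) (hi (suc r)) ∷ [])
    ; tail = λ {r} p → lin≡ (pred (σ (suc r)) ∷ r ∷ k ∷ σ (suc r) ∷ []) v0 (1+ v2 ⊹ v1) (:≡ (1+ v0) v3 (sp r) ∷ :≡ v3 (1+ v2 ⊹ 1+ v1) (tail (s≤s p)) ∷ [])
    }
    where
    open Adm A
    sp : ∀ r → suc (pred (σ (suc r))) ≡ σ (suc r)
    sp r = suc-pred-Adm A (suc r)

  CoreOf-cons : ∀ {k ℓ σ κ x q} → Adm k (suc ℓ) σ → CoreOf k ℓ κ (λ r → pred (σ (suc r))) →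
    suc q ≡ σ 0 → x + σ 0 ≡ suc k + row κ q → CoreOf k (suc ℓ) (cons⁺ x κ) σ
  CoreOf-cons {k} {ℓ} {σ} {κ} {x} {q} A C qe xe = record
    { partition = cons⁺-partition CP le
    ; adm       = A
    ; rec       = λ { zero → rec₀ (row-cons⁺-suc {x} CP le q) ; (suc r) → recₛ r (row-cons⁺-suc {x} CP le r) (row-cons⁺-suc {x} CP le (pred (σ (suc r)))) }
    }
    where
    open Adm A
    module C = CoreOf C
    CP = C.partition
    le : row κ 0 ≤ x
    le = lin (row κ 0 ∷ x ∷ pred (σ 1) ∷ row κ (pred (σ 1)) ∷ k ∷ σ 1 ∷ row κ q ∷ σ 0 ∷ []) v0 v1 (:≡ (v0 ⊹ v2) (1+ v4 ⊹ #0 ⊹ v3) (C.rec 0) ∷ :≥ v5 (1+ v2) (suc-pred-Adm A 1) ∷ :≥ (1+ v4 ⊹ v6) (v1 ⊹ v7) xe ∷ :≤ (1+ v7) v5 (mono 0) ∷ :≤ v3 v6 (row-antitone CP {q} {pred (σ 1)} (lin (q ∷ pred (σ 1) ∷ σ 1 ∷ σ 0 ∷ []) v0 v1 (:≥ v2 (1+ v1) (suc-pred-Adm A 1) ∷ :≤ (1+ v3) v2 (mono 0) ∷ :≡ (1+ v0) v3 qe ∷ []))) ∷ [])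
    rec₀ : row (cons⁺ x κ) (suc q) ≡ row κ q → row (cons⁺ x κ) 0 + σ 0 ≡ suc k + 0 + row (cons⁺ x κ) (σ 0)
    rec₀ e = lin≡ (σ 0 ∷ row (cons⁺ x κ) 0 ∷ row (cons⁺ x κ) (σ 0) ∷ k ∷ row κ q ∷ row (cons⁺ x κ) (suc q) ∷ x ∷ []) (v1 ⊹ v0) (1+ v3 ⊹ #0 ⊹ v2) (:≥ v4 v5 e ∷ :≡ v5 v2 (cong (row (cons⁺ x κ)) qe) ∷ :≡ (v6 ⊹ v0) (1+ v3 ⊹ v4) xe ∷ :≡ v1 v6 (row-cons⁺-zero x κ) ∷ [])
    recₛ : ∀ r → row (cons⁺ x κ) (suc r) ≡ row κ r → row (cons⁺ x κ) (suc (pred (σ (suc r)))) ≡ row κ (pred (σ (suc r))) →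
      row (cons⁺ x κ) (suc r) + σ (suc r) ≡ suc k + suc r + row (cons⁺ x κ) (σ (suc r))
    recₛ r e e′ = lin≡ (σ (suc r) ∷ row (cons⁺ x κ) (suc r) ∷ row (cons⁺ x κ) (σ (suc r)) ∷ r ∷ k ∷ row κ r ∷ row κ (pred (σ (suc r))) ∷ row (cons⁺ x κ) (suc (pred (σ (suc r)))) ∷ pred (σ (suc r)) ∷ []) (v1 ⊹ v0) (1+ v4 ⊹ 1+ v3 ⊹ v2) (:≡ v1 v5 e ∷ :≥ v6 v7 e′ ∷ :≡ v7 v2 (cong (row (cons⁺ x κ)) (suc-pred-Adm A (suc r))) ∷ :≡ (v5 ⊹ v8) (1+ v4 ⊹ v3 ⊹ v6) (C.rec r) ∷ :≥ v0 (1+ v8) (suc-pred-Adm A (suc r)) ∷ [])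

  -- The core is built from its last row upwards. Deleting row 0 renumbers both the rows and the
  -- values of `σ`, hence `pred (σ (suc r))`, and `rec` at row 0 dictates the new part.
  CoreOf-exists : ∀ {k} ℓ {σ} → Adm k ℓ σ → ∃ λ κ → CoreOf k ℓ κ σ
  CoreOf-exists zero {σ} A = [] , record
    { partition = [] , [] ; adm = A ; rec = λ r → trans (Adm.tail A z≤n) (sym (+-identityʳ _)) }
  CoreOf-exists {k} (suc ℓ) {σ} A with CoreOf-exists ℓ (Adm-suc A)
  ... | κ , C = cons⁺ (suc k ∸ σ 0 + row κ (pred (σ 0))) κ , CoreOf-cons A C (suc-pred-Adm A 0)
    (trans (trans (+-assoc (suc k ∸ σ 0) _ _) (trans (cong (suc k ∸ σ 0 +_) (+-comm (row κ (pred (σ 0))) (σ 0))) (sym (+-assoc (suc k ∸ σ 0) _ _))))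
      (cong (_+ row κ (pred (σ 0))) (m∸n+n≡m (subst (σ 0 ≤_) (+-identityʳ (suc k)) (Adm.hi A 0)))))

-- Removing ribbons along a runner, in terms of the offsets.

module Cover where
  open Core
  open Linear
  open import Data.Nat using (ℕ; zero; suc; _+_; _∸_; _≤_; _<_; z≤n; s≤s)
  open import Data.Nat.Properties
  open import Data.List using ([]; _∷_)
  open import Data.Product using (_,_)
  open import Data.Sum using (_⊎_; inj₁; inj₂; [_,_]′)
  open import Data.Empty using (⊥-elim)
  open import Function using (_∘_)
  open import Relation.Binary.PropositionalEquality

  module _ {k ℓ σ} (A : Adm k ℓ σ) where
    open Adm A

    -- `σ r - r` increases weakly because the encoded parts decrease; the form avoids subtraction.
    σ-mono : ∀ {a b} → a ≤ b → σ a + b ≤ σ b + a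
    σ-mono {a} {b} p with m≤n⇒∃[o]m+o≡n p
    ... | o , refl = go o
      where
      go : ∀ o → σ a + (a + o) ≤ σ (a + o) + a
      go zero    = lin (a ∷ σ a ∷ σ (a + 0) ∷ []) (v1 ⊹ (v0 ⊹ #0)) (v2 ⊹ v0) (:≥ v1 v2 (cong σ (+-identityʳ a)) ∷ [])
      go (suc o) = lin (o ∷ a ∷ σ a ∷ σ (a + suc o) ∷ σ (a + o) ∷ σ (suc (a + o)) ∷ []) (v2 ⊹ (v1 ⊹ 1+ v0)) (v3 ⊹ v1) (:≤ (v2 ⊹ (v1 ⊹ v0)) (v4 ⊹ v1) (go o) ∷ :≤ (1+ v4) v5 (mono (a + o)) ∷ :≥ v5 v3 (cong σ (+-suc a o)) ∷ [])

    σ-cancel-≤ : ∀ {a b} → σ a ≤ σ b → a ≤ b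
    σ-cancel-≤ {a} {b} p = ≮⇒≥ λ q → lin⊥ (σ a ∷ σ b ∷ b ∷ a ∷ []) (:≤ v0 v1 p ∷ :≤ (1+ v2) v3 q ∷ :≤ (v1 ⊹ v3) (v0 ⊹ v2) (σ-mono (<⇒≤ q)) ∷ [])

    σ-injective : ∀ {a b} → σ a ≡ σ b → a ≡ b
    σ-injective e = ≤-antisym (σ-cancel-≤ (≤-reflexive e)) (σ-cancel-≤ (≤-reflexive (sym e)))

  -- Indicator of lo ≤ r < lo + len.
  interval : ℕ → ℕ → ℕ → ℕ
  interval zero     zero      r       = 0
  interval zero     (suc len) zero    = 1
  interval zero     (suc len) (suc r) = interval zero len r
  interval (suc lo) len       zero    = 0
  interval (suc lo) len       (suc r) = interval lo len r

  data Interval (lo len r v : ℕ) : Set where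
    before : r < lo → v ≡ 0 → Interval lo len r v
    inside : ∀ i → i < len → r ≡ lo + i → v ≡ 1 → Interval lo len r v
    after  : lo + len ≤ r → v ≡ 0 → Interval lo len r v

  locate : ∀ lo len r → Interval lo len r (interval lo len r)
  locate zero     zero      r       = after z≤n refl
  locate zero     (suc len) zero    = inside 0 (s≤s z≤n) refl refl
  locate zero     (suc len) (suc r) with locate zero len r
  ... | inside i p e v = inside (suc i) (s≤s p) (cong suc e) v
  ... | after p v      = after (s≤s p) v
  locate (suc lo) len       zero    = before (s≤s z≤n) refl
  locate (suc lo) len       (suc r) with locate lo len r
  ... | before p v     = before (s≤s p) v
  ... | inside i p e v = inside i p (cong suc e) v
  ... | after p v      = after (s≤s p) v

  interval-inside : ∀ lo len {i} → i < len → interval lo len (lo + i) ≡ 1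
  interval-inside lo len {i} p with locate lo len (lo + i)
  ... | inside _ _ _ e = e
  ... | before q _     = ⊥-elim (lin⊥ (i ∷ lo ∷ []) (:≤ (1+ (v1 ⊹ v0)) v1 q ∷ []))
  ... | after q _      = ⊥-elim (lin⊥ (len ∷ lo ∷ i ∷ []) (:≤ (v1 ⊹ v0) (v1 ⊹ v2) q ∷ :≤ (1+ v2) v0 p ∷ []))

  interval-before : ∀ {lo len r} → r < lo → interval lo len r ≡ 0
  interval-before {lo} {len} {r} p with locate lo len r
  ... | inside i _ e _ = ⊥-elim (lin⊥ (r ∷ lo ∷ i ∷ []) (:≤ (1+ v0) v1 p ∷ :≥ (v1 ⊹ v2) v0 e ∷ []))
  ... | before _ v     = v
  ... | after _ v      = v

  interval-after : ∀ {lo len r} → lo + len ≤ r → interval lo len r ≡ 0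
  interval-after {lo} {len} {r} p with locate lo len r
  ... | inside i q e _ = ⊥-elim (lin⊥ (len ∷ lo ∷ r ∷ i ∷ []) (:≤ (v1 ⊹ v0) v2 p ∷ :≡ v2 (v1 ⊹ v3) e ∷ :≤ (1+ v3) v0 q ∷ []))
  ... | before _ v     = v
  ... | after _ v      = v

  -- With b r = κ r - r the r-th bead of the core, b (σ r) = b r - (k + 1): the rows Y 0 > Y 1 > ... > Y t are
  -- all the beads of one runner that lie on or above row y = Y 0.
  record Tower (σ : ℕ → ℕ) (m y t x : ℕ) (Y : ℕ → ℕ) : Set where
    field
      base : Y 0 ≡ y
      step : ∀ {j} → j < t → ∀ {i} → i ≤ m → σ (Y (suc j) + i) ≡ Y j + i
      roof : ∀ r → σ r ≢ Y t
      -- Rows `x`, ..., `x + m - 1` lie one step above rows `Y t + 1`, ..., `Y t + m` on their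
      -- runners. In the top ribbon only the first of the `m + 1` beads is the highest of its
      -- runner.
      side : ∀ {i} → i < m → σ (x + i) ≡ suc (Y t + i)

  -- The data under which the ribbons with top rows Y 0, ..., Y t and m + 1 rows each can be removed from a core.
  record Good (k : ℕ) (σ : ℕ → ℕ) (y m t x : ℕ) (Y : ℕ → ℕ) : Set where
    field
      -- For the encoded parts `suc k + r - σ r`: row `y` is nonempty, rows `y`, ..., `y + m` are
      -- equal, and row `y + m + 1` is shorter. `window` keeps ribbons of different levels apart.
      pos    : σ y ≤ k + y
      run    : ∀ {i} → i ≤ m → σ (y + i) ≡ σ y + i
      stop   : suc (σ y + m) < σ (suc (y + m))
      window : y + m < σ y
      tower  : Tower σ m y t x Y
    open Tower tower public

  module Geometry {k ℓ σ} (A : Adm k ℓ σ) {y m t x Y} (G : Good k σ y m t x Y) where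
    open Adm A
    open Good G

    -- The separation at the bottom passes to higher levels: if `Y j ≤ Y (suc j) + m`, the
    -- monotonicity of `σ r - r` between these two rows contradicts the gap one level below.
    gap : ∀ {j} → j ≤ t → Y j + m < σ (Y j)
    gap {zero}  p = subst (λ z → z + m < σ z) (sym base) window
    gap {suc j} p = ≰⇒> λ q → lin⊥ (σ (Y (suc j)) ∷ m ∷ Y (suc j) ∷ Y j ∷ σ (Y (suc j) + m) ∷ σ (Y j) ∷ []) (:≤ v0 (v2 ⊹ v1) q ∷ :≥ v3 v0 step₀ ∷ :≡ v4 (v3 ⊹ v1) (step p {m} ≤-refl) ∷ :≤ (1+ (v3 ⊹ v1)) v5 (gap (<⇒≤ p)) ∷ :≤ (v5 ⊹ (v2 ⊹ v1)) (v4 ⊹ v3) (σ-mono A {Y j} {Y (suc j) + m} (lin (Y j ∷ m ∷ Y (suc j) ∷ σ (Y (suc j)) ∷ []) v0 (v2 ⊹ v1) (:≤ v3 (v2 ⊹ v1) q ∷ :≥ v0 v3 step₀ ∷ []))) ∷ [])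
      where
      step₀ : σ (Y (suc j)) ≡ Y j
      step₀ = trans (cong σ (sym (+-identityʳ _))) (trans (step p {0} z≤n) (+-identityʳ _))

    step₀ : ∀ {j} → j < t → σ (Y (suc j)) ≡ Y j
    step₀ {j} p = trans (cong σ (sym (+-identityʳ _))) (trans (step p {0} z≤n) (+-identityʳ _))

    spaced : ∀ {j} → j < t → Y (suc j) + m < Y j
    spaced {j} p = lin (m ∷ Y (suc j) ∷ Y j ∷ σ (Y (suc j)) ∷ []) (1+ (v1 ⊹ v0)) v2 (:≤ (1+ (v1 ⊹ v0)) v3 (gap p) ∷ :≡ v3 v2 (step₀ p) ∷ [])

    descending : ∀ {i j} → i ≤ j → j ≤ t → Y j ≤ Y i
    descending {i} {zero} z≤n q = ≤-refl
    descending {i} {suc j} p q = [ (λ { refl → ≤-refl }) , (λ { (s≤s p′) → (lin (Y (suc j) ∷ Y i ∷ m ∷ Y j ∷ []) v0 v1 (:≤ (1+ (v0 ⊹ v2)) v3 (spaced q) ∷ :≤ v3 v1 (descending p′ (<⇒≤ q)) ∷ [])) }) ]′ (swap (m≤n⇒m<n∨m≡n p))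
      where
      swap : ∀ {A B : Set} → A ⊎ B → B ⊎ A
      swap (inj₁ a) = inj₂ a
      swap (inj₂ b) = inj₁ b

    spread : ∀ {i j} → i < j → j ≤ t → Y j + m < Y i
    spread {i} {suc j} (s≤s p) q = lin (m ∷ Y (suc j) ∷ Y i ∷ Y j ∷ []) (1+ (v1 ⊹ v0)) v2 (:≤ (1+ (v1 ⊹ v0)) v3 (spaced q) ∷ :≤ v3 v2 (descending p (<⇒≤ q)) ∷ [])

    side-< : ∀ {i} → i < m → x + i < Y t
    side-< {i} p = ≰⇒> λ q → lin⊥ (Y t ∷ i ∷ x ∷ m ∷ σ (x + i) ∷ σ (Y t) ∷ []) (:≤ v0 (v2 ⊹ v1) q ∷ :≤ (1+ v1) v3 p ∷ :≡ v4 (1+ (v0 ⊹ v1)) (side p) ∷ :≤ (1+ (v0 ⊹ v3)) v5 (gap {t} ≤-refl) ∷ :≤ (v5 ⊹ (v2 ⊹ v1)) (v4 ⊹ v0) (σ-mono A q) ∷ [])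

    top≤y : Y t ≤ y
    top≤y = subst (Y t ≤_) base (descending z≤n ≤-refl)

    y+m<ℓ : y + m < ℓ
    y+m<ℓ = ≰⇒> λ q → lin⊥ (m ∷ y ∷ k ∷ σ (y + m) ∷ σ y ∷ []) (:≥ (1+ v2 ⊹ (v1 ⊹ v0)) v3 (tail q) ∷ :≡ v3 (v4 ⊹ v0) (run {m} ≤-refl) ∷ :≤ v4 (v2 ⊹ v1) pos ∷ [])

    -- Of the new offset function only this equation, free of subtraction, is used.
    module _ {σ′ : ℕ → ℕ} (spec : ∀ r → σ′ r + interval x m r ≡ σ r + interval y (suc m) r) where
      private
        module _ (r : ℕ) where
          S  = spec r
          S′ = spec (suc r)

        drop : ∀ r → interval x m r ≤ 1
        drop r with locate x m r
        ... | before _ v     = lin (interval x m r ∷ []) v0 #1 (:≡ v0 #0 v ∷ [])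
        ... | inside _ _ _ v = lin (interval x m r ∷ []) v0 #1 (:≡ v0 #1 v ∷ [])
        ... | after _ v      = lin (interval x m r ∷ []) v0 #1 (:≡ v0 #0 v ∷ [])

        side-mono : ∀ r → σ r + interval x m (suc r) < σ (suc r) + interval x m r
        side-mono r with locate x m (suc r)
        ... | before _ v = lin (interval x m (suc r) ∷ σ r ∷ interval x m r ∷ σ (suc r) ∷ []) (1+ (v1 ⊹ v0)) (v3 ⊹ v2) (:≡ v0 #0 v ∷ :≤ (1+ v1) v3 (mono r) ∷ [])
        ... | after _ v  = lin (interval x m (suc r) ∷ σ r ∷ interval x m r ∷ σ (suc r) ∷ []) (1+ (v1 ⊹ v0)) (v3 ⊹ v2) (:≡ v0 #0 v ∷ :≤ (1+ v1) v3 (mono r) ∷ [])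
        ... | inside (suc i) p e v = lin (interval x m (suc r) ∷ σ r ∷ interval x m r ∷ σ (suc r) ∷ []) (1+ (v1 ⊹ v0)) (v3 ⊹ v2) (:≡ v0 #1 v ∷ :≤ (1+ v1) v3 (mono r) ∷ :≥ #1 v2 (trans (cong (interval x m) {r} {x + i} (lin≡ (r ∷ i ∷ x ∷ []) v0 (v2 ⊹ v1) (:≡ (1+ v0) (v2 ⊹ 1+ v1) e ∷ []))) (interval-inside x m (<-trans (n<1+n i) p))) ∷ [])
        -- Row `r` is the one just above row `x`, whose value falls from `Y t + 1` to `Y t`; by
        -- `roof` row `r` does not already have that value.
        ... | inside zero p e v = lin (interval x m (suc r) ∷ σ r ∷ interval x m r ∷ σ (suc r) ∷ Y t ∷ []) (1+ (v1 ⊹ v0)) (v3 ⊹ v2) (:≡ v0 #1 v ∷ :≤ (1+ v1) v4 σr<Yt ∷ :≥ (1+ (v4 ⊹ #0)) v3 σr+1 ∷ [])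
          where
          σr+1 : σ (suc r) ≡ suc (Y t + 0)
          σr+1 = trans (cong σ e) (side p)
          σr<Yt : σ r < Y t
          σr<Yt = ≤∧≢⇒< (lin (σ r ∷ Y t ∷ σ (suc r) ∷ []) v0 v1 (:≤ (1+ v0) v2 (mono r) ∷ :≡ v2 (1+ (v1 ⊹ #0)) σr+1 ∷ [])) (roof r)

        mono′ : ∀ r → σ′ r < σ′ (suc r)
        mono′ r with locate y (suc m) r
        ... | before _ v = lin (σ′ r ∷ σ′ (suc r) ∷ interval y (suc m) r ∷ interval x m r ∷ σ r ∷ interval y (suc m) (suc r) ∷ σ (suc r) ∷ interval x m (suc r) ∷ []) (1+ v0) v1 (:≡ v2 #0 v ∷ :≡ (v0 ⊹ v3) (v4 ⊹ v2) (S r) ∷ :≥ (v6 ⊹ v5) (v1 ⊹ v7) (S′ r) ∷ :≤ (1+ (v4 ⊹ v7)) (v6 ⊹ v3) (side-mono r) ∷ [])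
        ... | after _ v  = lin (σ′ r ∷ σ′ (suc r) ∷ interval y (suc m) r ∷ interval x m r ∷ σ r ∷ interval y (suc m) (suc r) ∷ σ (suc r) ∷ interval x m (suc r) ∷ []) (1+ v0) v1 (:≡ v2 #0 v ∷ :≡ (v0 ⊹ v3) (v4 ⊹ v2) (S r) ∷ :≥ (v6 ⊹ v5) (v1 ⊹ v7) (S′ r) ∷ :≤ (1+ (v4 ⊹ v7)) (v6 ⊹ v3) (side-mono r) ∷ [])
        ... | inside i p e v with m≤n⇒m<n∨m≡n p
        ...   | inj₁ (s≤s q) = lin (σ′ r ∷ σ′ (suc r) ∷ interval y (suc m) r ∷ interval x m r ∷ σ r ∷ interval y (suc m) (suc r) ∷ σ (suc r) ∷ interval x m (suc r) ∷ []) (1+ v0) v1 (:≡ v2 #1 v ∷ :≡ (v0 ⊹ v3) (v4 ⊹ v2) (S r) ∷ :≥ (v6 ⊹ v5) (v1 ⊹ v7) (S′ r) ∷ :≤ (1+ (v4 ⊹ v7)) (v6 ⊹ v3) (side-mono r) ∷ :≥ #1 v5 (trans (cong (interval y (suc m)) {suc r} {y + suc i} (lin≡ (r ∷ i ∷ y ∷ []) (1+ v0) (v2 ⊹ 1+ v1) (:≡ v0 (v2 ⊹ v1) e ∷ []))) (interval-inside y (suc m) (s≤s q))) ∷ [])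
        -- At the lower end of the plus block `stop` provides the free value needed for the
        -- increase.
        ...   | inj₂ refl with locate x m (suc r)
        ...     | before _ v′ = lin (σ′ r ∷ σ′ (suc r) ∷ interval y (suc i) r ∷ interval x i (suc r) ∷ interval x i r ∷ σ r ∷ interval y (suc i) (suc r) ∷ σ (suc r) ∷ σ (y + i) ∷ σ (suc (y + i)) ∷ i ∷ σ y ∷ []) (1+ v0) v1 (:≡ v2 #1 v ∷ :≡ v3 #0 v′ ∷ :≡ (v0 ⊹ v4) (v5 ⊹ v2) (S r) ∷ :≥ (v7 ⊹ v6) (v1 ⊹ v3) (S′ r) ∷ :≡ v5 v8 (cong σ e) ∷ :≥ v9 v7 (cong (σ ∘ suc) e) ∷ :≡ v8 (v11 ⊹ v10) (run {m} ≤-refl) ∷ :≤ (1+ (1+ (v11 ⊹ v10))) v9 stop ∷ [])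
        ...     | after _ v′  = lin (σ′ r ∷ σ′ (suc r) ∷ interval y (suc i) r ∷ interval x i (suc r) ∷ interval x i r ∷ σ r ∷ interval y (suc i) (suc r) ∷ σ (suc r) ∷ σ (y + i) ∷ σ (suc (y + i)) ∷ i ∷ σ y ∷ []) (1+ v0) v1 (:≡ v2 #1 v ∷ :≡ v3 #0 v′ ∷ :≡ (v0 ⊹ v4) (v5 ⊹ v2) (S r) ∷ :≥ (v7 ⊹ v6) (v1 ⊹ v3) (S′ r) ∷ :≡ v5 v8 (cong σ e) ∷ :≥ v9 v7 (cong (σ ∘ suc) e) ∷ :≡ v8 (v11 ⊹ v10) (run {m} ≤-refl) ∷ :≤ (1+ (1+ (v11 ⊹ v10))) v9 stop ∷ [])
        ...     | inside i′ p′ e′ v′ = ⊥-elim (lin⊥ (i′ ∷ x ∷ Y t ∷ y ∷ i ∷ r ∷ []) (:≤ (1+ (v1 ⊹ v0)) v2 (side-< p′) ∷ :≤ v2 v3 top≤y ∷ :≥ (v3 ⊹ v4) v5 e ∷ :≡ (1+ v5) (v1 ⊹ v0) e′ ∷ []))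

      lam-lo : ∀ r → r < σ′ r
      lam-lo r with locate x m r
      ... | before _ v     = lin (r ∷ σ′ r ∷ interval x m r ∷ interval y (suc m) r ∷ σ r ∷ []) (1+ v0) v1 (:≡ v2 #0 v ∷ :≥ (v4 ⊹ v3) (v1 ⊹ v2) (spec r) ∷ :≤ (1+ v0) v4 (lo r) ∷ [])
      ... | after _ v      = lin (r ∷ σ′ r ∷ interval x m r ∷ interval y (suc m) r ∷ σ r ∷ []) (1+ v0) v1 (:≡ v2 #0 v ∷ :≥ (v4 ⊹ v3) (v1 ⊹ v2) (spec r) ∷ :≤ (1+ v0) v4 (lo r) ∷ [])
      ... | inside i p e v = lin (r ∷ σ′ r ∷ interval x m r ∷ interval y (suc m) r ∷ σ r ∷ i ∷ Y t ∷ x ∷ []) (1+ v0) v1 (:≡ v2 #1 v ∷ :≥ (v4 ⊹ v3) (v1 ⊹ v2) (spec r) ∷ :≥ (1+ (v6 ⊹ v5)) v4 (trans (cong σ e) (side p)) ∷ :≤ (1+ (v7 ⊹ v5)) v6 (side-< p) ∷ :≡ v0 (v7 ⊹ v5) e ∷ [])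

      lam-hi : ∀ r → σ′ r ≤ suc k + r
      lam-hi r with locate y (suc m) r
      ... | before _ v           = lin (σ′ r ∷ r ∷ k ∷ interval y (suc m) r ∷ interval x m r ∷ σ r ∷ []) v0 (1+ (v2 ⊹ v1)) (:≡ v3 #0 v ∷ :≡ (v0 ⊹ v4) (v5 ⊹ v3) (spec r) ∷ :≤ v5 (1+ v2 ⊹ v1) (hi r) ∷ [])
      ... | after _ v            = lin (σ′ r ∷ r ∷ k ∷ interval y (suc m) r ∷ interval x m r ∷ σ r ∷ []) v0 (1+ (v2 ⊹ v1)) (:≡ v3 #0 v ∷ :≡ (v0 ⊹ v4) (v5 ⊹ v3) (spec r) ∷ :≤ v5 (1+ v2 ⊹ v1) (hi r) ∷ [])
      ... | inside i (s≤s p) e v = lin (σ′ r ∷ r ∷ k ∷ interval y (suc m) r ∷ interval x m r ∷ σ r ∷ i ∷ σ y ∷ y ∷ []) v0 (1+ (v2 ⊹ v1)) (:≡ v3 #1 v ∷ :≡ (v0 ⊹ v4) (v5 ⊹ v3) (spec r) ∷ :≡ v5 (v7 ⊹ v6) (trans (cong σ e) (run p)) ∷ :≤ v7 (v2 ⊹ v8) pos ∷ :≥ (v8 ⊹ v6) v1 e ∷ [])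

      lam-tail : ∀ {r} → ℓ ≤ r → σ′ r ≡ suc k + r
      lam-tail {r} p with locate x m r
      ... | before _ v     = lin≡ (σ′ r ∷ r ∷ k ∷ interval x m r ∷ interval y (suc m) r ∷ σ r ∷ []) v0 (1+ (v2 ⊹ v1)) (:≥ #0 v3 v ∷ :≡ (v0 ⊹ v3) (v5 ⊹ v4) (spec r) ∷ :≡ v5 (1+ v2 ⊹ v1) (tail p) ∷ :≡ v4 #0 (interval-after {y} {suc m} {r} (lin (m ∷ y ∷ r ∷ ℓ ∷ []) (v1 ⊹ 1+ v0) v2 (:≤ v3 v2 p ∷ :≤ (1+ (v1 ⊹ v0)) v3 y+m<ℓ ∷ []))) ∷ [])
      ... | after _ v      = lin≡ (σ′ r ∷ r ∷ k ∷ interval x m r ∷ interval y (suc m) r ∷ σ r ∷ []) v0 (1+ (v2 ⊹ v1)) (:≥ #0 v3 v ∷ :≡ (v0 ⊹ v3) (v5 ⊹ v4) (spec r) ∷ :≡ v5 (1+ v2 ⊹ v1) (tail p) ∷ :≡ v4 #0 (interval-after {y} {suc m} {r} (lin (m ∷ y ∷ r ∷ ℓ ∷ []) (v1 ⊹ 1+ v0) v2 (:≤ v3 v2 p ∷ :≤ (1+ (v1 ⊹ v0)) v3 y+m<ℓ ∷ []))) ∷ [])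
      ... | inside i q e v = ⊥-elim (lin⊥ (i ∷ x ∷ Y t ∷ y ∷ r ∷ m ∷ ℓ ∷ []) (:≤ (1+ (v1 ⊹ v0)) v2 (side-< q) ∷ :≤ v2 v3 top≤y ∷ :≡ v4 (v1 ⊹ v0) e ∷ :≤ (1+ (v3 ⊹ v5)) v6 y+m<ℓ ∷ :≤ v6 v4 p ∷ :≤ (1+ v0) v5 q ∷ []))

      lam-Adm : Adm k ℓ σ′
      lam-Adm = record { mono = mono′ ; lo = lam-lo ; hi = lam-hi ; tail = lam-tail }

      σ′-base : ∀ {i} → i ≤ m → σ′ (y + i) ≡ suc (σ y + i)
      σ′-base {i} p with locate x m (y + i)
      ... | before _ v     = lin≡ (σ′ (y + i) ∷ i ∷ σ y ∷ interval x m (y + i) ∷ interval y (suc m) (y + i) ∷ σ (y + i) ∷ []) v0 (1+ (v2 ⊹ v1)) (:≥ #0 v3 v ∷ :≡ (v0 ⊹ v3) (v5 ⊹ v4) (spec (y + i)) ∷ :≡ v5 (v2 ⊹ v1) (run p) ∷ :≡ v4 #1 (interval-inside y (suc m) (s≤s p)) ∷ [])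
      ... | after _ v      = lin≡ (σ′ (y + i) ∷ i ∷ σ y ∷ interval x m (y + i) ∷ interval y (suc m) (y + i) ∷ σ (y + i) ∷ []) v0 (1+ (v2 ⊹ v1)) (:≥ #0 v3 v ∷ :≡ (v0 ⊹ v3) (v5 ⊹ v4) (spec (y + i)) ∷ :≡ v5 (v2 ⊹ v1) (run p) ∷ :≡ v4 #1 (interval-inside y (suc m) (s≤s p)) ∷ [])
      ... | inside j q e v = ⊥-elim (lin⊥ (j ∷ x ∷ Y t ∷ y ∷ i ∷ []) (:≤ (1+ (v1 ⊹ v0)) v2 (side-< q) ∷ :≤ v2 v3 top≤y ∷ :≡ (v3 ⊹ v4) (v1 ⊹ v0) e ∷ []))

      σ′-step : ∀ {j} → j < t → ∀ {i} → i ≤ m → σ′ (Y (suc j) + i) ≡ Y j + i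
      σ′-step {j} q {i} p with locate x m (Y (suc j) + i)
      ... | before _ v = lin≡ (σ′ (Y (suc j) + i) ∷ i ∷ Y j ∷ interval x m (Y (suc j) + i) ∷ interval y (suc m) (Y (suc j) + i) ∷ σ (Y (suc j) + i) ∷ []) v0 (v2 ⊹ v1) (:≥ #0 v3 v ∷ :≡ (v0 ⊹ v3) (v5 ⊹ v4) (spec (Y (suc j) + i)) ∷ :≡ v5 (v2 ⊹ v1) (step q p) ∷ :≡ v4 #0 (interval-before {y} {suc m} {Y (suc j) + i} (lin (i ∷ Y (suc j) ∷ y ∷ m ∷ Y 0 ∷ []) (1+ (v1 ⊹ v0)) v2 (:≤ v0 v3 p ∷ :≡ v4 v2 base ∷ :≤ (1+ (v1 ⊹ v3)) v4 (spread {0} {suc j} (s≤s z≤n) q) ∷ []))) ∷ [])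
      ... | after _ v  = lin≡ (σ′ (Y (suc j) + i) ∷ i ∷ Y j ∷ interval x m (Y (suc j) + i) ∷ interval y (suc m) (Y (suc j) + i) ∷ σ (Y (suc j) + i) ∷ []) v0 (v2 ⊹ v1) (:≥ #0 v3 v ∷ :≡ (v0 ⊹ v3) (v5 ⊹ v4) (spec (Y (suc j) + i)) ∷ :≡ v5 (v2 ⊹ v1) (step q p) ∷ :≡ v4 #0 (interval-before {y} {suc m} {Y (suc j) + i} (lin (i ∷ Y (suc j) ∷ y ∷ m ∷ Y 0 ∷ []) (1+ (v1 ⊹ v0)) v2 (:≤ v0 v3 p ∷ :≡ v4 v2 base ∷ :≤ (1+ (v1 ⊹ v3)) v4 (spread {0} {suc j} (s≤s z≤n) q) ∷ []))) ∷ [])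
      ... | inside i′ p′ e v = ⊥-elim (lin⊥ (i′ ∷ x ∷ Y t ∷ Y (suc j) ∷ i ∷ []) (:≤ (1+ (v1 ⊹ v0)) v2 (side-< p′) ∷ :≤ v2 v3 (descending q ≤-refl) ∷ :≡ (v3 ⊹ v4) (v1 ⊹ v0) e ∷ []))

      σ′-side : ∀ {i} → i < m → σ′ (x + i) ≡ Y t + i
      σ′-side {i} p = lin≡ (σ′ (x + i) ∷ i ∷ Y t ∷ interval x m (x + i) ∷ interval y (suc m) (x + i) ∷ σ (x + i) ∷ []) v0 (v2 ⊹ v1) (:≡ (v0 ⊹ v3) (v5 ⊹ v4) (spec (x + i)) ∷ :≡ v5 (1+ (v2 ⊹ v1)) (side p) ∷ :≥ #1 v3 (interval-inside x m p) ∷ :≡ v4 #0 (interval-before {y} {suc m} {x + i} (lin (i ∷ x ∷ y ∷ Y t ∷ []) (1+ (v1 ⊹ v0)) v2 (:≤ (1+ (v1 ⊹ v0)) v3 (side-< p) ∷ :≤ v3 v2 top≤y ∷ []))) ∷ [])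

      σ′-other : ∀ {r} → interval x m r ≡ 0 → interval y (suc m) r ≡ 0 → σ′ r ≡ σ r
      σ′-other {r} u v = lin≡ (σ′ r ∷ σ r ∷ interval x m r ∷ interval y (suc m) r ∷ []) v0 v1 (:≥ #0 v2 u ∷ :≡ v3 #0 v ∷ :≡ (v0 ⊹ v2) (v1 ⊹ v3) (spec r) ∷ [])

  -- The sum of the offsets grows by `(m + 1) - m = 1`, whatever the number `t + 1` of ribbons: on
  -- the levels in between, `σ (Y (suc j) + i) ≡ Y j + i` holds before and after the removal.
  lam : (ℕ → ℕ) → ℕ → ℕ → ℕ → ℕ → ℕ
  lam σ y m x r = σ r + interval y (suc m) r ∸ interval x m r

  lam-spec : ∀ {σ y m x} → (∀ r → r < σ r) → ∀ r → lam σ y m x r + interval x m r ≡ σ r + interval y (suc m) r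
  lam-spec {σ} {y} {m} {x} lo r = m∸n+n≡m (≤-trans (≤-trans drop (≤-trans (s≤s z≤n) (lo r))) (m≤m+n (σ r) _))
    where
    drop : interval x m r ≤ 1
    drop with locate x m r
    ... | before _ v     = ≤-trans (≤-reflexive v) z≤n
    ... | inside _ _ _ v = ≤-reflexive v
    ... | after _ v      = ≤-trans (≤-reflexive v) z≤n

-- The rows of the core left by a removal.

module Rows where
  open Row
  open Core
  open Cover
  open Linear
  open import Data.Nat using (ℕ; zero; suc; _+_; _∸_; _≤_; _<_; z≤n; s≤s)
  open import Data.Nat.Properties
  open import Data.List using ([]; _∷_)
  open import Data.Product using (_×_; _,_; proj₁; proj₂)
  open import Data.Sum using (_⊎_; inj₁; inj₂; [_,_]′)
  open import Data.Empty using (⊥-elim)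
  open import Function using (_∘_)
  open import Relation.Binary.PropositionalEquality

  module _ {k ℓ κ σ} (C : CoreOf k ℓ κ σ) {y m t x Y} (G : Good k σ y m t x Y) where
    open CoreOf C using (adm; rec; partition; lo)
    open Good G
    open Geometry adm G

    -- The bead of row `y` slides down to the place `k + 1` above the bead of row `suc (σ y + m)`,
    -- which is vacant because `σ` skips that row. Seen `k + 1` places lower, this is the distance
    -- between the beads of rows `σ y` and `suc (σ y + m)`, the common size of the ribbons.
    ribbon : ℕ
    ribbon = row κ (σ y) + suc (σ y + m) ∸ (row κ (suc (σ y + m)) + σ y)

    ribbon-eq : ribbon + (row κ (suc (σ y + m)) + σ y) ≡ row κ (σ y) + suc (σ y + m)
    ribbon-eq = m∸n+n≡m {row κ (σ y) + suc (σ y + m)} {row κ (suc (σ y + m)) + σ y}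
      (lin (σ y ∷ row κ (suc (σ y + m)) ∷ m ∷ row κ (σ y) ∷ []) (v1 ⊹ v0) (v3 ⊹ 1+ (v0 ⊹ v2)) (:≤ v1 v3 (row-antitone partition {σ y} {suc (σ y + m)} (m≤n⇒m≤1+n (m≤m+n (σ y) m))) ∷ []))

    -- With `block-nonempty`: the bead of row `Y j`, moved down by `ribbon` places, lands strictly
    -- between the beads of rows `Y j + m` and `Y j + m + 1`. At level 0 this comes from `run` and
    -- `stop`; `rec` carries it from level to level.
    block-end : ∀ {j} → j ≤ t → row κ (suc (Y j + m)) + ribbon ≤ row κ (Y j) + m
    block-end {zero} p = subst (λ z → row κ (suc (z + m)) + ribbon ≤ row κ z + m) (sym base)
      (lin (ribbon ∷ row κ (suc (y + m)) ∷ m ∷ row κ y ∷ σ y ∷ row κ (suc (σ y + m)) ∷ row κ (σ y) ∷ y ∷ k ∷ σ (suc (y + m)) ∷ row κ (σ (suc (y + m))) ∷ []) (v1 ⊹ v0) (v3 ⊹ v2) (:≡ (v0 ⊹ (v5 ⊹ v4)) (v6 ⊹ 1+ (v4 ⊹ v2)) ribbon-eq ∷ :≥ (1+ v8 ⊹ v7 ⊹ v6) (v3 ⊹ v4) (rec y) ∷ :≡ (v1 ⊹ v9) (1+ v8 ⊹ 1+ (v7 ⊹ v2) ⊹ v10) (rec (suc (y + m))) ∷ :≤ (1+ (1+ (v4 ⊹ v2))) v9 stop ∷ :≤ v10 v5 (row-antitone partition {suc (σ y + m)} {σ (suc (y + m))} (<⇒≤ stop)) ∷ []))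
    block-end {suc j} p = lin (ribbon ∷ row κ (suc (Y (suc j) + m)) ∷ m ∷ row κ (Y (suc j)) ∷ row κ (suc (Y j + m)) ∷ row κ (Y j) ∷ row κ (σ (Y (suc j))) ∷ Y (suc j) ∷ k ∷ σ (Y (suc j)) ∷ σ (suc (Y (suc j) + m)) ∷ row κ (σ (suc (Y (suc j) + m))) ∷ Y j ∷ []) (v1 ⊹ v0) (v3 ⊹ v2) (:≤ (v4 ⊹ v0) (v5 ⊹ v2) (block-end (<⇒≤ p)) ∷ :≥ (1+ v8 ⊹ v7 ⊹ v6) (v3 ⊹ v9) (rec (Y (suc j))) ∷ :≡ (v1 ⊹ v10) (1+ v8 ⊹ 1+ (v7 ⊹ v2) ⊹ v11) (rec (suc (Y (suc j) + m))) ∷ :≡ v9 v12 (step₀ p) ∷ :≤ (1+ (v12 ⊹ v2)) v10 above ∷ :≤ v11 v4 (row-antitone partition above) ∷ :≥ v5 v6 (cong (row κ) (step₀ p)) ∷ [])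
      where
      above : suc (Y j + m) ≤ σ (suc (Y (suc j) + m))
      above = lin (m ∷ Y j ∷ σ (suc (Y (suc j) + m)) ∷ σ (Y (suc j) + m) ∷ []) (1+ (v1 ⊹ v0)) v2 (:≥ (v1 ⊹ v0) v3 (step p {m} ≤-refl) ∷ :≤ (1+ v3) v2 (CoreOf.mono C (Y (suc j) + m)) ∷ [])

    block-nonempty : ∀ {j} → j ≤ t → row κ (Y j) + m < row κ (Y j + m) + ribbon
    block-nonempty {zero} p = subst (λ z → row κ z + m < row κ (z + m) + ribbon) (sym base)
      (lin (m ∷ row κ y ∷ ribbon ∷ row κ (y + m) ∷ σ y ∷ row κ (σ y) ∷ row κ (suc (σ y + m)) ∷ y ∷ k ∷ row κ (σ (y + m)) ∷ σ (y + m) ∷ row κ (σ y + m) ∷ []) (1+ (v1 ⊹ v0)) (v3 ⊹ v2) (:≥ (v5 ⊹ 1+ (v4 ⊹ v0)) (v2 ⊹ (v6 ⊹ v4)) ribbon-eq ∷ :≡ (v1 ⊹ v4) (1+ v8 ⊹ v7 ⊹ v5) (rec y) ∷ :≥ (1+ v8 ⊹ (v7 ⊹ v0) ⊹ v9) (v3 ⊹ v10) (rec (y + m)) ∷ :≡ v10 (v4 ⊹ v0) (run {m} ≤-refl) ∷ :≥ v11 v9 (cong (row κ) (run {m} ≤-refl)) ∷ :≤ v6 v11 (row-antitone partition {σ y + m} {suc (σ y + m)} (n≤1+n (σ y + m))) ∷ []))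
    block-nonempty {suc j} p = lin (m ∷ row κ (Y (suc j)) ∷ ribbon ∷ row κ (Y (suc j) + m) ∷ row κ (Y j) ∷ row κ (Y j + m) ∷ σ (Y (suc j)) ∷ row κ (σ (Y (suc j))) ∷ Y (suc j) ∷ k ∷ row κ (σ (Y (suc j) + m)) ∷ σ (Y (suc j) + m) ∷ Y j ∷ []) (1+ (v1 ⊹ v0)) (v3 ⊹ v2) (:≤ (1+ (v4 ⊹ v0)) (v5 ⊹ v2) (block-nonempty (<⇒≤ p)) ∷ :≡ (v1 ⊹ v6) (1+ v9 ⊹ v8 ⊹ v7) (rec (Y (suc j))) ∷ :≥ (1+ v9 ⊹ (v8 ⊹ v0) ⊹ v10) (v3 ⊹ v11) (rec (Y (suc j) + m)) ∷ :≥ v12 v6 (step₀ p) ∷ :≡ v11 (v12 ⊹ v0) (step p {m} ≤-refl) ∷ :≡ v7 v4 (cong (row κ) (step₀ p)) ∷ :≥ v5 v10 (cong (row κ) (step p {m} ≤-refl)) ∷ [])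

    Outside : ℕ → Set
    Outside r = ∀ {j} → j ≤ t → r < Y j ⊎ Y j + m < r

    module _ {τ σ′} (C′ : CoreOf k ℓ τ σ′) (spec : ∀ r → σ′ r + interval x m r ≡ σ r + interval y (suc m) r) where
      private
        rec′ : ∀ r → row τ r + σ′ r ≡ suc k + r + row τ (σ′ r)
        rec′ = CoreOf.rec C′

      -- Sliding one bead past `m` others moves the rows in between up by one, with one box less
      -- (`Inner`); the moved bead becomes the last row of the block (`Last`).
      Inner Last Other : ℕ → Set
      Inner r = ∀ {j i} → j ≤ t → i < m → r ≡ Y j + i → suc (row τ r) ≡ row κ (suc r)
      Last  r = ∀ {j} → j ≤ t → r ≡ Y j + m → row τ r + ribbon ≡ row κ (Y j) + m
      Other r = Outside r → row τ r ≡ row κ r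

      private
        beyond : ∀ {r} → y + m < r → Outside r
        beyond {r} p {j} q = inj₂ (lin (m ∷ Y j ∷ r ∷ y ∷ Y 0 ∷ []) (1+ (v1 ⊹ v0)) v2 (:≤ (1+ (v3 ⊹ v0)) v2 p ∷ :≡ v4 v3 base ∷ :≤ v1 v4 (descending z≤n q) ∷ []))

        -- A row inside a block is hit by `σ` only from the block one level up or, at the top level,
        -- from a row `x + i`; the first row of the top block is not hit at all.
        outside-σ : ∀ {r} → Outside r → (∀ {i} → i < m → r ≢ x + i) → Outside (σ r)
        outside-σ {r} out nx {j} j≤t with ≤-<-connex (Y j) (σ r) | ≤-<-connex (σ r) (Y j + m)
        ... | inj₂ p | _      = inj₁ p
        ... | inj₁ _ | inj₂ q = inj₂ q
        ... | inj₁ p | inj₁ q with m≤n⇒∃[o]m+o≡n p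
        ...   | i , e with m≤n⇒m<n∨m≡n j≤t
        ...     | inj₁ j<t = ⊥-elim ([ (λ z → (lin⊥ (r ∷ Y (suc j) ∷ i ∷ σ r ∷ Y j ∷ []) (:≤ (1+ v0) v1 z ∷ :≥ (v1 ⊹ v2) v0 r≡ ∷ :≥ v3 (v4 ⊹ v2) e ∷ :≤ v4 v3 p ∷ []))) , (λ z → (lin⊥ (m ∷ Y (suc j) ∷ r ∷ i ∷ σ r ∷ Y j ∷ []) (:≤ (1+ (v1 ⊹ v0)) v2 z ∷ :≡ v2 (v1 ⊹ v3) r≡ ∷ :≤ v4 (v5 ⊹ v0) q ∷ :≡ (v5 ⊹ v3) v4 e ∷ []))) ]′ (out j<t))
          where
          r≡ : r ≡ Y (suc j) + i
          r≡ = σ-injective adm (trans (sym e) (sym (step j<t {i} (lin (i ∷ m ∷ σ r ∷ Y j ∷ []) v0 v1 (:≤ v2 (v3 ⊹ v1) q ∷ :≡ (v3 ⊹ v0) v2 e ∷ [])))))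
        outside-σ {r} out nx {j} j≤t | inj₁ p | inj₁ q | zero , e | inj₂ refl = ⊥-elim (roof r (trans (sym e) (+-identityʳ _)))
        outside-σ {r} out nx {j} j≤t | inj₁ p | inj₁ q | suc i , e | inj₂ refl =
          ⊥-elim (nx {i} (lin (i ∷ m ∷ σ r ∷ Y j ∷ []) (1+ v0) v1 (:≤ v2 (v3 ⊹ v1) q ∷ :≡ (v3 ⊹ 1+ v0) v2 e ∷ [])) (σ-injective adm (trans (sym e) (trans (+-suc (Y t) i) (sym (side {i} (lin (i ∷ m ∷ σ r ∷ Y j ∷ []) (1+ v0) v1 (:≤ v2 (v3 ⊹ v1) q ∷ :≡ (v3 ⊹ 1+ v0) v2 e ∷ []))))))))

        module Step (r : ℕ) (IH : ∀ {q} → r < q → Inner q × Last q × Other q) where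
          inner : Inner r
          inner {zero} {i} p q e = lin≡ (row τ r ∷ row κ (suc r) ∷ σ′ r ∷ row τ (σ′ r) ∷ r ∷ k ∷ row κ (σ (suc r)) ∷ σ (suc r) ∷ i ∷ σ y ∷ row τ (suc (σ y + i)) ∷ row κ (suc (σ y + i)) ∷ []) (1+ v0) v1 (:≡ (v0 ⊹ v2) (1+ v5 ⊹ v4 ⊹ v3) (rec′ r) ∷ :≥ (1+ v5 ⊹ 1+ v4 ⊹ v6) (v1 ⊹ v7) (rec (suc r)) ∷ :≥ (1+ (v9 ⊹ v8)) v2 s′ ∷ :≡ v7 (1+ (v9 ⊹ v8)) s ∷ :≡ v3 v10 (cong (row τ) s′) ∷ :≥ v11 v6 (cong (row κ) s) ∷ :≡ v10 v11 ih ∷ [])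
            where
            r≡ : r ≡ y + i
            r≡ = lin≡ (r ∷ i ∷ y ∷ Y 0 ∷ []) v0 (v2 ⊹ v1) (:≡ v0 (v3 ⊹ v1) e ∷ :≡ v3 v2 base ∷ [])
            s′ : σ′ r ≡ suc (σ y + i)
            s′ = trans (cong σ′ r≡) (σ′-base spec (<⇒≤ q))
            s : σ (suc r) ≡ suc (σ y + i)
            s = lin≡ (σ (suc r) ∷ i ∷ σ y ∷ []) v0 (1+ (v2 ⊹ v1)) (:≡ v0 (v2 ⊹ 1+ v1) (trans (cong σ {suc r} {y + suc i} (lin≡ (r ∷ i ∷ y ∷ []) (1+ v0) (v2 ⊹ 1+ v1) (:≡ v0 (v2 ⊹ v1) r≡ ∷ []))) (run q)) ∷ [])
            ih : row τ (suc (σ y + i)) ≡ row κ (suc (σ y + i))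
            ih = proj₂ (proj₂ (IH {suc (σ y + i)} (lin (r ∷ i ∷ σ y ∷ y ∷ m ∷ []) (1+ v0) (1+ (v2 ⊹ v1)) (:≡ v0 (v3 ⊹ v1) r≡ ∷ :≤ (1+ v1) v4 q ∷ :≤ (1+ (v3 ⊹ v4)) v2 window ∷ [])))) (beyond (lin (m ∷ y ∷ i ∷ σ y ∷ []) (1+ (v1 ⊹ v0)) (1+ (v3 ⊹ v2)) (:≤ (1+ (v1 ⊹ v0)) v3 window ∷ [])))
          inner {suc j} {i} p q e = lin≡ (row τ r ∷ row κ (suc r) ∷ σ′ r ∷ row τ (σ′ r) ∷ r ∷ k ∷ row κ (σ (suc r)) ∷ σ (suc r) ∷ i ∷ Y j ∷ row τ (Y j + i) ∷ row κ (suc (Y j + i)) ∷ []) (1+ v0) v1 (:≡ (v0 ⊹ v2) (1+ v5 ⊹ v4 ⊹ v3) (rec′ r) ∷ :≥ (1+ v5 ⊹ 1+ v4 ⊹ v6) (v1 ⊹ v7) (rec (suc r)) ∷ :≥ (v9 ⊹ v8) v2 s′ ∷ :≡ v7 (1+ (v9 ⊹ v8)) s ∷ :≡ v3 v10 (cong (row τ) s′) ∷ :≥ v11 v6 (cong (row κ) s) ∷ :≡ (1+ v10) v11 ih ∷ [])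
            where
            s′ : σ′ r ≡ Y j + i
            s′ = trans (cong σ′ e) (σ′-step spec p (<⇒≤ q))
            s : σ (suc r) ≡ suc (Y j + i)
            s = lin≡ (σ (suc r) ∷ i ∷ Y j ∷ []) v0 (1+ (v2 ⊹ v1)) (:≡ v0 (v2 ⊹ 1+ v1) (trans (cong σ {suc r} {Y (suc j) + suc i} (lin≡ (r ∷ i ∷ Y (suc j) ∷ []) (1+ v0) (v2 ⊹ 1+ v1) (:≡ v0 (v2 ⊹ v1) e ∷ []))) (step p q)) ∷ [])
            ih : suc (row τ (Y j + i)) ≡ row κ (suc (Y j + i))
            ih = proj₁ (IH {Y j + i} (lin (r ∷ i ∷ Y j ∷ Y (suc j) ∷ m ∷ []) (1+ v0) (v2 ⊹ v1) (:≡ v0 (v3 ⊹ v1) e ∷ :≤ (1+ v1) v4 q ∷ :≤ (1+ (v3 ⊹ v4)) v2 (spaced p) ∷ []))) (<⇒≤ p) q refl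

          last : Last r
          last {zero} p e = lin≡ (ribbon ∷ row τ r ∷ m ∷ row κ (Y 0) ∷ σ′ r ∷ row τ (σ′ r) ∷ r ∷ k ∷ row κ (σ y) ∷ y ∷ σ y ∷ row κ y ∷ row τ (suc (σ y + m)) ∷ row κ (suc (σ y + m)) ∷ []) (v1 ⊹ v0) (v3 ⊹ v2) (:≡ (v1 ⊹ v4) (1+ v7 ⊹ v6 ⊹ v5) (rec′ r) ∷ :≥ (1+ v7 ⊹ v9 ⊹ v8) (v11 ⊹ v10) (rec y) ∷ :≥ (1+ (v10 ⊹ v2)) v4 s′ ∷ :≡ v5 v12 (cong (row τ) s′) ∷ :≡ v12 v13 ih ∷ :≡ (v0 ⊹ (v13 ⊹ v10)) (v8 ⊹ 1+ (v10 ⊹ v2)) ribbon-eq ∷ :≡ v6 (v9 ⊹ v2) r≡ ∷ :≥ v11 v3 (cong (row κ) base) ∷ [])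
            where
            r≡ : r ≡ y + m
            r≡ = lin≡ (r ∷ m ∷ y ∷ Y 0 ∷ []) v0 (v2 ⊹ v1) (:≡ v0 (v3 ⊹ v1) e ∷ :≡ v3 v2 base ∷ [])
            s′ : σ′ r ≡ suc (σ y + m)
            s′ = trans (cong σ′ r≡) (σ′-base spec ≤-refl)
            ih : row τ (suc (σ y + m)) ≡ row κ (suc (σ y + m))
            ih = proj₂ (proj₂ (IH {suc (σ y + m)} (lin (r ∷ m ∷ σ y ∷ y ∷ []) (1+ v0) (1+ (v2 ⊹ v1)) (:≡ v0 (v3 ⊹ v1) r≡ ∷ :≤ (1+ (v3 ⊹ v1)) v2 window ∷ [])))) (beyond (lin (m ∷ y ∷ σ y ∷ []) (1+ (v1 ⊹ v0)) (1+ (v2 ⊹ v0)) (:≤ (1+ (v1 ⊹ v0)) v2 window ∷ [])))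
          last {suc j} p e = lin≡ (ribbon ∷ row τ r ∷ m ∷ row κ (Y (suc j)) ∷ r ∷ Y (suc j) ∷ σ′ r ∷ row τ (σ′ r) ∷ k ∷ row κ (σ (Y (suc j))) ∷ σ (Y (suc j)) ∷ Y j ∷ row τ (Y j + m) ∷ row κ (Y j) ∷ []) (v1 ⊹ v0) (v3 ⊹ v2) (:≡ v4 (v5 ⊹ v2) e ∷ :≡ (v1 ⊹ v6) (1+ v8 ⊹ v4 ⊹ v7) (rec′ r) ∷ :≥ (1+ v8 ⊹ v5 ⊹ v9) (v3 ⊹ v10) (rec (Y (suc j))) ∷ :≥ (v11 ⊹ v2) v6 s′ ∷ :≡ v7 v12 (cong (row τ) s′) ∷ :≡ v10 v11 (step₀ p) ∷ :≥ v13 v9 (cong (row κ) (step₀ p)) ∷ :≡ (v12 ⊹ v0) (v13 ⊹ v2) ih ∷ [])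
            where
            s′ : σ′ r ≡ Y j + m
            s′ = trans (cong σ′ e) (σ′-step spec p ≤-refl)
            ih : row τ (Y j + m) + ribbon ≡ row κ (Y j) + m
            ih = proj₁ (proj₂ (IH {Y j + m} (lin (r ∷ m ∷ Y j ∷ Y (suc j) ∷ []) (1+ v0) (v2 ⊹ v1) (:≡ v0 (v3 ⊹ v1) e ∷ :≤ (1+ (v3 ⊹ v1)) v2 (spaced p) ∷ [])))) (<⇒≤ p) refl

          other : Other r
          other out with locate x m r
          ... | inside i p e v = lin≡ (row τ r ∷ row κ r ∷ σ′ r ∷ row τ (σ′ r) ∷ r ∷ k ∷ row κ (σ r) ∷ σ r ∷ i ∷ Y t ∷ row τ (Y t + i) ∷ row κ (suc (Y t + i)) ∷ []) v0 v1 (:≡ (v0 ⊹ v2) (1+ v5 ⊹ v4 ⊹ v3) (rec′ r) ∷ :≥ (1+ v5 ⊹ v4 ⊹ v6) (v1 ⊹ v7) (rec r) ∷ :≥ (v9 ⊹ v8) v2 s′ ∷ :≡ v7 (1+ (v9 ⊹ v8)) s ∷ :≡ v3 v10 (cong (row τ) s′) ∷ :≥ v11 v6 (cong (row κ) s) ∷ :≡ (1+ v10) v11 ih ∷ [])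
            where
            s′ : σ′ r ≡ Y t + i
            s′ = trans (cong σ′ e) (σ′-side spec p)
            s : σ r ≡ suc (Y t + i)
            s = trans (cong σ e) (side p)
            ih : suc (row τ (Y t + i)) ≡ row κ (suc (Y t + i))
            ih = proj₁ (IH {Y t + i} (lin (r ∷ i ∷ Y t ∷ x ∷ []) (1+ v0) (v2 ⊹ v1) (:≡ v0 (v3 ⊹ v1) e ∷ :≤ (1+ (v3 ⊹ v1)) v2 (side-< p) ∷ []))) ≤-refl p refl
          ... | before p v = plain v λ {i} _ e → lin⊥ (r ∷ x ∷ i ∷ []) (:≤ (1+ v0) v1 p ∷ :≥ (v1 ⊹ v2) v0 e ∷ [])
            where
            plain : interval x m r ≡ 0 → (∀ {i} → i < m → r ≢ x + i) → row τ r ≡ row κ r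
            plain v nx = lin≡ (row τ r ∷ row κ r ∷ σ′ r ∷ row τ (σ′ r) ∷ r ∷ k ∷ row κ (σ r) ∷ σ r ∷ row τ (σ r) ∷ []) v0 v1 (:≡ (v0 ⊹ v2) (1+ v5 ⊹ v4 ⊹ v3) (rec′ r) ∷ :≥ (1+ v5 ⊹ v4 ⊹ v6) (v1 ⊹ v7) (rec r) ∷ :≥ v7 v2 s′ ∷ :≡ v3 v8 (cong (row τ) s′) ∷ :≡ v8 v6 ih ∷ [])
              where
              iy : interval y (suc m) r ≡ 0
              iy = [ (λ z → interval-before {y} {suc m} {r} (lin (r ∷ y ∷ Y 0 ∷ []) (1+ v0) v1 (:≤ (1+ v0) v2 z ∷ :≡ v2 v1 base ∷ []))) , (λ z → interval-after {y} {suc m} {r} (lin (m ∷ y ∷ r ∷ Y 0 ∷ []) (v1 ⊹ 1+ v0) v2 (:≤ (1+ (v3 ⊹ v0)) v2 z ∷ :≥ v1 v3 base ∷ []))) ]′ (out {0} z≤n)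
              s′ : σ′ r ≡ σ r
              s′ = σ′-other spec v iy
              ih : row τ (σ r) ≡ row κ (σ r)
              ih = proj₂ (proj₂ (IH (lo r))) (outside-σ out nx)
          ... | after p v = plain v λ {i} q e → lin⊥ (m ∷ x ∷ r ∷ i ∷ []) (:≤ (v1 ⊹ v0) v2 p ∷ :≡ v2 (v1 ⊹ v3) e ∷ :≤ (1+ v3) v0 q ∷ [])
            where
            plain : interval x m r ≡ 0 → (∀ {i} → i < m → r ≢ x + i) → row τ r ≡ row κ r
            plain v nx = lin≡ (row τ r ∷ row κ r ∷ σ′ r ∷ row τ (σ′ r) ∷ r ∷ k ∷ row κ (σ r) ∷ σ r ∷ row τ (σ r) ∷ []) v0 v1 (:≡ (v0 ⊹ v2) (1+ v5 ⊹ v4 ⊹ v3) (rec′ r) ∷ :≥ (1+ v5 ⊹ v4 ⊹ v6) (v1 ⊹ v7) (rec r) ∷ :≥ v7 v2 s′ ∷ :≡ v3 v8 (cong (row τ) s′) ∷ :≡ v8 v6 ih ∷ [])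
              where
              iy : interval y (suc m) r ≡ 0
              iy = [ (λ z → interval-before {y} {suc m} {r} (lin (r ∷ y ∷ Y 0 ∷ []) (1+ v0) v1 (:≤ (1+ v0) v2 z ∷ :≡ v2 v1 base ∷ []))) , (λ z → interval-after {y} {suc m} {r} (lin (m ∷ y ∷ r ∷ Y 0 ∷ []) (v1 ⊹ 1+ v0) v2 (:≤ (1+ (v3 ⊹ v0)) v2 z ∷ :≥ v1 v3 base ∷ []))) ]′ (out {0} z≤n)
              s′ : σ′ r ≡ σ r
              s′ = σ′-other spec v iy
              ih : row τ (σ r) ≡ row κ (σ r)
              ih = proj₂ (proj₂ (IH (lo r))) (outside-σ out nx)

        -- `rec` expresses row `r` through row `σ r > r`, so the three descriptions are proved
        -- together, from the last row upwards.
        shape : ∀ f {r} → ℓ ≤ f + r → Inner r × Last r × Other r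
        shape zero {r} p = (λ {j} {i} q u e → ⊥-elim (lin⊥ (ℓ ∷ r ∷ m ∷ y ∷ Y 0 ∷ Y j ∷ i ∷ []) (:≤ v0 (#0 ⊹ v1) p ∷ :≤ (1+ (v3 ⊹ v2)) v0 y+m<ℓ ∷ :≡ v4 v3 base ∷ :≤ v5 v4 (descending z≤n q) ∷ :≡ v1 (v5 ⊹ v6) e ∷ :≤ (1+ v6) v2 u ∷ []))) ,
          (λ {j} q e → ⊥-elim (lin⊥ (ℓ ∷ r ∷ m ∷ y ∷ Y 0 ∷ Y j ∷ []) (:≤ v0 (#0 ⊹ v1) p ∷ :≤ (1+ (v3 ⊹ v2)) v0 y+m<ℓ ∷ :≡ v4 v3 base ∷ :≤ v5 v4 (descending z≤n q) ∷ :≡ v1 (v5 ⊹ v2) e ∷ []))) ,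
          λ _ → trans (row-≥ℓ C′ p) (sym (row-≥ℓ C p))
        shape (suc f) {r} p = inner , last , other
          where
          IH : ∀ {q} → r < q → Inner q × Last q × Other q
          IH {q} r<q = shape f {q} (lin (ℓ ∷ q ∷ f ∷ r ∷ []) v0 (v2 ⊹ v1) (:≤ v0 (1+ v2 ⊹ v3) p ∷ :≤ (1+ v3) v1 r<q ∷ []))
          open Step r IH

      row-inner : ∀ {j i} → j ≤ t → i < m → suc (row τ (Y j + i)) ≡ row κ (suc (Y j + i))
      row-inner {j} {i} p q = proj₁ (shape ℓ (m≤m+n ℓ (Y j + i))) p q refl

      row-last : ∀ {j} → j ≤ t → row τ (Y j + m) + ribbon ≡ row κ (Y j) + m
      row-last {j} p = proj₁ (proj₂ (shape ℓ (m≤m+n ℓ (Y j + m)))) p refl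

      row-outside : ∀ {r} → Outside r → row τ r ≡ row κ r
      row-outside {r} = proj₂ (proj₂ (shape ℓ (m≤m+n ℓ r)))

  Σ< : ℕ → (ℕ → ℕ) → ℕ
  Σ< zero    f = 0
  Σ< (suc N) f = f 0 + Σ< N (f ∘ suc)

  Σ<-cong : ∀ N {f g} → (∀ r → f r ≡ g r) → Σ< N f ≡ Σ< N g
  Σ<-cong zero    e = refl
  Σ<-cong (suc N) e = cong₂ _+_ (e 0) (Σ<-cong N (e ∘ suc))

  Σ<-+ : ∀ N f g → Σ< N (λ r → f r + g r) ≡ Σ< N f + Σ< N g
  Σ<-+ zero    f g = refl
  Σ<-+ (suc N) f g = shuffle (f 0) (g 0) _ _ _ (Σ<-+ N (f ∘ suc) (g ∘ suc))
    where
    shuffle : ∀ a b c d s → s ≡ c + d → (a + b) + s ≡ (a + c) + (b + d)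
    shuffle a b c d s e = lin≡ (s ∷ b ∷ a ∷ d ∷ c ∷ []) (v2 ⊹ v1 ⊹ v0) (v2 ⊹ v4 ⊹ (v1 ⊹ v3)) (:≡ v0 (v4 ⊹ v3) e ∷ [])

  Σ<-zero : ∀ N {f} → (∀ r → f r ≡ 0) → Σ< N f ≡ 0
  Σ<-zero zero    e = refl
  Σ<-zero (suc N) e = cong₂ _+_ (e 0) (Σ<-zero N (e ∘ suc))

  Σ<-interval : ∀ N lo len → lo + len ≤ N → Σ< N (interval lo len) ≡ len
  Σ<-interval N       zero     zero      p       = Σ<-zero N (λ _ → refl)
  Σ<-interval (suc N) zero     (suc len) (s≤s p) = cong suc (Σ<-interval N zero len p)
  Σ<-interval (suc N) (suc lo) len       (s≤s p) = Σ<-interval N lo len p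
  Σ<-interval zero    (suc lo) len       ()

-- Connected components by iterated growth.

module Grow where
  open import Defs
  open Linear
  open import Data.Bool using (Bool; true; false; T; _∨_; _∧_)
  open import Data.Bool.Properties using (T-≡; T-∧; T-∨; T?)
  open import Data.Nat using (ℕ; zero; suc; _≤_; _<_; z≤n; s≤s; _≡ᵇ_)
  open import Data.Nat.Properties
  open import Data.List using (List; []; _∷_; length; filterᵇ)
  open import Data.List.Properties using (length-filter)
  open import Data.List.Relation.Unary.Any using (here; there)
  open import Data.List.Relation.Unary.Any.Properties using (any⁺; any⁻)
  open import Data.List.Membership.Propositional using (_∈_; find; lose)
  open import Data.List.Membership.Propositional.Properties using (∈-filter⁺; ∈-filter⁻)
  open import Data.Product using (_×_; _,_; proj₁; ∃)
  open import Data.Sum using (_⊎_; inj₁; inj₂)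
  open import Data.Empty using (⊥-elim)
  open import Function using (_∘_)
  open import Function.Bundles using (Equivalence)
  open import Relation.Binary.PropositionalEquality

  T→true : ∀ {b} → T b → b ≡ true
  T→true = Equivalence.to T-≡

  Near : Box → Box → Set
  Near x y = T (eqBox x y ∨ adjacent x y)

  Near-refl : ∀ x → Near x x
  Near-refl (r , c) = Equivalence.from T-∨ (inj₁ (Equivalence.from T-∧ (≡⇒≡ᵇ r r refl , ≡⇒≡ᵇ c c refl)))

  data NearCases : Box → Box → Set where
    level : ∀ {r c c′} → NearCases (r , c) (r , c′)
    below : ∀ {r c} → NearCases (suc r , c) (r , c)
    above : ∀ {r c} → NearCases (r , c) (suc r , c)

  near-cases : ∀ x y → Near x y → NearCases x y
  near-cases (r , c) (r′ , c′) p with Equivalence.to (T-∨ {eqBox (r , c) (r′ , c′)}) p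
  ... | inj₁ q with refl ← ≡ᵇ⇒≡ r r′ (proj₁ (Equivalence.to (T-∧ {r ≡ᵇ r′}) q)) = level
  ... | inj₂ q with Equivalence.to (T-∨ {(r ≡ᵇ r′) ∧ ((suc c ≡ᵇ c′) ∨ (suc c′ ≡ᵇ c))}) q
  ...   | inj₁ u with refl ← ≡ᵇ⇒≡ r r′ (proj₁ (Equivalence.to (T-∧ {r ≡ᵇ r′}) u)) = level
  ...   | inj₂ u with Equivalence.to (T-∧ {c ≡ᵇ c′}) u
  ...     | v , w with refl ← ≡ᵇ⇒≡ c c′ v with Equivalence.to (T-∨ {suc r ≡ᵇ r′}) w
  ...       | inj₁ z with refl ← ≡ᵇ⇒≡ (suc r) r′ z = above
  ...       | inj₂ z with refl ← ≡ᵇ⇒≡ (suc r′) r z = below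

  near-right : ∀ r c → Near (r , suc c) (r , c)
  near-right r c = Equivalence.from (T-∨ {eqBox (r , suc c) (r , c)}) (inj₂ (Equivalence.from T-∨ (inj₁
    (Equivalence.from T-∧ (≡⇒≡ᵇ r r refl , Equivalence.from (T-∨ {suc (suc c) ≡ᵇ c}) (inj₂ (≡⇒≡ᵇ c c refl)))))))

  near-left : ∀ r c → Near (r , c) (r , suc c)
  near-left r c = Equivalence.from (T-∨ {eqBox (r , c) (r , suc c)}) (inj₂ (Equivalence.from T-∨ (inj₁
    (Equivalence.from T-∧ (≡⇒≡ᵇ r r refl , Equivalence.from T-∨ (inj₁ (≡⇒≡ᵇ c c refl)))))))

  near-below : ∀ r c → Near (suc r , c) (r , c)
  near-below r c = Equivalence.from (T-∨ {eqBox (suc r , c) (r , c)}) (inj₂ (Equivalence.from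
    (T-∨ {(suc r ≡ᵇ r) ∧ ((suc c ≡ᵇ c) ∨ (suc c ≡ᵇ c))}) (inj₂
    (Equivalence.from T-∧ (≡⇒≡ᵇ c c refl , Equivalence.from (T-∨ {suc (suc r) ≡ᵇ r}) (inj₂ (≡⇒≡ᵇ r r refl)))))))

  near-above : ∀ r c → Near (r , c) (suc r , c)
  near-above r c = Equivalence.from (T-∨ {eqBox (r , c) (suc r , c)}) (inj₂ (Equivalence.from
    (T-∨ {(r ≡ᵇ suc r) ∧ ((suc c ≡ᵇ c) ∨ (suc c ≡ᵇ c))}) (inj₂
    (Equivalence.from T-∧ (≡⇒≡ᵇ c c refl , Equivalence.from T-∨ (inj₁ (≡⇒≡ᵇ r r refl)))))))

  ∈-filterᵇ⁺ : ∀ {A : Set} (p : A → Bool) {x xs} → x ∈ xs → T (p x) → x ∈ filterᵇ p xs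
  ∈-filterᵇ⁺ p = ∈-filter⁺ (T? ∘ p)

  ∈-filterᵇ⁻ : ∀ {A : Set} (p : A → Bool) {x xs} → x ∈ filterᵇ p xs → x ∈ xs × T (p x)
  ∈-filterᵇ⁻ p = ∈-filter⁻ (T? ∘ p)

  ∈-grow⁺ : ∀ {B S x y} → x ∈ B → y ∈ S → Near x y → x ∈ grow B S
  ∈-grow⁺ {B} {S} {x} p q n = ∈-filterᵇ⁺ _ p (any⁺ (λ y → eqBox x y ∨ adjacent x y) (lose q n))

  ∈-grow⁻ : ∀ {B S x} → x ∈ grow B S → x ∈ B × ∃ λ y → y ∈ S × Near x y
  ∈-grow⁻ {B} {S} {x} p with ∈-filterᵇ⁻ _ p
  ... | q , n = q , find (any⁻ (λ y → eqBox x y ∨ adjacent x y) S n)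

  -- This dichotomy bounds the number of growth steps: a step that changes the set adds at least one
  -- box.
  filterᵇ-⊆ : ∀ {A : Set} (p q : A → Bool) xs → (∀ {x} → x ∈ xs → T (p x) → T (q x)) →
    filterᵇ p xs ≡ filterᵇ q xs ⊎ length (filterᵇ p xs) < length (filterᵇ q xs)
  filterᵇ-⊆ p q [] imp = inj₁ refl
  filterᵇ-⊆ p q (x ∷ xs) imp with p x | q x | imp {x} (here refl) | filterᵇ-⊆ p q xs (imp ∘ there)
  ... | true  | true  | _ | inj₁ e = inj₁ (cong (x ∷_) e)
  ... | true  | true  | _ | inj₂ l = inj₂ (s≤s l)
  ... | true  | false | f | _      = ⊥-elim (f _)
  ... | false | true  | _ | inj₁ e = inj₂ (s≤s (≤-reflexive (cong length e)))
  ... | false | true  | _ | inj₂ l = inj₂ (m<n⇒m<1+n l)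
  ... | false | false | _ | r      = r

  iter-suc : ∀ {A : Set} n (f : A → A) a → iter (suc n) f a ≡ f (iter n f a)
  iter-suc zero    f a = refl
  iter-suc (suc n) f a = iter-suc n f (f a)

  module _ {B : List Box} {b : Box} (b∈B : b ∈ B) where
    private
      S : ℕ → List Box
      S n = iter n (grow B) (b ∷ [])

      S-suc : ∀ n → S (suc n) ≡ grow B (S n)
      S-suc n = iter-suc n (grow B) (b ∷ [])

      S-mono : ∀ n {x} → x ∈ S n → x ∈ S (suc n)
      S-mono zero (here refl) = ∈-grow⁺ {B} {b ∷ []} b∈B (here refl) (Near-refl b)
      S-mono (suc n) {x} p with ∈-grow⁻ {B} {S n} (subst (x ∈_) (S-suc n) p)
      ... | q , y , r , nr = subst (x ∈_) (sym (S-suc (suc n))) (∈-grow⁺ q (S-mono n r) nr)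

      b∈S : ∀ n → b ∈ S n
      b∈S zero    = here refl
      b∈S (suc n) = S-mono n (b∈S n)

      nonempty : ∀ {A : Set} {x : A} {xs} → x ∈ xs → 1 ≤ length xs
      nonempty (here _)  = s≤s z≤n
      nonempty (there _) = s≤s z≤n

      growth : ∀ n → grow B (S n) ≡ grow B (grow B (S n)) ⊎ length (grow B (S n)) < length (grow B (grow B (S n)))
      growth n = filterᵇ-⊆ _ _ B λ {x} x∈B px →
        let y , y∈ , nr = find (any⁻ (λ y → eqBox x y ∨ adjacent x y) (S n) px)
        in any⁺ (λ y → eqBox x y ∨ adjacent x y) (lose (subst (y ∈_) (S-suc n) (S-mono n y∈)) nr)

      -- Each iteration adds a box until nothing changes, so |B| iterations suffice.
      stable : ∀ n → grow B (S n) ≡ grow B (grow B (S n)) ⊎ suc n < length (grow B (grow B (S n)))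
      stable zero with growth 0
      ... | inj₁ e = inj₁ e
      ... | inj₂ l = inj₂ (≤-trans (s≤s (nonempty (b∈S 1))) l)
      stable (suc n) with growth (suc n) | stable n
      ... | inj₁ e | _      = inj₁ e
      ... | inj₂ _ | inj₁ e rewrite S-suc n = inj₁ (cong (grow B) e)
      ... | inj₂ l | inj₂ u rewrite S-suc n = inj₂ (≤-trans (s≤s u) l)

      closed : ∀ n → length B ≡ suc n → ∀ {x y} → x ∈ B → y ∈ S (suc n) → Near x y → x ∈ S (suc n)
      closed n len {x} {y} x∈B y∈S nr with stable n
      ... | inj₁ e = subst (x ∈_) (sym (S-suc n)) (subst (x ∈_) (sym e) (∈-grow⁺ x∈B (subst (y ∈_) (S-suc n) y∈S) nr))
      ... | inj₂ l = ⊥-elim (<⇒≱ l (≤-trans (length-filter (T? ∘ _) B) (≤-reflexive len)))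

    component-closed : ∀ {x y} → x ∈ B → y ∈ component B b → Near x y → x ∈ component B b
    component-closed with length B in eq | nonempty b∈B
    ... | suc n | _ = closed n eq

    ∈-component : b ∈ component B b
    ∈-component = b∈S (length B)

    component-⊆ : ∀ {x} → x ∈ component B b → x ∈ B
    component-⊆ {x} = go (length B)
      where
      go : ∀ n {x} → x ∈ S n → x ∈ B
      go zero    (here refl) = b∈B
      go (suc n) {x} p = proj₁ (∈-grow⁻ {B} {S n} (subst (x ∈_) (S-suc n) p))

    component-⊆-class : (Q : Box → Set) → Q b → (∀ {x y} → x ∈ B → y ∈ B → Near x y → Q y → Q x) →
      ∀ {x} → x ∈ component B b → Q x
    component-⊆-class Q Qb step = go (length B)
      where
      ⊆B : ∀ n {x} → x ∈ S n → x ∈ B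
      ⊆B zero    (here refl) = b∈B
      ⊆B (suc n) {x} p = proj₁ (∈-grow⁻ {B} {S n} (subst (x ∈_) (S-suc n) p))
      go : ∀ n {x} → x ∈ S n → Q x
      go zero    (here refl) = Qb
      go (suc n) {x} p with ∈-grow⁻ {B} {S n} (subst (x ∈_) (S-suc n) p)
      ... | q , y , r , nr = step q (⊆B n r) nr (go n r)

-- Components of a skew shape consisting of separate ribbons.

module Blocks where
  open import Defs
  open Row
  open Core
  open Grow
  open Linear
  open import Data.Bool using (Bool; true; false; T)
  open import Data.Bool.Properties using (T-≡; T-∧; T-∨; T?)
  open import Data.Bool.ListAction using (all)
  open import Data.Nat using (ℕ; zero; suc; _+_; _*_; _∸_; _≤_; _<_; z≤n; s≤s; _≡ᵇ_; _<ᵇ_; _⊓_; _⊔_)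
  open import Data.Nat.Properties
  open import Data.List using (List; []; _∷_; length; filterᵇ; map; upTo; applyUpTo; foldr)
  open import Data.List.Properties using (length-map; length-upTo; map-upTo; map-applyUpTo)
  open import Data.List.Relation.Unary.Any using (Any; here; there)
  open import Data.List.Relation.Unary.All as All using (All; []; _∷_)
  open import Data.List.Relation.Unary.All.Properties as AllP using (all⁺; all⁻)
  open import Data.List.Relation.Unary.AllPairs as AllPairs using (AllPairs)
  import Data.List.Relation.Unary.AllPairs.Properties as AllPairsP
  open import Data.List.Relation.Unary.Unique.Propositional using (Unique)
  import Data.List.Relation.Unary.Unique.Propositional.Properties as UniqueP
  open import Data.List.Relation.Binary.Permutation.Propositional using (_↭_; ↭-sym)
  open import Data.List.Relation.Binary.Permutation.Propositional.Properties using (↭-length; Any-resp-↭; All-resp-↭; filter-↭) renaming (map⁺ to ↭-map⁺)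
  open import Data.List.Relation.Binary.BagAndSetEquality using (∼bag⇒↭)
  open import Data.List.Membership.Propositional using (_∈_; find; lose)
  open import Data.List.Membership.Propositional.Properties using (∈-map⁺; ∈-map⁻; ∈-upTo⁺; ∈-upTo⁻; ∈-concatMap⁺; ∈-concatMap⁻)
  open import Data.List.Membership.Propositional.Properties.WithK using (unique∧set⇒bag)
  open import Data.Product using (_×_; _,_; proj₁; proj₂; ∃)
  open import Data.Sum using (_⊎_; inj₁; inj₂; [_,_]′)
  open import Data.Empty using (⊥; ⊥-elim)
  open import Function using (_∘_)
  open import Function.Bundles using (Equivalence; mk⇔)
  open import Relation.Binary.Definitions using (tri<; tri≈; tri>)
  open import Relation.Binary.PropositionalEquality

  unique-set-↭ : ∀ {A : Set} {xs ys : List A} → Unique xs → Unique ys →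
    (∀ {x} → x ∈ xs → x ∈ ys) → (∀ {x} → x ∈ ys → x ∈ xs) → xs ↭ ys
  unique-set-↭ u v f g = ∼bag⇒↭ (unique∧set⇒bag u v (mk⇔ f g))

  ∈-skew⁺ : ∀ {τ κ r c} → row τ r < c → c ≤ row κ r → (suc r , c) ∈ skewBoxes τ κ
  ∈-skew⁺ {τ} {κ} {r} {c} p q with m≤n⇒∃[o]m+o≡n p
  ... | o , e = ∈-concatMap⁺ _ (lose (∈-upTo⁺ r<len)
    (subst (λ z → (suc r , z) ∈ map (λ j → (suc r , row τ r + suc j)) (upTo (row κ r ∸ row τ r))) (trans (+-suc (row τ r) o) e)
      (∈-map⁺ (λ j → (suc r , row τ r + suc j)) (∈-upTo⁺ o<))))
    where
    r<len : r < length κ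
    r<len = ≰⇒> λ z → lin⊥ (row τ r ∷ c ∷ row κ r ∷ []) (:≤ (1+ v0) v1 p ∷ :≤ v1 v2 q ∷ :≡ v2 #0 (row-≥length κ z) ∷ [])
    o< : o < row κ r ∸ row τ r
    o< = lin (o ∷ row κ r ∸ row τ r ∷ c ∷ row κ r ∷ row τ r ∷ []) (1+ v0) v1 (:≤ v2 v3 q ∷ :≡ (1+ (v4 ⊹ v0)) v2 e ∷ :≥ v3 (v1 ⊹ v4) (m∸n+n≡m {row κ r} {row τ r} (<⇒≤ (≤-trans p q))) ∷ [])

  ∈-skew⁻ : ∀ {τ κ R c} → (R , c) ∈ skewBoxes τ κ → ∃ λ r → R ≡ suc r × row τ r < c × c ≤ row κ r
  ∈-skew⁻ {τ} {κ} p with find (∈-concatMap⁻ _ {xs = upTo (length κ)} p)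
  ... | r , _ , q with ∈-map⁻ (λ j → (suc r , row τ r + suc j)) q
  ...   | j , j∈ , refl = r , refl , (lin (row τ r ∷ j ∷ []) (1+ v0) (v0 ⊹ 1+ v1) ([])) , bound (∈-upTo⁻ j∈)
    where
    bound : j < row κ r ∸ row τ r → row τ r + suc j ≤ row κ r
    bound z = [ (λ le → (lin (j ∷ row τ r ∷ row κ r ∷ row κ r ∸ row τ r ∷ []) (v1 ⊹ 1+ v0) v2 (:≡ (v3 ⊹ v1) v2 (m∸n+n≡m le) ∷ :≤ (1+ v0) v3 z ∷ []))) , (λ lt → ⊥-elim (lin⊥ (j ∷ row κ r ∸ row τ r ∷ []) (:≤ (1+ v0) v1 z ∷ :≡ v1 #0 (m≤n⇒m∸n≡0 {row κ r} {row τ r} (<⇒≤ lt)) ∷ []))) ]′ (≤-<-connex (row τ r) (row κ r))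

  skewBoxes-unique : ∀ τ κ → Unique (skewBoxes τ κ)
  skewBoxes-unique τ κ = UniqueP.concat⁺
    (AllP.map⁺ (All.universal (λ r → UniqueP.map⁺ (λ {x} {y} e → suc-injective (+-cancelˡ-≡ (row τ r) (suc x) (suc y) (cong proj₂ e))) (UniqueP.upTo⁺ _)) _))
    (AllPairsP.map⁺ (AllPairs.map (λ i≢j {x} (p , q) → i≢j (same p q)) (UniqueP.upTo⁺ (length κ))))
    where
    same : ∀ {x i j} {xs ys : List ℕ} → x ∈ map (λ z → (suc i , row τ i + suc z)) xs → x ∈ map (λ z → (suc j , row τ j + suc z)) ys → i ≡ j
    same p q with ∈-map⁻ _ p | ∈-map⁻ _ q
    ... | _ , _ , e | _ , _ , e′ = suc-injective (cong proj₁ (trans (sym e) e′))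

  foldr-⊓-≤ : ∀ e xs {x} → x ∈ xs → foldr _⊓_ e xs ≤ x
  foldr-⊓-≤ e (x ∷ xs) (here refl) = m⊓n≤m x _
  foldr-⊓-≤ e (x ∷ xs) (there p)   = ≤-trans (m⊓n≤n x _) (foldr-⊓-≤ e xs p)

  foldr-⊓-≤e : ∀ e xs → foldr _⊓_ e xs ≤ e
  foldr-⊓-≤e e []       = ≤-refl
  foldr-⊓-≤e e (x ∷ xs) = ≤-trans (m⊓n≤n x _) (foldr-⊓-≤e e xs)

  foldr-⊓-≥ : ∀ {b e} xs → b ≤ e → All (b ≤_) xs → b ≤ foldr _⊓_ e xs
  foldr-⊓-≥ []       p []       = p
  foldr-⊓-≥ (x ∷ xs) p (q ∷ qs) = ⊓-glb q (foldr-⊓-≥ xs p qs)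

  foldr-⊔-≥ : ∀ e xs {x} → x ∈ xs → x ≤ foldr _⊔_ e xs
  foldr-⊔-≥ e (x ∷ xs) (here refl) = m≤m⊔n x _
  foldr-⊔-≥ e (x ∷ xs) (there p)   = ≤-trans (foldr-⊔-≥ e xs p) (m≤n⊔m x _)

  foldr-⊔-≥e : ∀ e xs → e ≤ foldr _⊔_ e xs
  foldr-⊔-≥e e []       = ≤-refl
  foldr-⊔-≥e e (x ∷ xs) = ≤-trans (foldr-⊔-≥e e xs) (m≤n⊔m x _)

  foldr-⊔-≤ : ∀ {b e} xs → e ≤ b → All (_≤ b) xs → foldr _⊔_ e xs ≤ b
  foldr-⊔-≤ []       p []       = p
  foldr-⊔-≤ (x ∷ xs) p (q ∷ qs) = ⊔-lub q (foldr-⊔-≤ xs p qs)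

  topRow-≡ : ∀ {S a c} → (a , c) ∈ S → (∀ {x} → x ∈ S → a ≤ proj₁ x) → topRow S ≡ a
  topRow-≡ {(r , c′) ∷ S} p lb = ≤-antisym (le p)
    (foldr-⊓-≥ (map proj₁ S) (lb (here refl)) (AllP.map⁺ (All.tabulate (lb ∘ there))))
    where
    le : ∀ {a c} → (a , c) ∈ (r , c′) ∷ S → topRow ((r , c′) ∷ S) ≤ a
    le (here refl) = foldr-⊓-≤e r (map proj₁ S)
    le (there q)   = foldr-⊓-≤ r (map proj₁ S) (∈-map⁺ proj₁ q)

  bottomRow-≡ : ∀ {S a c} → (a , c) ∈ S → (∀ {x} → x ∈ S → proj₁ x ≤ a) → bottomRow S ≡ a
  bottomRow-≡ {(r , c′) ∷ S} p ub = ≤-antisym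
    (foldr-⊔-≤ (map proj₁ S) (ub (here refl)) (AllP.map⁺ (All.tabulate (ub ∘ there)))) (ge p)
    where
    ge : ∀ {a c} → (a , c) ∈ (r , c′) ∷ S → a ≤ bottomRow ((r , c′) ∷ S)
    ge (here refl) = foldr-⊔-≥e r (map proj₁ S)
    ge (there q)   = foldr-⊔-≥ r (map proj₁ S) (∈-map⁺ proj₁ q)

  heightAt-≡ : ∀ {h r} Cs → All (λ S → height S ≡ h) Cs → Any (λ S → topRow S ≡ r) Cs → heightAt r Cs ≡ h
  heightAt-≡ {h} {r} (S ∷ Cs) (e ∷ es) p with topRow S ≡ᵇ r in eq | p
  ... | true  | _       = e
  ... | false | there q = heightAt-≡ Cs es q
  ... | false | here z with () ← trans (sym (Equivalence.to T-≡ (≡⇒≡ᵇ _ _ z))) eq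

  count-prefix : ∀ Q a m → (∀ {i} → i < a → Q i ≡ true) → (∀ {i} → a ≤ i → i < a + m → Q i ≡ false) →
    count Q (a + m) ≡ a
  count-prefix Q zero    zero    lo hi = refl
  count-prefix Q zero    (suc m) lo hi rewrite hi {0} z≤n (s≤s z≤n) = count-prefix (Q ∘ suc) 0 m (λ ()) (λ _ q → hi z≤n (s≤s q))
  count-prefix Q (suc a) m       lo hi rewrite lo {0} (s≤s z≤n) =
    cong suc (count-prefix (Q ∘ suc) a m (λ p → lo (s≤s p)) (λ p q → hi (s≤s p) (s≤s q)))

  -- `inner` gives consecutive rows of a block a common column and so connects it; `end` keeps the
  -- row below from sharing an edge with it. Blocks are numbered from the bottom upwards.
  record Blocks (τ κ : List ℕ) (t m : ℕ) (Y : ℕ → ℕ) : Set where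
    field
      partitionτ : IsPartition τ
      partitionκ : IsPartition κ
      inner      : ∀ {j i} → j ≤ t → i < m → row τ (Y j + i) < row κ (suc (Y j + i))
      end        : ∀ {j} → j ≤ t → row κ (suc (Y j + m)) ≤ row τ (Y j + m)
      last       : ∀ {j} → j ≤ t → row τ (Y j + m) < row κ (Y j + m)
      outside    : ∀ {r} → (∀ {j} → j ≤ t → r < Y j ⊎ Y j + m < r) → row τ r ≡ row κ r
      spread     : ∀ {i j} → i < j → j ≤ t → Y j + m < Y i

  compare-block : ∀ y m r → (∃ λ i → i ≤ m × r ≡ y + i) ⊎ (r < y ⊎ y + m < r)
  compare-block y m r with ≤-<-connex y r | ≤-<-connex r (y + m)
  ... | inj₂ p | _      = inj₂ (inj₁ p)
  ... | inj₁ _ | inj₂ q = inj₂ (inj₂ q)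
  ... | inj₁ p | inj₁ q with m≤n⇒∃[o]m+o≡n p
  ...   | i , e = inj₁ (i , (lin (i ∷ m ∷ r ∷ y ∷ []) v0 v1 (:≤ v2 (v3 ⊹ v1) q ∷ :≡ (v3 ⊹ v0) v2 e ∷ [])) , sym e)

  locate-block : ∀ t m (Y : ℕ → ℕ) r → (∃ λ j → j ≤ t × ∃ λ i → i ≤ m × r ≡ Y j + i) ⊎ (∀ {j} → j ≤ t → r < Y j ⊎ Y j + m < r)
  locate-block t m Y r with compare-block (Y t) m r
  locate-block t       m Y r | inj₁ p = inj₁ (t , ≤-refl , p)
  locate-block zero    m Y r | inj₂ p = inj₂ λ { z≤n → p }
  locate-block (suc t) m Y r | inj₂ p with locate-block t m Y r
  ... | inj₁ (j , q , rest) = inj₁ (j , m≤n⇒m≤1+n q , rest)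
  ... | inj₂ out = inj₂ λ {j} q → [ (λ { (s≤s z) → out z }) , (λ { refl → p }) ]′ (m≤n⇒m<n∨m≡n q)

  module _ {τ κ t m Y} (D : Blocks τ κ t m Y) where
    open Blocks D
    private
      B = skewBoxes τ κ

      box : ∀ {r c} → row τ r < c → c ≤ row κ r → (suc r , c) ∈ B
      box = ∈-skew⁺ {τ} {κ}

      f-anti : ∀ r → row κ (suc r) ≤ row κ r
      f-anti = row-antitone-suc (proj₁ partitionκ)
      g-anti : ∀ r → row τ (suc r) ≤ row τ r
      g-anti = row-antitone-suc (proj₁ partitionτ)

      row-nonempty : ∀ {j i} → j ≤ t → i ≤ m → row τ (Y j + i) < row κ (Y j + i)
      row-nonempty {j} {i} p q = [ (λ z → (lin (row τ (Y j + i) ∷ row κ (Y j + i) ∷ row κ (suc (Y j + i)) ∷ []) (1+ v0) v1 (:≤ (1+ v0) v2 (inner p z) ∷ :≤ v2 v1 (f-anti (Y j + i)) ∷ []))) , (λ { refl → last p }) ]′ (m≤n⇒m<n∨m≡n q)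

      Run : ℕ → Box → Set
      Run j x = ∃ λ i → i ≤ m × proj₁ x ≡ suc (Y j + i)

      box-run : ∀ {r c} → row τ r < c → c ≤ row κ r → ∃ λ j → j ≤ t × ∃ λ i → i ≤ m × r ≡ Y j + i
      box-run {r} {c} p q with locate-block t m Y r
      ... | inj₁ z   = z
      ... | inj₂ out = ⊥-elim (lin⊥ (row τ r ∷ c ∷ row κ r ∷ []) (:≤ (1+ v0) v1 p ∷ :≤ v1 v2 q ∷ :≥ v2 v0 (outside out) ∷ []))

      same-block : ∀ {j j′ i i′} → j ≤ t → j′ ≤ t → i ≤ m → i′ ≤ m → Y j + i ≡ Y j′ + i′ → j ≡ j′ × i ≡ i′
      same-block {j} {j′} {i} {i′} p p′ q q′ e with <-cmp j j′
      ... | tri< u _ _    = ⊥-elim (lin⊥ (m ∷ Y j′ ∷ Y j ∷ i ∷ i′ ∷ []) (:≤ (1+ (v1 ⊹ v0)) v2 (spread u p′) ∷ :≡ (v2 ⊹ v3) (v1 ⊹ v4) e ∷ :≤ v4 v0 q′ ∷ []))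
      ... | tri> _ _ u    = ⊥-elim (lin⊥ (m ∷ Y j ∷ Y j′ ∷ i′ ∷ i ∷ []) (:≤ (1+ (v1 ⊹ v0)) v2 (spread u p) ∷ :≥ (v2 ⊹ v3) (v1 ⊹ v4) e ∷ :≤ v4 v0 q ∷ []))
      ... | tri≈ _ refl _ = refl , +-cancelˡ-≡ (Y j) i i′ e

      -- Adjacent boxes in different rows share a column, and across the lower border of a block
      -- `end` forbids this.
      run-step : ∀ {j} → j ≤ t → ∀ {x y} → x ∈ B → y ∈ B → Near x y → Run j y → Run j x
      run-step {j} j≤t {x} {y} x∈ y∈ nr (i , i≤m , e) with near-cases x y nr
      ... | level = i , i≤m , e
      ... | below {c = c} with ∈-skew⁻ {τ} {κ} x∈ | ∈-skew⁻ {τ} {κ} y∈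
      ...   | _ , refl , gx , fx | r , refl , gy , fy with m≤n⇒m<n∨m≡n i≤m
      ...     | inj₁ i<m = suc i , i<m , (lin≡ (r ∷ i ∷ Y j ∷ []) (1+ (1+ v0)) (1+ (v2 ⊹ 1+ v1)) (:≡ (1+ v0) (1+ (v2 ⊹ v1)) e ∷ []))
      ...     | inj₂ refl = ⊥-elim (lin⊥ (row τ r ∷ c ∷ row κ (suc r) ∷ row κ (suc (Y j + i)) ∷ row τ (Y j + i) ∷ []) (:≤ (1+ v0) v1 gy ∷ :≤ v1 v2 fx ∷ :≤ v3 v4 (end j≤t) ∷ :≡ v2 v3 (cong (row κ) {suc r} {suc (Y j + i)} e) ∷ :≥ v4 v0 (cong (row τ) {r} {Y j + i} (suc-injective e)) ∷ []))
      run-step {j} j≤t x∈ y∈ nr (i , i≤m , e) | above {c = c} with ∈-skew⁻ {τ} {κ} x∈ | ∈-skew⁻ {τ} {κ} y∈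
      ...   | r , refl , gx , fx | _ , refl , gy , fy with box-run gx fx
      ...     | j′ , j′≤t , i′ , i′≤m , re with m≤n⇒m<n∨m≡n i′≤m
      ...       | inj₂ refl = ⊥-elim (lin⊥ (row τ r ∷ c ∷ row κ (suc r) ∷ row κ (suc (Y j′ + i′)) ∷ row τ (Y j′ + i′) ∷ []) (:≤ (1+ v0) v1 gx ∷ :≤ v1 v2 fy ∷ :≤ v3 v4 (end j′≤t) ∷ :≡ v2 v3 (cong (row κ ∘ suc) re) ∷ :≥ v4 v0 (cong (row τ) re) ∷ []))
      ...       | inj₁ i′<m with same-block j′≤t j≤t i′<m i≤m (lin≡ (i′ ∷ Y j′ ∷ i ∷ Y j ∷ r ∷ []) (v1 ⊹ 1+ v0) (v3 ⊹ v2) (:≡ (1+ (1+ v4)) (1+ (v3 ⊹ v2)) e ∷ :≥ (v1 ⊹ v0) v4 re ∷ []))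
      ...         | refl , _ = i′ , <⇒≤ i′<m , cong suc re

      first : ℕ → Box
      first j = suc (Y j) , suc (row τ (Y j))

      first-∈ : ∀ {j} → j ≤ t → first j ∈ B
      first-∈ {j} p = box ≤-refl (subst (λ z → row τ z < row κ z) (+-identityʳ (Y j)) (row-nonempty p z≤n))

      module _ {b : Box} (b∈ : b ∈ B) where
        private
          K = component B b

          rightwards : ∀ {r c} o → (suc r , c) ∈ K → row τ r < c → c + o ≤ row κ r → (suc r , c + o) ∈ K
          rightwards {r} {c} zero p q z = subst (λ w → (suc r , w) ∈ K) (sym (+-identityʳ c)) p
          rightwards {r} {c} (suc o) p q z = subst (λ w → (suc r , w) ∈ K) (sym (+-suc c o))
            (component-closed b∈ (box (lin (row τ r ∷ o ∷ c ∷ []) (1+ v0) (1+ (v2 ⊹ v1)) (:≤ (1+ v0) v2 q ∷ [])) (lin (o ∷ c ∷ row κ r ∷ []) (1+ (v1 ⊹ v0)) v2 (:≤ (v1 ⊹ 1+ v0) v2 z ∷ []))) (rightwards o p q (lin (o ∷ c ∷ row κ r ∷ []) (v1 ⊹ v0) v2 (:≤ (v1 ⊹ 1+ v0) v2 z ∷ []))) (near-right (suc r) (c + o)))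

          leftwards : ∀ {r c} o → (suc r , c + o) ∈ K → row τ r < c → c + o ≤ row κ r → (suc r , c) ∈ K
          leftwards {r} {c} zero p q z = subst (λ w → (suc r , w) ∈ K) (+-identityʳ c) p
          leftwards {r} {c} (suc o) p q z = component-closed b∈ (box q (lin (c ∷ row κ r ∷ o ∷ []) v0 v1 (:≤ (v0 ⊹ 1+ v2) v1 z ∷ [])))
            (leftwards {r} {suc c} o (subst (λ w → (suc r , w) ∈ K) (+-suc c o) p) (m<n⇒m<1+n q) (lin (o ∷ c ∷ row κ r ∷ []) (1+ v1 ⊹ v0) v2 (:≤ (v1 ⊹ 1+ v0) v2 z ∷ []))) (near-left (suc r) c)

          along : ∀ {r c c′} → (suc r , c) ∈ K → row τ r < c → c ≤ row κ r → row τ r < c′ → c′ ≤ row κ r → (suc r , c′) ∈ K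
          along {r} {c} {c′} p a b a′ b′ with ≤-total c c′
          ... | inj₁ z with o , refl ← m≤n⇒∃[o]m+o≡n z = rightwards o p a b′
          ... | inj₂ z with o , refl ← m≤n⇒∃[o]m+o≡n z = leftwards o p a′ b

          Full : ℕ → Set
          Full r = ∀ {c} → row τ r < c → c ≤ row κ r → (suc r , c) ∈ K

          -- The column `row κ (suc (Y j + i))` belongs to both rows, and the boxes within one row
          -- are connected.
          full-down : ∀ {j i} → j ≤ t → i < m → Full (Y j + i) → Full (suc (Y j + i))
          full-down {j} {i} p q F = along
            (component-closed b∈ (box {r = suc (Y j + i)} (lin (row τ (suc (Y j + i)) ∷ row κ (suc (Y j + i)) ∷ row τ (Y j + i) ∷ []) (1+ v0) v1 (:≤ v0 v2 (g-anti (Y j + i)) ∷ :≤ (1+ v2) v1 (inner p q) ∷ [])) ≤-refl) (F {row κ (suc (Y j + i))} (inner p q) (f-anti (Y j + i))) (near-below (suc (Y j + i)) (row κ (suc (Y j + i)))))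
            (lin (row τ (suc (Y j + i)) ∷ row κ (suc (Y j + i)) ∷ row τ (Y j + i) ∷ []) (1+ v0) v1 (:≤ v0 v2 (g-anti (Y j + i)) ∷ :≤ (1+ v2) v1 (inner p q) ∷ [])) ≤-refl

          full-up : ∀ {j i} → j ≤ t → i < m → Full (suc (Y j + i)) → Full (Y j + i)
          full-up {j} {i} p q F = along
            (component-closed b∈ (box {r = Y j + i} (inner p q) (f-anti (Y j + i))) (F {row κ (suc (Y j + i))} (lin (row τ (suc (Y j + i)) ∷ row κ (suc (Y j + i)) ∷ row τ (Y j + i) ∷ []) (1+ v0) v1 (:≤ v0 v2 (g-anti (Y j + i)) ∷ :≤ (1+ v2) v1 (inner p q) ∷ [])) ≤-refl) (near-above (suc (Y j + i)) (row κ (suc (Y j + i)))))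
            (inner p q) (f-anti (Y j + i))

          full-all-up : ∀ {j} → j ≤ t → ∀ i {i′} → i + i′ ≤ m → Full (Y j + (i + i′)) → Full (Y j + i′)
          full-all-up p zero z F = F
          full-all-up {j} p (suc i) {i′} z F = full-all-up p i (lin (i′ ∷ i ∷ m ∷ []) (v1 ⊹ v0) v2 (:≤ (1+ v1 ⊹ v0) v2 z ∷ [])) (full-up p z (subst Full (+-suc (Y j) (i + i′)) F))

          full-all-down : ∀ {j} → j ≤ t → ∀ i {i′} → i + i′ ≤ m → Full (Y j + i′) → Full (Y j + (i + i′))
          full-all-down p zero z F = F
          full-all-down {j} p (suc i) {i′} z F = subst Full (sym (+-suc (Y j) (i + i′))) (full-down p z (full-all-down p i (lin (i′ ∷ i ∷ m ∷ []) (v1 ⊹ v0) v2 (:≤ (1+ v1 ⊹ v0) v2 z ∷ [])) F))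

        component-full : ∀ {j i i′ c c₀} → j ≤ t → i ≤ m → i′ ≤ m → b ≡ (suc (Y j + i) , c₀) → row τ (Y j + i′) < c → c ≤ row κ (Y j + i′) →
          (suc (Y j + i′) , c) ∈ component B b
        component-full {j} {i} {i′} p q q′ refl with ∈-skew⁻ {τ} {κ} b∈
        ... | _ , refl , gb , fb with ≤-total i i′
        ...   | inj₁ z with o , e ← m≤n⇒∃[o]m+o≡n z with refl ← trans (+-comm o i) e = full-all-down p o q′ (along (∈-component b∈) gb fb)
        ...   | inj₂ z with o , e ← m≤n⇒∃[o]m+o≡n z with refl ← trans (+-comm o i′) e = full-all-up p o q (along (∈-component b∈) gb fb)

        component-run : ∀ {j i c₀} → j ≤ t → i ≤ m → b ≡ (suc (Y j + i) , c₀) → ∀ {x} → x ∈ component B b → Run j x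
        component-run {j} {i} p q refl = component-⊆-class b∈ (Run j) (i , q , refl) (run-step p)

      first≡ : ∀ j → first j ≡ (suc (Y j + 0) , suc (row τ (Y j)))
      first≡ j = cong (λ z → suc z , suc (row τ (Y j))) (sym (+-identityʳ (Y j)))

      leader : Box → Bool
      leader b = all (lexLeq b) (component B b)

      lex-intro : ∀ {r c r′ c′} → r < r′ ⊎ (r ≡ r′ × c ≤ c′) → T (lexLeq (r , c) (r′ , c′))
      lex-intro {r} {c} {r′} (inj₁ p)          = Equivalence.from T-∨ (inj₁ (<⇒<ᵇ p))
      lex-intro {r} {c} {r′} (inj₂ (refl , q)) = Equivalence.from (T-∨ {r <ᵇ r}) (inj₂ (Equivalence.from T-∧ (≡⇒≡ᵇ r r refl , ≤⇒≤ᵇ q)))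

      lex-elim : ∀ {r c r′ c′} → T (lexLeq (r , c) (r′ , c′)) → r < r′ ⊎ (r ≡ r′ × c ≤ c′)
      lex-elim {r} {c} {r′} {c′} p with Equivalence.to (T-∨ {r <ᵇ r′}) p
      ... | inj₁ q = inj₁ (<ᵇ⇒< r r′ q)
      ... | inj₂ q = inj₂ (≡ᵇ⇒≡ r r′ (proj₁ (Equivalence.to (T-∧ {r ≡ᵇ r′}) q)) , ≤ᵇ⇒≤ c c′ (proj₂ (Equivalence.to (T-∧ {r ≡ᵇ r′}) q)))

      leader⁺ : ∀ {j} → j ≤ t → T (leader (first j))
      leader⁺ {j} p = all⁻ (lexLeq (first j)) (All.tabulate λ {x} x∈ → least x∈ (component-run (first-∈ p) p z≤n (first≡ j) x∈) (∈-skew⁻ {τ} {κ} (component-⊆ (first-∈ p) x∈)))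
        where
        least : ∀ {x} → x ∈ component B (first j) → Run j x → (∃ λ r → proj₁ x ≡ suc r × row τ r < proj₂ x × proj₂ x ≤ row κ r) → T (lexLeq (first j) x)
        least {R , C} x∈ (zero  , _ , e) (r , e′ , a , _) = lex-intro {suc (Y j)} {suc (row τ (Y j))} {R} {C} (inj₂ (trans (cong suc (sym (+-identityʳ (Y j)))) (sym e) ,
          subst (λ z → row τ z < _) (trans (suc-injective (trans (sym e′) e)) (+-identityʳ (Y j))) a))
        least {R , C} x∈ (suc i , _ , e) _ = lex-intro {suc (Y j)} {suc (row τ (Y j))} {R} {C} (inj₁ (lin (Y j ∷ R ∷ i ∷ []) (1+ (1+ v0)) v1 (:≥ (1+ (v0 ⊹ 1+ v2)) v1 e ∷ [])))

      -- The component of a leader in block `j` contains `first j`; being lexicographically least,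
      -- the leader can only be that box.
      leader⁻ : ∀ {b} → b ∈ B → T (leader b) → ∃ λ j → j ≤ t × b ≡ first j
      leader⁻ {b} b∈ l with ∈-skew⁻ {τ} {κ} b∈
      ... | r , refl , gb , fb with box-run gb fb
      ...   | j , p , i , q , refl = j , p , eq (lex-elim (All.lookup (all⁺ (lexLeq b) (component B b) l) first∈))
        where
        first∈ : first j ∈ component B b
        first∈ = subst (_∈ component B b) (sym (first≡ j))
          (component-full b∈ p q z≤n refl (s≤s (≤-reflexive (cong (row τ) (+-identityʳ (Y j))))) (subst (λ z → suc (row τ (Y j)) ≤ row κ z) (sym (+-identityʳ (Y j))) (subst (λ z → row τ z < row κ z) (+-identityʳ (Y j)) (row-nonempty p z≤n))))
        eq : suc (Y j + i) < suc (Y j) ⊎ (suc (Y j + i) ≡ suc (Y j) × proj₂ b ≤ suc (row τ (Y j))) → b ≡ first j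
        eq (inj₁ z)       = ⊥-elim (lin⊥ (i ∷ Y j ∷ []) (:≤ (1+ (1+ (v1 ⊹ v0))) (1+ v1) z ∷ []))
        eq (inj₂ (z , w)) = cong₂ _,_ z (≤-antisym w (subst (λ v → row τ v < proj₂ b) (suc-injective z) gb))

      first-injective : ∀ {i j} → i ≤ t → j ≤ t → first i ≡ first j → i ≡ j
      first-injective {i} {j} p q e = proj₁ (same-block p q z≤n z≤n (cong (_+ 0) (suc-injective (cong proj₁ e))))

      firsts : List Box
      firsts = map first (upTo (suc t))

      map-unique : ∀ n → n ≤ suc t → Unique (map first (upTo n))
      map-unique n p = AllPairsP.map⁺ (go (UniqueP.upTo⁺ n) (All.tabulate λ z → ∈-upTo⁻ z))
        where
        go : ∀ {xs} → Unique xs → All (_< n) xs → AllPairs (λ x y → first x ≢ first y) xs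
        go AllPairs.[] [] = AllPairs.[]
        go (u AllPairs.∷ us) (x< ∷ xs<) = All.map (λ { (≢ , y<) e → ≢ (first-injective (≤-pred (≤-trans x< p)) (≤-pred (≤-trans y< p)) e) }) (All.zip (u , xs<)) AllPairs.∷ go us xs<

      leaders↭ : filterᵇ leader B ↭ firsts
      leaders↭ = unique-set-↭ (UniqueP.filter⁺ (T? ∘ leader) (skewBoxes-unique τ κ)) (map-unique (suc t) ≤-refl) to from
        where
        to : ∀ {x} → x ∈ filterᵇ leader B → x ∈ firsts
        to p with ∈-filterᵇ⁻ leader p
        ... | b∈ , l with leader⁻ b∈ l
        ...   | j , q , refl = ∈-map⁺ first (∈-upTo⁺ (s≤s q))
        from : ∀ {x} → x ∈ firsts → x ∈ filterᵇ leader B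
        from p with ∈-map⁻ first p
        ... | j , j∈ , refl = ∈-filterᵇ⁺ leader (first-∈ (≤-pred (∈-upTo⁻ j∈))) (leader⁺ (≤-pred (∈-upTo⁻ j∈)))

      Cs = components B

      Cs↭ : Cs ↭ map (component B) firsts
      Cs↭ = ↭-map⁺ (component B) leaders↭

      topRow-first : ∀ {j} → j ≤ t → topRow (component B (first j)) ≡ suc (Y j)
      topRow-first {j} p = topRow-≡ (∈-component (first-∈ p)) λ {x} x∈ → lb {x} (component-run (first-∈ p) p z≤n (first≡ j) x∈)
        where
        lb : ∀ {x} → Run j x → suc (Y j) ≤ proj₁ x
        lb {x} (i , _ , e) = lin (Y j ∷ proj₁ x ∷ i ∷ []) (1+ v0) v1 (:≥ (1+ (v0 ⊹ v2)) v1 e ∷ [])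

      bottomRow-first : ∀ {j} → j ≤ t → bottomRow (component B (first j)) ≡ suc (Y j + m)
      bottomRow-first {j} p = bottomRow-≡ (component-full (first-∈ p) p z≤n ≤-refl (first≡ j) (last p) ≤-refl)
        λ {x} x∈ → ub {x} (component-run (first-∈ p) p z≤n (first≡ j) x∈)
        where
        ub : ∀ {x} → Run j x → proj₁ x ≤ suc (Y j + m)
        ub {x} (i , q , e) = lin (proj₁ x ∷ m ∷ Y j ∷ i ∷ []) v0 (1+ (v2 ⊹ v1)) (:≡ v0 (1+ (v2 ⊹ v3)) e ∷ :≤ v3 v1 q ∷ [])

      height-first : ∀ {j} → j ≤ t → height (component B (first j)) ≡ suc m
      height-first {j} p = trans (cong₂ (λ a b → suc a ∸ b) (bottomRow-first p) (topRow-first p))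
        (trans (cong (_∸ Y j) (sym (+-suc (Y j) m))) (m+n∸m≡n (Y j) (suc m)))

      Cs-all : (Q : List Box → Set) → (∀ {j} → j ≤ t → Q (component B (first j))) → All Q Cs
      Cs-all Q q = All-resp-↭ (↭-sym Cs↭) (AllP.map⁺ (AllP.map⁺ (All.tabulate λ z → q (≤-pred (∈-upTo⁻ z)))))

    blocks-marked⁺ : ∀ {j} → j ≤ t → Any (λ S → topRow S ≡ suc (Y j)) (components (skewBoxes τ κ))
    blocks-marked⁺ {j} p = Any-resp-↭ (↭-sym Cs↭) (lose (∈-map⁺ (component B) (∈-map⁺ first (∈-upTo⁺ (s≤s p)))) (topRow-first p))

    blocks-marked⁻ : ∀ {R} → Any (λ S → topRow S ≡ R) (components (skewBoxes τ κ)) → ∃ λ j → j ≤ t × R ≡ suc (Y j)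
    blocks-marked⁻ {R} p = go (find p)
      where
      Q : List Box → Set
      Q S = ∃ λ j → j ≤ t × topRow S ≡ suc (Y j)
      go : (∃ λ S → S ∈ Cs × topRow S ≡ R) → ∃ λ j → j ≤ t × R ≡ suc (Y j)
      go (S , S∈ , e) = conclude (All.lookup (Cs-all Q (λ {j} q → j , q , topRow-first q)) S∈)
        where
        conclude : Q S → ∃ λ j → j ≤ t × R ≡ suc (Y j)
        conclude (j , q , e′) = j , q , trans (sym e) e′

    private
      -- The numbering runs upwards, so the blocks entirely below block `j` are those with smaller
      -- number.
      count-above : ∀ {j} → j ≤ t → length (filterᵇ (λ S → suc (Y j) <ᵇ topRow S) Cs) ≡ j
      count-above {j} p = trans (↭-length (filter-↭ (T? ∘ λ S → suc (Y j) <ᵇ topRow S) Cs↭)) (trans (cong (λ xs → length (filterᵇ (λ S → suc (Y j) <ᵇ topRow S) xs)) lists)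
        (trans (length-filter-applyUpTo (λ S → suc (Y j) <ᵇ topRow S) (component B ∘ first) (suc t)) final′))
        where
        lists : map (component B) firsts ≡ applyUpTo (component B ∘ first) (suc t)
        lists = trans (cong (map (component B)) (map-upTo first (suc t))) (map-applyUpTo first (component B) (suc t))
        final′ : count ((λ S → suc (Y j) <ᵇ topRow S) ∘ component B ∘ first) (suc t) ≡ j
        final′ = trans (cong (count _) (sym len)) (count-prefix _ j (suc t ∸ j) yes no)
          where
          len : j + (suc t ∸ j) ≡ suc t
          len = m+[n∸m]≡n (m≤n⇒m≤1+n p)
          yes : ∀ {i} → i < j → (suc (Y j) <ᵇ topRow (component B (first i))) ≡ true
          yes {i} q = T→true (<⇒<ᵇ (subst (suc (Y j) <_) (sym (topRow-first (≤-trans (<⇒≤ q) p))) (s≤s (≤-trans (s≤s (m≤m+n (Y j) m)) (spread q p)))))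
          no : ∀ {i} → j ≤ i → i < j + (suc t ∸ j) → (suc (Y j) <ᵇ topRow (component B (first i))) ≡ false
          no {i} q z with suc (Y j) <ᵇ topRow (component B (first i)) in eq
          ... | false = refl
          ... | true  = ⊥-elim (bad (<ᵇ⇒< _ _ (Equivalence.from T-≡ eq)))
            where
            i≤t : i ≤ t
            i≤t = ≤-pred (subst (i <_) len z)
            low : Y i ≤ Y j
            low = [ (λ lt → (lin (Y i ∷ Y j ∷ m ∷ []) v0 v1 (:≤ (1+ (v0 ⊹ v2)) v1 (spread lt i≤t) ∷ []))) , (λ { refl → ≤-refl }) ]′ (m≤n⇒m<n∨m≡n q)
            bad : suc (Y j) < topRow (component B (first i)) → ⊥
            bad w = <⇒≱ (subst (suc (Y j) <_) (topRow-first i≤t) w) (s≤s low)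

    -- There are `t + 1` components of `m + 1` rows each, which gives `suc t * m`; the blocks below
    -- the marked one give `j`.
    blocks-spin : ∀ {j} → j ≤ t → coverSpin τ (suc (Y j)) κ ≡ suc t * m + j
    blocks-spin {j} p = cong₂ _+_ (cong₂ _*_ len (cong (_∸ 1) (heightAt-≡ Cs (Cs-all _ height-first) (blocks-marked⁺ p)))) (count-above p)
      where
      len : length Cs ≡ suc t
      len = trans (↭-length Cs↭) (trans (length-map (component B) firsts) (trans (length-map first (upTo (suc t))) (length-upTo (suc t))))

-- The strong marked covers produced by a removal.

module MarkedCovers where
  open import Defs
  open Row
  open Core
  open Cover
  open Rows
  open Blocks
  open Linear
  open import Data.Nat using (ℕ; zero; suc; _+_; _*_; _≤_; _<_; z≤n; s≤s)
  open import Data.Nat.Properties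
  open import Data.List using (List; []; _∷_; length; applyUpTo)
  open import Data.Nat.ListAction using (sum)
  open import Data.Product using (_×_; _,_; proj₁; proj₂; ∃)
  open import Data.Sum using (inj₁; inj₂)
  open import Function using (_∘_)
  open import Relation.Binary.PropositionalEquality

  sum-applyUpTo : ∀ h N → sum (applyUpTo h N) ≡ Σ< N h
  sum-applyUpTo h zero    = refl
  sum-applyUpTo h (suc N) = cong (h 0 +_) (sum-applyUpTo (h ∘ suc) N)

  Σ<-extend : ∀ {N M h} → N ≤ M → (∀ {r} → N ≤ r → h r ≡ 0) → Σ< M h ≡ Σ< N h
  Σ<-extend {M = M} z≤n z     = Σ<-zero M (λ r → z z≤n)
  Σ<-extend {h = h} (s≤s p) z = cong (h 0 +_) (Σ<-extend p (λ q → z (s≤s q)))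

  abstract
    -- Opaque, so that the size is a single atom in the linear certificates; `weight-def` is the way
    -- back.
    weight : ℕ → List ℕ → ℕ
    weight k κ = sum (𝔭 k κ)

    weight-def : ∀ k κ → weight k κ ≡ sum (𝔭 k κ)
    weight-def k κ = refl

  pRow-≥length : ∀ k κ {r} → length κ ≤ r → pRow k κ (suc r) ≡ 0
  pRow-≥length k κ {r} p = trans (pRow-count k κ r) (cong (count (small k κ r)) (row-≥length κ p))

  -- `pRow-CoreOf` summed over `ℓ` rows; rows beyond the end of the list contribute 0.
  weight-Σ : ∀ {k ℓ κ σ} → CoreOf k ℓ κ σ → weight k κ + Σ< ℓ σ ≡ Σ< ℓ (suc k +_)
  weight-Σ {k} {ℓ} {κ} {σ} C = trans (cong (_+ Σ< ℓ σ) (trans (trans (weight-def k κ) (sum-applyUpTo _ (length κ))) (sym (Σ<-extend (length≤ℓ C) (pRow-≥length k κ)))))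
    (trans (sym (Σ<-+ ℓ _ σ)) (Σ<-cong ℓ (pRow-CoreOf C)))

  -- For `m = 0` the row `x` of a tower is arbitrary, so the bound can be demanded only of a
  -- nonempty interval.
  Σ<-interval′ : ∀ N lo len → (0 < len → lo + len ≤ N) → Σ< N (interval lo len) ≡ len
  Σ<-interval′ N lo zero      p = Σ<-zero N λ r → vanish (locate lo 0 r)
    where
    vanish : ∀ {r v} → Interval lo 0 r v → v ≡ 0
    vanish (before _ e)      = e
    vanish (inside _ () _ _)
    vanish (after _ e)       = e
  Σ<-interval′ N lo (suc len) p = Σ<-interval N lo (suc len) (p (s≤s z≤n))

  module _ {k ℓ κ σ} (C : CoreOf k ℓ κ σ) {y m t x Y} (G : Good k σ y m t x Y) where
    open Good G
    open Geometry (CoreOf.adm C) G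

    private
      σ′ : ℕ → ℕ
      σ′ = lam σ y m x

      spec : ∀ r → σ′ r + interval x m r ≡ σ r + interval y (suc m) r
      spec = lam-spec {σ} {y} {m} {x} (CoreOf.lo C)

    abstract
      lower : List ℕ
      lower = proj₁ (CoreOf-exists ℓ (lam-Adm {σ′ = lam σ y m x} (lam-spec {σ} {y} {m} {x} (CoreOf.lo C))))

      lower-CoreOf : CoreOf k ℓ lower (lam σ y m x)
      lower-CoreOf = proj₂ (CoreOf-exists ℓ (lam-Adm {σ′ = lam σ y m x} (lam-spec {σ} {y} {m} {x} (CoreOf.lo C))))

    private
      C′ : CoreOf k ℓ lower σ′
      C′ = lower-CoreOf

      lower-inner : ∀ {j i} → j ≤ t → i < m → row lower (Y j + i) < row κ (suc (Y j + i))
      lower-inner p q = ≤-reflexive (row-inner C G C′ spec p q)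

      lower-end : ∀ {j} → j ≤ t → row κ (suc (Y j + m)) ≤ row lower (Y j + m)
      lower-end {j} p = lin (row κ (suc (Y j + m)) ∷ row lower (Y j + m) ∷ m ∷ row κ (Y j) ∷ ribbon C G ∷ []) v0 v1 (:≥ (v3 ⊹ v2) (v1 ⊹ v4) (row-last C G C′ spec p) ∷ :≤ (v0 ⊹ v4) (v3 ⊹ v2) (block-end C G p) ∷ [])

      lower-last : ∀ {j} → j ≤ t → row lower (Y j + m) < row κ (Y j + m)
      lower-last {j} p = lin (row lower (Y j + m) ∷ row κ (Y j + m) ∷ ribbon C G ∷ m ∷ row κ (Y j) ∷ []) (1+ v0) v1 (:≡ (v0 ⊹ v2) (v4 ⊹ v3) (row-last C G C′ spec p) ∷ :≤ (1+ (v4 ⊹ v3)) (v1 ⊹ v2) (block-nonempty C G p) ∷ [])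

    lower-blocks : Blocks lower κ t m Y
    lower-blocks = record
      { partitionτ = CoreOf.partition C′
      ; partitionκ = CoreOf.partition C
      ; inner      = lower-inner
      ; end        = lower-end
      ; last       = lower-last
      ; outside    = row-outside C G C′ spec
      ; spread     = spread
      }

    lower-⊆ : ∀ r → row lower r ≤ row κ r
    lower-⊆ r with locate-block t m Y r
    ... | inj₂ out = ≤-reflexive (row-outside C G C′ spec out)
    ... | inj₁ (j , p , i , q , refl) with m≤n⇒m<n∨m≡n q
    ...   | inj₁ z    = ≤-trans (<⇒≤ (lower-inner p z)) (row-antitone-suc (proj₁ (CoreOf.partition C)) (Y j + i))
    ...   | inj₂ refl = <⇒≤ (lower-last p)

    lower-weight : weight k lower + 1 ≡ weight k κ
    lower-weight = lin≡ (weight k lower ∷ weight k κ ∷ Σ< ℓ (_+_ (suc k)) ∷ Σ< ℓ σ ∷ Σ< ℓ σ′ ∷ Σ< ℓ (interval y (suc m)) ∷ Σ< ℓ (interval x m) ∷ m ∷ []) (v0 ⊹ #1) v1 (:≥ v2 (v1 ⊹ v3) (weight-Σ C) ∷ :≡ (v0 ⊹ v4) v2 (weight-Σ {σ = σ′} C′) ∷ :≥ (v3 ⊹ v5) (v4 ⊹ v6) total ∷ :≡ v6 v7 ix ∷ :≥ (1+ v7) v5 iy ∷ [])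
      where
      total : Σ< ℓ σ′ + Σ< ℓ (interval x m) ≡ Σ< ℓ σ + Σ< ℓ (interval y (suc m))
      total = trans (sym (Σ<-+ ℓ σ′ _)) (trans (Σ<-cong ℓ spec) (Σ<-+ ℓ σ _))
      ix : Σ< ℓ (interval x m) ≡ m
      ix = Σ<-interval′ ℓ x m λ p → bound m p side-<
        where
        bound : ∀ m′ → 0 < m′ → (∀ {i} → i < m′ → x + i < Y t) → x + m′ ≤ ℓ
        bound (suc m′) _ f = lin (m′ ∷ x ∷ ℓ ∷ Y t ∷ y ∷ m ∷ []) (v1 ⊹ 1+ v0) v2 (:≤ (1+ (v1 ⊹ v0)) v3 (f {m′} ≤-refl) ∷ :≤ v3 v4 top≤y ∷ :≤ (1+ (v4 ⊹ v5)) v2 y+m<ℓ ∷ [])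
      iy : Σ< ℓ (interval y (suc m)) ≡ suc m
      iy = Σ<-interval ℓ y (suc m) (lin (m ∷ y ∷ ℓ ∷ []) (v1 ⊹ 1+ v0) v2 (:≤ (1+ (v1 ⊹ v0)) v2 y+m<ℓ ∷ []))

    lower-cover : StrongCover k lower κ
    lower-cover = CoreOf-core C′ , CoreOf-core C , (λ { zero → ≤-reflexive (trans (part-zero lower) (sym (part-zero κ))) ; (suc r) → lower-⊆ r }) ,
      trans (cong (_+ 1) (sym (weight-def k lower))) (trans lower-weight (weight-def k κ))
      where
      part-zero : ∀ κ → part κ 0 ≡ 0
      part-zero []      = refl
      part-zero (_ ∷ _) = refl

    lower-marked : ∀ {j} → j ≤ t → MarkedCover k lower (suc (Y j)) κ
    lower-marked p = lower-cover , s≤s z≤n , blocks-marked⁺ lower-blocks p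

    lower-marked⁻ : ∀ {R} → MarkedCover k lower R κ → ∃ λ j → j ≤ t × R ≡ suc (Y j)
    lower-marked⁻ (_ , _ , p) = blocks-marked⁻ lower-blocks p

    lower-spin : ∀ {j} → j ≤ t → coverSpin lower (suc (Y j)) κ ≡ suc t * m + j
    lower-spin = blocks-spin lower-blocks

-- Searching for the tower above a row.

module Search where
  open Core
  open Cover
  open Linear
  open import Data.Nat using (ℕ; zero; suc; _+_; _≤_; _<_; z≤n; s≤s)
  open import Data.Nat.Properties
  open import Data.List using ([]; _∷_)
  open import Data.Product using (_×_; _,_; proj₁; proj₂; ∃)
  open import Data.Sum using (_⊎_; inj₁; inj₂; [_,_]′)
  open import Data.Empty using (⊥; ⊥-elim)
  open import Relation.Nullary using (yes; no)
  open import Relation.Binary.PropositionalEquality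

  all-or-first : {P Q : ℕ → Set} → (∀ i → P i ⊎ Q i) → ∀ N →
    (∀ {i} → i < N → P i) ⊎ (∃ λ i → i < N × Q i × (∀ {j} → j < i → P j))
  all-or-first d zero = inj₁ λ ()
  all-or-first {P} d (suc N) with all-or-first d N
  ... | inj₂ (i , p , q , h) = inj₂ (i , m<n⇒m<1+n p , q , h)
  ... | inj₁ h with d N
  ...   | inj₂ q = inj₂ (N , ≤-refl , q , h)
  ...   | inj₁ p = inj₁ λ { (s≤s z) → [ h , (λ { refl → p }) ]′ (m≤n⇒m<n∨m≡n z) }

  search : (f : ℕ → ℕ) (v N : ℕ) → (∃ λ r → r < N × f r ≡ v) ⊎ (∀ {r} → r < N → f r ≢ v)
  search f v N with all-or-first {λ r → f r ≢ v} {λ r → f r ≡ v} dec N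
    where
    dec : ∀ r → f r ≢ v ⊎ f r ≡ v
    dec r with f r ≟ v
    ... | yes e = inj₂ e
    ... | no ne = inj₁ ne
  ... | inj₁ h               = inj₂ h
  ... | inj₂ (r , p , e , _) = inj₁ (r , p , e)

  module _ {k ℓ σ} (A : Adm k ℓ σ) where
    open Adm A

    -- A preimage of `Y` is smaller than `Y`, since `r < σ r`; this makes the search finite.
    hit? : ∀ Y → (∃ λ r → σ r ≡ Y) ⊎ (∀ r → σ r ≢ Y)
    hit? Y with search σ Y Y
    ... | inj₁ (r , _ , e) = inj₁ (r , e)
    ... | inj₂ h           = inj₂ λ r e → h (lin (r ∷ Y ∷ σ r ∷ []) (1+ v0) v1 (:≡ v2 v1 e ∷ :≤ (1+ v0) v2 (lo r) ∷ [])) e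

    abstract
      up : ℕ → ℕ
      up Y with hit? Y
      ... | inj₁ (r , _) = r
      -- A dummy value: outside this block `up` is known only through `up-hit`.
      ... | inj₂ _       = 0

      up-hit : ∀ {Y r} → σ r ≡ Y → σ (up Y) ≡ Y
      up-hit {Y} {r} e with hit? Y
      ... | inj₁ (_ , e′) = e′
      ... | inj₂ h        = ⊥-elim (h r e)

    level : ℕ → ℕ → ℕ
    level y zero    = y
    level y (suc j) = up (level y j)

    -- `σ` increases strictly, so no row fits between two rows with consecutive values.
    contiguous : ∀ {a b v} → σ a ≡ v → σ b ≡ suc v → b ≡ suc a
    contiguous {a} {b} {v} e e′ = ≤-antisym
      (σ-cancel-≤ A (lin (σ b ∷ σ (suc a) ∷ σ a ∷ v ∷ []) v0 v1 (:≤ (1+ v2) v1 (mono a) ∷ :≥ v3 v2 e ∷ :≡ v0 (1+ v3) e′ ∷ [])))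
      (≰⇒> λ p → (lin⊥ (a ∷ σ b ∷ b ∷ σ a ∷ v ∷ []) (:≤ (v1 ⊹ v0) (v3 ⊹ v2) (σ-mono A p) ∷ :≡ v3 v4 e ∷ :≥ (1+ v4) v1 e′ ∷ :≤ v2 v0 p ∷ [])))

    contiguous* : ∀ {a v m} → σ a ≡ v → (∀ {i} → i < m → ∃ λ r → σ r ≡ suc (v + i)) → ∀ {i} → i ≤ m → σ (a + i) ≡ v + i
    contiguous* {a} {v} e h {zero}  p = lin≡ (σ (a + 0) ∷ v ∷ σ a ∷ []) v0 (v1 ⊹ #0) (:≡ v2 v1 e ∷ :≡ v0 v2 (cong σ (+-identityʳ a)) ∷ [])
    contiguous* {a} {v} e h {suc i} p with h p
    ... | r , e′ = lin≡ (σ (a + suc i) ∷ i ∷ v ∷ σ r ∷ σ (suc (a + i)) ∷ []) v0 (v2 ⊹ 1+ v1) (:≡ v3 (1+ (v2 ⊹ v1)) e′ ∷ :≥ v4 v3 (cong σ (contiguous (contiguous* e h (<⇒≤ p)) e′)) ∷ :≡ v0 v4 (cong σ (+-suc a i)) ∷ [])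

    Steps : ℕ → ℕ → ℕ → Set
    Steps m y t = ∀ {j} → j < t → ∀ {i} → i ≤ m → σ (level y (suc j) + i) ≡ level y j + i

    -- The climb ends at the top of the runner or at the first of the `m` following beads of a level
    -- that has no bead above it. Row `y` does not count as such a bead, because its own offset is
    -- about to change; this also absorbs the case of a window that is too small.
    data Outcome (m y : ℕ) : Set where
      complete : ∀ t x → y + m < σ y → Steps m y t → (∀ r → σ r ≢ level y t) → (∀ {i} → i < m → x + i ≢ y × σ (x + i) ≡ suc (level y t + i)) → Outcome m y
      stuck    : ∀ s i x → s ≡ 0 ⊎ y + m < σ y → Steps m y s → i < m → (∀ r → r ≢ y → σ r ≢ suc (level y s + i)) →
                 (∀ {j} → j < i → x + j ≢ y × σ (x + j) ≡ suc (level y s + j)) → Outcome m y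

    private
      hit≢? : ∀ y Y → (∃ λ r → r ≢ y × σ r ≡ Y) ⊎ (∀ r → r ≢ y → σ r ≢ Y)
      hit≢? y Y with hit? Y
      ... | inj₂ h = inj₂ λ r _ → h r
      ... | inj₁ (r , e) with r ≟ y
      ...   | no ne    = inj₁ (r , ne , e)
      ...   | yes refl = inj₂ λ r′ ne e′ → ne (σ-injective A (trans e′ (sym e)))

      -- Rows hitting consecutive values are consecutive; x is the first of them.
      line-up : ∀ y v i → (∀ {j} → j < i → ∃ λ r → r ≢ y × σ r ≡ suc (v + j)) →
        ∃ λ x → ∀ {j} → j < i → x + j ≢ y × σ (x + j) ≡ suc (v + j)
      line-up y v zero    h = 0 , λ ()
      line-up y v (suc i) h with h {0} (s≤s z≤n)
      ... | x , _ , e = x , each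
        where
        eqs : ∀ {j} → j ≤ i → σ (x + j) ≡ suc (v + 0) + j
        eqs = contiguous* e λ {j} p → let r , _ , e′ = h {suc j} (s≤s p) in r , (lin≡ (σ (proj₁ (h (s≤s p))) ∷ j ∷ v ∷ []) v0 (1+ (1+ (v2 ⊹ #0) ⊹ v1)) (:≡ v0 (1+ (v2 ⊹ 1+ v1)) e′ ∷ []))
        each : ∀ {j} → j < suc i → x + j ≢ y × σ (x + j) ≡ suc (v + j)
        each {j} (s≤s p) = (λ z → proj₁ (proj₂ (h (s≤s p))) (trans (σ-injective A (lin≡ (σ (proj₁ (h (s≤s p))) ∷ σ (x + j) ∷ j ∷ v ∷ []) v0 v1 (:≡ v0 (1+ (v3 ⊹ v2)) (proj₂ (proj₂ (h (s≤s p)))) ∷ :≥ (1+ (v3 ⊹ #0) ⊹ v2) v1 (eqs p) ∷ []))) z)) , (lin≡ (σ (x + j) ∷ j ∷ v ∷ []) v0 (1+ (v2 ⊹ v1)) (:≡ v0 (1+ (v2 ⊹ #0) ⊹ v1) (eqs p) ∷ []))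

      -- If `σ y` were one of `y + 1`, ..., `y + m`, a row different from `y` would have the same
      -- value.
      window : ∀ {m y s} → s ≡ 0 ⊎ y + m < σ y → (∀ {i} → i < m → ∃ λ r → r ≢ y × σ r ≡ suc (level y s + i)) → y + m < σ y
      window (inj₂ v) h = v
      window {m} {y} (inj₁ refl) h = ≰⇒> λ z → clash z (m≤n⇒∃[o]m+o≡n (lo y))
        where
        clash : σ y ≤ y + m → (∃ λ i → suc y + i ≡ σ y) → ⊥
        clash z (i , e) with r , ne , e′ ← h {i} (lin (i ∷ m ∷ σ y ∷ y ∷ []) (1+ v0) v1 (:≤ v2 (v3 ⊹ v1) z ∷ :≡ (1+ v3 ⊹ v0) v2 e ∷ [])) = ne (σ-injective A (trans e′ e))

      climb : ∀ fuel m y s → level y s < fuel → s ≡ 0 ⊎ y + m < σ y → Steps m y s → Outcome m y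
      climb (suc fuel) m y s p w st with all-or-first (λ i → hit≢? y (suc (level y s + i))) m
      ... | inj₂ (i , q , h , prev) with x , each ← line-up y (level y s) i prev = stuck s i x w st q h each
      ... | inj₁ h with hit? (level y s)
      ...   | inj₂ roof with x , each ← line-up y (level y s) m h = complete s x (window w h) st roof each
      ...   | inj₁ (r , e) = climb fuel m y (suc s) (≤-trans (lo (up (level y s))) (≤-trans (≤-reflexive (up-hit e)) (≤-pred p))) (inj₂ (window w h)) st′
        where
        st′ : Steps m y (suc s)
        st′ {j} (s≤s q) with m≤n⇒m<n∨m≡n q
        ... | inj₁ z    = st z
        ... | inj₂ refl = contiguous* (up-hit e) λ z → let r , _ , e′ = h z in r , e′

    outcome : ∀ m y → Outcome m y
    outcome m y = climb (suc y) m y 0 ≤-refl (inj₁ refl) λ ()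

    -- The run cannot reach row `ℓ`: there `σ r ≡ suc k + r`, and the run would carry this back to
    -- row `y`, against `pos`.
    run-length : ∀ {y} → σ y ≤ k + y → ∃ λ m → (∀ {i} → i ≤ m → σ (y + i) ≡ σ y + i) × suc (σ y + m) < σ (suc (y + m))
    run-length {y} pos = go ℓ 0 (lin (ℓ ∷ y ∷ []) v0 (v0 ⊹ (v1 ⊹ #0)) ([])) λ { {i} z≤n → trans (cong σ (+-identityʳ y)) (sym (+-identityʳ (σ y))) }
      where
      go : ∀ fuel m → ℓ ≤ fuel + (y + m) → (∀ {i} → i ≤ m → σ (y + i) ≡ σ y + i) →
        ∃ λ m → (∀ {i} → i ≤ m → σ (y + i) ≡ σ y + i) × suc (σ y + m) < σ (suc (y + m))
      go fuel m p run with m≤n⇒m<n∨m≡n {suc (σ y + m)} {σ (suc (y + m))} (lin (m ∷ σ y ∷ σ (suc (y + m)) ∷ σ (y + m) ∷ []) (1+ (v1 ⊹ v0)) v2 (:≤ (1+ v3) v2 (mono (y + m)) ∷ :≥ (v1 ⊹ v0) v3 (run {m} ≤-refl) ∷ []))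
      ... | inj₁ stop = m , (λ {i} → run {i}) , stop
      go zero m p run | inj₂ e = ⊥-elim (lin⊥ (m ∷ y ∷ k ∷ σ (y + m) ∷ σ y ∷ []) (:≥ (1+ v2 ⊹ (v1 ⊹ v0)) v3 (tail {y + m} p) ∷ :≡ v3 (v4 ⊹ v0) (run {m} ≤-refl) ∷ :≤ v4 (v2 ⊹ v1) pos ∷ []))
      go (suc fuel) m p run | inj₂ e = go fuel (suc m) (lin (ℓ ∷ m ∷ y ∷ fuel ∷ []) v0 (v3 ⊹ (v2 ⊹ 1+ v1)) (:≤ v0 (1+ v3 ⊹ (v2 ⊹ v1)) p ∷ [])) λ {i} q → [ (λ { (s≤s z) → run z }) , (λ { refl → trans (cong σ (+-suc y m)) (trans (sym e) (sym (+-suc (σ y) m))) }) ]′ (m≤n⇒m<n∨m≡n q)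

    iterate-σ : ℕ → ℕ → ℕ
    iterate-σ zero    r = r
    iterate-σ (suc j) r = σ (iterate-σ j r)

-- Every strong cover is a removal of ribbons.

module Lascoux where
  open Row
  open Core
  open Cover
  open Rows
  open Blocks
  open MarkedCovers
  open Search
  open Linear
  open import Data.Nat using (ℕ; zero; suc; _+_; _∸_; _≤_; _<_; z≤n; s≤s)
  open import Data.Nat.Properties
  open import Data.List using (List; []; _∷_)
  open import Data.Product using (Σ; _×_; _,_; proj₁; proj₂; ∃)
  open import Data.Sum using (_⊎_; inj₁; inj₂; [_,_]′)
  open import Data.Empty using (⊥; ⊥-elim)
  open import Function using (id)
  open import Relation.Nullary using (¬_; yes; no)
  open import Relation.Binary.PropositionalEquality

  module _ {k ℓ κ τ σ ρ} (C : CoreOf k ℓ κ σ) (D : CoreOf k ℓ τ ρ) (sub : ∀ r → row τ r ≤ row κ r) where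
    private
      module C = CoreOf C
      module D = CoreOf D
      A = C.adm

      f-anti : ∀ {a b} → a ≤ b → row κ b ≤ row κ a
      f-anti = row-antitone C.partition
      g-anti : ∀ {a b} → a ≤ b → row τ b ≤ row τ a
      g-anti = row-antitone D.partition

      -- κ/τ has a box on the diagonal lying i steps below the bead of row y.
      Diagonal : ℕ → ℕ → Set
      Diagonal y i = ∃ λ r → row τ r + y + i < row κ y + r × row κ y + r ≤ row κ r + y + i

      -- `Bead-κ s r`: the bead of row `s` of `τ` is the bead of row `r` of `κ`. `Bead-τ y r`: the
      -- bead of row `y` of `κ` is the bead of row `r` of `τ`.
      Bead-κ Bead-τ : ℕ → ℕ → Set
      Bead-κ s r = row κ r + s ≡ row τ s + r
      Bead-τ y r = row τ r + y ≡ row κ y + r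

      diagonal? : ∀ y i → Diagonal y i ⊎ ¬ Diagonal y i
      diagonal? y i with all-or-first {λ r → ¬ (row τ r + y + i < row κ y + r × row κ y + r ≤ row κ r + y + i)} {λ r → row τ r + y + i < row κ y + r × row κ y + r ≤ row κ r + y + i} dec ℓ
        where
        dec : ∀ r → ¬ (row τ r + y + i < row κ y + r × row κ y + r ≤ row κ r + y + i) ⊎ (row τ r + y + i < row κ y + r × row κ y + r ≤ row κ r + y + i)
        dec r with ≤-<-connex (row κ y + r) (row τ r + y + i) | ≤-<-connex (row κ y + r) (row κ r + y + i)
        ... | inj₁ p | _      = inj₁ λ (q , _) → <⇒≱ q p
        ... | inj₂ _ | inj₂ p = inj₁ λ (_ , q) → <⇒≱ p q
        ... | inj₂ p | inj₁ q = inj₂ (p , q)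
      ... | inj₂ (r , _ , d , _) = inj₁ (r , d)
      ... | inj₁ h = inj₂ λ { (r , p , q) → [ (λ z → (lin⊥ (i ∷ y ∷ row τ r ∷ r ∷ row κ y ∷ row κ r ∷ []) (:≤ (1+ (v2 ⊹ v1 ⊹ v0)) (v4 ⊹ v3) p ∷ :≤ (v4 ⊹ v3) (v5 ⊹ v1 ⊹ v0) q ∷ :≡ v5 #0 (row-≥ℓ C z) ∷ :≥ #0 v2 (row-≥ℓ D z) ∷ []))) , (λ z → h z (p , q)) ]′ (≤-<-connex ℓ r) }

      -- The equation says that the same diagonal is counted from the beads of two different rows.
      shift : ∀ {y z i j} → row κ y + z + j ≡ row κ z + y + i → Diagonal y i → Diagonal z j
      shift {y} {z} {i} {j} e (r , p , q) = r , (lin (j ∷ z ∷ row τ r ∷ r ∷ row κ z ∷ row κ y ∷ i ∷ y ∷ []) (1+ (v2 ⊹ v1 ⊹ v0)) (v4 ⊹ v3) (:≡ (v5 ⊹ v1 ⊹ v0) (v4 ⊹ v7 ⊹ v6) e ∷ :≤ (1+ (v2 ⊹ v7 ⊹ v6)) (v5 ⊹ v3) p ∷ [])) , (lin (r ∷ row κ z ∷ j ∷ z ∷ row κ r ∷ i ∷ y ∷ row κ y ∷ []) (v1 ⊹ v0) (v4 ⊹ v3 ⊹ v2) (:≥ (v1 ⊹ v6 ⊹ v5) (v7 ⊹ v3 ⊹ v2) e ∷ :≤ (v7 ⊹ v0) (v4 ⊹ v6 ⊹ v5) q ∷ []))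

      on-bead : ∀ {y} → (∀ r → ¬ Bead-τ y r) → Diagonal y 0
      on-bead {y} h = y , ≤∧≢⇒< (lin (y ∷ row τ y ∷ row κ y ∷ []) (v1 ⊹ v0 ⊹ #0) (v2 ⊹ v0) (:≤ v1 v2 (sub y) ∷ [])) (λ e → h y (lin≡ (y ∷ row τ y ∷ row κ y ∷ []) (v1 ⊹ v0) (v2 ⊹ v0) (:≡ (v1 ⊹ v0 ⊹ #0) (v2 ⊹ v0) e ∷ []))) , (lin (y ∷ row κ y ∷ []) (v1 ⊹ v0) (v1 ⊹ v0 ⊹ #0) ([]))

      bead-κ? : ∀ s → (∃ λ r → Bead-κ s r) ⊎ (∀ r → ¬ Bead-κ s r)
      bead-κ? s with all-or-first {λ r → ¬ Bead-κ s r} {Bead-κ s} dec (ℓ + suc s)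
        where
        dec : ∀ r → ¬ Bead-κ s r ⊎ Bead-κ s r
        dec r with row κ r + s ≟ row τ s + r
        ... | yes e = inj₂ e
        ... | no ne = inj₁ ne
      ... | inj₂ (r , _ , e , _) = inj₁ (r , e)
      ... | inj₁ h = inj₂ λ r e → h (lin (r ∷ s ∷ ℓ ∷ []) (1+ v0) (v2 ⊹ 1+ v1) (:≤ (1+ v0) (v2 ⊹ 1+ v1) (bound r e) ∷ [])) e
        where
        bound : ∀ r → Bead-κ s r → r < ℓ + suc s
        bound r e = ≰⇒> λ z → lin⊥ (r ∷ row τ s ∷ s ∷ row κ r ∷ ℓ ∷ []) (:≥ (v1 ⊹ v0) (v3 ⊹ v2) e ∷ :≤ (v4 ⊹ 1+ v2) v0 z ∷ :≡ v3 #0 (row-≥ℓ C {r} (lin (ℓ ∷ r ∷ s ∷ []) v0 v1 (:≤ (v0 ⊹ 1+ v2) v1 z ∷ []))) ∷ [])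

      -- Going down from a diagonal of κ/τ to one that is not, we pass a bead of τ missing from κ, and vice versa.
      exit-down : ∀ {y i} → Diagonal y i → ¬ Diagonal y (suc i) → ∃ λ s → row τ s + y + suc i ≡ row κ y + s × (∀ r → ¬ Bead-κ s r)
      exit-down {y} {i} (s , p , q) nd = s , here , missing
        where
        here : row τ s + y + suc i ≡ row κ y + s
        here = ≤-antisym (lin (i ∷ y ∷ row τ s ∷ s ∷ row κ y ∷ []) (v2 ⊹ v1 ⊹ 1+ v0) (v4 ⊹ v3) (:≤ (1+ (v2 ⊹ v1 ⊹ v0)) (v4 ⊹ v3) p ∷ [])) (≮⇒≥ λ z → nd (s , z , (lin (s ∷ row κ y ∷ i ∷ y ∷ row κ s ∷ []) (v1 ⊹ v0) (v4 ⊹ v3 ⊹ 1+ v2) (:≤ (v1 ⊹ v0) (v4 ⊹ v3 ⊹ v2) q ∷ []))))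
        missing : ∀ r → ¬ Bead-κ s r
        missing r e with ≤-<-connex r s
        ... | inj₁ z = [ (λ lt → (lin⊥ (r ∷ s ∷ []) (:≤ (1+ v0) v1 lt ∷ :≤ v1 v0 below ∷ []))) , (λ { refl → (lin⊥ (s ∷ row κ s ∷ row τ s ∷ i ∷ y ∷ row κ y ∷ []) (:≡ (v1 ⊹ v0) (v2 ⊹ v0) e ∷ :≡ (v2 ⊹ v4 ⊹ 1+ v3) (v5 ⊹ v0) here ∷ :≤ (v5 ⊹ v0) (v1 ⊹ v4 ⊹ v3) q ∷ [])) }) ]′ (m≤n⇒m<n∨m≡n z)
          where
          below : s ≤ r
          below = ≮⇒≥ λ lt → lin⊥ (s ∷ row κ r ∷ r ∷ row τ s ∷ i ∷ y ∷ row κ y ∷ row κ s ∷ []) (:≡ (v1 ⊹ v0) (v3 ⊹ v2) e ∷ :≡ (v3 ⊹ v5 ⊹ 1+ v4) (v6 ⊹ v0) here ∷ :≤ (v6 ⊹ v0) (v7 ⊹ v5 ⊹ v4) q ∷ :≤ v7 v1 (f-anti (<⇒≤ lt)) ∷ :≤ (1+ v2) v0 lt ∷ [])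
            where
            above : row κ y + r ≤ row τ r + y + suc i
            above = ≮⇒≥ λ w → nd (r , w , (lin (r ∷ row κ y ∷ i ∷ y ∷ row κ r ∷ row τ s ∷ s ∷ []) (v1 ⊹ v0) (v4 ⊹ v3 ⊹ 1+ v2) (:≥ (v5 ⊹ v0) (v4 ⊹ v6) e ∷ :≥ (v1 ⊹ v6) (v5 ⊹ v3 ⊹ 1+ v2) here ∷ [])))
        ... | inj₂ z = lin⊥ (i ∷ y ∷ row τ s ∷ s ∷ row κ y ∷ r ∷ row τ r ∷ []) (:≡ (v2 ⊹ v1 ⊹ 1+ v0) (v4 ⊹ v3) here ∷ :≤ (1+ v3) v5 z ∷ :≤ v6 v2 (g-anti (<⇒≤ z)) ∷ :≤ (v4 ⊹ v5) (v6 ⊹ v1 ⊹ 1+ v0) above ∷ [])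
          where
          above : row κ y + r ≤ row τ r + y + suc i
          above = ≮⇒≥ λ w → nd (r , w , (lin (r ∷ row κ y ∷ i ∷ y ∷ row κ r ∷ row τ s ∷ s ∷ []) (v1 ⊹ v0) (v4 ⊹ v3 ⊹ 1+ v2) (:≥ (v5 ⊹ v0) (v4 ⊹ v6) e ∷ :≥ (v1 ⊹ v6) (v5 ⊹ v3 ⊹ 1+ v2) here ∷ [])))

      exit-up : ∀ {y i} → Diagonal y (suc i) → ¬ Diagonal y i → ∃ λ r → row κ r + y + suc i ≡ row κ y + r × (∀ s → ¬ Bead-τ r s)
      exit-up {y} {i} (r , p , q) nd = r , here , missing
        where
        here : row κ r + y + suc i ≡ row κ y + r
        here = ≤-antisym (≮⇒≥ λ z → nd (r , (lin (i ∷ y ∷ row τ r ∷ r ∷ row κ y ∷ []) (1+ (v2 ⊹ v1 ⊹ v0)) (v4 ⊹ v3) (:≤ (1+ (v2 ⊹ v1 ⊹ 1+ v0)) (v4 ⊹ v3) p ∷ [])) , (lin (r ∷ row κ y ∷ i ∷ y ∷ row κ r ∷ []) (v1 ⊹ v0) (v4 ⊹ v3 ⊹ v2) (:≤ (1+ (v1 ⊹ v0)) (v4 ⊹ v3 ⊹ 1+ v2) z ∷ [])))) (lin (r ∷ row κ y ∷ i ∷ y ∷ row κ r ∷ []) (v1 ⊹ v0) (v4 ⊹ v3 ⊹ 1+ v2) (:≤ (v1 ⊹ v0) (v4 ⊹ v3 ⊹ 1+ v2) q ∷ []))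
        missing : ∀ s → ¬ Bead-τ r s
        missing s e with ≤-<-connex r s
        ... | inj₁ z = lin⊥ (s ∷ row κ r ∷ r ∷ row τ s ∷ row κ y ∷ i ∷ y ∷ row τ r ∷ []) (:≥ (v1 ⊹ v0) (v3 ⊹ v2) e ∷ :≥ (v4 ⊹ v2) (v1 ⊹ v6 ⊹ 1+ v5) here ∷ :≤ (1+ (v7 ⊹ v6 ⊹ 1+ v5)) (v4 ⊹ v2) p ∷ :≤ v2 v0 z ∷ :≤ v3 v7 (g-anti z) ∷ [])
        ... | inj₂ z = nd (s , (lin (i ∷ y ∷ row τ s ∷ s ∷ row κ y ∷ r ∷ row κ r ∷ []) (1+ (v2 ⊹ v1 ⊹ v0)) (v4 ⊹ v3) (:≡ (v2 ⊹ v5) (v6 ⊹ v3) e ∷ :≡ (v6 ⊹ v1 ⊹ 1+ v0) (v4 ⊹ v5) here ∷ [])) , (lin (s ∷ row κ y ∷ i ∷ y ∷ row κ s ∷ r ∷ row κ r ∷ []) (v1 ⊹ v0) (v4 ⊹ v3 ⊹ v2) (:≥ (v1 ⊹ v5) (v6 ⊹ v3 ⊹ 1+ v2) here ∷ :≤ (1+ v0) v5 z ∷ :≤ v6 v4 (f-anti (<⇒≤ z)) ∷ [])))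

      Above : ℕ → ℕ → Set
      Above y Z = ∃ λ j → iterate-σ A j Z ≡ y

      Strip : ℕ → ℕ → Set
      Strip y L = ∀ {i} → i < L → Diagonal y i

      Strips : ℕ → ℕ → Set
      Strips y L = ∀ Z → Above y Z → Strip Z L

      above-step : ∀ {y Z} → Above (σ y) Z → Z ≡ σ y ⊎ Above y Z
      above-step (zero  , e) = inj₁ e
      above-step (suc j , e) = inj₂ (j , σ-injective A e)

      -- L is the distance from the bead of row y down to a + (k + 1), a being the bead of row q.
      Distance : ℕ → ℕ → ℕ → Set
      Distance y L q = row κ q + suc k + y + L ≡ row κ y + q

      -- All beads weakly above row `y` on its runner can slide down by `L` along diagonals of
      -- `κ/τ`, and the lowest of them then reaches a vacant place, `k + 1` above the bead of row
      -- `q`.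
      Candidate : Set
      Candidate = ∃ λ y → ∃ λ L → ∃ λ q → 1 ≤ L × Strips y L × Distance y L q × (∀ r → σ r ≢ q)

      -- A bead of `κ` missing from `τ` and, `L` places lower, a bead of `τ` missing from `κ`, with
      -- all diagonals from the first one on, `L` of them, in `κ/τ`. In contrast to a candidate, the
      -- other beads of the runner are not controlled.
      record Pair (L : ℕ) : Set where
        field
          y s     : ℕ
          at-s    : row τ s + y + L ≡ row κ y + s
          y∉τ     : ∀ r → ¬ Bead-τ y r
          s∉κ     : ∀ r → ¬ Bead-κ s r
          strip   : Strip y L

      module Shorten (L : ℕ) (IH : ∀ {L′} → L′ < L → Pair L′ → Candidate) where
        -- When a bead is missing from the core `τ`, so are all beads above it on the runner. If one
        -- of their strips ends early, it ends at a bead of `τ` missing from `κ`, and this is a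
        -- shorter pair.
        upwards : ∀ fuel {y} → y < fuel → (∀ r → ¬ Bead-τ y r) → Candidate ⊎ Strips y L
        upwards (suc fuel) {y} p y∉τ with all-or-first (diagonal? y) L
        ... | inj₂ (zero , q , nd , _) = ⊥-elim (nd (on-bead y∉τ))
        ... | inj₂ (suc i , q , nd , prev) with exit-down (prev ≤-refl) nd
        ...   | s , e , s∉κ = inj₁ (IH q (record { y = y ; s = s ; at-s = e ; y∉τ = y∉τ ; s∉κ = s∉κ ; strip = prev }))
        upwards (suc fuel) {y} p y∉τ | inj₁ ok with hit? A y
        ... | inj₂ roof = inj₂ λ { Z (zero , refl) → ok ; Z (suc j , e) → ⊥-elim (roof _ e) }
        ... | inj₁ (r , refl) with upwards fuel {r} (lin (r ∷ fuel ∷ σ r ∷ []) (1+ v0) v1 (:≤ (1+ v2) (1+ v1) p ∷ :≤ (1+ v0) v2 (C.lo r) ∷ [])) r∉τ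
          where
          r∉τ : ∀ s → ¬ Bead-τ r s
          r∉τ s e = y∉τ (ρ s) (lin≡ (σ r ∷ row τ (ρ s) ∷ ρ s ∷ row κ (σ r) ∷ r ∷ row τ s ∷ s ∷ row κ r ∷ k ∷ []) (v1 ⊹ v0) (v3 ⊹ v2) (:≡ (v5 ⊹ v4) (v7 ⊹ v6) e ∷ :≡ (v7 ⊹ v0) (1+ v8 ⊹ v4 ⊹ v3) (C.rec r) ∷ :≥ (1+ v8 ⊹ v6 ⊹ v1) (v5 ⊹ v2) (D.rec s) ∷ []))
        ...   | inj₁ c  = inj₁ c
        ...   | inj₂ up′ = inj₂ λ Z a → [ (λ { refl → ok }) , up′ Z ]′ (above-step a)

        -- Both beads go down their runners until the one below `s` in `τ` belongs to `κ`; its row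
        -- `q` is then not hit, as otherwise `s` would belong to `κ`. The new strip is inspected
        -- from its lower end, so that a gap leaves a shorter strip ending at the bead of `ρ s`.
        downwards : ∀ fuel {y s} → ℓ ≤ fuel + s → 1 ≤ L → Strips y L → row τ s + y + L ≡ row κ y + s → (∀ r → ¬ Bead-κ s r) → Candidate
        downwards fuel {y} {s} p 1≤L strips e s∉κ with bead-κ? (ρ s)
        ... | inj₁ (q , b) = y , L , q , 1≤L , strips , (lin≡ (L ∷ y ∷ k ∷ row κ q ∷ q ∷ row κ y ∷ row τ s ∷ s ∷ ρ s ∷ row τ (ρ s) ∷ []) (v3 ⊹ 1+ v2 ⊹ v1 ⊹ v0) (v5 ⊹ v4) (:≡ (v6 ⊹ v1 ⊹ v0) (v5 ⊹ v7) e ∷ :≡ (v3 ⊹ v8) (v9 ⊹ v4) b ∷ :≥ (1+ v2 ⊹ v7 ⊹ v9) (v6 ⊹ v8) (D.rec s) ∷ [])) , λ { r refl → s∉κ r (lin≡ (s ∷ row κ r ∷ r ∷ row τ s ∷ ρ s ∷ row κ (σ r) ∷ σ r ∷ row τ (ρ s) ∷ k ∷ []) (v1 ⊹ v0) (v3 ⊹ v2) (:≡ (v5 ⊹ v4) (v7 ⊹ v6) b ∷ :≡ (v1 ⊹ v6) (1+ v8 ⊹ v2 ⊹ v5) (C.rec r) ∷ :≥ (1+ v8 ⊹ v0 ⊹ v7) (v3 ⊹ v4) (D.rec s) ∷ [])) }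
        downwards zero {y} {s} p 1≤L strips e s∉κ | inj₂ nb = ⊥-elim (s∉κ s (lin≡ (s ∷ row κ s ∷ row τ s ∷ []) (v1 ⊹ v0) (v2 ⊹ v0) (:≡ v1 #0 (row-≥ℓ C {s} p) ∷ :≥ #0 v2 (row-≥ℓ D {s} p) ∷ [])))
        downwards (suc fuel) {y} {s} p 1≤L strips e s∉κ | inj₂ nb with m≤n⇒∃[o]m+o≡n 1≤L
        ... | L′ , refl with all-or-first (λ i → diagonal? (σ y) (L′ ∸ i)) (suc L′)
        ...   | inj₁ ok = downwards fuel {σ y} {ρ s} (lin (ℓ ∷ ρ s ∷ fuel ∷ s ∷ []) v0 (v2 ⊹ v1) (:≤ v0 (1+ (v2 ⊹ v3)) p ∷ :≤ (1+ v3) v1 (D.lo s) ∷ [])) 1≤L strips′ (lin≡ (L′ ∷ σ y ∷ row τ (ρ s) ∷ ρ s ∷ row κ (σ y) ∷ y ∷ row τ s ∷ s ∷ row κ y ∷ k ∷ []) (v2 ⊹ v1 ⊹ 1+ v0) (v4 ⊹ v3) (:≡ (v6 ⊹ v5 ⊹ 1+ v0) (v8 ⊹ v7) e ∷ :≡ (v8 ⊹ v1) (1+ v9 ⊹ v5 ⊹ v4) (C.rec y) ∷ :≥ (1+ v9 ⊹ v7 ⊹ v2) (v6 ⊹ v3) (D.rec s) ∷ [])) nb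
          where
          strips′ : Strips (σ y) (suc L′)
          strips′ Z a {i} z with above-step a
          ... | inj₂ a′   = strips Z a′ z
          ... | inj₁ refl = subst (Diagonal (σ y)) (m∸[m∸n]≡n (≤-pred z)) (ok {L′ ∸ i} (s≤s (m∸n≤m L′ i)))
        ...   | inj₂ (zero , q , nd , _) = ⊥-elim (nd (ρ s , (lin (L′ ∷ σ y ∷ row τ (ρ s) ∷ ρ s ∷ row κ (σ y) ∷ y ∷ row τ s ∷ s ∷ row κ y ∷ k ∷ []) (1+ (v2 ⊹ v1 ⊹ v0)) (v4 ⊹ v3) (:≡ (v6 ⊹ v5 ⊹ 1+ v0) (v8 ⊹ v7) e ∷ :≡ (v8 ⊹ v1) (1+ v9 ⊹ v5 ⊹ v4) (C.rec y) ∷ :≥ (1+ v9 ⊹ v7 ⊹ v2) (v6 ⊹ v3) (D.rec s) ∷ [])) , (lin (ρ s ∷ row κ (σ y) ∷ L′ ∷ σ y ∷ row κ (ρ s) ∷ s ∷ row κ y ∷ y ∷ row τ s ∷ k ∷ row τ (ρ s) ∷ []) (v1 ⊹ v0) (v4 ⊹ v3 ⊹ v2) (:≥ (v6 ⊹ v5) (v8 ⊹ v7 ⊹ 1+ v2) e ∷ :≥ (1+ v9 ⊹ v7 ⊹ v1) (v6 ⊹ v3) (C.rec y) ∷ :≡ (v8 ⊹ v0) (1+ v9 ⊹ v5 ⊹ v10) (D.rec s) ∷ :≤ (1+ v10) v4 lt ∷ []))))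
          where
          lt : row τ (ρ s) < row κ (ρ s)
          lt = ≤∧≢⇒< (sub (ρ s)) λ z → nb (ρ s) (lin≡ (ρ s ∷ row κ (ρ s) ∷ row τ (ρ s) ∷ []) (v1 ⊹ v0) (v2 ⊹ v0) (:≥ v1 v2 z ∷ []))
        ...   | inj₂ (suc i , q , nd , prev) with m≤n⇒∃[o]m+o≡n (≤-pred q)
        ...     | o , refl with exit-up {σ y} {o} (subst (Diagonal (σ y)) o₁ (prev ≤-refl)) (λ d → nd (subst (Diagonal (σ y)) (sym o₀) d))
          where
          o₀ : suc i + o ∸ suc i ≡ o
          o₀ = m+n∸m≡n (suc i) o
          o₁ : suc i + o ∸ i ≡ suc o
          o₁ = trans (cong (_∸ i) (sym (+-suc i o))) (m+n∸m≡n i (suc o))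
        ...       | r , at-r , r∉τ = IH q (record { y = r ; s = ρ s ; at-s = (lin≡ (i ∷ r ∷ row τ (ρ s) ∷ ρ s ∷ row κ r ∷ row κ (σ y) ∷ o ∷ σ y ∷ y ∷ row τ s ∷ s ∷ row κ y ∷ k ∷ []) (v2 ⊹ v1 ⊹ 1+ v0) (v4 ⊹ v3) (:≥ (v5 ⊹ v1) (v4 ⊹ v7 ⊹ 1+ v6) at-r ∷ :≡ (v9 ⊹ v8 ⊹ 1+ (1+ (v0 ⊹ v6))) (v11 ⊹ v10) e ∷ :≡ (v11 ⊹ v7) (1+ v12 ⊹ v8 ⊹ v5) (C.rec y) ∷ :≥ (1+ v12 ⊹ v10 ⊹ v2) (v9 ⊹ v3) (D.rec s) ∷ [])) ; y∉τ = r∉τ ; s∉κ = nb ; strip = strip′ })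
          where
          strip′ : Strip r (suc i)
          strip′ {j} z with m≤n⇒∃[o]m+o≡n z
          ... | o′ , refl = shift {σ y} {r} {suc i + o ∸ o′} {j} (lin≡ (j ∷ r ∷ row κ (σ y) ∷ suc (j + o′) + o ∸ o′ ∷ σ y ∷ row κ r ∷ o ∷ o′ ∷ []) (v2 ⊹ v1 ⊹ v0) (v5 ⊹ v4 ⊹ v3) (:≥ (v2 ⊹ v1) (v5 ⊹ v4 ⊹ 1+ v6) at-r ∷ :≥ (1+ (v0 ⊹ v7) ⊹ v6) (v7 ⊹ v3) (m+[n∸m]≡n {o′} {suc (j + o′) + o} (lin (o′ ∷ o ∷ j ∷ []) v0 (1+ (v2 ⊹ v0) ⊹ v1) (:≤ (1+ (1+ (v2 ⊹ v0))) (1+ (1+ (v2 ⊹ v0 ⊹ v1))) q ∷ []))) ∷ [])) (prev {o′} (lin (o′ ∷ j ∷ []) (1+ v0) (1+ (v1 ⊹ v0)) ([])))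

      shorten : ∀ fuel {L} → L ≤ fuel → Pair L → Candidate
      shorten fuel {zero} p P = ⊥-elim (s∉κ y (lin≡ (Pair.s P ∷ row κ (Pair.y P) ∷ Pair.y P ∷ row τ (Pair.s P) ∷ []) (v1 ⊹ v0) (v3 ⊹ v2) (:≥ (v1 ⊹ v0) (v3 ⊹ v2 ⊹ #0) at-s ∷ [])))
        where open Pair P
      shorten (suc fuel) {suc L} p P = [ id , (λ strips → downwards ℓ (m≤m+n ℓ s) (s≤s z≤n) strips at-s s∉κ) ]′ (upwards (suc y) ≤-refl y∉τ)
        where
        open Pair P
        IH : ∀ {L′} → L′ < suc L → Pair L′ → Candidate
        IH q P′ = shorten fuel (≤-trans (≤-pred q) (≤-pred p)) P′
        open Shorten (suc L) IH

      -- `υ` stands for the core left by a removal. `τ` fits into it because every diagonal occupied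
      -- by the ribbons meets `κ/τ`.
      module _ {m t : ℕ} {Y : ℕ → ℕ} (L : ℕ) (υ : List ℕ)
        (inner    : ∀ {j i} → j ≤ t → i < m → suc (row υ (Y j + i)) ≡ row κ (suc (Y j + i)))
        (last     : ∀ {j} → j ≤ t → row υ (Y j + m) + L ≡ row κ (Y j) + m)
        (outside  : ∀ {r} → (∀ {j} → j ≤ t → r < Y j ⊎ Y j + m < r) → row υ r ≡ row κ r)
        (end      : ∀ {j} → j ≤ t → row κ (suc (Y j + m)) + L ≤ row κ (Y j) + m)
        (nonempty : ∀ {j} → j ≤ t → row κ (Y j) + m < row κ (Y j + m) + L)
        (strips   : ∀ {j} → j ≤ t → Strip (Y j) L) where
        private
          -- A diagonal strictly above the bead of row Z + 1 is met by a row of κ/τ not below row Z.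
          squeeze : ∀ {Y₀ Z i} → Diagonal Y₀ i → row κ (suc Z) + Y₀ + i < row κ Y₀ + suc Z → row τ Z + Y₀ + i < row κ Y₀ + Z
          squeeze {Y₀} {Z} {i} (r , p , q) lt with ≤-<-connex r Z
          ... | inj₁ z = lin (i ∷ Y₀ ∷ row τ Z ∷ Z ∷ row κ Y₀ ∷ row τ r ∷ r ∷ []) (1+ (v2 ⊹ v1 ⊹ v0)) (v4 ⊹ v3) (:≤ (1+ (v5 ⊹ v1 ⊹ v0)) (v4 ⊹ v6) p ∷ :≤ v6 v3 z ∷ :≤ v2 v5 (g-anti z) ∷ [])
          ... | inj₂ z = ⊥-elim (lin⊥ (r ∷ row κ Y₀ ∷ i ∷ Y₀ ∷ row κ r ∷ row κ (suc Z) ∷ Z ∷ []) (:≤ (v1 ⊹ v0) (v4 ⊹ v3 ⊹ v2) q ∷ :≤ (1+ (v5 ⊹ v3 ⊹ v2)) (v1 ⊹ 1+ v6) lt ∷ :≤ (1+ v6) v0 z ∷ :≤ v4 v5 (f-anti z) ∷ []))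

          fit-last : ∀ {j} → j ≤ t → row τ (Y j + m) ≤ row υ (Y j + m)
          fit-last {j} p with m≤n⇒∃[o]m+o≡n {1} {L} (lin (L ∷ m ∷ row κ (Y j) ∷ row κ (Y j + m) ∷ []) #1 v0 (:≤ (1+ (v2 ⊹ v1)) (v3 ⊹ v0) (nonempty p) ∷ :≤ v3 v2 (f-anti (m≤m+n (Y j) m)) ∷ []))
          ... | o , e = lin (row τ (Y j + m) ∷ row υ (Y j + m) ∷ m ∷ row κ (Y j) ∷ L ∷ o ∷ Y j ∷ []) v0 v1 (:≥ (v3 ⊹ v2) (v1 ⊹ v4) (last p) ∷ :≥ v4 (1+ v5) e ∷ :≤ (1+ (v0 ⊹ v6 ⊹ v5)) (v3 ⊹ (v6 ⊹ v2)) (squeeze {Y j} {Y j + m} {o} (strips p (lin (o ∷ L ∷ []) (1+ v0) v1 (:≡ (1+ v0) v1 e ∷ []))) (lin (o ∷ Y j ∷ row κ (suc (Y j + m)) ∷ m ∷ row κ (Y j) ∷ L ∷ []) (1+ (v2 ⊹ v1 ⊹ v0)) (v4 ⊹ 1+ (v1 ⊹ v3)) (:≤ (v2 ⊹ v5) (v4 ⊹ v3) (end p) ∷ :≡ (1+ v0) v5 e ∷ []))) ∷ [])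

          fit-inner : ∀ {j i} → j ≤ t → i < m → row τ (Y j + i) ≤ row υ (Y j + i)
          fit-inner {j} {i} p q with m≤n⇒∃[o]m+o≡n {suc (row κ (suc (Y j + i)) + Y j)} {row κ (Y j) + suc (Y j + i)} (lin (Y j ∷ row κ (suc (Y j + i)) ∷ i ∷ row κ (Y j) ∷ []) (1+ (v1 ⊹ v0)) (v3 ⊹ 1+ (v0 ⊹ v2)) (:≤ v1 v3 (f-anti {Y j} {suc (Y j + i)} (lin (Y j ∷ i ∷ []) v0 (1+ (v0 ⊹ v1)) ([]))) ∷ []))
          ... | o , e = lin (row τ (Y j + i) ∷ row υ (Y j + i) ∷ row κ (suc (Y j + i)) ∷ i ∷ Y j ∷ row κ (Y j) ∷ o ∷ []) v0 v1 (:≥ v2 (1+ v1) (inner p q) ∷ :≥ (v5 ⊹ 1+ (v4 ⊹ v3)) (1+ (v2 ⊹ v4 ⊹ v6)) e ∷ :≤ (1+ (v0 ⊹ v4 ⊹ v6)) (v5 ⊹ (v4 ⊹ v3)) (squeeze {Y j} {Y j + i} {o} (strips p o<L) (lin (o ∷ Y j ∷ row κ (suc (Y j + i)) ∷ i ∷ row κ (Y j) ∷ []) (1+ (v2 ⊹ v1 ⊹ v0)) (v4 ⊹ 1+ (v1 ⊹ v3)) (:≡ (1+ (v2 ⊹ v1 ⊹ v0)) (v4 ⊹ 1+ (v1 ⊹ v3)) e ∷ []))) ∷ [])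
            where
            o<L : o < L
            o<L = lin (o ∷ L ∷ Y j ∷ row κ (suc (Y j + i)) ∷ i ∷ row κ (Y j) ∷ m ∷ row κ (Y j + m) ∷ []) (1+ v0) v1 (:≡ (1+ (v3 ⊹ v2 ⊹ v0)) (v5 ⊹ 1+ (v2 ⊹ v4)) e ∷ :≤ (1+ (v5 ⊹ v6)) (v7 ⊹ v1) (nonempty p) ∷ :≤ v7 v3 (f-anti {suc (Y j + i)} {Y j + m} (lin (i ∷ Y j ∷ m ∷ []) (1+ (v1 ⊹ v0)) (v1 ⊹ v2) (:≤ (1+ v0) v2 q ∷ []))) ∷ :≤ (1+ v4) v6 q ∷ [])

        fits : ∀ r → row τ r ≤ row υ r
        fits r with locate-block t m Y r
        ... | inj₂ out = ≤-trans (sub r) (≤-reflexive (sym (outside out)))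
        ... | inj₁ (j , p , i , q , refl) with m≤n⇒m<n∨m≡n q
        ...   | inj₁ z    = fit-inner p z
        ...   | inj₂ refl = fit-last p

      -- Rows `Y j` and `Y j + i` descend their runners together, so the distance of their beads is
      -- the same on all levels.
      level-offset : ∀ (Y : ℕ → ℕ) {y s i} → Y 0 ≡ y → (∀ {j} → j < s → σ (Y (suc j)) ≡ Y j) → (∀ {j} → j < s → σ (Y (suc j) + i) ≡ Y j + i) →
        ∀ {j} → j ≤ s → row κ (Y j) + (Y j + i) + row κ (y + i) + y ≡ row κ (Y j + i) + Y j + row κ y + (y + i)
      level-offset Y {y} {s} {i} refl a b {zero}  _ = lin≡ (Y 0 ∷ row κ (Y 0 + i) ∷ i ∷ row κ (Y 0) ∷ []) (v3 ⊹ (v0 ⊹ v2) ⊹ v1 ⊹ v0) (v1 ⊹ v0 ⊹ v3 ⊹ (v0 ⊹ v2)) ([])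
      level-offset Y {y} {s} {i} e a b {suc j} z = lin≡ (y ∷ row κ (y + i) ∷ i ∷ Y (suc j) ∷ row κ (Y (suc j)) ∷ row κ y ∷ row κ (Y (suc j) + i) ∷ Y j ∷ row κ (Y j) ∷ row κ (Y j + i) ∷ σ (Y (suc j)) ∷ row κ (σ (Y (suc j))) ∷ k ∷ row κ (σ (Y (suc j) + i)) ∷ σ (Y (suc j) + i) ∷ []) (v4 ⊹ (v3 ⊹ v2) ⊹ v1 ⊹ v0) (v6 ⊹ v3 ⊹ v5 ⊹ (v0 ⊹ v2)) (:≡ (v8 ⊹ (v7 ⊹ v2) ⊹ v1 ⊹ v0) (v9 ⊹ v7 ⊹ v5 ⊹ (v0 ⊹ v2)) (level-offset Y e a b (<⇒≤ z)) ∷ :≡ (v4 ⊹ v10) (1+ v12 ⊹ v3 ⊹ v11) (C.rec (Y (suc j))) ∷ :≥ (1+ v12 ⊹ (v3 ⊹ v2) ⊹ v13) (v6 ⊹ v14) (C.rec (Y (suc j) + i)) ∷ :≥ v7 v10 (a z) ∷ :≡ v11 v8 (cong (row κ) (a z)) ∷ :≡ v14 (v7 ⊹ v2) (b z) ∷ :≥ v9 v13 (cong (row κ) (b z)) ∷ [])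

      climb-levels : ∀ {y m t} → Steps A m y t → ∀ i {j} → j ≤ t → ∀ o → i + o ≡ j → iterate-σ A i (level A y j) ≡ level A y o
      climb-levels st zero    p o refl = refl
      climb-levels {y} {m} {t} st (suc i) {j} p o refl = trans (cong σ (climb-levels st i p (suc o) (+-suc i o))) (step₀ st (lin (o ∷ t ∷ i ∷ []) (1+ v0) v1 (:≤ (1+ v2 ⊹ v0) v1 p ∷ [])))
        where
        step₀ : ∀ {y m t} → Steps A m y t → o < t → σ (level A y (suc o)) ≡ level A y o
        step₀ {y} st q = trans (cong σ (sym (+-identityʳ _))) (trans (st q {0} z≤n) (+-identityʳ (level A y o)))

      above-level : ∀ {y m t} → Steps A m y t → ∀ {j} → j ≤ t → Above y (level A y j)
      above-level st {j} p = j , climb-levels st j p 0 (+-identityʳ j)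

    Fits : Set
    Fits = ∃ λ y → ∃ λ m → ∃ λ t → ∃ λ x → Σ (Good k σ y m t x (level A y)) λ G → ∀ r → row τ r ≤ row (lower C G) r

    private
      good-fits : ∀ {y m t x} (G : Good k σ y m t x (level A y)) → Strips y (ribbon C G) → ∀ r → row τ r ≤ row (lower C G) r
      good-fits {y} {m} {t} {x} G strips = fits (ribbon C G) (lower C G)
        (row-inner C G (lower-CoreOf C G) spec) (row-last C G (lower-CoreOf C G) spec) (row-outside C G (lower-CoreOf C G) spec)
        (block-end C G) (block-nonempty C G) (λ {j} p → strips (level A y j) (above-level (Good.step G) p))
        where
        spec : ∀ r → lam σ y m x r + interval x m r ≡ σ r + interval y (suc m) r
        spec = lam-spec {σ} {y} {m} {x} C.lo

      -- Among the candidates a shortest one satisfies all conditions of Good.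
      module _ (y L q : ℕ) (1≤L : 1 ≤ L) (strips : Strips y L) (dist : Distance y L q) (unhit : ∀ r → σ r ≢ q)
        (IH : ∀ {y′ L′ q′} → 1 ≤ L′ → L′ < L → Strips y′ L′ → Distance y′ L′ q′ → (∀ r → σ r ≢ q′) → Fits) where

        private
          σy<q : σ y < q
          σy<q = ≰⇒> λ z → lin⊥ (L ∷ y ∷ k ∷ row κ q ∷ q ∷ row κ y ∷ σ y ∷ row κ (σ y) ∷ []) (:≡ (v3 ⊹ 1+ v2 ⊹ v1 ⊹ v0) (v5 ⊹ v4) dist ∷ :≡ (v5 ⊹ v6) (1+ v2 ⊹ v1 ⊹ v7) (C.rec y) ∷ :≤ #1 v0 1≤L ∷ :≤ v7 v3 (f-anti z) ∷ :≤ v4 v6 z ∷ [])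

          apart : ∀ {a b} → a < b → ∃ λ o → row κ b + a + suc o ≡ row κ a + b
          apart {a} {b} p with m≤n⇒∃[o]m+o≡n {suc (row κ b + a)} {row κ a + b} (lin (a ∷ row κ b ∷ b ∷ row κ a ∷ []) (1+ (v1 ⊹ v0)) (v3 ⊹ v2) (:≤ v1 v3 (f-anti (<⇒≤ p)) ∷ :≤ (1+ v0) v2 p ∷ []))
          ... | o , e = o , (lin≡ (o ∷ a ∷ row κ b ∷ b ∷ row κ a ∷ []) (v2 ⊹ v1 ⊹ 1+ v0) (v4 ⊹ v3) (:≡ (1+ (v2 ⊹ v1 ⊹ v0)) (v4 ⊹ v3) e ∷ []))

          weaken : ∀ {y′ L′} → L′ ≤ L → Strips y L → (y′ ≡ y) → Strips y′ L′
          weaken p s refl Z a z = s Z a (≤-trans z p)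

          -- A value skipped before `q` is a vacant place closer to the bead of `y`, hence a shorter
          -- candidate.
          skipped : ∀ {i} → suc (σ y + i) < q → (∀ r → σ r ≢ suc (σ y + i)) → Fits
          skipped {i} p h with apart {σ y} {suc (σ y + i)} (lin (σ y ∷ i ∷ []) (1+ v0) (1+ (v0 ⊹ v1)) ([]))
          ... | o , e = IH {y} {suc o} {suc (σ y + i)} (s≤s z≤n) o<L (weaken (<⇒≤ o<L) strips refl) (lin≡ (o ∷ y ∷ k ∷ row κ (suc (σ y + i)) ∷ i ∷ σ y ∷ row κ y ∷ row κ (σ y) ∷ []) (v3 ⊹ 1+ v2 ⊹ v1 ⊹ 1+ v0) (v6 ⊹ 1+ (v5 ⊹ v4)) (:≡ (v3 ⊹ v5 ⊹ 1+ v0) (v7 ⊹ 1+ (v5 ⊹ v4)) e ∷ :≥ (1+ v2 ⊹ v1 ⊹ v7) (v6 ⊹ v5) (C.rec y) ∷ [])) h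
            where
            o<L : suc o < L
            o<L = lin (o ∷ L ∷ σ y ∷ row κ (suc (σ y + i)) ∷ i ∷ row κ (σ y) ∷ q ∷ row κ y ∷ y ∷ k ∷ row κ q ∷ []) (1+ (1+ v0)) v1 (:≡ (v3 ⊹ v2 ⊹ 1+ v0) (v5 ⊹ 1+ (v2 ⊹ v4)) e ∷ :≥ (v7 ⊹ v6) (v10 ⊹ 1+ v9 ⊹ v8 ⊹ v1) dist ∷ :≥ (1+ v9 ⊹ v8 ⊹ v5) (v7 ⊹ v2) (C.rec y) ∷ :≤ (1+ (1+ (v2 ⊹ v4))) v6 p ∷ :≤ v10 v3 (f-anti (<⇒≤ p)) ∷ [])

          -- If row `y` were empty, all later rows would satisfy `σ r ≡ suc k + r` and one of them
          -- would hit `q`.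
          pos : σ y ≤ k + y
          pos = ≮⇒≥ λ z → let o , e = m≤n⇒∃[o]m+o≡n (<⇒≤ σy<q) in
            unhit (y + o) (trans (≤-antisym (lin (σ (y + proj₁ (m≤n⇒∃[o]m+o≡n (<⇒≤ σy<q))) ∷ proj₁ (m≤n⇒∃[o]m+o≡n (<⇒≤ σy<q)) ∷ y ∷ k ∷ []) v0 (1+ v3 ⊹ (v2 ⊹ v1)) (:≤ v0 (1+ v3 ⊹ (v2 ⊹ v1)) (C.hi (y + o)) ∷ [])) (lin (proj₁ (m≤n⇒∃[o]m+o≡n (<⇒≤ σy<q)) ∷ y ∷ k ∷ σ (y + proj₁ (m≤n⇒∃[o]m+o≡n (<⇒≤ σy<q))) ∷ σ y ∷ []) (1+ v2 ⊹ (v1 ⊹ v0)) v3 (:≤ (v4 ⊹ (v1 ⊹ v0)) (v3 ⊹ v1) (σ-mono A (m≤m+n y o)) ∷ :≤ (1+ (v2 ⊹ v1)) v4 z ∷ []))) (trans (sym (+-assoc (suc k) y o)) (trans (cong (_+ o) (≤-antisym (lin (y ∷ k ∷ σ y ∷ []) (1+ (v1 ⊹ v0)) v2 (:≤ (1+ (v1 ⊹ v0)) v2 z ∷ [])) (C.hi y))) e)))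

          module _ {m : ℕ} (qe : q ≡ suc (σ y + m)) (run : ∀ {i} → i ≤ m → σ (y + i) ≡ σ y + i) where
            -- The later rows of the block have the same vacant place below them, at a distance that
            -- is smaller by at least `i`.
            next-row : ∀ {i} → i ≤ m → ∃ λ o → row κ q + suc k + (y + i) + suc o ≡ row κ (y + i) + q × suc o + i ≤ L
            next-row {i} p with apart {σ y + i} {q} (lin (i ∷ σ y ∷ q ∷ m ∷ []) (1+ (v1 ⊹ v0)) v2 (:≥ (1+ (v1 ⊹ v3)) v2 qe ∷ :≤ v0 v3 p ∷ []))
            ... | o , e = o , (lin≡ (o ∷ i ∷ y ∷ k ∷ row κ q ∷ q ∷ row κ (y + i) ∷ σ y ∷ row κ (σ y + i) ∷ row κ (σ (y + i)) ∷ σ (y + i) ∷ []) (v4 ⊹ 1+ v3 ⊹ (v2 ⊹ v1) ⊹ 1+ v0) (v6 ⊹ v5) (:≡ (v4 ⊹ (v7 ⊹ v1) ⊹ 1+ v0) (v8 ⊹ v5) e ∷ :≥ (1+ v3 ⊹ (v2 ⊹ v1) ⊹ v9) (v6 ⊹ v10) (C.rec (y + i)) ∷ :≡ v10 (v7 ⊹ v1) (run p) ∷ :≥ v8 v9 (cong (row κ) (run p)) ∷ [])) , (lin (i ∷ o ∷ L ∷ σ y ∷ row κ q ∷ q ∷ row κ (σ y + i) ∷ row κ y ∷ y ∷ k ∷ row κ (σ y) ∷ []) (1+ (v1 ⊹ v0)) v2 (:≡ (v4 ⊹ (v3 ⊹ v0) ⊹ 1+ v1) (v6 ⊹ v5)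 e ∷ :≥ (v7 ⊹ v5) (v4 ⊹ 1+ v9 ⊹ v8 ⊹ v2) dist ∷ :≥ (1+ v9 ⊹ v8 ⊹ v10) (v7 ⊹ v3) (C.rec y) ∷ :≤ v6 v10 (f-anti (m≤m+n (σ y) i)) ∷ []))

            stop : suc (σ y + m) < σ (suc (y + m))
            stop = ≤∧≢⇒< (lin (m ∷ σ y ∷ σ (suc (y + m)) ∷ σ (y + m) ∷ []) (1+ (v1 ⊹ v0)) v2 (:≥ (v1 ⊹ v0) v3 (run {m} ≤-refl) ∷ :≤ (1+ v3) v2 (C.mono (y + m)) ∷ [])) λ z → unhit (suc (y + m)) (trans (sym z) (sym qe))

            -- If the block of `y` reaches row `σ y`, the candidate starting at `σ y` is shorter:
            -- the strip of `σ y` is the part of the strip of `y` that begins `k + 1` places further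
            -- down.
            wrapped : ∀ {i} → i ≤ m → y + i ≡ σ y → Fits
            wrapped {i} p e with next-row p
            ... | o , d , le = IH {σ y} {suc o} {q} (s≤s z≤n) o<L strips′ (lin≡ (o ∷ σ y ∷ k ∷ row κ q ∷ q ∷ row κ (σ y) ∷ row κ (y + i) ∷ i ∷ y ∷ []) (v3 ⊹ 1+ v2 ⊹ v1 ⊹ 1+ v0) (v5 ⊹ v4) (:≡ v6 v5 (cong (row κ) e) ∷ :≡ (v3 ⊹ 1+ v2 ⊹ (v8 ⊹ v7) ⊹ 1+ v0) (v6 ⊹ v4) d ∷ :≥ v1 (v8 ⊹ v7) e ∷ [])) unhit
              where
              o<L : suc o < L
              o<L = lin (o ∷ L ∷ i ∷ y ∷ σ y ∷ []) (1+ (1+ v0)) v1 (:≤ (1+ (v0 ⊹ v2)) v1 le ∷ :≤ (1+ v3) v4 (C.lo y) ∷ :≥ v4 (v3 ⊹ v2) e ∷ [])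
              long : suc o + suc k ≤ L
              long = lin (k ∷ o ∷ L ∷ i ∷ y ∷ row κ q ∷ q ∷ row κ (y + i) ∷ row κ y ∷ row κ (σ y) ∷ σ y ∷ []) (1+ v1 ⊹ 1+ v0) v2 (:≡ (v5 ⊹ 1+ v0 ⊹ (v4 ⊹ v3) ⊹ 1+ v1) (v7 ⊹ v6) d ∷ :≥ (v8 ⊹ v6) (v5 ⊹ 1+ v0 ⊹ v4 ⊹ v2) dist ∷ :≥ (1+ v0 ⊹ v4 ⊹ v9) (v8 ⊹ v10) (C.rec y) ∷ :≥ v10 (v4 ⊹ v3) e ∷ :≡ v7 v9 (cong (row κ) e) ∷ [])
              strips′ : Strips (σ y) (suc o)
              strips′ Z a {i′} z with above-step a
              ... | inj₂ a′ = strips Z a′ (<-trans z o<L)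
              ... | inj₁ refl = shift {y} {σ y} {i′ + suc k} {i′} (lin≡ (i′ ∷ σ y ∷ row κ y ∷ k ∷ y ∷ row κ (σ y) ∷ []) (v2 ⊹ v1 ⊹ v0) (v5 ⊹ v4 ⊹ (v0 ⊹ 1+ v3)) (:≡ (v2 ⊹ v1) (1+ v3 ⊹ v4 ⊹ v5) (C.rec y) ∷ [])) (strips y (0 , refl) (lin (k ∷ i′ ∷ L ∷ o ∷ []) (1+ (v1 ⊹ 1+ v0)) v2 (:≤ (1+ v1) (1+ v3) z ∷ :≤ (1+ v3 ⊹ 1+ v0) v2 long ∷ [])))

            finish : y + m < σ y → Outcome A m y → Fits
            finish window (complete t x _ st roof side) = y , m , t , x , G , good-fits G (weaken (≤-reflexive Lr) strips refl)
              where
              G : Good k σ y m t x (level A y)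
              G = record { pos = pos ; run = run ; stop = stop ; window = window
                         ; tower = record { base = refl ; step = st ; roof = roof ; side = λ p → proj₂ (side p) } }
              Lr : ribbon C G ≡ L
              Lr = lin≡ (ribbon C G ∷ L ∷ σ y ∷ row κ (suc (σ y + m)) ∷ m ∷ row κ (σ y) ∷ q ∷ row κ y ∷ y ∷ k ∷ row κ q ∷ []) v0 v1 (:≡ (v0 ⊹ (v3 ⊹ v2)) (v5 ⊹ 1+ (v2 ⊹ v4)) (ribbon-eq C G) ∷ :≥ (v7 ⊹ v6) (v10 ⊹ 1+ v9 ⊹ v8 ⊹ v1) dist ∷ :≥ (1+ v9 ⊹ v8 ⊹ v5) (v7 ⊹ v2) (C.rec y) ∷ :≥ (1+ (v2 ⊹ v4)) v6 qe ∷ :≡ v10 v3 (cong (row κ) qe) ∷ [])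
            -- The runner of row `y + suc i` breaks off at level `s`, so the only rows above it are
            -- `lev j + suc i` with `j ≤ s`, and their strips are lower parts of the strips of the
            -- rows `lev j`.
            finish window (stuck s i x _ st p h prev) with next-row {suc i} p
            ... | o , d , le = IH {y + suc i} {suc o} {q} (s≤s z≤n) o<L strips′ d unhit
              where
              o<L : suc o < L
              o<L = lin (o ∷ L ∷ i ∷ []) (1+ (1+ v0)) v1 (:≤ (1+ (v0 ⊹ 1+ v2)) v1 le ∷ [])
              lev : ℕ → ℕ
              lev = level A y
              step₀ : ∀ {j} → j < s → σ (lev (suc j)) ≡ lev j
              step₀ {j} z = trans (cong σ (sym (+-identityʳ _))) (trans (st z {0} z≤n) (+-identityʳ (lev j)))
              low-level : ∀ {j} → j ≤ s → lev j ≤ y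
              low-level {zero}  z = ≤-refl
              low-level {suc j} z = ≤-trans (<⇒≤ (C.lo (lev (suc j)))) (≤-trans (≤-reflexive (step₀ z)) (low-level (<⇒≤ z)))
              stays : ∀ j {Z} → iterate-σ A j Z ≡ y + suc i → j ≤ s × Z ≡ lev j + suc i
              stays j {Z} e = subst (λ w → w ≤ s × Z ≡ lev w + suc i) (+-identityʳ j) (go j 0 z≤n e)
                where
                top-unhit : ∀ r → σ r ≢ lev s + suc i
                top-unhit r e′ = h r (λ { refl → (lin⊥ (σ r ∷ i ∷ lev s ∷ m ∷ r ∷ []) (:≡ v0 (v2 ⊹ 1+ v1) e′ ∷ :≤ (1+ (v4 ⊹ v3)) v0 window ∷ :≤ (1+ v1) v3 p ∷ :≤ v2 v4 (low-level {s} ≤-refl) ∷ [])) }) (trans e′ (+-suc (lev s) i))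
                go : ∀ j o → o ≤ s → iterate-σ A j Z ≡ lev o + suc i → j + o ≤ s × Z ≡ lev (j + o) + suc i
                go zero    o z e = z , e
                go (suc j) o z e with m≤n⇒m<n∨m≡n z
                ... | inj₂ refl = ⊥-elim (top-unhit _ e)
                ... | inj₁ o<s with go j (suc o) o<s (σ-injective A (trans e (sym (st o<s p))))
                ...   | z′ , e′ = subst (_≤ s) (+-suc j o) z′ , trans e′ (cong (λ w → lev w + suc i) (+-suc j o))
              strips′ : Strips (y + suc i) (suc o)
              strips′ Z (j , e) {i′} z with stays j {Z} e | apart {y} {y + suc i} (lin (y ∷ i ∷ []) (1+ v0) (v0 ⊹ 1+ v1) ([]))
              ... | j≤s , refl | D , ap = shift {lev j} {lev j + suc i} {i′ + suc D} {i′} (lin≡ (i′ ∷ i ∷ lev j ∷ row κ (lev j) ∷ D ∷ row κ (lev j + suc i) ∷ y ∷ row κ (y + suc i) ∷ row κ y ∷ []) (v3 ⊹ (v2 ⊹ 1+ v1) ⊹ v0) (v5 ⊹ v2 ⊹ (v0 ⊹ 1+ v4)) (:≡ (v3 ⊹ (v2 ⊹ 1+ v1) ⊹ v7 ⊹ v6) (v5 ⊹ v2 ⊹ v8 ⊹ (v6 ⊹ 1+ v1)) (level-offset lev {y} {s} {suc i} refl step₀ (λ w → st w p) j≤s) ∷ :≥ (v8 ⊹ (v6 ⊹ 1+ v1)) (v7 ⊹ v6 ⊹ 1+ v4) ap ∷ []))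
                (strips (lev j) (above-level st j≤s) (lin (D ∷ i′ ∷ L ∷ o ∷ y ∷ row κ (y + suc i) ∷ i ∷ row κ y ∷ k ∷ row κ q ∷ q ∷ []) (1+ (v1 ⊹ 1+ v0)) v2 (:≤ (1+ v1) (1+ v3) z ∷ :≡ (v5 ⊹ v4 ⊹ 1+ v0) (v7 ⊹ (v4 ⊹ 1+ v6)) ap ∷ :≡ (v9 ⊹ 1+ v8 ⊹ (v4 ⊹ 1+ v6) ⊹ 1+ v3) (v5 ⊹ v10) d ∷ :≥ (v7 ⊹ v10) (v9 ⊹ 1+ v8 ⊹ v4 ⊹ v2) dist ∷ [])))

            conclude : Fits
            conclude with ≤-<-connex (σ y) (y + m)
            ... | inj₂ window = finish window (outcome A m y)
            ... | inj₁ z with m≤n⇒∃[o]m+o≡n (<⇒≤ (C.lo y))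
            ...   | i , e = wrapped {i} (lin (i ∷ m ∷ σ y ∷ y ∷ []) v0 v1 (:≤ v2 (v3 ⊹ v1) z ∷ :≡ (v3 ⊹ v0) v2 e ∷ [])) e

        candidate-step : Fits
        candidate-step with m≤n⇒∃[o]m+o≡n σy<q
        ... | m , e with all-or-first (λ i → hit? A (suc (σ y + i))) m
        ...   | inj₂ (i , p , h , _) = skipped (lin (i ∷ σ y ∷ q ∷ m ∷ []) (1+ (1+ (v1 ⊹ v0))) v2 (:≡ (1+ (v1 ⊹ v3)) v2 e ∷ :≤ (1+ v0) v3 p ∷ [])) h
        ...   | inj₁ hits = conclude {m} (sym e) (contiguous* A refl hits)

      candidate-fits : ∀ fuel {y L q} → L ≤ fuel → 1 ≤ L → Strips y L → Distance y L q → (∀ r → σ r ≢ q) → Fits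
      candidate-fits zero {y} {L} p 1≤L = ⊥-elim (lin⊥ (L ∷ []) (:≤ v0 #0 p ∷ :≤ #1 v0 1≤L ∷ []))
      candidate-fits (suc fuel) {y} {L} {q} p 1≤L strips dist unhit = candidate-step y L q 1≤L strips dist unhit
        λ 1≤L′ L′<L → candidate-fits fuel (≤-pred (≤-trans L′<L p)) 1≤L′

      -- In the first row where the shapes differ the bead of `κ` is missing from `τ`, because the
      -- earlier rows agree and the later beads of `τ` are lower.
      first-gap : ∀ {y} → row τ y < row κ y → (∀ {r} → r < y → row τ r ≡ row κ r) → ∃ Pair
      first-gap {y} lt eqs with all-or-first (diagonal? y) (suc (row κ y + ℓ))
      ... | inj₁ all = ⊥-elim (below (all ≤-refl))
        where
        below : ¬ Diagonal y (row κ y + ℓ)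
        below (r , p , q) = lin⊥ (ℓ ∷ row κ y ∷ y ∷ row τ r ∷ r ∷ row κ r ∷ []) (:≤ (1+ (v3 ⊹ v2 ⊹ (v1 ⊹ v0))) (v1 ⊹ v4) p ∷ :≤ (v1 ⊹ v4) (v5 ⊹ v2 ⊹ (v1 ⊹ v0)) q ∷ :≡ v5 #0 (row-≥ℓ C {r} (lin (ℓ ∷ r ∷ row κ y ∷ y ∷ row τ r ∷ []) v0 v1 (:≤ (1+ (v4 ⊹ v3 ⊹ (v2 ⊹ v0))) (v2 ⊹ v1) p ∷ []))) ∷ [])
      ... | inj₂ (zero , _ , nd , _) = ⊥-elim (nd (y , (lin (y ∷ row τ y ∷ row κ y ∷ []) (1+ (v1 ⊹ v0 ⊹ #0)) (v2 ⊹ v0) (:≤ (1+ v1) v2 lt ∷ [])) , (lin (y ∷ row κ y ∷ []) (v1 ⊹ v0) (v1 ⊹ v0 ⊹ #0) ([]))))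
      ... | inj₂ (suc i , _ , nd , prev) with exit-down (prev ≤-refl) nd
      ...   | s , e , s∉κ = suc i , record { y = y ; s = s ; at-s = e ; y∉τ = y∉τ ; s∉κ = s∉κ ; strip = prev }
        where
        y∉τ : ∀ r → ¬ Bead-τ y r
        y∉τ r b = [ (λ z → (lin⊥ (r ∷ row κ y ∷ y ∷ row τ r ∷ row τ y ∷ []) (:≥ (v1 ⊹ v0) (v3 ⊹ v2) b ∷ :≤ (1+ v4) v1 lt ∷ :≤ v2 v0 z ∷ :≤ v3 v4 (g-anti z) ∷ []))) , (λ z → (lin⊥ (y ∷ row τ r ∷ r ∷ row κ y ∷ row κ r ∷ []) (:≡ (v1 ⊹ v0) (v3 ⊹ v2) b ∷ :≤ (1+ v2) v0 z ∷ :≥ v4 v1 (eqs z) ∷ :≤ v3 v4 (f-anti (<⇒≤ z)) ∷ []))) ]′ (≤-<-connex y r)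

    -- Lascoux: strong order on cores is containment, and it is generated by the removals described by Good.
    proper-fits : ∀ {r} → row τ r < row κ r → Fits
    proper-fits {r} lt with all-or-first {λ r → row τ r ≡ row κ r} {λ r → row τ r < row κ r} dec (suc r)
      where
      dec : ∀ r → row τ r ≡ row κ r ⊎ row τ r < row κ r
      dec r with m≤n⇒m<n∨m≡n (sub r)
      ... | inj₁ z = inj₂ z
      ... | inj₂ z = inj₁ z
    ... | inj₁ same = ⊥-elim (<⇒≢ lt (same ≤-refl))
    ... | inj₂ (y , _ , z , eqs) with first-gap z eqs
    ...   | L , P with shorten L ≤-refl P
    ...     | y′ , L′ , q , 1≤L′ , strips , dist , unhit = candidate-fits L′ ≤-refl 1≤L′ strips dist unhit

  weight-cong : ∀ {k τ κ} → τ ≡ κ → weight k τ ≡ weight k κ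
  weight-cong refl = refl

  equal-or-proper : ∀ {k ℓ κ τ σ ρ} → CoreOf k ℓ κ σ → CoreOf k ℓ τ ρ → (∀ r → row τ r ≤ row κ r) → τ ≡ κ ⊎ ∃ λ r → row τ r < row κ r
  equal-or-proper {ℓ = ℓ} {κ} {τ} C D sub with all-or-first {λ r → row τ r ≡ row κ r} {λ r → row τ r < row κ r} dec ℓ
    where
    dec : ∀ r → row τ r ≡ row κ r ⊎ row τ r < row κ r
    dec r with m≤n⇒m<n∨m≡n (sub r)
    ... | inj₁ z = inj₂ z
    ... | inj₂ z = inj₁ z
  ... | inj₂ (r , _ , z , _) = inj₂ (r , z)
  ... | inj₁ same = inj₁ (row-ext (proj₂ (CoreOf.partition D)) (proj₂ (CoreOf.partition C)) eq)
    where
    eq : ∀ r → row τ r ≡ row κ r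
    eq r = [ (λ z → trans (row-≥ℓ D z) (sym (row-≥ℓ C z))) , same ]′ (≤-<-connex ℓ r)

  private
    pred-≤ : ∀ {a b c} → a + 1 ≡ b → b ≤ suc c → a ≤ c
    pred-≤ {a} {b} {c} e p = lin (a ∷ c ∷ b ∷ []) v0 v1 (:≤ v2 (1+ v1) p ∷ :≡ (v0 ⊹ #1) v2 e ∷ [])

    pred-≤′ : ∀ {a b} → a + 1 ≡ b → a ≤ b
    pred-≤′ {a} {b} e = lin (a ∷ b ∷ []) v0 v1 (:≡ (v0 ⊹ #1) v1 e ∷ [])

    no-pred : ∀ {a b} {A : Set} → a + 1 ≡ b → b ≤ 0 → A
    no-pred {a} {b} e p = ⊥-elim (lin⊥ (b ∷ a ∷ []) (:≤ v0 #0 p ∷ :≡ (v1 ⊹ #1) v0 e ∷ []))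

    no-fixed : ∀ {a b} {A : Set} → a + 1 ≡ b → a ≡ b → A
    no-fixed {a} {b} e p = ⊥-elim (lin⊥ (b ∷ a ∷ []) (:≥ v0 v1 p ∷ :≡ (v1 ⊹ #1) v0 e ∷ []))

    no-two : ∀ {a b c d} → a + 1 ≡ b → c + 1 ≡ b → d + 1 ≡ c → a ≤ d → ⊥
    no-two {a} {b} {c} {d} e e′ e″ p = lin⊥ (a ∷ d ∷ c ∷ b ∷ []) (:≤ v0 v1 p ∷ :≡ (v1 ⊹ #1) v2 e″ ∷ :≡ (v2 ⊹ #1) v3 e′ ∷ :≥ v3 (v0 ⊹ #1) e ∷ [])

  -- Removals lead from `κ` towards `τ` as long as the shapes differ, and each of them lowers the
  -- size.
  weight-mono : ∀ {k ℓ} fuel {κ τ σ ρ} → weight k κ ≤ fuel → CoreOf k ℓ κ σ → CoreOf k ℓ τ ρ → (∀ r → row τ r ≤ row κ r) → weight k τ ≤ weight k κ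
  weight-mono {k} {ℓ} fuel {κ} {τ} p C D sub = [ (λ e → ≤-reflexive (weight-cong {k} e)) , (λ { (r , z) → descend fuel p (proper-fits C D sub z) }) ]′ (equal-or-proper C D sub)
    where
    descend : ∀ fuel → weight k κ ≤ fuel → Fits C D sub → weight k τ ≤ weight k κ
    descend zero       p (_ , _ , _ , _ , G , le) = no-pred (lower-weight C G) p
    descend (suc fuel) p (_ , _ , _ , _ , G , le) = ≤-trans (weight-mono fuel {lower C G} (pred-≤ (lower-weight C G) p) (lower-CoreOf C G) D le) (pred-≤′ (lower-weight C G))

  IsLower : ∀ {k ℓ κ σ} → CoreOf k ℓ κ σ → List ℕ → Set
  IsLower {k} {σ = σ} C τ = ∃ λ y → ∃ λ m → ∃ λ t → ∃ λ x → Σ (Good k σ y m t x (level (CoreOf.adm C) y)) λ G → τ ≡ lower C G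

  -- One removal that still contains `τ` uses up the difference 1. If it did not give `τ`, a second
  -- one would fall below the size of `τ`.
  cover-is-lower : ∀ {k ℓ κ τ σ ρ} (C : CoreOf k ℓ κ σ) → CoreOf k ℓ τ ρ → (∀ r → row τ r ≤ row κ r) → weight k τ + 1 ≡ weight k κ → IsLower C τ
  cover-is-lower {k} {ℓ} {κ} {τ} {σ} C D sub w =
    [ (λ e → no-fixed w (weight-cong {k} e)) , (λ { (r , z) → descend (proper-fits C D sub z) }) ]′ (equal-or-proper C D sub)
    where
    two-steps : ∀ {υ ρ} (E : CoreOf k ℓ υ ρ) → weight k υ + 1 ≡ weight k κ → (le : ∀ r → row τ r ≤ row υ r) → Fits E D le → ⊥
    two-steps {υ} E we le (_ , _ , _ , _ , G′ , le′) = no-two w we (lower-weight E G′) (weight-mono (weight k (lower E G′)) ≤-refl (lower-CoreOf E G′) D le′)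
    descend : Fits C D sub → IsLower C τ
    descend (y , m , t , x , G , le) = [ (λ e → y , m , t , x , G , e) ,
      (λ { (r , z) → ⊥-elim (two-steps (lower-CoreOf C G) (lower-weight C G) le (proper-fits (lower-CoreOf C G) D le z)) }) ]′ (equal-or-proper (lower-CoreOf C G) D le)

-- Convolutions and products of monomial coefficients.

module Sums where
  open import Defs
  open import Data.Nat using (ℕ; zero; suc; _∸_)
  open import Data.Integer using (ℤ; 0ℤ) renaming (_+_ to _+ᶻ_; _*_ to _*ᶻ_)
  import Data.Integer.Properties as ℤP
  open import Data.Integer.Tactic.RingSolver using (solve-∀)
  open import Data.Fin as Fin using (Fin)
  open import Data.List using (List; []; _∷_; _++_; map; concatMap; upTo; applyUpTo; _∷ʳ_)
  open import Data.List.Properties using (map-++; map-upTo; map-∘; map-cong)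
  open import Data.Product using (_×_; _,_; proj₁; proj₂)
  open import Function using (_∘_)
  open import Relation.Binary.PropositionalEquality

  +-interchangeᶻ : ∀ a b c d → (a +ᶻ b) +ᶻ (c +ᶻ d) ≡ (a +ᶻ c) +ᶻ (b +ᶻ d)
  +-interchangeᶻ = solve-∀

  -- Cauchy convolution: the terms with `a + b = n`.
  conv : ℕ → (ℕ → ℕ → ℤ) → ℤ
  conv zero    f = f 0 0
  conv (suc n) f = f 0 (suc n) +ᶻ conv n (λ a b → f (suc a) b)

  conv-cong : ∀ n {f g} → (∀ a b → f a b ≡ g a b) → conv n f ≡ conv n g
  conv-cong zero    e = e 0 0
  conv-cong (suc n) e = cong₂ _+ᶻ_ (e 0 (suc n)) (conv-cong n (λ a b → e (suc a) b))

  conv-+ : ∀ n f g → conv n (λ a b → f a b +ᶻ g a b) ≡ conv n f +ᶻ conv n g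
  conv-+ zero    f g = refl
  conv-+ (suc n) f g = trans (cong (f 0 (suc n) +ᶻ g 0 (suc n) +ᶻ_) (conv-+ n (λ a → f (suc a)) (λ a → g (suc a))))
    (+-interchangeᶻ (f 0 (suc n)) (g 0 (suc n)) (conv n (λ a → f (suc a))) (conv n (λ a → g (suc a))))

  conv-*ˡ : ∀ n c f → conv n (λ a b → c *ᶻ f a b) ≡ c *ᶻ conv n f
  conv-*ˡ zero    c f = refl
  conv-*ˡ (suc n) c f = trans (cong (c *ᶻ f 0 (suc n) +ᶻ_) (conv-*ˡ n c (λ a → f (suc a)))) (sym (ℤP.*-distribˡ-+ c (f 0 (suc n)) (conv n (λ a → f (suc a)))))

  conv-zero : ∀ n → conv n (λ _ _ → 0ℤ) ≡ 0ℤ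
  conv-zero zero    = refl
  conv-zero (suc n) = trans (ℤP.+-identityˡ _) (conv-zero n)

  -- Triples with sum `n + 1`, sorted by whether the middle entry is 0.
  conv-peel : ∀ n (G : ℕ → ℕ → ℕ → ℤ) →
    conv (suc n) (λ a b → conv b (G a)) ≡ conv (suc n) (λ a b → G a 0 b) +ᶻ conv n (λ a b → conv b (λ c e → G a (suc c) e))
  conv-peel zero    G = +-rot (G 0 0 1) (G 0 1 0) (G 1 0 0)
    where
    +-rot : ∀ a b c → (a +ᶻ b) +ᶻ c ≡ (a +ᶻ c) +ᶻ b
    +-rot = solve-∀
  conv-peel (suc n) G = trans (cong (conv (suc (suc n)) (G 0) +ᶻ_) (conv-peel n (λ a → G (suc a))))
    (+-interchangeᶻ (G 0 0 (suc (suc n))) (conv (suc n) (λ c → G 0 (suc c))) (conv (suc n) (λ a b → G (suc a) 0 b)) (conv n (λ a b → conv b (λ c e → G (suc a) (suc c) e))))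

  conv-swap : ∀ n (F : ℕ → ℕ → ℕ → ℤ) → conv n (λ a b → conv b (F a)) ≡ conv n (λ a b → conv b (λ c → F c a))
  conv-swap zero    F = refl
  conv-swap (suc n) F = trans (trans (cong (conv (suc n) (F 0) +ᶻ_) (conv-swap n (λ a → F (suc a))))
    (regroup (F 0 0 (suc n)) _ _)) (sym (trans (conv-peel n (λ a c → F c a)) refl))
    where
    regroup : ∀ x y z → (x +ᶻ y) +ᶻ z ≡ (x +ᶻ y) +ᶻ z
    regroup x y z = refl

  sumFℤ : (n : ℕ) → (Fin n → ℤ) → ℤ
  sumFℤ zero    f = 0ℤ
  sumFℤ (suc n) f = f Fin.zero +ᶻ sumFℤ n (f ∘ Fin.suc)

  sumFin-eval : ∀ n f η → sumFin n f η ≡ sumFℤ n (λ j → f j η)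
  sumFin-eval zero    f η = refl
  sumFin-eval (suc n) f η = cong (f Fin.zero η +ᶻ_) (sumFin-eval n (f ∘ Fin.suc) η)

  sumFℤ-cong : ∀ n {f g : Fin n → ℤ} → (∀ j → f j ≡ g j) → sumFℤ n f ≡ sumFℤ n g
  sumFℤ-cong zero    e = refl
  sumFℤ-cong (suc n) e = cong₂ _+ᶻ_ (e Fin.zero) (sumFℤ-cong n (e ∘ Fin.suc))

  sumFℤ-+ : ∀ n f g → sumFℤ n (λ j → f j +ᶻ g j) ≡ sumFℤ n f +ᶻ sumFℤ n g
  sumFℤ-+ zero    f g = refl
  sumFℤ-+ (suc n) f g = trans (cong (f Fin.zero +ᶻ g Fin.zero +ᶻ_) (sumFℤ-+ n (f ∘ Fin.suc) (g ∘ Fin.suc)))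
    (+-interchangeᶻ (f Fin.zero) (g Fin.zero) (sumFℤ n (f ∘ Fin.suc)) (sumFℤ n (g ∘ Fin.suc)))

  sumFℤ-*ˡ : ∀ n c f → sumFℤ n (λ j → c *ᶻ f j) ≡ c *ᶻ sumFℤ n f
  sumFℤ-*ˡ zero    c f = sym (ℤP.*-zeroʳ c)
  sumFℤ-*ˡ (suc n) c f = trans (cong (c *ᶻ f Fin.zero +ᶻ_) (sumFℤ-*ˡ n c (f ∘ Fin.suc))) (sym (ℤP.*-distribˡ-+ c (f Fin.zero) (sumFℤ n (f ∘ Fin.suc))))

  sumFℤ-zero : ∀ n {f : Fin n → ℤ} → (∀ j → f j ≡ 0ℤ) → sumFℤ n f ≡ 0ℤ
  sumFℤ-zero zero    e = refl
  sumFℤ-zero (suc n) e = cong₂ _+ᶻ_ (e Fin.zero) (sumFℤ-zero n (e ∘ Fin.suc))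

  conv-sumFℤ : ∀ m n (F : Fin n → ℕ → ℕ → ℤ) → conv m (λ a b → sumFℤ n (λ j → F j a b)) ≡ sumFℤ n (λ j → conv m (F j))
  conv-sumFℤ m zero    F = conv-zero m
  conv-sumFℤ m (suc n) F = trans (conv-+ m (F Fin.zero) (λ a b → sumFℤ n (λ j → F (Fin.suc j) a b))) (cong (conv m (F Fin.zero) +ᶻ_) (conv-sumFℤ m n (F ∘ Fin.suc)))

  sumℤ-++ : ∀ xs ys → sumℤ (xs ++ ys) ≡ sumℤ xs +ᶻ sumℤ ys
  sumℤ-++ []       ys = sym (ℤP.+-identityˡ _)
  sumℤ-++ (x ∷ xs) ys = trans (cong (x +ᶻ_) (sumℤ-++ xs ys)) (sym (ℤP.+-assoc x _ _))

  sumℤ-concatMap : ∀ {A B : Set} (F : B → ℤ) (G : A → List B) xs →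
    sumℤ (map F (concatMap G xs)) ≡ sumℤ (map (λ x → sumℤ (map F (G x))) xs)
  sumℤ-concatMap F G []       = refl
  sumℤ-concatMap F G (x ∷ xs) = trans (cong sumℤ (map-++ F (G x) (concatMap G xs)))
    (trans (sumℤ-++ (map F (G x)) (map F (concatMap G xs))) (cong (sumℤ (map F (G x)) +ᶻ_) (sumℤ-concatMap F G xs)))

  sumℤ-upTo : ∀ (h : ℕ → ℕ → ℤ) n → sumℤ (map (λ a → h a (n ∸ a)) (upTo (suc n))) ≡ conv n h
  sumℤ-upTo h n = trans (cong sumℤ (map-upTo (λ a → h a (n ∸ a)) (suc n))) (go h n)
    where
    go : ∀ (h : ℕ → ℕ → ℤ) n → sumℤ (applyUpTo (λ a → h a (n ∸ a)) (suc n)) ≡ conv n h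
    go h zero    = ℤP.+-identityʳ _
    go h (suc n) = cong (h 0 (suc n) +ᶻ_) (go (λ a → h (suc a)) n)

  infix 4 _≈_
  _≈_ : Ser → Ser → Set
  f ≈ g = ∀ η → f η ≡ g η

  ⊛-nil : ∀ f g → (f ⊛ g) [] ≡ f [] *ᶻ g []
  ⊛-nil f g = ℤP.+-identityʳ _

  ⊛-cons : ∀ f g n η → (f ⊛ g) (n ∷ η) ≡ conv n (λ a b → ((λ ξ → f (a ∷ ξ)) ⊛ (λ ξ → g (b ∷ ξ))) η)
  ⊛-cons f g n η = trans (sumℤ-concatMap (λ p → f (proj₁ p) *ᶻ g (proj₂ p)) block (upTo (suc n)))
    (trans (cong sumℤ (map-cong {f = λ a → sumℤ (map (λ p → f (proj₁ p) *ᶻ g (proj₂ p)) (block a))} {g = λ a → h a (n ∸ a)} (λ a → cong sumℤ (sym (map-∘ (splits η)))) (upTo (suc n))))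
      (sumℤ-upTo h n))
    where
    h : ℕ → ℕ → ℤ
    h a b = ((λ ξ → f (a ∷ ξ)) ⊛ (λ ξ → g (b ∷ ξ))) η
    block : ℕ → List (List ℕ × List ℕ)
    block a = map (λ p → (a ∷ proj₁ p , (n ∸ a) ∷ proj₂ p)) (splits η)

  ⊛-cong : ∀ {f f′ g g′} → f ≈ f′ → g ≈ g′ → f ⊛ g ≈ f′ ⊛ g′
  ⊛-cong {f} {f′} {g} {g′} p q η = cong sumℤ (map-cong (λ x → cong₂ _*ᶻ_ (p (proj₁ x)) (q (proj₂ x))) (splits η))

  sumℤ-map-+ : ∀ {A : Set} (F G : A → ℤ) xs → sumℤ (map (λ x → F x +ᶻ G x) xs) ≡ sumℤ (map F xs) +ᶻ sumℤ (map G xs)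
  sumℤ-map-+ F G []       = refl
  sumℤ-map-+ F G (x ∷ xs) = trans (cong (F x +ᶻ G x +ᶻ_) (sumℤ-map-+ F G xs)) (+-interchangeᶻ (F x) (G x) (sumℤ (map F xs)) (sumℤ (map G xs)))

  sumℤ-map-* : ∀ {A : Set} c (F : A → ℤ) xs → sumℤ (map (λ x → c *ᶻ F x) xs) ≡ c *ᶻ sumℤ (map F xs)
  sumℤ-map-* c F []       = sym (ℤP.*-zeroʳ c)
  sumℤ-map-* c F (x ∷ xs) = trans (cong (c *ᶻ F x +ᶻ_) (sumℤ-map-* c F xs)) (sym (ℤP.*-distribˡ-+ c (F x) (sumℤ (map F xs))))

  ⊛-+ʳ : ∀ u v w → u ⊛ (λ η → v η +ᶻ w η) ≈ (λ η → (u ⊛ v) η +ᶻ (u ⊛ w) η)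
  ⊛-+ʳ u v w η = trans (cong sumℤ (map-cong (λ p → ℤP.*-distribˡ-+ (u (proj₁ p)) _ _) (splits η))) (sumℤ-map-+ _ _ (splits η))

  ⊛-*ʳ : ∀ u c v → u ⊛ (λ η → c *ᶻ v η) ≈ (λ η → c *ᶻ (u ⊛ v) η)
  ⊛-*ʳ u c v η = trans (cong sumℤ (map-cong (λ p → pull (u (proj₁ p)) c (v (proj₂ p))) (splits η))) (sumℤ-map-* c _ (splits η))
    where
    pull : ∀ a c b → a *ᶻ (c *ᶻ b) ≡ c *ᶻ (a *ᶻ b)
    pull = solve-∀

  sumℤ-map-zero : ∀ {A : Set} {F : A → ℤ} xs → (∀ x → F x ≡ 0ℤ) → sumℤ (map F xs) ≡ 0ℤ
  sumℤ-map-zero []       e = refl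
  sumℤ-map-zero (x ∷ xs) e = cong₂ _+ᶻ_ (e x) (sumℤ-map-zero xs e)

  ⊛-zeroʳ : ∀ u {v} → v ≈ zeroS → u ⊛ v ≈ zeroS
  ⊛-zeroʳ u e η = sumℤ-map-zero (splits η) λ p → trans (cong (u (proj₁ p) *ᶻ_) (e (proj₂ p))) (ℤP.*-zeroʳ (u (proj₁ p)))

  ⊛-zeroˡ : ∀ {u} v → u ≈ zeroS → u ⊛ v ≈ zeroS
  ⊛-zeroˡ v e η = sumℤ-map-zero (splits η) λ p → trans (cong (_*ᶻ v (proj₂ p)) (e (proj₁ p))) (ℤP.*-zeroˡ (v (proj₂ p)))

  ⊛-sumFℤ : ∀ u n (F : Fin n → Ser) → u ⊛ (λ η → sumFℤ n (λ j → F j η)) ≈ (λ η → sumFℤ n (λ j → (u ⊛ F j) η))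
  ⊛-sumFℤ u zero    F η = ⊛-zeroʳ u (λ _ → refl) η
  ⊛-sumFℤ u (suc n) F η = trans (⊛-+ʳ u (F Fin.zero) (λ η → sumFℤ n (λ j → F (Fin.suc j) η)) η) (cong ((u ⊛ F Fin.zero) η +ᶻ_) (⊛-sumFℤ u n (F ∘ Fin.suc) η))

  ⊛-conv : ∀ u n (F : ℕ → ℕ → Ser) → u ⊛ (λ η → conv n (λ a b → F a b η)) ≈ (λ η → conv n (λ a b → (u ⊛ F a b) η))
  ⊛-conv u zero    F η = refl
  ⊛-conv u (suc n) F η = trans (⊛-+ʳ u (F 0 (suc n)) (λ η → conv n (λ a b → F (suc a) b η)) η) (cong ((u ⊛ F 0 (suc n)) η +ᶻ_) (⊛-conv u n (λ a b → F (suc a) b) η))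

  -- Associativity and commutativity in one law, reduced to `conv-swap` variable by variable; it
  -- lets two rows trade places in a double expansion.
  ⊛-left-comm : ∀ u v w → u ⊛ (v ⊛ w) ≈ v ⊛ (u ⊛ w)
  ⊛-left-comm u v w [] = trans (⊛-nil u (v ⊛ w)) (trans (cong (u [] *ᶻ_) (⊛-nil v w))
    (trans (pull (u []) (v []) (w [])) (sym (trans (⊛-nil v (u ⊛ w)) (cong (v [] *ᶻ_) (⊛-nil u w))))))
    where
    pull : ∀ a c b → a *ᶻ (c *ᶻ b) ≡ c *ᶻ (a *ᶻ b)
    pull = solve-∀
  ⊛-left-comm u v w (n ∷ η) = trans (expand u v) (trans (conv-swap n _)
    (trans (conv-cong n (λ a b → conv-cong b (λ c e → ⊛-left-comm (λ ξ → u (c ∷ ξ)) (λ ξ → v (a ∷ ξ)) (λ ξ → w (e ∷ ξ)) η))) (sym (expand v u))))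
    where
    expand : ∀ u v → (u ⊛ (v ⊛ w)) (n ∷ η) ≡ conv n (λ a b → conv b (λ c e → ((λ ξ → u (a ∷ ξ)) ⊛ ((λ ξ → v (c ∷ ξ)) ⊛ (λ ξ → w (e ∷ ξ)))) η))
    expand u v = trans (⊛-cons u (v ⊛ w) n η) (conv-cong n λ a b →
      trans (⊛-cong {λ ξ → u (a ∷ ξ)} (λ _ → refl) (λ ξ → ⊛-cons v w b ξ) η) (⊛-conv (λ ξ → u (a ∷ ξ)) b _ η))

  conv-exchange : ∀ m n (F : ℕ → ℕ → ℕ → ℕ → ℤ) → conv m (λ a b → conv n (λ c e → F a b c e)) ≡ conv n (λ c e → conv m (λ a b → F a b c e))
  conv-exchange m zero    F = refl
  conv-exchange m (suc n) F = trans (conv-+ m (λ a b → F a b 0 (suc n)) (λ a b → conv n (λ c e → F a b (suc c) e))) (cong (conv m (λ a b → F a b 0 (suc n)) +ᶻ_) (conv-exchange m n (λ a b c e → F a b (suc c) e)))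

  ⊛-snoc : ∀ f g η m → (f ⊛ g) (η ∷ʳ m) ≡ conv m (λ a b → ((λ ξ → f (ξ ∷ʳ a)) ⊛ (λ ξ → g (ξ ∷ʳ b))) η)
  ⊛-snoc f g [] m = trans (⊛-cons f g m []) (conv-cong m λ a b → refl)
  ⊛-snoc f g (n ∷ η) m = trans (⊛-cons f g n (η ∷ʳ m)) (trans (conv-cong n λ a b → ⊛-snoc (λ ξ → f (a ∷ ξ)) (λ ξ → g (b ∷ ξ)) η m)
    (trans (conv-exchange n m _) (conv-cong m λ c e → sym (⊛-cons (λ ξ → f (ξ ∷ʳ c)) (λ ξ → g (ξ ∷ʳ e)) n η))))

-- Determinants and the exchange of adjacent rows.

module Det where
  open import Defs
  open Sums
  open import Data.Nat as ℕ using (ℕ; zero; suc; s≤s; z≤n)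
  open import Data.Integer using (ℤ; 0ℤ; 1ℤ) renaming (_+_ to _+ᶻ_; _*_ to _*ᶻ_; -_ to -ᶻ_; _-_ to _-ᶻ_)
  import Data.Integer.Properties as ℤP
  open import Data.Integer.Tactic.RingSolver using (solve-∀)
  open import Data.Fin as Fin using (Fin; toℕ; punchIn)
  open import Function using (_∘_)
  open import Relation.Binary.PropositionalEquality

  altSign-suc : ∀ n → altSign (suc n) ≡ -ᶻ altSign n
  altSign-suc zero          = refl
  altSign-suc (suc zero)    = refl
  altSign-suc (suc (suc n)) = altSign-suc n

  Rows : ℕ → Set
  Rows n = ℕ → Fin n → Ser

  -- With rows indexed by ℕ, deleting the first row is a shift and a transposition of rows is a
  -- composition.
  D : (n : ℕ) → Rows n → Ser
  D n M = det n (λ i j → M (toℕ i) j)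

  minor : ∀ {n} → Fin (suc n) → Rows (suc n) → Rows n
  minor j M r j′ = M (suc r) (punchIn j j′)

  D-suc : ∀ n (M : Rows (suc n)) η → D (suc n) M η ≡ sumFℤ (suc n) (λ j → altSign (toℕ j) *ᶻ (M 0 j ⊛ D n (minor j M)) η)
  D-suc n M η = sumFin-eval (suc n) (λ j → scaleS (altSign (toℕ j)) (M 0 j ⊛ D n (minor j M))) η

  D-cong< : ∀ n {M M′ : Rows n} → (∀ {r} → r ℕ.< n → ∀ j → M r j ≈ M′ r j) → D n M ≈ D n M′
  D-cong< zero    e η = refl
  D-cong< (suc n) {M} {M′} e η = trans (D-suc n M η) (trans
    (sumFℤ-cong (suc n) λ j → cong (altSign (toℕ j) *ᶻ_) (⊛-cong (e (s≤s z≤n) j) (D-cong< n λ p j′ → e (s≤s p) (punchIn j j′)) η))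
    (sym (D-suc n M′ η)))

  D-cong : ∀ n {M M′ : Rows n} → (∀ r j → M r j ≈ M′ r j) → D n M ≈ D n M′
  D-cong n e = D-cong< n λ {r} _ → e r

  -- The two ways of choosing the ordered column pair {j, punchIn j j′} in a double Laplace expansion.
  data Partner : ∀ {n} → Fin (suc (suc n)) → Fin (suc n) → Fin (suc (suc n)) → Fin (suc n) → Set where
    first : ∀ {n} {j : Fin (suc n)} → Partner Fin.zero j (Fin.suc j) Fin.zero
    next  : ∀ {n} {j p : Fin (suc (suc n))} {j′ p′ : Fin (suc n)} → Partner j j′ p p′ → Partner (Fin.suc j) (Fin.suc j′) (Fin.suc p) (Fin.suc p′)

  partner-column : ∀ {n} {j p : Fin (suc (suc n))} {j′ p′} → Partner j j′ p p′ → punchIn j j′ ≡ p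
  partner-column first    = refl
  partner-column (next q) = cong Fin.suc (partner-column q)

  partner-column′ : ∀ {n} {j p : Fin (suc (suc n))} {j′ p′} → Partner j j′ p p′ → punchIn p p′ ≡ j
  partner-column′ first    = refl
  partner-column′ (next q) = cong Fin.suc (partner-column′ q)

  partner-rest : ∀ {n} {j p : Fin (suc (suc n))} {j′ p′} → Partner j j′ p p′ → ∀ c → punchIn j (punchIn j′ c) ≡ punchIn p (punchIn p′ c)
  partner-rest first    c           = refl
  partner-rest (next q) Fin.zero    = refl
  partner-rest (next q) (Fin.suc c) = cong Fin.suc (partner-rest q c)

  partner-sign : ∀ {n} {j p : Fin (suc (suc n))} {j′ p′} → Partner j j′ p p′ →
    altSign (toℕ j) *ᶻ altSign (toℕ j′) ≡ -ᶻ (altSign (toℕ p) *ᶻ altSign (toℕ p′))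
  partner-sign (first {j = j}) = trans (flip (altSign (toℕ j))) (cong (λ z → -ᶻ (z *ᶻ 1ℤ)) (sym (altSign-suc (toℕ j))))
    where
    flip : ∀ x → 1ℤ *ᶻ x ≡ -ᶻ ((-ᶻ x) *ᶻ 1ℤ)
    flip = solve-∀
  partner-sign (next {j = j} {p} {j′} {p′} q) = trans (cong₂ _*ᶻ_ (altSign-suc (toℕ j)) (altSign-suc (toℕ j′)))
    (trans (neg² (altSign (toℕ j)) (altSign (toℕ j′))) (trans (partner-sign q)
      (cong -ᶻ_ (sym (trans (cong₂ _*ᶻ_ (altSign-suc (toℕ p)) (altSign-suc (toℕ p′))) (neg² (altSign (toℕ p)) (altSign (toℕ p′))))))))
    where
    neg² : ∀ x y → (-ᶻ x) *ᶻ (-ᶻ y) ≡ x *ᶻ y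
    neg² = solve-∀

  pairSum : ∀ n → (Fin (suc (suc n)) → Fin (suc n) → ℤ) → ℤ
  pairSum n F = sumFℤ (suc (suc n)) (λ j → sumFℤ (suc n) (F j))

  -- Splitting off the pairs that involve column 0 leaves the same problem with one column less.
  pairSum-zero : ∀ n F → (∀ j j′ p p′ → Partner j j′ p p′ → F j j′ +ᶻ F p p′ ≡ 0ℤ) → pairSum n F ≡ 0ℤ
  pairSum-zero n F h = trans (cong (sumFℤ (suc n) (F Fin.zero) +ᶻ_) (sumFℤ-+ (suc n) (λ i → F (Fin.suc i) Fin.zero) (λ i → sumFℤ n (λ i′ → F (Fin.suc i) (Fin.suc i′)))))
    (trans (sym (ℤP.+-assoc (sumFℤ (suc n) (F Fin.zero)) (sumFℤ (suc n) (λ i → F (Fin.suc i) Fin.zero)) (sumFℤ (suc n) (λ i → sumFℤ n (λ i′ → F (Fin.suc i) (Fin.suc i′)))))) (cong₂ _+ᶻ_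
      (trans (sym (sumFℤ-+ (suc n) (F Fin.zero) (λ i → F (Fin.suc i) Fin.zero))) (sumFℤ-zero (suc n) (λ j → h Fin.zero j (Fin.suc j) Fin.zero first)))
      (rest n F h)))
    where
    rest : ∀ n (F : Fin (suc (suc n)) → Fin (suc n) → ℤ) → (∀ j j′ p p′ → Partner j j′ p p′ → F j j′ +ᶻ F p p′ ≡ 0ℤ) →
      sumFℤ (suc n) (λ i → sumFℤ n (λ i′ → F (Fin.suc i) (Fin.suc i′))) ≡ 0ℤ
    rest zero    F h = refl
    rest (suc n) F h = pairSum-zero n (λ i i′ → F (Fin.suc i) (Fin.suc i′)) (λ j j′ p p′ q → h (Fin.suc j) (Fin.suc j′) (Fin.suc p) (Fin.suc p′) (next q))

  pairSum-+ : ∀ n F G → pairSum n (λ j j′ → F j j′ +ᶻ G j j′) ≡ pairSum n F +ᶻ pairSum n G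
  pairSum-+ n F G = trans (sumFℤ-cong (suc (suc n)) λ j → sumFℤ-+ (suc n) (F j) (G j))
    (sumFℤ-+ (suc (suc n)) (λ j → sumFℤ (suc n) (F j)) (λ j → sumFℤ (suc n) (G j)))

  rest₂ : ∀ {n} → Rows (suc (suc n)) → Fin (suc (suc n)) → Fin (suc n) → Ser
  rest₂ {n} M j j′ = D n (minor j′ (minor j M))

  D-suc² : ∀ n (M : Rows (suc (suc n))) η → D (suc (suc n)) M η ≡
    pairSum n (λ j j′ → (altSign (toℕ j) *ᶻ altSign (toℕ j′)) *ᶻ (M 0 j ⊛ (M 1 (punchIn j j′) ⊛ rest₂ M j j′)) η)
  D-suc² n M η = trans (D-suc (suc n) M η) (sumFℤ-cong (suc (suc n)) λ j →
    trans (cong (altSign (toℕ j) *ᶻ_) (trans (⊛-cong {M 0 j} (λ _ → refl) (D-suc n (minor j M)) η)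
      (⊛-sumFℤ (M 0 j) (suc n) (λ j′ ξ → altSign (toℕ j′) *ᶻ (M 1 (punchIn j j′) ⊛ rest₂ M j j′) ξ) η)))
    (trans (sym (sumFℤ-*ˡ (suc n) (altSign (toℕ j)) (λ j′ → (M 0 j ⊛ (λ ξ → altSign (toℕ j′) *ᶻ (M 1 (punchIn j j′) ⊛ rest₂ M j j′) ξ)) η))) (sumFℤ-cong (suc n) λ j′ →
      trans (cong (altSign (toℕ j) *ᶻ_) (⊛-*ʳ (M 0 j) (altSign (toℕ j′)) (M 1 (punchIn j j′) ⊛ rest₂ M j j′) η))
        (sym (ℤP.*-assoc (altSign (toℕ j)) (altSign (toℕ j′)) ((M 0 j ⊛ (M 1 (punchIn j j′) ⊛ rest₂ M j j′)) η))))))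

  swapRow : ℕ → ℕ → ℕ
  swapRow zero    zero          = 1
  swapRow zero    (suc zero)    = 0
  swapRow zero    (suc (suc r)) = suc (suc r)
  swapRow (suc y) zero          = zero
  swapRow (suc y) (suc r)       = suc (swapRow y r)

  x≡-y : ∀ {x y : ℤ} → x +ᶻ y ≡ 0ℤ → x ≡ -ᶻ y
  x≡-y {x} {y} e = trans (rearrange x y) (trans (cong (_+ᶻ (-ᶻ y)) e) (ℤP.+-identityˡ (-ᶻ y)))
    where
    rearrange : ∀ x y → x ≡ (x +ᶻ y) +ᶻ (-ᶻ y)
    rearrange = solve-∀

  -- For the first two rows, the double Laplace expansions of both determinants are added and cancel
  -- between partners, whose signs are opposite. Lower rows are reached by expanding along row 0.
  D-swap : ∀ y n (M : Rows n) → suc y ℕ.< n → ∀ η → D n (M ∘ swapRow y) η ≡ -ᶻ D n M η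
  D-swap zero (suc (suc n)) M _ η = x≡-y (trans (cong₂ _+ᶻ_ (D-suc² n (M ∘ swapRow 0) η) (D-suc² n M η))
    (trans (sym (pairSum-+ n (λ j j′ → sg j j′ *ᶻ term j j′ (punchIn j j′) 1 0) (λ j j′ → sg j j′ *ᶻ term j j′ (punchIn j j′) 0 1)))
      (pairSum-zero n (λ j j′ → sg j j′ *ᶻ term j j′ (punchIn j j′) 1 0 +ᶻ sg j j′ *ᶻ term j j′ (punchIn j j′) 0 1) cancel)))
    where
    term : Fin (suc (suc n)) → Fin (suc n) → Fin (suc (suc n)) → ℕ → ℕ → ℤ
    term j j′ p a b = (M a j ⊛ (M b p ⊛ rest₂ M j j′)) η
    sg : Fin (suc (suc n)) → Fin (suc n) → ℤ
    sg j j′ = altSign (toℕ j) *ᶻ altSign (toℕ j′)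
    cancel : ∀ j j′ p p′ → Partner j j′ p p′ →
      (sg j j′ *ᶻ term j j′ (punchIn j j′) 1 0 +ᶻ sg j j′ *ᶻ term j j′ (punchIn j j′) 0 1) +ᶻ
      (sg p p′ *ᶻ term p p′ (punchIn p p′) 1 0 +ᶻ sg p p′ *ᶻ term p p′ (punchIn p p′) 0 1) ≡ 0ℤ
    cancel j j′ p p′ q rewrite partner-column q | partner-column′ q | partner-sign q =
      trans (cong₂ (λ u v → ((-ᶻ sg p p′) *ᶻ term j j′ p 1 0 +ᶻ (-ᶻ sg p p′) *ᶻ term j j′ p 0 1) +ᶻ (sg p p′ *ᶻ u +ᶻ sg p p′ *ᶻ v)) (exchange 1 0) (exchange 0 1))
        (vanish (sg p p′) (term j j′ p 1 0) (term j j′ p 0 1))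
      where
      same : rest₂ M p p′ ≈ rest₂ M j j′
      same = D-cong n λ r c ξ → cong (λ z → M (suc (suc r)) z ξ) (sym (partner-rest q c))
      exchange : ∀ a b → term p p′ j a b ≡ term j j′ p b a
      exchange a b = trans (⊛-cong {M a p} (λ _ → refl) (⊛-cong {M b j} (λ _ → refl) same) η) (⊛-left-comm (M a p) (M b j) (rest₂ M j j′) η)
      vanish : ∀ s x y → ((-ᶻ s) *ᶻ x +ᶻ (-ᶻ s) *ᶻ y) +ᶻ (s *ᶻ y +ᶻ s *ᶻ x) ≡ 0ℤ
      vanish = solve-∀
  D-swap zero (suc zero) M (s≤s ()) η
  D-swap (suc y) (suc n) M (s≤s p) η = trans (D-suc n (M ∘ swapRow (suc y)) η) (trans
    (sumFℤ-cong (suc n) λ j → trans (cong (altSign (toℕ j) *ᶻ_) (trans (⊛-cong {M 0 j} (λ _ → refl) (λ ξ → trans (D-swap y n (minor j M) p ξ) (neg1 (D n (minor j M) ξ))) η)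
        (⊛-*ʳ (M 0 j) (-ᶻ 1ℤ) (D n (minor j M)) η))) (pull (altSign (toℕ j)) ((M 0 j ⊛ D n (minor j M)) η)))
    (trans (sumFℤ-*ˡ (suc n) (-ᶻ 1ℤ) (λ j → altSign (toℕ j) *ᶻ (M 0 j ⊛ D n (minor j M)) η)) (trans (sym (neg1 (sumFℤ (suc n) (λ j → altSign (toℕ j) *ᶻ (M 0 j ⊛ D n (minor j M)) η)))) (cong -ᶻ_ (sym (D-suc n M η))))))
    where
    neg1 : ∀ x → -ᶻ x ≡ (-ᶻ 1ℤ) *ᶻ x
    neg1 = solve-∀
    pull : ∀ s x → s *ᶻ ((-ᶻ 1ℤ) *ᶻ x) ≡ (-ᶻ 1ℤ) *ᶻ (s *ᶻ x)
    pull = solve-∀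

  D-zero : ∀ n {M : Rows (suc n)} η → (∀ j → (M 0 j ⊛ D n (minor j M)) η ≡ 0ℤ) → D (suc n) M η ≡ 0ℤ
  D-zero n {M} η h = trans (D-suc n M η) (sumFℤ-zero (suc n) λ j → trans (cong (altSign (toℕ j) *ᶻ_) (h j)) (ℤP.*-zeroʳ (altSign (toℕ j))))

-- Power series in raising operators.

module Expand where
  open Sums
  open Det
  open import Data.Bool using (if_then_else_)
  open import Data.Nat as ℕ using (ℕ; zero; suc; _≡ᵇ_)
  open import Data.Integer using (ℤ; +_; -[1+_]; 0ℤ; 1ℤ) renaming (_+_ to _+ᶻ_; -_ to -ᶻ_; _-_ to _-ᶻ_)
  open import Data.Integer.Tactic.RingSolver using (solve-∀)
  open import Data.List using (List; []; _∷_; _++_; map)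
  open import Data.List.Relation.Unary.All using (All; []; _∷_)
  open import Data.List.Relation.Binary.Permutation.Propositional as Perm using (_↭_)
  open import Data.Product using (_×_; _,_)
  open import Data.Empty using (⊥-elim)
  open import Function using (_∘_)
  open import Relation.Nullary using (yes; no)
  open import Relation.Binary.PropositionalEquality

  Weight Root : Set
  Weight = ℕ → ℤ
  Root   = ℕ × ℕ

  unit : ℕ → Weight
  unit i x = if i ≡ᵇ x then 1ℤ else 0ℤ

  unit-same : ∀ i → unit i i ≡ 1ℤ
  unit-same zero    = refl
  unit-same (suc i) = unit-same i

  unit-other : ∀ {i x} → i ≢ x → unit i x ≡ 0ℤ
  unit-other {zero}  {zero}  ne = ⊥-elim (ne refl)
  unit-other {zero}  {suc x} ne = refl
  unit-other {suc i} {zero}  ne = refl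
  unit-other {suc i} {suc x} ne = unit-other {i} {x} (ne ∘ cong suc)

  infixl 6 _⊞_
  _⊞_ : Weight → Root → Weight
  (γ ⊞ (i , j)) x = γ x +ᶻ (unit i x -ᶻ unit j x)

  ⊞-cong : ∀ {γ γ′} α → γ ≗ γ′ → γ ⊞ α ≗ γ′ ⊞ α
  ⊞-cong (i , j) e x = cong (_+ᶻ (unit i x -ᶻ unit j x)) (e x)

  ⊞-comm : ∀ γ α β → γ ⊞ α ⊞ β ≗ γ ⊞ β ⊞ α
  ⊞-comm γ (i , j) (p , q) x = shuffle (γ x) _ _
    where
    shuffle : ∀ a b c → a +ᶻ b +ᶻ c ≡ a +ᶻ c +ᶻ b
    shuffle = solve-∀

  -- A family G d of functionals of the weight γ is read as the coefficients of a power series in t.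
  Graded : Set
  Graded = ℕ → Weight → ℤ

  Respects : Graded → Set
  Respects G = ∀ d {γ γ′} → γ ≗ γ′ → G d γ ≡ G d γ′

  -- The coefficient of t ^ d in the product of G and the series 1 / (1 - t z_i / z_j), (i , j) ∈ Ψ, evaluated at z ^ γ.
  E : Graded → List Root → Graded
  E G []      d       γ = G d γ
  E G (α ∷ Ψ) zero    γ = E G Ψ zero γ
  E G (α ∷ Ψ) (suc d) γ = E G Ψ (suc d) γ +ᶻ E G (α ∷ Ψ) d (γ ⊞ α)

  E-respects : ∀ {G} → Respects G → ∀ Ψ → Respects (E G Ψ)
  E-respects R []      d       e = R d e
  E-respects R (α ∷ Ψ) zero    e = E-respects R Ψ zero e
  E-respects R (α ∷ Ψ) (suc d) e = cong₂ _+ᶻ_ (E-respects R Ψ (suc d) e) (E-respects R (α ∷ Ψ) d (⊞-cong α e))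

  E-++ : ∀ G Ψ Φ d γ → E G (Ψ ++ Φ) d γ ≡ E (E G Φ) Ψ d γ
  E-++ G []      Φ d       γ = refl
  E-++ G (α ∷ Ψ) Φ zero    γ = E-++ G Ψ Φ zero γ
  E-++ G (α ∷ Ψ) Φ (suc d) γ = cong₂ _+ᶻ_ (E-++ G Ψ Φ (suc d) γ) (E-++ G (α ∷ Ψ) Φ d (γ ⊞ α))

  Closed : (Weight → Set) → List Root → Set
  Closed Q = All (λ α → ∀ {γ} → Q γ → Q (γ ⊞ α))

  -- `Q` is an invariant of all weights that occur, so the functionals need to be compared only
  -- where it holds.
  E-agree : ∀ {G G′} (Q : Weight → Set) {Ψ} → Closed Q Ψ → (∀ d {γ} → Q γ → G d γ ≡ G′ d γ) → ∀ d {γ} → Q γ → E G Ψ d γ ≡ E G′ Ψ d γ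
  E-agree Q []       h d       q = h d q
  E-agree Q (c ∷ cs) h zero    q = E-agree Q cs h zero q
  E-agree Q (c ∷ cs) h (suc d) q = cong₂ _+ᶻ_ (E-agree Q cs h (suc d) q) (E-agree Q (c ∷ cs) h d (c q))

  E-vanish : ∀ {G} (Q : Weight → Set) {Ψ} → Closed Q Ψ → (∀ d {γ} → Q γ → G d γ ≡ 0ℤ) → ∀ d {γ} → Q γ → E G Ψ d γ ≡ 0ℤ
  E-vanish Q []       h d       q = h d q
  E-vanish Q (c ∷ cs) h zero    q = E-vanish Q cs h zero q
  E-vanish Q (c ∷ cs) h (suc d) q = cong₂ _+ᶻ_ (E-vanish Q cs h (suc d) q) (E-vanish Q (c ∷ cs) h d (c q))

  module _ {G : Graded} (R : Respects G) where
    E-swap : ∀ α β Ψ d γ → E G (α ∷ β ∷ Ψ) d γ ≡ E G (β ∷ α ∷ Ψ) d γ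
    E-swap α β Ψ zero          γ = refl
    E-swap α β Ψ (suc zero)    γ = shuffle (E G Ψ 1 γ) (E G Ψ 0 (γ ⊞ β)) (E G Ψ 0 (γ ⊞ α))
      where
      shuffle : ∀ a b c → (a +ᶻ b) +ᶻ c ≡ (a +ᶻ c) +ᶻ b
      shuffle = solve-∀
    E-swap α β Ψ (suc (suc d)) γ = regroup (E G Ψ (suc (suc d)) γ) (X (suc d) (γ ⊞ β)) (X d (γ ⊞ β ⊞ α)) (Y (suc d) (γ ⊞ α)) (Y d (γ ⊞ α ⊞ β))
        (E-swap α β Ψ (suc d) (γ ⊞ β)) (E-swap α β Ψ (suc d) (γ ⊞ α))
        (trans (E-swap α β Ψ d (γ ⊞ β ⊞ α)) (E-respects R (β ∷ α ∷ Ψ) d (⊞-comm γ β α)))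
      where
      X Y : Graded
      X = E G (α ∷ β ∷ Ψ)
      Y = E G (β ∷ α ∷ Ψ)
      regroup : ∀ z x₁ x₀ y₁ y₀ {b a x y} → b +ᶻ x₀ ≡ y → x ≡ a +ᶻ y₀ → x₀ ≡ y₀ → (z +ᶻ b) +ᶻ x ≡ (z +ᶻ a) +ᶻ y
      regroup z x₁ x₀ y₁ y₀ {b} {a} {x} {y} refl refl refl = solver z a b x₀
        where
        solver : ∀ z a b x₀ → (z +ᶻ b) +ᶻ (a +ᶻ x₀) ≡ (z +ᶻ a) +ᶻ (b +ᶻ x₀)
        solver = solve-∀

    E-prep : ∀ α {Ψ Φ} → (∀ d γ → E G Ψ d γ ≡ E G Φ d γ) → ∀ d γ → E G (α ∷ Ψ) d γ ≡ E G (α ∷ Φ) d γ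
    E-prep α h zero    γ = h zero γ
    E-prep α h (suc d) γ = cong₂ _+ᶻ_ (h (suc d) γ) (E-prep α h d (γ ⊞ α))

    E-↭ : ∀ {Ψ Φ} → Ψ ↭ Φ → ∀ d γ → E G Ψ d γ ≡ E G Φ d γ
    E-↭ Perm.refl         d γ = refl
    E-↭ (Perm.prep α p)   d γ = E-prep α (E-↭ p) d γ
    E-↭ (Perm.swap {xs = Ψ} α β p) d γ = trans (E-prep α (E-prep β (E-↭ p)) d γ) (E-swap α β _ d γ)
    E-↭ (Perm.trans p q)  d γ = trans (E-↭ p d γ) (E-↭ q d γ)

  infixl 6 _⊞[_]_
  _⊞[_]_ : Weight → ℕ → Root → Weight
  γ ⊞[ zero ] α  = γ
  γ ⊞[ suc a ] α = (γ ⊞ α) ⊞[ a ] α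

  E-conv : ∀ G α Ψ d γ → E G (α ∷ Ψ) d γ ≡ conv d (λ a b → E G Ψ b (γ ⊞[ a ] α))
  E-conv G α Ψ zero    γ = refl
  E-conv G α Ψ (suc d) γ = cong (E G Ψ (suc d) γ +ᶻ_) (E-conv G α Ψ d (γ ⊞ α))

  swapRow-involutive : ∀ y r → swapRow y (swapRow y r) ≡ r
  swapRow-involutive zero    zero          = refl
  swapRow-involutive zero    (suc zero)    = refl
  swapRow-involutive zero    (suc (suc r)) = refl
  swapRow-involutive (suc y) zero          = refl
  swapRow-involutive (suc y) (suc r)       = cong suc (swapRow-involutive y r)

  swapRow-left : ∀ y → swapRow y y ≡ suc y
  swapRow-left zero    = refl
  swapRow-left (suc y) = cong suc (swapRow-left y)

  swapRow-right : ∀ y → swapRow y (suc y) ≡ y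
  swapRow-right zero    = refl
  swapRow-right (suc y) = cong suc (swapRow-right y)

  swapRow-other : ∀ {y r} → r ≢ y → r ≢ suc y → swapRow y r ≡ r
  swapRow-other {zero}  {zero}        p q = ⊥-elim (p refl)
  swapRow-other {zero}  {suc zero}    p q = ⊥-elim (q refl)
  swapRow-other {zero}  {suc (suc r)} p q = refl
  swapRow-other {suc y} {zero}        p q = refl
  swapRow-other {suc y} {suc r}       p q = cong suc (swapRow-other (p ∘ cong suc) (q ∘ cong suc))

  unit-swap : ∀ y i x → unit i (swapRow y x) ≡ unit (swapRow y i) x
  unit-swap zero    zero          zero          = refl
  unit-swap zero    zero          (suc zero)    = refl
  unit-swap zero    zero          (suc (suc x)) = refl
  unit-swap zero    (suc zero)    zero          = refl
  unit-swap zero    (suc zero)    (suc zero)    = refl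
  unit-swap zero    (suc zero)    (suc (suc x)) = refl
  unit-swap zero    (suc (suc i)) zero          = refl
  unit-swap zero    (suc (suc i)) (suc zero)    = refl
  unit-swap zero    (suc (suc i)) (suc (suc x)) = refl
  unit-swap (suc y) zero          zero          = refl
  unit-swap (suc y) zero          (suc x)       = refl
  unit-swap (suc y) (suc i)       zero          = refl
  unit-swap (suc y) (suc i)       (suc x)       = unit-swap y i x

  -- The action of the transposition of rows y and y + 1 on γ + ρ, ρ = (0, -1, -2, ...).
  dot : ℕ → Weight → Weight
  dot y γ x = γ (swapRow y x) -ᶻ + swapRow y x +ᶻ + x

  swapRoot : ℕ → Root → Root
  swapRoot y (i , j) = swapRow y i , swapRow y j

  dot-⊞ : ∀ y γ α → dot y (γ ⊞ α) ≗ dot y γ ⊞ swapRoot y α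
  dot-⊞ y γ (i , j) x rewrite unit-swap y i x | unit-swap y j x =
    shuffle (γ (swapRow y x)) (unit (swapRow y i) x -ᶻ unit (swapRow y j) x) (+ swapRow y x) (+ x)
    where
    shuffle : ∀ a b c d → (a +ᶻ b) -ᶻ c +ᶻ d ≡ (a -ᶻ c +ᶻ d) +ᶻ b
    shuffle = solve-∀

  neg-+ : ∀ x y → (-ᶻ x) +ᶻ (-ᶻ y) ≡ -ᶻ (x +ᶻ y)
  neg-+ = solve-∀

  Alternating : ℕ → Graded → Set
  Alternating y G = ∀ d γ → G d (dot y γ) ≡ -ᶻ G d γ

  E-alternating : ∀ {y G} → Respects G → Alternating y G → ∀ Ψ d γ → E G (map (swapRoot y) Ψ) d (dot y γ) ≡ -ᶻ E G Ψ d γ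
  E-alternating R A []      d       γ = A d γ
  E-alternating R A (α ∷ Ψ) zero    γ = E-alternating R A Ψ zero γ
  E-alternating {y} {G} R A (α ∷ Ψ) (suc d) γ = trans (cong₂ _+ᶻ_ (E-alternating R A Ψ (suc d) γ)
    (trans (E-respects R (map (swapRoot y) (α ∷ Ψ)) d (λ x → sym (dot-⊞ y γ α x))) (E-alternating R A (α ∷ Ψ) d (γ ⊞ α))))
    (neg-+ (E G Ψ (suc d) γ) (E G (α ∷ Ψ) d (γ ⊞ α)))

  self-negative : ∀ {x : ℤ} → x ≡ -ᶻ x → x ≡ 0ℤ
  self-negative {+ zero}    e = refl
  self-negative {+ suc n}   ()
  self-negative { -[1+ n ]} ()

  -- The condition on `γ` says that `dot y` fixes it, so by alternation the value is its own
  -- negative.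
  E-symmetric-zero : ∀ {y G Ψ} → Respects G → Alternating y G → map (swapRoot y) Ψ ↭ Ψ →
    ∀ d γ → γ y ≡ γ (suc y) -ᶻ 1ℤ → E G Ψ d γ ≡ 0ℤ
  E-symmetric-zero {y} {G} {Ψ} R A p d γ e = self-negative (trans (E-respects R Ψ d fixed)
    (trans (sym (E-↭ R p d (dot y γ))) (E-alternating R A Ψ d γ)))
    where
    left : ∀ a c → a -ᶻ 1ℤ ≡ a -ᶻ (1ℤ +ᶻ c) +ᶻ c
    left = solve-∀
    right : ∀ a c → a ≡ (a -ᶻ 1ℤ) -ᶻ c +ᶻ (1ℤ +ᶻ c)
    right = solve-∀
    stay : ∀ a c → a ≡ a -ᶻ c +ᶻ c
    stay = solve-∀
    fixed : γ ≗ dot y γ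
    fixed x with x ℕ.≟ y | x ℕ.≟ suc y
    ... | yes refl | _ rewrite swapRow-left y = trans e (left (γ (suc y)) (+ y))
    ... | no _ | yes refl rewrite swapRow-right y = trans (right (γ (suc y)) (+ y)) (cong (λ z → z -ᶻ + y +ᶻ + suc y) (sym e))
    ... | no p | no q rewrite swapRow-other p q = stay (γ x) (+ x)

-- Jacobi-Trudi determinants and their last variable.

module Schur where
  open import Defs
  open Sums
  open Det
  open Expand
  open import Data.Bool using (true; false)
  open import Data.Bool.Properties using (T-≡)
  open import Data.Nat as ℕ using (ℕ; zero; suc; _≡ᵇ_; s≤s)
  import Data.Nat.Properties as ℕP
  open import Data.Nat.ListAction using (sum)
  open import Data.Integer as ℤ using (ℤ; +_; -[1+_]; 0ℤ; 1ℤ) renaming (_+_ to _+ᶻ_; _*_ to _*ᶻ_; -_ to -ᶻ_; _-_ to _-ᶻ_)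
  import Data.Integer.Properties as ℤP
  open import Data.Integer.Tactic.RingSolver using (solve-∀)
  open import Data.Fin using (Fin; toℕ; punchIn)
  open import Data.List using (List; []; _∷_; _∷ʳ_)
  open import Data.List.Relation.Unary.All using ([]; _∷_)
  open import Data.Product using (_,_)
  open import Data.Empty using (⊥-elim)
  open import Function using (_∘_)
  open import Function.Bundles using (Equivalence)
  open import Relation.Nullary using (yes; no)
  open import Relation.Binary.PropositionalEquality

  entry : ℕ → Weight → ℕ → ℕ → ℤ
  entry i γ c r = (γ (i ℕ.+ r) +ᶻ + c) -ᶻ + (i ℕ.+ r)

  -- Rows i, i + 1, ... of the Jacobi-Trudi matrix of γ, restricted to the columns c.
  jacobiTrudi : ∀ {n} → ℕ → Weight → (Fin n → ℕ) → Rows n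
  jacobiTrudi i γ c r j = hS (entry i γ (c j) r)

  entry-suc : ∀ i γ c r → entry i γ c (suc r) ≡ entry (suc i) γ c r
  entry-suc i γ c r rewrite ℕP.+-suc i r = refl

  minor-jacobiTrudi : ∀ {n} i γ (c : Fin (suc n) → ℕ) j → D n (minor j (jacobiTrudi i γ c)) ≈ D n (jacobiTrudi (suc i) γ (c ∘ punchIn j))
  minor-jacobiTrudi {n} i γ c j = D-cong n λ r j′ η → cong (λ a → hS a η) (entry-suc i γ (c (punchIn j j′)) r)

  hS-yes : ∀ a η → a ≡ + sum η → hS a η ≡ 1ℤ
  hS-yes .(+ sum η) η refl with sum η ≡ᵇ sum η | ℕP.≡⇒≡ᵇ (sum η) (sum η) refl
  ... | true | _ = refl

  hS-no : ∀ a η → a ≢ + sum η → hS a η ≡ 0ℤ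
  hS-no (+ n)    η ne with sum η ≡ᵇ n in eq
  ... | false = refl
  ... | true  = ⊥-elim (ne (cong +_ (sym (ℕP.≡ᵇ⇒≡ (sum η) n (Equivalence.from T-≡ eq)))))
  hS-no -[1+ _ ] η ne = refl

  sum-snoc : ∀ η m → sum (η ∷ʳ m) ≡ sum η ℕ.+ m
  sum-snoc []      m = ℕP.+-identityʳ m
  sum-snoc (n ∷ η) m = trans (cong (n ℕ.+_) (sum-snoc η m)) (sym (ℕP.+-assoc n (sum η) m))

  hS-snoc : ∀ a η m → hS a (η ∷ʳ m) ≡ hS (a -ᶻ + m) η
  hS-snoc a η m with (a -ᶻ + m) ℤ.≟ + sum η
  ... | yes e = trans (hS-yes a (η ∷ʳ m) (trans (back a (+ m)) (trans (cong (_+ᶻ + m) e) (cong +_ (sym (sum-snoc η m)))))) (sym (hS-yes _ η e))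
    where
    back : ∀ a m → a ≡ (a -ᶻ m) +ᶻ m
    back = solve-∀
  ... | no ne = trans (hS-no a (η ∷ʳ m) λ e → ne (trans (cong (_-ᶻ + m) (trans e (cong +_ (sum-snoc η m)))) (back (+ sum η) (+ m)))) (sym (hS-no _ η ne))
    where
    back : ∀ a m → (a +ᶻ m) -ᶻ m ≡ a
    back = solve-∀

  oneS-snoc-zero : ∀ η → oneS (η ∷ʳ 0) ≡ oneS η
  oneS-snoc-zero []          = refl
  oneS-snoc-zero (zero ∷ η)  = oneS-snoc-zero η
  oneS-snoc-zero (suc n ∷ η) = refl

  oneS-snoc-suc : ∀ η m → oneS (η ∷ʳ suc m) ≡ 0ℤ
  oneS-snoc-suc []          m = refl
  oneS-snoc-suc (zero ∷ η)  m = oneS-snoc-suc η m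
  oneS-snoc-suc (suc n ∷ η) m = refl

  lift : (Weight → ℤ) → Graded
  lift Φ zero    γ = Φ γ
  lift Φ (suc d) γ = 0ℤ

  lift-cong : ∀ {Φ Φ′ : Weight → ℤ} {Q : Weight → Set} → (∀ {γ} → Q γ → Φ γ ≡ Φ′ γ) → ∀ d {γ} → Q γ → lift Φ d γ ≡ lift Φ′ d γ
  lift-cong h zero    q = h q
  lift-cong h (suc d) q = refl

  ⊛-E : ∀ u (X : Weight → Ser) Ψ d γ η → (u ⊛ (λ ξ → E (lift (λ γ′ → X γ′ ξ)) Ψ d γ)) η ≡ E (lift (λ γ′ → (u ⊛ X γ′) η)) Ψ d γ
  ⊛-E u X []      zero    γ η = refl
  ⊛-E u X []      (suc d) γ η = ⊛-zeroʳ u (λ _ → refl) η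
  ⊛-E u X (α ∷ Ψ) zero    γ η = ⊛-E u X Ψ zero γ η
  ⊛-E u X (α ∷ Ψ) (suc d) γ η = trans (⊛-+ʳ u (λ ξ → E (lift (λ γ′ → X γ′ ξ)) Ψ (suc d) γ) (λ ξ → E (lift (λ γ′ → X γ′ ξ)) (α ∷ Ψ) d (γ ⊞ α)) η)
    (cong₂ _+ᶻ_ (⊛-E u X Ψ (suc d) γ η) (⊛-E u X (α ∷ Ψ) d (γ ⊞ α) η))

  sumFℤ-E : ∀ n (s : Fin n → ℤ) (X : Fin n → Weight → ℤ) Ψ d γ →
    sumFℤ n (λ j → s j *ᶻ E (lift (X j)) Ψ d γ) ≡ E (lift (λ γ′ → sumFℤ n (λ j → s j *ᶻ X j γ′))) Ψ d γ
  sumFℤ-E n s X []      zero    γ = refl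
  sumFℤ-E n s X []      (suc d) γ = sumFℤ-zero n λ j → ℤP.*-zeroʳ (s j)
  sumFℤ-E n s X (α ∷ Ψ) zero    γ = sumFℤ-E n s X Ψ zero γ
  sumFℤ-E n s X (α ∷ Ψ) (suc d) γ = trans (sumFℤ-cong n λ j → ℤP.*-distribˡ-+ (s j) (E (lift (X j)) Ψ (suc d) γ) (E (lift (X j)) (α ∷ Ψ) d (γ ⊞ α)))
    (trans (sumFℤ-+ n (λ j → s j *ᶻ E (lift (X j)) Ψ (suc d) γ) (λ j → s j *ᶻ E (lift (X j)) (α ∷ Ψ) d (γ ⊞ α)))
      (cong₂ _+ᶻ_ (sumFℤ-E n s X Ψ (suc d) γ) (sumFℤ-E n s X (α ∷ Ψ) d (γ ⊞ α))))

  -- Using the root `(g , v)` moves a box from row `v` to the index `g`, which thus records how many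
  -- boxes have been taken away.
  lowsFrom : ℕ → ℕ → ℕ → List Root
  lowsFrom g i zero    = []
  lowsFrom g i (suc n) = (g , i) ∷ lowsFrom g (suc i) n

  ⊞[]-other : ∀ {g i x} a γ → x ≢ g → x ≢ i → (γ ⊞[ a ] (g , i)) x ≡ γ x
  ⊞[]-other zero    γ p q = refl
  ⊞[]-other {g} {i} {x} (suc a) γ p q = trans (⊞[]-other a (γ ⊞ (g , i)) p q)
    (trans (cong₂ (λ u v → γ x +ᶻ (u -ᶻ v)) (unit-other (p ∘ sym)) (unit-other (q ∘ sym))) (ℤP.+-identityʳ (γ x)))

  ⊞[]-lower : ∀ {g i} a γ → i ≢ g → (γ ⊞[ a ] (g , i)) i ≡ γ i -ᶻ + a
  ⊞[]-lower zero    γ p = sym (ℤP.+-identityʳ _)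
  ⊞[]-lower {g} {i} (suc a) γ p = trans (⊞[]-lower a (γ ⊞ (g , i)) p)
    (trans (cong₂ (λ u v → γ i +ᶻ (u -ᶻ v) -ᶻ + a) (unit-other (p ∘ sym)) (unit-same i)) (shuffle (γ i) (+ a)))
    where
    shuffle : ∀ x a → x +ᶻ (0ℤ -ᶻ 1ℤ) -ᶻ a ≡ x -ᶻ (1ℤ +ᶻ a)
    shuffle = solve-∀

  lows-closed : ∀ g v a i n → v ℕ.< i → g ≢ v → Closed (λ γ → γ v ≡ a) (lowsFrom g i n)
  lows-closed g v a i zero    p q = []
  lows-closed g v a i (suc n) p q = (λ {γ} e → trans (⊞[]-other {g} {i} {v} 1 γ (q ∘ sym) (ℕP.<⇒≢ p)) e) ∷ lows-closed g v a (suc i) n (ℕP.m<n⇒m<1+n p) q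

  -- Extracting the coefficient of the last variable lowers the rows of γ by nonnegative integers with sum m.
  D-snoc : ∀ n g i γ (c : Fin n → ℕ) η m → i ℕ.+ n ℕ.≤ g →
    D n (jacobiTrudi i γ c) (η ∷ʳ m) ≡ E (lift (λ γ′ → D n (jacobiTrudi i γ′ c) η)) (lowsFrom g i n) m γ
  D-snoc zero g i γ c η zero    p = oneS-snoc-zero η
  D-snoc zero g i γ c η (suc m) p = oneS-snoc-suc η m
  D-snoc (suc n) g i γ c η m p = trans (D-suc n (jacobiTrudi i γ c) (η ∷ʳ m)) (trans
    (sumFℤ-cong (suc n) λ j → trans (cong (sg j *ᶻ_) (column j)) (sym (conv-*ˡ m (sg j) (λ a b → E (lift (X j a)) L b (γ ⊞[ a ] (g , i))))))
    (trans (sym (conv-sumFℤ m (suc n) (λ j a b → sg j *ᶻ E (lift (X j a)) L b (γ ⊞[ a ] (g , i)))))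
    (trans (conv-cong m collect) (sym (E-conv _ (g , i) L m γ)))))
    where
    L = lowsFrom g (suc i) n
    sg : Fin (suc n) → ℤ
    sg j = altSign (toℕ j)
    i<g : i ℕ.< g
    i<g = ℕP.≤-trans (ℕP.≤-trans (s≤s (ℕP.m≤m+n i n)) (ℕP.≤-reflexive (sym (ℕP.+-suc i n)))) p
    h : Fin (suc n) → ℕ → Ser
    h j a = hS (entry i γ (c j) 0 -ᶻ + a)
    X : Fin (suc n) → ℕ → Weight → ℤ
    X j a γ′ = (h j a ⊛ D n (jacobiTrudi (suc i) γ′ (c ∘ punchIn j))) η
    lowered : ∀ j a → D n (jacobiTrudi (suc i) γ (c ∘ punchIn j)) ≈ D n (jacobiTrudi (suc i) (γ ⊞[ a ] (g , i)) (c ∘ punchIn j))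
    lowered j a = D-cong< n λ {r} r<n j′ ξ → cong (λ z → hS ((z +ᶻ + c (punchIn j j′)) -ᶻ + (suc i ℕ.+ r)) ξ)
      (sym (⊞[]-other a γ (ℕP.<⇒≢ (ℕP.≤-trans (s≤s (ℕP.+-monoʳ-< i r<n)) (ℕP.≤-trans (ℕP.≤-reflexive (sym (ℕP.+-suc i n))) p))) (ℕP.<⇒≢ (s≤s (ℕP.m≤m+n i r)) ∘ sym)))
    column : ∀ j → (jacobiTrudi i γ c 0 j ⊛ D n (minor j (jacobiTrudi i γ c))) (η ∷ʳ m) ≡ conv m (λ a b → E (lift (X j a)) L b (γ ⊞[ a ] (g , i)))
    column j = trans (⊛-snoc (jacobiTrudi i γ c 0 j) (D n (minor j (jacobiTrudi i γ c))) η m) (conv-cong m λ a b →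
      trans (⊛-cong (λ ξ → hS-snoc (entry i γ (c j) 0) ξ a)
        (λ ξ → trans (minor-jacobiTrudi i γ c j (ξ ∷ʳ b)) (trans (lowered j a (ξ ∷ʳ b)) (D-snoc n g (suc i) (γ ⊞[ a ] (g , i)) (c ∘ punchIn j) ξ b
          (ℕP.≤-trans (ℕP.≤-reflexive (sym (ℕP.+-suc i n))) p)))) η)
        (⊛-E (h j a) (λ γ′ → D n (jacobiTrudi (suc i) γ′ (c ∘ punchIn j))) L b (γ ⊞[ a ] (g , i)) η))
    collect : ∀ a b → sumFℤ (suc n) (λ j → sg j *ᶻ E (lift (X j a)) L b (γ ⊞[ a ] (g , i))) ≡ E (lift (λ γ′ → D (suc n) (jacobiTrudi i γ′ c) η)) L b (γ ⊞[ a ] (g , i))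
    collect a b = trans (sumFℤ-E (suc n) sg (λ j → X j a) L b (γ ⊞[ a ] (g , i)))
      -- The roots in `L` leave row `i` alone, so its entry is still lowered by exactly `a` and the
      -- first row can be put back into the determinant.
      (E-agree (λ γ′ → γ′ i ≡ γ i -ᶻ + a) (lows-closed g i (γ i -ᶻ + a) (suc i) n ℕP.≤-refl (ℕP.<⇒≢ i<g ∘ sym))
        (lift-cong {Q = λ γ′ → γ′ i ≡ γ i -ᶻ + a} λ {γ′} e → sym (trans (D-suc n (jacobiTrudi i γ′ c) η) (sumFℤ-cong (suc n) λ j → cong (sg j *ᶻ_)
          (⊛-cong (λ ξ → cong (λ z → hS z ξ) (head γ′ e j)) (minor-jacobiTrudi i γ′ c j) η))))
        b (⊞[]-lower a γ (ℕP.<⇒≢ i<g)))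
      where
      head : ∀ γ′ → γ′ i ≡ γ i -ᶻ + a → ∀ j → entry i γ′ (c j) 0 ≡ entry i γ (c j) 0 -ᶻ + a
      head γ′ e j rewrite ℕP.+-identityʳ i = trans (cong (λ z → (z +ᶻ + c j) -ᶻ + i) e) (shuffle (γ i) (+ a) (+ c j) (+ i))
        where
        shuffle : ∀ x a c i → ((x -ᶻ a) +ᶻ c) -ᶻ i ≡ ((x +ᶻ c) -ᶻ i) -ᶻ a
        shuffle = solve-∀

-- Vanishing of determinants for reasons of degree.

module SchurDegree where
  open import Defs
  open Sums
  open Det
  open Expand
  open Schur
  open import Data.Nat as ℕ using (ℕ; zero; suc; s≤s; z≤n)
  import Data.Nat.Properties as ℕP
  open import Data.Integer as ℤ using (ℤ; +_; -[1+_]; 0ℤ; 1ℤ) renaming (_+_ to _+ᶻ_; _*_ to _*ᶻ_; -_ to -ᶻ_; _-_ to _-ᶻ_)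
  import Data.Integer.Properties as ℤP
  open import Data.Integer.Tactic.RingSolver using (solve-∀)
  open import Data.Fin as Fin using (Fin; toℕ; punchIn)
  open import Data.List using ([])
  open import Data.List.Relation.Unary.All using ([])
  open import Data.Empty using (⊥; ⊥-elim)
  open import Function using (_∘_)
  open import Relation.Nullary using (yes; no)
  open import Relation.Binary.PropositionalEquality

  -- The shift by ρ in `dot` compensates for the row index in the entries, so that `dot y` exchanges
  -- two rows of the matrix.
  D-dot : ∀ {ℓ} y γ → suc y ℕ.< ℓ → ∀ η → D ℓ (jacobiTrudi 0 (dot y γ) toℕ) η ≡ -ᶻ D ℓ (jacobiTrudi 0 γ toℕ) η
  D-dot {ℓ} y γ p η = trans (D-cong ℓ (λ r j ξ → cong (λ a → hS a ξ) (entries r (toℕ j))) η) (D-swap y ℓ (jacobiTrudi 0 γ toℕ) p η)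
    where
    cancel : ∀ g s r c → ((g -ᶻ s +ᶻ r) +ᶻ c) -ᶻ r ≡ (g +ᶻ c) -ᶻ s
    cancel = solve-∀
    entries : ∀ r c → entry 0 (dot y γ) c r ≡ entry 0 γ c (swapRow y r)
    entries r c = cancel (γ (swapRow y r)) (+ swapRow y r) (+ r) (+ c)

  sumFℤ-punchIn : ∀ n (f : Fin (suc n) → ℤ) j → sumFℤ (suc n) f ≡ f j +ᶻ sumFℤ n (f ∘ punchIn j)
  sumFℤ-punchIn n       f Fin.zero    = refl
  sumFℤ-punchIn (suc n) f (Fin.suc j) = trans (cong (f Fin.zero +ᶻ_) (sumFℤ-punchIn n (f ∘ Fin.suc) j)) (swap (f Fin.zero) (f (Fin.suc j)) _)
    where
    swap : ∀ a b c → a +ᶻ (b +ᶻ c) ≡ b +ᶻ (a +ᶻ c)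
    swap = solve-∀

  sumFℤ-mono : ∀ n {f g : Fin n → ℤ} → (∀ j → f j ℤ.≤ g j) → sumFℤ n f ℤ.≤ sumFℤ n g
  sumFℤ-mono zero    h = ℤP.≤-refl
  sumFℤ-mono (suc n) h = ℤP.+-mono-≤ (h Fin.zero) (sumFℤ-mono n (h ∘ Fin.suc))

  -- The degree of the determinant of the rows i, ..., i + n - 1 and columns c.
  degree : ∀ n → ℕ → Weight → (Fin n → ℕ) → ℤ
  degree n i γ c = sumFℤ n (λ j → γ (i ℕ.+ toℕ j) -ᶻ + (i ℕ.+ toℕ j)) +ᶻ sumFℤ n (λ j → + c j)

  degree-minor : ∀ n i γ (c : Fin (suc n) → ℕ) j → degree (suc n) i γ c ≡ entry i γ (c j) 0 +ᶻ degree n (suc i) γ (c ∘ punchIn j)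
  degree-minor n i γ c j = trans (cong₂ _+ᶻ_ (cong (γ (i ℕ.+ 0) -ᶻ + (i ℕ.+ 0) +ᶻ_) (sumFℤ-cong n λ j′ → cong (λ z → γ z -ᶻ + z) (ℕP.+-suc i (toℕ j′))))
    (sumFℤ-punchIn n (+_ ∘ c) j)) (shuffle (γ (i ℕ.+ 0)) (+ (i ℕ.+ 0)) (sumFℤ n (λ j → γ (suc i ℕ.+ toℕ j) -ᶻ + (suc i ℕ.+ toℕ j))) (+ c j) (sumFℤ n (λ j′ → + c (punchIn j j′))))
    where
    shuffle : ∀ g r s c d → (g -ᶻ r +ᶻ s) +ᶻ (c +ᶻ d) ≡ ((g +ᶻ c) -ᶻ r) +ᶻ (s +ᶻ d)
    shuffle = solve-∀

  -- In the first row an entry of negative index vanishes, and one of nonnegative index leaves a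
  -- minor that again has negative degree.
  D-negative : ∀ n i γ (c : Fin n → ℕ) η → degree n i γ c ℤ.< 0ℤ → D n (jacobiTrudi i γ c) η ≡ 0ℤ
  D-negative zero    i γ c η p = ⊥-elim (ℤP.<-irrefl refl p)
  D-negative (suc n) i γ c η p = D-zero n {jacobiTrudi i γ c} η λ j → column j (entry i γ (c j) 0) refl
    where
    column : ∀ j a → entry i γ (c j) 0 ≡ a → (jacobiTrudi i γ c 0 j ⊛ D n (minor j (jacobiTrudi i γ c))) η ≡ 0ℤ
    column j -[1+ a ] e = ⊛-zeroˡ (D n (minor j (jacobiTrudi i γ c))) (λ ξ → cong (λ z → hS z ξ) e) η
    column j (+ a)    e = ⊛-zeroʳ (jacobiTrudi i γ c 0 j) (λ ξ → trans (minor-jacobiTrudi i γ c j ξ) (D-negative n (suc i) γ (c ∘ punchIn j) ξ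
      (ℤP.≤-<-trans (ℤP.i≤j+i (degree n (suc i) γ (c ∘ punchIn j)) (+ a)) (subst (ℤ._< 0ℤ) (trans (degree-minor n i γ c j) (cong (_+ᶻ degree n (suc i) γ (c ∘ punchIn j)) e)) p)))) η

  punchIn-≤ : ∀ {n} (j : Fin (suc n)) j′ → toℕ (punchIn j j′) ℕ.≤ suc (toℕ j′)
  punchIn-≤ Fin.zero    j′           = ℕP.≤-refl
  punchIn-≤ (Fin.suc j) Fin.zero     = z≤n
  punchIn-≤ (Fin.suc j) (Fin.suc j′) = s≤s (punchIn-≤ j j′)

  tailSum : ℕ → Weight → ℕ → ℤ
  tailSum n γ y = sumFℤ n (λ j → γ (y ℕ.+ toℕ j))

  -- Expanding along the first `y` rows leaves minors of the last `n` rows. The bound on `c`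
  -- survives the deletion of columns and keeps the degree of these minors at most the tail sum.
  D-negative-tail : ∀ y n i γ (c : Fin (y ℕ.+ n) → ℕ) η → (∀ j → c j ℕ.≤ toℕ j ℕ.+ i) → tailSum n γ (i ℕ.+ y) ℤ.< 0ℤ →
    D (y ℕ.+ n) (jacobiTrudi i γ c) η ≡ 0ℤ
  D-negative-tail zero n i γ c η le p = D-negative n i γ c η (ℤP.≤-<-trans bound p)
    where
    bound : degree n i γ c ℤ.≤ tailSum n γ (i ℕ.+ 0)
    bound = subst₂ ℤ._≤_ (sumFℤ-+ n (λ j → γ (i ℕ.+ toℕ j) -ᶻ + (i ℕ.+ toℕ j)) (λ j → + c j)) (cong (tailSum n γ) (sym (ℕP.+-identityʳ i)))
      (sumFℤ-mono n λ j → subst ((γ (i ℕ.+ toℕ j) -ᶻ + (i ℕ.+ toℕ j)) +ᶻ + c j ℤ.≤_) (restore (γ (i ℕ.+ toℕ j)) (+ (i ℕ.+ toℕ j)))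
        (ℤP.+-monoʳ-≤ (γ (i ℕ.+ toℕ j) -ᶻ + (i ℕ.+ toℕ j)) (ℤ.+≤+ (ℕP.≤-trans (le j) (ℕP.≤-reflexive (ℕP.+-comm (toℕ j) i))))))
      where
      restore : ∀ g r → (g -ᶻ r) +ᶻ r ≡ g
      restore = solve-∀
  D-negative-tail (suc y) n i γ c η le p = D-zero (y ℕ.+ n) {jacobiTrudi i γ c} η λ j → ⊛-zeroʳ (jacobiTrudi i γ c 0 j)
    (λ ξ → trans (minor-jacobiTrudi i γ c j ξ) (D-negative-tail y n (suc i) γ (c ∘ punchIn j) ξ
      (λ j′ → ℕP.≤-trans (le (punchIn j j′)) (ℕP.≤-trans (ℕP.+-monoˡ-≤ i (punchIn-≤ j j′)) (ℕP.≤-reflexive (sym (ℕP.+-suc (toℕ j′) i)))))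
      (subst (λ z → tailSum n γ z ℤ.< 0ℤ) (ℕP.+-suc i y) p))) η

  -- Without variables only the complete homogeneous function of degree 0 survives, so the factors
  -- of a nonzero term have total degree 0.
  D-positive-nil : ∀ n i γ (c : Fin n → ℕ) → 0ℤ ℤ.< degree n i γ c → D n (jacobiTrudi i γ c) [] ≡ 0ℤ
  D-positive-nil zero    i γ c p = ⊥-elim (ℤP.<-irrefl refl p)
  D-positive-nil (suc n) i γ c p = D-zero n {jacobiTrudi i γ c} [] λ j → trans (⊛-nil (jacobiTrudi i γ c 0 j) (D n (minor j (jacobiTrudi i γ c)))) (column j)
    where
    column : ∀ j → hS (entry i γ (c j) 0) [] *ᶻ D n (minor j (jacobiTrudi i γ c)) [] ≡ 0ℤ
    column j with entry i γ (c j) 0 ℤ.≟ 0ℤ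
    ... | no ne = trans (cong (_*ᶻ D n (minor j (jacobiTrudi i γ c)) []) (hS-no (entry i γ (c j) 0) [] ne)) (ℤP.*-zeroˡ (D n (minor j (jacobiTrudi i γ c)) []))
    ... | yes e = trans (cong (hS (entry i γ (c j) 0) [] *ᶻ_) (trans (minor-jacobiTrudi i γ c j []) (D-positive-nil n (suc i) γ (c ∘ punchIn j)
      (subst (0ℤ ℤ.<_) (trans (degree-minor n i γ c j) (trans (cong (_+ᶻ degree n (suc i) γ (c ∘ punchIn j)) e) (ℤP.+-identityˡ _))) p)))) (ℤP.*-zeroʳ (hS (entry i γ (c j) 0) []))

  -- Without variables this matrix is the identity.
  D-unit : ∀ n i γ (c : Fin n → ℕ) → (∀ x → γ x ≡ 0ℤ) → (∀ j → c j ≡ toℕ j ℕ.+ i) → D n (jacobiTrudi i γ c) [] ≡ 1ℤ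
  D-unit zero    i γ c z ce = refl
  D-unit (suc n) i γ c z ce = trans (D-suc n (jacobiTrudi i γ c) []) (trans (cong₂ _+ᶻ_ head (sumFℤ-zero n rest)) refl)
    where
    entry-≡ : ∀ j → entry i γ (c j) 0 ≡ + toℕ j
    entry-≡ j rewrite z (i ℕ.+ 0) | ce j | ℕP.+-identityʳ i = cancel (+ toℕ j) (+ i)
      where
      cancel : ∀ a b → (0ℤ +ᶻ (a +ᶻ b)) -ᶻ b ≡ a
      cancel = solve-∀
    minor-one : D n (minor Fin.zero (jacobiTrudi i γ c)) [] ≡ 1ℤ
    minor-one = trans (minor-jacobiTrudi i γ c Fin.zero []) (D-unit n (suc i) γ (c ∘ Fin.suc) z λ j → trans (ce (Fin.suc j)) (sym (ℕP.+-suc (toℕ j) i)))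
    head : 1ℤ *ᶻ (jacobiTrudi i γ c 0 Fin.zero ⊛ D n (minor Fin.zero (jacobiTrudi i γ c))) [] ≡ 1ℤ
    head = trans (ℤP.*-identityˡ _) (trans (⊛-nil (jacobiTrudi i γ c 0 Fin.zero) (D n (minor Fin.zero (jacobiTrudi i γ c))))
      (cong₂ _*ᶻ_ (hS-yes (entry i γ (c Fin.zero) 0) [] (entry-≡ Fin.zero)) minor-one))
    rest : ∀ j → altSign (toℕ (Fin.suc j)) *ᶻ (jacobiTrudi i γ c 0 (Fin.suc j) ⊛ D n (minor (Fin.suc j) (jacobiTrudi i γ c))) [] ≡ 0ℤ
    rest j = trans (cong (altSign (toℕ (Fin.suc j)) *ᶻ_) (trans (⊛-nil (jacobiTrudi i γ c 0 (Fin.suc j)) (D n (minor (Fin.suc j) (jacobiTrudi i γ c))))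
      (trans (cong (_*ᶻ D n (minor (Fin.suc j) (jacobiTrudi i γ c)) []) (hS-no (entry i γ (c (Fin.suc j)) 0) [] λ e → absurd (trans (sym (entry-≡ (Fin.suc j))) e))) (ℤP.*-zeroˡ (D n (minor (Fin.suc j) (jacobiTrudi i γ c)) [])))))
      (ℤP.*-zeroʳ (altSign (toℕ (Fin.suc j))))
      where
      absurd : + suc (toℕ j) ≡ + 0 → ⊥
      absurd ()

-- Straightening of Catalan functions with a ghost row.

module Straighten where
  open import Defs
  open Blocks using (unique-set-↭)
  open Grow using (∈-filterᵇ⁺; ∈-filterᵇ⁻)
  open Det
  open Expand
  open Schur
  open SchurDegree
  open Linear
  open import Data.Bool using (Bool)
  open import Data.Bool.Properties using (T?)
  open import Data.Nat using (ℕ; zero; suc; _+_; _≤_; _<_; s≤s; _≤ᵇ_)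
  open import Data.Nat.Properties
  open import Data.Integer using (ℤ; +_; -[1+_]; 0ℤ; 1ℤ) renaming (_+_ to _+ᶻ_; -_ to -ᶻ_; _-_ to _-ᶻ_)
  import Data.Integer.Properties as ℤP
  open import Data.Integer.Tactic.RingSolver using (solve-∀)
  open import Data.Fin using (toℕ)
  open import Data.List using (List; []; _∷_; map; upTo; filterᵇ; cartesianProduct)
  open import Data.List.Membership.Propositional using (_∈_)
  open import Data.List.Membership.Propositional.Properties using (∈-map⁺; ∈-map⁻; ∈-upTo⁺; ∈-upTo⁻; ∈-cartesianProduct⁺; ∈-cartesianProduct⁻)
  open import Data.List.Relation.Unary.Any using (here; there)
  open import Data.List.Relation.Unary.All as All using (All; []; _∷_)
  open import Data.List.Relation.Unary.AllPairs as AllPairs using (AllPairs)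
  open import Data.List.Relation.Unary.Unique.Propositional using (Unique)
  import Data.List.Relation.Unary.Unique.Propositional.Properties as UniqueP
  open import Data.List.Relation.Binary.Permutation.Propositional using (_↭_)
  open import Data.Product using (_×_; _,_)
  open import Data.Sum using (inj₁; inj₂)
  open import Data.Empty using (⊥; ⊥-elim)
  open import Function using (_∘_; id)
  open import Relation.Nullary using (Dec; yes; no)
  open import Relation.Binary.PropositionalEquality

  -- Multiplication by t ^ m of a power series given by its coefficients.
  infixl 7 _↑_
  _↑_ : (ℕ → ℤ) → ℕ → ℕ → ℤ
  (f ↑ zero)  d       = f d
  (f ↑ suc m) zero    = 0ℤ
  (f ↑ suc m) (suc d) = (f ↑ m) d

  ↑-cong : ∀ {f g} m → (∀ d → f d ≡ g d) → ∀ d → (f ↑ m) d ≡ (g ↑ m) d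
  ↑-cong zero    e d       = e d
  ↑-cong (suc m) e zero    = refl
  ↑-cong (suc m) e (suc d) = ↑-cong m e d

  ↑-zero : ∀ {f} m → (∀ d → f d ≡ 0ℤ) → ∀ d → (f ↑ m) d ≡ 0ℤ
  ↑-zero zero    e d       = e d
  ↑-zero (suc m) e zero    = refl
  ↑-zero (suc m) e (suc d) = ↑-zero m e d

  ↑-+ : ∀ f m m′ d → ((f ↑ m) ↑ m′) d ≡ (f ↑ (m′ + m)) d
  ↑-+ f m zero     d       = refl
  ↑-+ f m (suc m′) zero    = refl
  ↑-+ f m (suc m′) (suc d) = ↑-+ f m m′ d

  upd : (ℕ → ℕ) → ℕ → ℕ → ℕ → ℕ
  upd σ i v x with x ≟ i
  ... | yes _ = v
  ... | no _  = σ x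

  upd-same : ∀ σ i v → upd σ i v i ≡ v
  upd-same σ i v with i ≟ i
  ... | yes _ = refl
  ... | no ne = ⊥-elim (ne refl)

  upd-other : ∀ σ {i v x} → x ≢ i → upd σ i v x ≡ σ x
  upd-other σ {i} {v} {x} ne with x ≟ i
  ... | yes e = ⊥-elim (ne e)
  ... | no _  = refl

  -- σ′ arises from σ by removing the root (i , σ i).
  record Removes (σ σ′ : ℕ → ℕ) (i : ℕ) : Set where
    constructor removes
    field
      moved : σ′ i ≡ suc (σ i)
      fixed : ∀ {x} → x ≢ i → σ′ x ≡ σ x

  -- Selects the terms in which the additional variable ends with exponent 0.
  indicator : ℤ → ℤ → ℤ
  indicator (+ zero) a = a
  indicator _        a = 0ℤ

  indicator-neg : ∀ b a → indicator b (-ᶻ a) ≡ -ᶻ indicator b a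
  indicator-neg (+ zero)  a = refl
  indicator-neg (+ suc b) a = refl
  indicator-neg -[1+ b ]  a = refl

  module Straightening (k ℓ : ℕ) (η : List ℕ) where

    -- Index ℓ is an additional variable z_ℓ = 1 / u, so that a root (ℓ , i) stands for a factor 1 / (1 - t u⁻¹ / z_i).
    Φ : Weight → ℤ
    Φ γ = indicator (γ ℓ) (D ℓ (jacobiTrudi 0 γ toℕ) η)

    G : Graded
    G = lift Φ

    D-respects : ∀ {γ γ′} → (∀ {x} → x < ℓ → γ x ≡ γ′ x) → D ℓ (jacobiTrudi 0 γ toℕ) η ≡ D ℓ (jacobiTrudi 0 γ′ toℕ) η
    D-respects e = D-cong< ℓ (λ {r} p j ξ → cong (λ z → hS ((z +ᶻ + toℕ j) -ᶻ + r) ξ) (e p)) η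

    G-respects : Respects G
    G-respects zero    {γ} {γ′} e = cong₂ indicator (e ℓ) (D-respects {γ} {γ′} λ {x} _ → e x)
    G-respects (suc d) e = refl

    G-alternating : ∀ {y} → suc y < ℓ → Alternating y G
    G-alternating {y} p zero    γ = trans (cong₂ indicator ghost (D-dot {ℓ} y γ p η)) (indicator-neg (γ ℓ) (D ℓ (jacobiTrudi 0 γ toℕ) η))
      where
      stay : ∀ a c → a -ᶻ c +ᶻ c ≡ a
      stay = solve-∀
      ghost : dot y γ ℓ ≡ γ ℓ
      ghost rewrite swapRow-other {y} {ℓ} (<⇒≢ (<-trans (n<1+n y) p) ∘ sym) (<⇒≢ p ∘ sym) = stay (γ ℓ) (+ ℓ)
    G-alternating p (suc d) γ = refl

    grid : List Root
    grid = cartesianProduct (upTo (suc ℓ)) (upTo ℓ)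

    inIdeal : (ℕ → ℕ) → Root → Bool
    inIdeal σ (i , j) = σ i ≤ᵇ j

    -- For the ghost, `σ ℓ = z` means that the roots `(ℓ , z)`, ..., `(ℓ , ℓ - 1)` are present, and
    -- `σ ℓ = ℓ` that there are none.
    Roots : (ℕ → ℕ) → List Root
    Roots σ = filterᵇ (inIdeal σ) grid

    ∈-Roots⁺ : ∀ {σ i j} → i ≤ ℓ → j < ℓ → σ i ≤ j → (i , j) ∈ Roots σ
    ∈-Roots⁺ {σ} p q r = ∈-filterᵇ⁺ (inIdeal σ) (∈-cartesianProduct⁺ (∈-upTo⁺ (s≤s p)) (∈-upTo⁺ q)) (≤⇒≤ᵇ r)

    ∈-Roots⁻ : ∀ {σ i j} → (i , j) ∈ Roots σ → i ≤ ℓ × j < ℓ × σ i ≤ j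
    ∈-Roots⁻ {σ} {i} {j} p with ∈-filterᵇ⁻ (inIdeal σ) p
    ... | q , r with ∈-cartesianProduct⁻ (upTo (suc ℓ)) (upTo ℓ) q
    ...   | a , b = ≤-pred (∈-upTo⁻ a) , ∈-upTo⁻ b , ≤ᵇ⇒≤ (σ i) j r

    Roots-unique : ∀ σ → Unique (Roots σ)
    Roots-unique σ = UniqueP.filter⁺ (T? ∘ inIdeal σ) (UniqueP.cartesianProduct⁺ (UniqueP.upTo⁺ (suc ℓ)) (UniqueP.upTo⁺ ℓ))

    Roots-agree : ∀ {σ σ′} → (∀ {x} → x ≤ ℓ → σ x ≡ σ′ x) → Roots σ ↭ Roots σ′
    Roots-agree {σ} {σ′} e = unique-set-↭ (Roots-unique σ) (Roots-unique σ′) (to e) (to (sym ∘ e))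
      where
      to : ∀ {σ σ′} → (∀ {x} → x ≤ ℓ → σ x ≡ σ′ x) → ∀ {x} → x ∈ Roots σ → x ∈ Roots σ′
      to {σ} {σ′} e {i , j} p with ∈-Roots⁻ {σ} p
      ... | a , b , c = ∈-Roots⁺ {σ′} a b (≤-trans (≤-reflexive (sym (e a))) c)

    Roots-remove : ∀ {σ σ′ i} → Removes σ σ′ i → i ≤ ℓ → σ i < ℓ → Roots σ ↭ (i , σ i) ∷ Roots σ′
    Roots-remove {σ} {σ′} {i} (removes moved fixed) p q = unique-set-↭ (Roots-unique σ) (All.tabulate new AllPairs.∷ Roots-unique σ′) to from
      where
      new : ∀ {x} → x ∈ Roots σ′ → (i , σ i) ≢ x
      new m refl with ∈-Roots⁻ {σ′} m
      ... | _ , _ , c = lin⊥ (σ′ i ∷ σ i ∷ []) (:≤ v0 v1 c ∷ :≥ (1+ v1) v0 moved ∷ [])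
      to : ∀ {x} → x ∈ Roots σ → x ∈ (i , σ i) ∷ Roots σ′
      to {a , b} m with ∈-Roots⁻ {σ} m
      ... | u , v , w with a ≟ i
      ...   | no ne = there (∈-Roots⁺ {σ′} u v (≤-trans (≤-reflexive (fixed ne)) w))
      ...   | yes refl with m≤n⇒m<n∨m≡n w
      ...     | inj₁ lt   = there (∈-Roots⁺ {σ′} u v (≤-trans (≤-reflexive moved) lt))
      ...     | inj₂ refl = here refl
      from : ∀ {x} → x ∈ (i , σ i) ∷ Roots σ′ → x ∈ Roots σ
      from (here refl) = ∈-Roots⁺ {σ} p q ≤-refl
      from {a , b} (there m) with ∈-Roots⁻ {σ′} m
      ... | u , v , w with a ≟ i
      ...   | no ne    = ∈-Roots⁺ {σ} u v (≤-trans (≤-reflexive (sym (fixed ne))) w)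
      ...   | yes refl = ∈-Roots⁺ {σ} u v (lin (σ a ∷ b ∷ σ′ a ∷ []) v0 v1 (:≥ (1+ v0) v2 moved ∷ :≤ v2 v1 w ∷ []))

    Roots-same : ∀ {σ σ′ i} → Removes σ σ′ i → ℓ ≤ σ i → Roots σ ↭ Roots σ′
    Roots-same {σ} {σ′} {i} (removes moved fixed) q = unique-set-↭ (Roots-unique σ) (Roots-unique σ′) to from
      where
      to : ∀ {x} → x ∈ Roots σ → x ∈ Roots σ′
      to {a , b} m with ∈-Roots⁻ {σ} m
      ... | u , v , w with a ≟ i
      ...   | no ne    = ∈-Roots⁺ {σ′} u v (≤-trans (≤-reflexive (fixed ne)) w)
      ...   | yes refl = ⊥-elim (lin⊥ (ℓ ∷ σ a ∷ b ∷ []) (:≤ v0 v1 q ∷ :≤ (1+ v2) v0 v ∷ :≤ v1 v2 w ∷ []))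
      from : ∀ {x} → x ∈ Roots σ′ → x ∈ Roots σ
      from {a , b} m with ∈-Roots⁻ {σ′} m
      ... | u , v , w with a ≟ i
      ...   | no ne    = ∈-Roots⁺ {σ} u v (≤-trans (≤-reflexive (sym (fixed ne))) w)
      ...   | yes refl = ⊥-elim (lin⊥ (ℓ ∷ σ a ∷ σ′ a ∷ b ∷ []) (:≤ v0 v1 q ∷ :≥ (1+ v1) v2 moved ∷ :≤ (1+ v3) v0 v ∷ :≤ v2 v3 w ∷ []))

    F : (ℕ → ℕ) → ℕ → Weight → ℤ
    F σ = E G (Roots σ)

    F-respects : ∀ σ d {γ γ′} → γ ≗ γ′ → F σ d γ ≡ F σ d γ′
    F-respects σ = E-respects G-respects (Roots σ)

    F-agree : ∀ {σ σ′} → (∀ {x} → x ≤ ℓ → σ x ≡ σ′ x) → ∀ d γ → F σ d γ ≡ F σ′ d γ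
    F-agree e = E-↭ G-respects (Roots-agree e)

    -- The identity `1 / (1 - t α) = 1 + t α / (1 - t α)` for the first root `α` of row `i`.
    F-remove : ∀ {σ σ′ i} → Removes σ σ′ i → i ≤ ℓ → σ i < ℓ → ∀ d γ →
      F σ d γ ≡ F σ′ d γ +ᶻ ((λ d′ → F σ d′ (γ ⊞ (i , σ i))) ↑ 1) d
    F-remove {σ} {σ′} {i} R p q zero γ = trans (E-↭ G-respects (Roots-remove R p q) zero γ) (sym (ℤP.+-identityʳ _))
    F-remove {σ} {σ′} {i} R p q (suc d) γ = trans (E-↭ G-respects (Roots-remove R p q) (suc d) γ)
      (cong (F σ′ (suc d) γ +ᶻ_) (sym (E-↭ G-respects (Roots-remove R p q) d (γ ⊞ (i , σ i)))))

    -- The second term of `F-remove` is assumed to vanish; if the first root lies outside the grid,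
    -- there is no such term and the root set does not change.
    F-remove-zero : ∀ {σ σ′ i} → Removes σ σ′ i → i ≤ ℓ → ∀ {γ} → (∀ d → F σ d (γ ⊞ (i , σ i)) ≡ 0ℤ) → ∀ d → F σ d γ ≡ F σ′ d γ
    F-remove-zero {σ} {σ′} {i} R p {γ} z d with ≤-<-connex ℓ (σ i)
    ... | inj₁ q = E-↭ G-respects (Roots-same R q) d γ
    ... | inj₂ q = trans (F-remove R p q d γ) (trans (cong (F σ′ d γ +ᶻ_) (↑-zero 1 z d)) (ℤP.+-identityʳ _))

    -- Rows `y`, `y + 1` have the same roots and no row separates columns `y` and `y + 1`, so the
    -- root set is stable under exchanging these two indices.
    Symmetric : (ℕ → ℕ) → ℕ → Set
    Symmetric σ y = suc y < ℓ × σ y ≡ σ (suc y) × (∀ {i} → i ≤ ℓ → σ i ≢ suc y)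

    F-symmetric-zero : ∀ {σ y} → Symmetric σ y → ∀ d γ → γ y ≡ γ (suc y) -ᶻ 1ℤ → F σ d γ ≡ 0ℤ
    F-symmetric-zero {σ} {y} (p , e , h) = E-symmetric-zero G-respects (G-alternating p)
      (unique-set-↭ (UniqueP.map⁺ inj (Roots-unique σ)) (Roots-unique σ) to from)
      where
      swap² : ∀ (x : Root) → swapRoot y (swapRoot y x) ≡ x
      swap² (i , j) = cong₂ _,_ (swapRow-involutive y i) (swapRow-involutive y j)
      inj : ∀ {x z} → swapRoot y x ≡ swapRoot y z → x ≡ z
      inj {x} {z} q = trans (sym (swap² x)) (trans (cong (swapRoot y) q) (swap² z))
      bound : ∀ {i N} → suc y < N → i < N → swapRow y i < N
      bound {i} {N} u v with i ≟ y | i ≟ suc y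
      ... | yes refl | _        = subst (_< N) (sym (swapRow-left y)) u
      ... | no _     | yes refl = subst (_< N) (sym (swapRow-right y)) (<-trans (n<1+n y) u)
      ... | no a     | no b     = subst (_< N) (sym (swapRow-other a b)) v
      σ-swap : ∀ i → σ (swapRow y i) ≡ σ i
      σ-swap i with i ≟ y | i ≟ suc y
      ... | yes refl | _        = trans (cong σ (swapRow-left y)) (sym e)
      ... | no _     | yes refl = trans (cong σ (swapRow-right y)) e
      ... | no a     | no b     = cong σ (swapRow-other a b)
      column : ∀ {v j} → v ≢ suc y → v ≤ j → v ≤ swapRow y j
      column {v} {j} ne le with j ≟ y | j ≟ suc y
      ... | yes refl | _        = ≤-trans (m≤n⇒m≤1+n le) (≤-reflexive (sym (swapRow-left y)))
      ... | no _     | yes refl = ≤-trans (≤-pred (≤∧≢⇒< le ne)) (≤-reflexive (sym (swapRow-right y)))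
      ... | no a     | no b     = ≤-trans le (≤-reflexive (sym (swapRow-other a b)))
      closed : ∀ {x} → x ∈ Roots σ → swapRoot y x ∈ Roots σ
      closed {i , j} m with ∈-Roots⁻ {σ} m
      ... | a , b , c = ∈-Roots⁺ {σ} (≤-pred (bound (m<n⇒m<1+n p) (s≤s a))) (bound p b) (≤-trans (≤-reflexive (σ-swap i)) (column (h a) c))
      to : ∀ {x} → x ∈ map (swapRoot y) (Roots σ) → x ∈ Roots σ
      to m with ∈-map⁻ (swapRoot y) m
      ... | _ , q , refl = closed q
      from : ∀ {x} → x ∈ Roots σ → x ∈ map (swapRoot y) (Roots σ)
      from {x} m = subst (_∈ map (swapRoot y) (Roots σ)) (swap² x) (∈-map⁺ (swapRoot y) (closed m))

    -- The weight whose entry in row x is (k + 1) + x - σ x; the entry of the additional variable is - M.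
    wt : (ℕ → ℕ) → ℕ → Weight
    wt σ M x with x ≟ ℓ
    ... | yes _ = -ᶻ (+ M)
    ... | no _  = + (suc k + x) -ᶻ + σ x

    wt-row : ∀ {σ M x} → x ≢ ℓ → wt σ M x ≡ + (suc k + x) -ᶻ + σ x
    wt-row {σ} {M} {x} ne with x ≟ ℓ
    ... | yes e = ⊥-elim (ne e)
    ... | no _  = refl

    wt-ghost : ∀ {σ M} → wt σ M ℓ ≡ -ᶻ (+ M)
    wt-ghost with ℓ ≟ ℓ
    ... | yes _ = refl
    ... | no ne = ⊥-elim (ne refl)

    wt-agree : ∀ {σ σ′ M} → (∀ {x} → x ≢ ℓ → σ x ≡ σ′ x) → wt σ M ≗ wt σ′ M
    wt-agree {σ} {σ′} {M} e x with x ≟ ℓ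
    ... | yes _ = refl
    ... | no ne = cong (λ z → + (suc k + x) -ᶻ + z) (e ne)

    -- Root set and weight are both read off `σ`. The ghost starts with exponent `- M` and must end
    -- with 0, so every surviving term uses exactly `M` ghost roots, counted with multiplicity.
    𝕋 : (ℕ → ℕ) → ℕ → ℕ → ℤ
    𝕋 σ M d = F σ d (wt σ M)

    𝕋-agree : ∀ {σ σ′ M} → σ ≗ σ′ → ∀ d → 𝕋 σ M d ≡ 𝕋 σ′ M d
    𝕋-agree {σ} {σ′} {M} e d = trans (F-agree (λ {x} _ → e x) d (wt σ M)) (F-respects σ′ d (wt-agree λ {x} _ → e x))

    -- Equal offsets in adjacent rows mean weights that differ by 1, the situation in which `dot y`
    -- fixes the weight.
    tie-weight : ∀ {σ M y} → suc y < ℓ → σ y ≡ σ (suc y) → wt σ M y ≡ wt σ M (suc y) -ᶻ 1ℤ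
    tie-weight {σ} {M} {y} p e = trans (wt-row (<⇒≢ (<-trans (n<1+n y) p))) (trans (trans (cong (λ z → + (suc k + y) -ᶻ + z) e) (shift (+ (suc k + y)) (+ σ (suc y))))
      (cong (_-ᶻ 1ℤ) (sym (trans (wt-row (<⇒≢ p)) (cong (λ z → + z -ᶻ + σ (suc y)) (+-suc (suc k) y))))))
      where
      shift : ∀ a s → a -ᶻ s ≡ ((1ℤ +ᶻ a) -ᶻ s) -ᶻ 1ℤ
      shift = solve-∀

    𝕋-zero : ∀ {σ y M} → Symmetric σ y → ∀ d → 𝕋 σ M d ≡ 0ℤ
    𝕋-zero {σ} {y} {M} S@(p , e , _) d = F-symmetric-zero S d (wt σ M) (tie-weight {σ} {M} p e)

    -- Moving the first root of row x one column to the left across the tie of rows y, y + 1.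
    𝕋-step : ∀ {σ y x M} → suc y < ℓ → σ y ≡ σ (suc y) → y < σ y → x ≤ ℓ → σ x ≡ suc y → (∀ {i} → i ≤ ℓ → i ≢ x → σ i ≢ suc y) → x ≢ ℓ →
      ∀ d → 𝕋 σ M d ≡ (𝕋 (upd (upd σ x y) (suc y) (suc (σ (suc y)))) M ↑ 1) d
    𝕋-step {σ} {y} {x} {M} p tie y<w x≤ℓ σx uniq x≢ℓ d = trans (F-remove R⁺ x≤ℓ (subst (_< ℓ) (sym σx) p) d γ)
        (trans (cong (_+ᶻ ((λ d′ → F σ d′ (γ ⊞ (x , σ x))) ↑ 1) d) (F-symmetric-zero sym⁺ d γ tieγ)) (trans (ℤP.+-identityˡ _) (↑-cong 1 body d)))
      where
      γ = wt σ M
      tieγ : γ y ≡ γ (suc y) -ᶻ 1ℤ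
      tieγ = tie-weight {σ} {M} p tie
      y<ℓ : y < ℓ
      y<ℓ = <-trans (n<1+n y) p
      x≢y : x ≢ y
      x≢y refl = uniq (<⇒≤ p) (1+n≢n ∘ id) (trans (sym tie) σx)
      x≢y+1 : x ≢ suc y
      x≢y+1 refl = uniq (<⇒≤ y<ℓ) (λ e → 1+n≢n (sym e)) (trans tie σx)
      -- `σ⁺` drops the root `(x , y + 1)` from `σ`, `σ₂` adds `(x , y)` to `σ`, and `σ′` drops the
      -- first root of row `y + 1` from `σ₂`. Both `σ⁺` and `σ₂` are symmetric in `y` and `y + 1`;
      -- `σ` is not, because of row `x`.
      σ⁺ σ₂ σ′ : ℕ → ℕ
      σ⁺ = upd σ x (suc (suc y))
      σ₂ = upd σ x y
      σ′ = upd σ₂ (suc y) (suc (σ (suc y)))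
      R⁺ : Removes σ σ⁺ x
      R⁺ = removes (trans (upd-same σ x _) (cong suc (sym σx))) (upd-other σ)
      R₂ : Removes σ₂ σ x
      R₂ = removes (trans σx (cong suc (sym (upd-same σ x y)))) (λ ne → sym (upd-other σ ne))
      R′ : Removes σ₂ σ′ (suc y)
      R′ = removes (trans (upd-same σ₂ (suc y) _) (cong suc (sym (upd-other σ (x≢y+1 ∘ sym))))) (upd-other σ₂)
      sym⁺ : Symmetric σ⁺ y
      sym⁺ = p , trans (upd-other σ (x≢y ∘ sym)) (trans tie (sym (upd-other σ (x≢y+1 ∘ sym)))) , λ {i} le e → away i le e (i ≟ x)
        where
        away : ∀ i → i ≤ ℓ → σ⁺ i ≡ suc y → _ → ⊥
        away i le e (yes refl) = 1+n≢n (trans (sym (upd-same σ x (suc (suc y)))) e)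
        away i le e (no ne)    = uniq le ne (trans (sym (upd-other σ ne)) e)
      sym₂ : Symmetric σ₂ y
      sym₂ = p , trans (upd-other σ (x≢y ∘ sym)) (trans tie (sym (upd-other σ (x≢y+1 ∘ sym)))) , λ {i} le e → away i le e (i ≟ x)
        where
        away : ∀ i → i ≤ ℓ → σ₂ i ≡ suc y → _ → ⊥
        away i le e (yes refl) = 1+n≢n (sym (trans (sym (upd-same σ x y)) e))
        away i le e (no ne)    = uniq le ne (trans (sym (upd-other σ ne)) e)
      γ′ = γ ⊞ (x , suc y)
      w = σ₂ (suc y)
      w≡ : w ≡ σ y
      w≡ = trans (upd-other σ (x≢y+1 ∘ sym)) (sym tie)
      lower-both : ∀ a b → a ≡ b -ᶻ 1ℤ → ((a +ᶻ (0ℤ -ᶻ 0ℤ)) +ᶻ (0ℤ -ᶻ 1ℤ)) ≡ ((b +ᶻ (0ℤ -ᶻ 1ℤ)) +ᶻ (0ℤ -ᶻ 0ℤ)) -ᶻ 1ℤ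
      lower-both a b refl = identity b
        where
        identity : ∀ b → ((b -ᶻ 1ℤ) +ᶻ (0ℤ -ᶻ 0ℤ)) +ᶻ (0ℤ -ᶻ 1ℤ) ≡ ((b +ᶻ (0ℤ -ᶻ 1ℤ)) +ᶻ (0ℤ -ᶻ 0ℤ)) -ᶻ 1ℤ
        identity = solve-∀
      lower-none : ∀ a b → a ≡ b -ᶻ 1ℤ → ((a +ᶻ (0ℤ -ᶻ 0ℤ)) +ᶻ (0ℤ -ᶻ 0ℤ)) ≡ ((b +ᶻ (0ℤ -ᶻ 1ℤ)) +ᶻ (1ℤ -ᶻ 0ℤ)) -ᶻ 1ℤ
      lower-none a b refl = identity b
        where
        identity : ∀ b → ((b -ᶻ 1ℤ) +ᶻ (0ℤ -ᶻ 0ℤ)) +ᶻ (0ℤ -ᶻ 0ℤ) ≡ ((b +ᶻ (0ℤ -ᶻ 1ℤ)) +ᶻ (1ℤ -ᶻ 0ℤ)) -ᶻ 1ℤ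
        identity = solve-∀
      -- The root `(x , y)` lowers row `y` just as row `y + 1` has been lowered, so the tie is
      -- restored.
      tie₁ : (γ′ ⊞ (x , y)) y ≡ (γ′ ⊞ (x , y)) (suc y) -ᶻ 1ℤ
      tie₁ rewrite unit-other {x} {y} x≢y | unit-other {x} {suc y} x≢y+1 | unit-other {suc y} {y} 1+n≢n | unit-same y | unit-other {y} {suc y} (1+n≢n ∘ sym) =
        lower-both (γ y) (γ (suc y)) tieγ
      -- The root `(y + 1 , w)` gives row `y + 1` its box back.
      tie₂ : (γ′ ⊞ (suc y , w)) y ≡ (γ′ ⊞ (suc y , w)) (suc y) -ᶻ 1ℤ
      tie₂ rewrite unit-other {x} {y} x≢y | unit-other {x} {suc y} x≢y+1 | unit-other {suc y} {y} 1+n≢n | unit-same y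
        | unit-other {w} {y} (λ e → <⇒≢ y<w (sym (trans (sym w≡) e))) | unit-other {w} {suc y} (λ e → uniq (<⇒≤ y<ℓ) (x≢y ∘ sym) (trans (sym w≡) e)) =
        lower-none (γ y) (γ (suc y)) tieγ
      up1 : ∀ a b → (a -ᶻ (1ℤ +ᶻ b)) +ᶻ 1ℤ ≡ a -ᶻ b
      up1 = solve-∀
      down1 : ∀ a b → (a -ᶻ b) +ᶻ (0ℤ -ᶻ 1ℤ) ≡ a -ᶻ (1ℤ +ᶻ b)
      down1 = solve-∀
      row-weight : ∀ z → Dec (z ≡ x) → Dec (z ≡ suc y) → (+ (suc k + z) -ᶻ + σ z) +ᶻ (unit x z -ᶻ unit (suc y) z) ≡ + (suc k + z) -ᶻ + σ′ z
      row-weight z (yes refl) _ = trans (cong₂ (λ u v → (+ (suc k + x) -ᶻ + σ x) +ᶻ (u -ᶻ v)) (unit-same x) (unit-other (x≢y+1 ∘ sym)))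
        (trans (cong (λ v → (+ (suc k + x) -ᶻ + v) +ᶻ 1ℤ) σx) (trans (up1 (+ (suc k + x)) (+ y))
          (cong (λ v → + (suc k + x) -ᶻ + v) (sym (trans (upd-other σ₂ x≢y+1) (upd-same σ x y))))))
      row-weight z (no z≢x) (yes refl) = trans (cong₂ (λ u v → (+ (suc k + suc y) -ᶻ + σ (suc y)) +ᶻ (u -ᶻ v)) (unit-other x≢y+1) (unit-same y))
        (trans (down1 (+ (suc k + suc y)) (+ σ (suc y))) (cong (λ v → + (suc k + suc y) -ᶻ + v) (sym (upd-same σ₂ (suc y) (suc (σ (suc y)))))))
      row-weight z (no z≢x) (no z≢) = trans (cong₂ (λ u v → (+ (suc k + z) -ᶻ + σ z) +ᶻ (u -ᶻ v)) (unit-other (z≢x ∘ sym)) (unit-other (z≢ ∘ sym)))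
        (trans (ℤP.+-identityʳ _) (cong (λ v → + (suc k + z) -ᶻ + v) (sym (trans (upd-other σ₂ z≢) (upd-other σ z≢x)))))
      weights : γ′ ≗ wt σ′ M
      weights z = by (z ≟ ℓ)
        where
        by : Dec (z ≡ ℓ) → γ′ z ≡ wt σ′ M z
        by (yes refl) = trans (cong₂ (λ u v → γ ℓ +ᶻ (u -ᶻ v)) (unit-other x≢ℓ) (unit-other (<⇒≢ p)))
          (trans (ℤP.+-identityʳ _) (trans (wt-ghost {σ} {M}) (sym (wt-ghost {σ′} {M}))))
        by (no ne) = trans (cong (_+ᶻ (unit x z -ᶻ unit (suc y) z)) (wt-row {σ} {M} ne)) (trans (row-weight z (z ≟ x) (z ≟ suc y)) (sym (wt-row {σ′} {M} ne)))
      body : ∀ d → F σ d (γ ⊞ (x , σ x)) ≡ 𝕋 σ′ M d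
      body d = trans (cong (λ v → F σ d (γ ⊞ (x , v))) σx) (trans (sym (F-remove-zero R₂ x≤ℓ (λ d → trans (cong (λ v → F σ₂ d (γ′ ⊞ (x , v))) (upd-same σ x y)) (F-symmetric-zero sym₂ d (γ′ ⊞ (x , y)) tie₁)) d))
        (trans (F-remove-zero R′ (<⇒≤ p) (λ d → F-symmetric-zero sym₂ d (γ′ ⊞ (suc y , w)) tie₂) d) (F-respects σ′ d weights)))

-- Moving a block of rows up one level of the runner.

module Levels where
  open Cover
  open Straighten
  open Linear
  open import Data.Nat using (ℕ; zero; suc; _+_; _≤_; _<_; z≤n; s≤s)
  open import Data.Nat.Properties
  open import Data.Integer using (+_)
  open import Data.List using (List; []; _∷_)
  open import Data.List.Relation.Unary.All using ([]; _∷_)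
  open import Data.Empty using (⊥; ⊥-elim)
  open import Function using (_∘_)
  open import Relation.Nullary using (Dec; yes; no)
  open import Relation.Binary.PropositionalEquality

  interval-empty : ∀ lo r → interval lo 0 r ≡ 0
  interval-empty lo r with locate lo 0 r
  ... | before _ v      = v
  ... | inside _ () _ _
  ... | after _ v       = v

  interval-head : ∀ lo m → interval lo (suc m) lo ≡ 1
  interval-head lo m = trans (cong (interval lo (suc m)) (sym (+-identityʳ lo))) (interval-inside lo (suc m) {0} (s≤s z≤n))

  interval-tail : ∀ {lo m r} → r ≢ lo → interval lo (suc m) r ≡ interval (suc lo) m r
  interval-tail {lo} {m} {r} ne with locate lo (suc m) r
  ... | before p v             = trans v (sym (interval-before {suc lo} {m} (m<n⇒m<1+n p)))
  ... | inside zero p e v      = ⊥-elim (ne (trans e (+-identityʳ lo)))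
  ... | inside (suc i) p e v   = trans v (sym (trans (cong (interval (suc lo) m) (trans e (+-suc lo i))) (interval-inside (suc lo) m (≤-pred p))))
  ... | after p v              = trans v (sym (interval-after {suc lo} {m} (≤-trans (≤-reflexive (sym (+-suc lo m))) p)))

  module LevelSteps (k ℓ : ℕ) (η : List ℕ) where
    open Straightening k ℓ η public

    -- Iterates 𝕋-step over the rows y, y + 1, ..., y + m.
    𝕋-level : ∀ m {σ σ′ y x v M} → y + m < ℓ → (∀ {i} → i < m → x + i < y) → σ y ≡ v → (∀ {i} → i < m → σ (suc y + i) ≡ v + i) → y + m < v →
      (∀ {i} → i < m → σ (x + i) ≡ suc y + i) →
      (∀ {r} → r ≤ ℓ → (∀ {i} → i < m → r ≢ x + i) → ∀ {i} → i < m → σ r ≢ suc y + i) →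
      (∀ r → σ′ r + interval x m r ≡ σ r + interval (suc y) m r) →
      ∀ d → 𝕋 σ M d ≡ (𝕋 σ′ M ↑ m) d
    𝕋-level zero {σ} {σ′} {y} {x} b bx sy srun yv hx others spec d =
      𝕋-agree (λ r → sym (lin≡ (σ′ r ∷ σ r ∷ interval x 0 r ∷ interval (suc y) 0 r ∷ []) v0 v1 (:≡ (v0 ⊹ v2) (v1 ⊹ v3) (spec r) ∷ :≥ #0 v2 (interval-empty x r) ∷ :≡ v3 #0 (interval-empty (suc y) r) ∷ []))) d
    𝕋-level (suc m) {σ} {σ′} {y} {x} {v} {M} b bx sy srun yv hx others spec d =
      trans (𝕋-step {σ} {y} {x} {M} (lin (y ∷ ℓ ∷ m ∷ []) (1+ (1+ v0)) v1 (:≤ (1+ (v0 ⊹ 1+ v2)) v1 b ∷ [])) tie (lin (y ∷ σ y ∷ v ∷ m ∷ []) (1+ v0) v1 (:≥ v2 v1 sy ∷ :≤ (1+ (v0 ⊹ 1+ v3)) v2 yv ∷ [])) x≤ℓ σx uniq (<⇒≢ x<ℓ) d)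
        -- Row `y + 1` now has offset `v + 1`, which ties it with row `y + 2`; there the induction
        -- continues.
        (trans (↑-cong {g = 𝕋 σ′ M ↑ m} 1 (𝕋-level m {σ₁} {σ′} {suc y} {suc x} {suc v} {M} (lin (m ∷ y ∷ ℓ ∷ []) (1+ (1+ v1 ⊹ v0)) v2 (:≤ (1+ (v1 ⊹ 1+ v0)) v2 b ∷ [])) (λ {i} p → s≤s (bx (<-trans p (n<1+n m)))) sy₁ srun₁ (lin (m ∷ y ∷ v ∷ []) (1+ (1+ v1 ⊹ v0)) (1+ v2) (:≤ (1+ (v1 ⊹ 1+ v0)) v2 yv ∷ [])) hx₁ others₁ spec₁) d) (↑-+ (𝕋 σ′ M) m 1 d))
      where
      x<y : x < y
      x<y = subst (_< y) (+-identityʳ x) (bx (s≤s z≤n))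
      x<ℓ : x < ℓ
      x<ℓ = lin (x ∷ ℓ ∷ y ∷ m ∷ []) (1+ v0) v1 (:≤ (1+ v0) v2 x<y ∷ :≤ (1+ (v2 ⊹ 1+ v3)) v1 b ∷ [])
      x≤ℓ = <⇒≤ x<ℓ
      σx : σ x ≡ suc y
      σx = trans (cong σ (sym (+-identityʳ x))) (trans (hx (s≤s z≤n)) (cong suc (+-identityʳ y)))
      σy+1 : σ (suc y) ≡ v
      σy+1 = trans (cong (σ ∘ suc) (sym (+-identityʳ y))) (trans (srun (s≤s z≤n)) (+-identityʳ v))
      tie : σ y ≡ σ (suc y)
      tie = trans sy (sym σy+1)
      uniq : ∀ {i} → i ≤ ℓ → i ≢ x → σ i ≢ suc y
      uniq {i} le ne e with locate x (suc m) i
      ... | before p _            = others le (λ {i′} _ z → (lin⊥ (i ∷ x ∷ i′ ∷ []) (:≤ (1+ v0) v1 p ∷ :≥ (v1 ⊹ v2) v0 z ∷ []))) {0} (s≤s z≤n) (trans e (cong suc (sym (+-identityʳ y))))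
      ... | after p _             = others le (λ {i′} q z → (lin⊥ (m ∷ x ∷ i ∷ i′ ∷ []) (:≤ (v1 ⊹ 1+ v0) v2 p ∷ :≤ (1+ v3) (1+ v0) q ∷ :≡ v2 (v1 ⊹ v3) z ∷ []))) {0} (s≤s z≤n) (trans e (cong suc (sym (+-identityʳ y))))
      ... | inside zero p q _     = ne (trans q (+-identityʳ x))
      ... | inside (suc i′) p q _ = lin⊥ (i′ ∷ y ∷ σ (x + suc i′) ∷ σ i ∷ []) (:≥ (1+ (v1 ⊹ 1+ v0)) v2 (hx p) ∷ :≥ v2 v3 (cong σ q) ∷ :≡ v3 (1+ v1) e ∷ [])
      σ₁ : ℕ → ℕ
      σ₁ = upd (upd σ x y) (suc y) (suc (σ (suc y)))
      at-x : σ₁ x ≡ y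
      at-x = trans (upd-other (upd σ x y) (<⇒≢ (m<n⇒m<1+n x<y))) (upd-same σ x y)
      at-y : σ₁ (suc y) ≡ suc (σ (suc y))
      at-y = upd-same (upd σ x y) (suc y) (suc (σ (suc y)))
      at-other : ∀ {r} → r ≢ x → r ≢ suc y → σ₁ r ≡ σ r
      at-other p q = trans (upd-other (upd σ x y) q) (upd-other σ p)
      sy₁ : σ₁ (suc y) ≡ suc v
      sy₁ = trans at-y (cong suc σy+1)
      srun₁ : ∀ {i} → i < m → σ₁ (suc (suc y) + i) ≡ suc v + i
      srun₁ {i} p = trans (at-other (λ e → (lin⊥ (i ∷ y ∷ x ∷ []) (:≡ (1+ (1+ (v1 ⊹ v0))) v2 e ∷ :≤ (1+ v2) v1 x<y ∷ []))) (λ e → (lin⊥ (i ∷ y ∷ []) (:≡ (1+ (1+ (v1 ⊹ v0))) (1+ v1) e ∷ [])))) (trans (cong (σ ∘ suc) (sym (+-suc y i))) (trans (srun (s≤s p)) (+-suc v i)))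
      hx₁ : ∀ {i} → i < m → σ₁ (suc x + i) ≡ suc (suc y) + i
      hx₁ {i} p = trans (at-other (λ e → (lin⊥ (i ∷ x ∷ []) (:≡ (1+ (v1 ⊹ v0)) v1 e ∷ []))) (λ e → (lin⊥ (y ∷ i ∷ x ∷ []) (:≥ (1+ v0) (1+ (v2 ⊹ v1)) e ∷ :≤ (1+ (v2 ⊹ 1+ v1)) v0 (bx (s≤s p)) ∷ [])))) (trans (cong σ (sym (+-suc x i))) (trans (hx (s≤s p)) (cong suc (+-suc y i))))
      others₁ : ∀ {r} → r ≤ ℓ → (∀ {i} → i < m → r ≢ suc x + i) → ∀ {i} → i < m → σ₁ r ≢ suc (suc y) + i
      others₁ {r} le out {i} p e = by (r ≟ x) (r ≟ suc y)
        where
        by : Dec (r ≡ x) → Dec (r ≡ suc y) → ⊥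
        by (yes refl) _ = lin⊥ (σ₁ x ∷ y ∷ i ∷ []) (:≡ v0 v1 at-x ∷ :≥ (1+ (1+ v1) ⊹ v2) v0 e ∷ [])
        by (no _) (yes refl) = lin⊥ (v ∷ σ₁ (suc y) ∷ i ∷ y ∷ m ∷ []) (:≥ (1+ v0) v1 sy₁ ∷ :≡ v1 (1+ (1+ v3) ⊹ v2) e ∷ :≤ (1+ (v3 ⊹ 1+ v4)) v0 yv ∷ :≤ (1+ v2) v4 p ∷ [])
        by (no r≢x) (no r≢y) = others le (λ { {zero} _ z → r≢x (trans z (+-identityʳ x)) ; {suc i′} q z → out {i′} (≤-pred q) (trans z (+-suc x i′)) })
          (s≤s p) (trans (sym (at-other r≢x r≢y)) (trans e (cong suc (sym (+-suc y i)))))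
      spec₁ : ∀ r → σ′ r + interval (suc x) m r ≡ σ₁ r + interval (suc (suc y)) m r
      spec₁ r = by (r ≟ x) (r ≟ suc y)
        where
        by : Dec (r ≡ x) → Dec (r ≡ suc y) → σ′ r + interval (suc x) m r ≡ σ₁ r + interval (suc (suc y)) m r
        by (yes refl) _ = lin≡ (interval (suc x) m x ∷ σ′ x ∷ interval (suc (suc y)) m x ∷ σ₁ x ∷ interval x (suc m) x ∷ interval (suc y) (suc m) x ∷ σ x ∷ y ∷ []) (v1 ⊹ v0) (v3 ⊹ v2) (:≡ (v1 ⊹ v4) (v6 ⊹ v5) (spec x) ∷ :≥ #1 v4 (interval-head x m) ∷ :≡ v0 #0 (interval-before {suc x} {m} {x} ≤-refl) ∷ :≡ v5 #0 (interval-before {suc y} {suc m} {x} (m<n⇒m<1+n x<y)) ∷ :≥ #0 v2 (interval-before {suc (suc y)} {m} {x} (m<n⇒m<1+n (m<n⇒m<1+n x<y))) ∷ :≥ v7 v3 at-x ∷ :≡ v6 (1+ v7) σx ∷ [])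
        by (no r≢x) (yes refl) = lin≡ (interval (suc x) m (suc y) ∷ σ′ (suc y) ∷ interval (suc (suc y)) m (suc y) ∷ σ₁ (suc y) ∷ interval x (suc m) (suc y) ∷ interval (suc y) (suc m) (suc y) ∷ σ (suc y) ∷ []) (v1 ⊹ v0) (v3 ⊹ v2) (:≡ (v1 ⊹ v4) (v6 ⊹ v5) (spec (suc y)) ∷ :≥ v0 v4 (interval-tail {x} {m} r≢x) ∷ :≡ v5 #1 (interval-head (suc y) m) ∷ :≥ #0 v2 (interval-before {suc (suc y)} {m} {suc y} ≤-refl) ∷ :≥ (1+ v6) v3 at-y ∷ [])
        by (no r≢x) (no r≢y) = lin≡ (interval (suc x) m r ∷ σ′ r ∷ interval (suc (suc y)) m r ∷ σ₁ r ∷ interval x (suc m) r ∷ interval (suc y) (suc m) r ∷ σ r ∷ []) (v1 ⊹ v0) (v3 ⊹ v2) (:≡ (v1 ⊹ v4) (v6 ⊹ v5) (spec r) ∷ :≥ v0 v4 (interval-tail {x} {m} r≢x) ∷ :≡ v5 v2 (interval-tail {suc y} {m} r≢y) ∷ :≥ v6 v3 (at-other r≢x r≢y) ∷ [])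

-- Straightening on one level of a tower.

module Towers where
  open Core
  open Cover
  open Search
  open Straighten
  open Levels
  open Linear
  open import Data.Nat using (ℕ; zero; suc; _+_; _∸_; _≤_; _<_; z≤n; s≤s)
  open import Data.Nat.Properties
  open import Data.Integer using (+_; 0ℤ)
  open import Data.List using (List; []; _∷_)
  open import Data.List.Relation.Unary.All using ([]; _∷_)
  open import Data.Product using (_×_; _,_; proj₂; ∃)
  open import Data.Sum using (_⊎_; inj₁; inj₂)
  open import Data.Empty using (⊥)
  open import Relation.Nullary using (Dec; yes; no)
  open import Relation.Binary.PropositionalEquality

  module TowerEval (k ℓ : ℕ) (η : List ℕ) where
    open LevelSteps k ℓ η public

    -- The ghost, at z, stays clear of the values Y + 1, ..., Y + m.
    Visible : ℕ → ℕ → ℕ → Set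
    Visible z Y m = z ≤ Y ⊎ Y + m < z

    module _ {δ : ℕ → ℕ} (A : Adm k ℓ δ) where
      private
        module A = Adm A

      module _ {m s : ℕ} {Y : ℕ → ℕ} (st : ∀ {j} → j < s → ∀ {i} → i ≤ m → δ (Y (suc j) + i) ≡ Y j + i) where
        ladder-step : ∀ {j} → j < s → δ (Y (suc j)) ≡ Y j
        ladder-step {j} p = trans (cong δ (sym (+-identityʳ _))) (trans (st p {0} z≤n) (+-identityʳ (Y j)))

        -- The argument of `gap`, for a tower that may be incomplete.
        ladder-gap : Y 0 + m < δ (Y 0) → ∀ {j} → j ≤ s → Y j + m < δ (Y j)
        ladder-gap w {zero}  p = w
        ladder-gap w {suc j} p = ≰⇒> λ q → lin⊥ (δ (Y (suc j)) ∷ m ∷ Y (suc j) ∷ Y j ∷ δ (Y (suc j) + m) ∷ δ (Y j) ∷ []) (:≤ v0 (v2 ⊹ v1) q ∷ :≥ v3 v0 (ladder-step p) ∷ :≡ v4 (v3 ⊹ v1) (st p {m} ≤-refl) ∷ :≤ (1+ (v3 ⊹ v1)) v5 (ladder-gap w (<⇒≤ p)) ∷ :≤ (v5 ⊹ (v2 ⊹ v1)) (v4 ⊹ v3) (σ-mono A {Y j} {Y (suc j) + m} (lin (Y j ∷ m ∷ Y (suc j) ∷ δ (Y (suc j)) ∷ []) v0 (v2 ⊹ v1) (:≤ v3 (v2 ⊹ v1) q ∷ :≥ v0 v3 (ladder-step p) ∷ []))) ∷ [])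

        ladder-spaced : Y 0 + m < δ (Y 0) → ∀ {j} → j < s → Y (suc j) + m < Y j
        ladder-spaced w {j} p = lin (m ∷ Y (suc j) ∷ Y j ∷ δ (Y (suc j)) ∷ []) (1+ (v1 ⊹ v0)) v2 (:≤ (1+ (v1 ⊹ v0)) v3 (ladder-gap w p) ∷ :≡ v3 v2 (ladder-step p) ∷ [])

        ladder-≤ : ∀ {j} → j ≤ s → Y j ≤ Y 0
        ladder-≤ {zero}  p = ≤-refl
        ladder-≤ {suc j} p = lin (Y (suc j) ∷ Y 0 ∷ δ (Y (suc j)) ∷ Y j ∷ []) v0 v1 (:≤ (1+ v0) v2 (A.lo (Y (suc j))) ∷ :≡ v2 v3 (ladder-step p) ∷ :≤ v3 v1 (ladder-≤ (<⇒≤ p)) ∷ [])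

      -- The first row of the minus block before it has moved (base), or after it has climbed the runner (upper).
      data Position (y m Y v : ℕ) : Set where
        base  : Y ≡ y → v ≡ suc (δ y) → Position y m Y v
        upper : (∀ {i} → i ≤ m → δ (Y + i) ≡ v + i) → Y + m < v → Y + m < y → y + m < δ y → Position y m Y v

      position : ∀ {y m s} → Steps A m y s → s ≡ 0 ⊎ y + m < δ y → ∃ λ v → Position y m (level A y s) v
      position {y} {m} {zero}  st w        = suc (δ y) , base refl refl
      position {y} {m} {suc s} st (inj₂ w) = level A y s , upper (λ p → st ≤-refl p) (ladder-spaced {m} {suc s} {level A y} st w ≤-refl) (≤-trans (ladder-spaced {m} {suc s} {level A y} st w ≤-refl) (ladder-≤ {m} {suc s} {level A y} st (n≤1+n s))) w

      -- `S` arises from `δ` by adding 1 on the plus block `[y , y + m]` and subtracting 1 on the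
      -- minus block `[Y + 1 , Y + m]`. At the bottom, where `Y = y`, the blocks cancel except in
      -- row `y`; on every level, if `m > 0`, row `Y` is tied with row `Y + 1`.
      module Facts {y m Y v z : ℕ} {S : ℕ → ℕ} (run : ∀ {i} → i ≤ m → δ (y + i) ≡ δ y + i) (y+m<ℓ : y + m < ℓ) (vis : Visible z Y m) (P : Position y m Y v)
        (S-spec : ∀ {r} → r ≢ ℓ → S r + interval (suc Y) m r ≡ δ r + interval y (suc m) r) (S-ghost : S ℓ ≡ z) where

        ≢ℓ : ∀ {r} → r ≤ y + m → r ≢ ℓ
        ≢ℓ {r} p e = lin⊥ (r ∷ m ∷ y ∷ ℓ ∷ []) (:≤ v0 (v2 ⊹ v1) p ∷ :≥ v3 v0 e ∷ :≤ (1+ (v2 ⊹ v1)) v3 y+m<ℓ ∷ [])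

        Y≤y : Y ≤ y
        Y≤y = get P
          where
          get : Position y m Y v → Y ≤ y
          get (base e _)      = ≤-reflexive e
          get (upper _ _ p _) = lin (Y ∷ y ∷ m ∷ []) v0 v1 (:≤ (1+ (v0 ⊹ v2)) v1 p ∷ [])

        at-Y : S Y ≡ v
        at-Y = get P
          where
          get : Position y m Y v → S Y ≡ v
          get (base e ev)     = lin≡ (S Y ∷ v ∷ δ y ∷ interval (suc Y) m Y ∷ interval y (suc m) Y ∷ δ Y ∷ []) v0 v1 (:≥ (1+ v2) v1 ev ∷ :≡ (v0 ⊹ v3) (v5 ⊹ v4) (S-spec {Y} (≢ℓ (lin (Y ∷ m ∷ y ∷ []) v0 (v2 ⊹ v1) (:≡ v0 v2 e ∷ [])))) ∷ :≥ #0 v3 (interval-before {suc Y} {m} {Y} ≤-refl) ∷ :≡ v4 #1 (trans (cong (interval y (suc m)) e) (interval-head y m)) ∷ :≡ v5 v2 (cong δ e) ∷ [])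
          get (upper h _ p _) = lin≡ (S Y ∷ v ∷ interval (suc Y) m Y ∷ interval y (suc m) Y ∷ δ Y ∷ δ (Y + 0) ∷ []) v0 v1 (:≡ (v0 ⊹ v2) (v4 ⊹ v3) (S-spec {Y} (≢ℓ (lin (Y ∷ m ∷ y ∷ []) v0 (v2 ⊹ v1) (:≤ (1+ (v0 ⊹ v1)) v2 p ∷ [])))) ∷ :≥ #0 v2 (interval-before {suc Y} {m} {Y} ≤-refl) ∷ :≡ v3 #0 (interval-before {y} {suc m} {Y} (lin (Y ∷ y ∷ m ∷ []) (1+ v0) v1 (:≤ (1+ (v0 ⊹ v2)) v1 p ∷ []))) ∷ :≡ v5 (v1 ⊹ #0) (h z≤n) ∷ :≥ v4 v5 (cong δ (+-identityʳ Y)) ∷ [])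

        at-run : ∀ {i} → i < m → S (suc Y + i) ≡ v + i
        at-run {i} p = get P
          where
          get : Position y m Y v → S (suc Y + i) ≡ v + i
          get (base e ev)     = lin≡ (S (suc Y + i) ∷ i ∷ v ∷ δ y ∷ interval (suc Y) m (suc Y + i) ∷ interval y (suc m) (suc Y + i) ∷ δ (suc Y + i) ∷ []) v0 (v2 ⊹ v1) (:≥ (1+ v3) v2 ev ∷ :≡ (v0 ⊹ v4) (v6 ⊹ v5) (S-spec {suc Y + i} (≢ℓ (lin (i ∷ Y ∷ m ∷ y ∷ []) (1+ v1 ⊹ v0) (v3 ⊹ v2) (:≤ (1+ v0) v2 p ∷ :≡ v1 v3 e ∷ [])))) ∷ :≥ #1 v4 (interval-inside (suc Y) m p) ∷ :≡ v5 #1 (trans (cong (interval y (suc m)) {suc Y + i} {y + suc i} (lin≡ (i ∷ Y ∷ y ∷ []) (1+ v1 ⊹ v0) (v2 ⊹ 1+ v0) (:≡ v1 v2 e ∷ []))) (interval-inside y (suc m) (s≤s p))) ∷ :≡ v6 (v3 ⊹ 1+ v1) (trans (cong δ {suc Y + i} {y + suc i} (lin≡ (i ∷ Y ∷ y ∷ []) (1+ v1 ⊹ v0) (v2 ⊹ 1+ v0) (:≡ v1 v2 e ∷ []))) (run p)) ∷ [])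
          get (upper h _ q _) = lin≡ (S (suc Y + i) ∷ i ∷ v ∷ interval (suc Y) m (suc Y + i) ∷ interval y (suc m) (suc Y + i) ∷ δ (suc Y + i) ∷ δ (Y + suc i) ∷ []) v0 (v2 ⊹ v1) (:≡ (v0 ⊹ v3) (v5 ⊹ v4) (S-spec {suc Y + i} (≢ℓ (lin (i ∷ Y ∷ m ∷ y ∷ []) (1+ v1 ⊹ v0) (v3 ⊹ v2) (fact 2 (1+ v0) v2 (p) ∷ :≤ (1+ (v1 ⊹ v2)) v3 q ∷ [])))) ∷ :≥ #1 v3 (interval-inside (suc Y) m p) ∷ :≡ v4 #0 (interval-before {y} {suc m} {suc Y + i} (lin (i ∷ Y ∷ y ∷ m ∷ []) (1+ (1+ v1 ⊹ v0)) v2 (:≤ (1+ v0) v3 p ∷ :≤ (1+ (v1 ⊹ v3)) v2 q ∷ []))) ∷ :≥ v5 v6 (cong δ {Y + suc i} {suc Y + i} (+-suc Y i)) ∷ :≡ v6 (v2 ⊹ 1+ v1) (h p) ∷ [])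

        -- Passing from `δ` to `S` creates no new occurrence of such a value: the ghost keeps clear
        -- by `Visible`, and the rows of both blocks have larger values.
        avoid : ∀ {r i} → i < m → Y + i < δ y → r ≤ ℓ → (r ≢ y → δ r ≢ suc Y + i) → S r ≢ suc Y + i
        avoid {r} {i} p big le nh e = by (r ≟ ℓ)
          where
          ghost : Visible z Y m → z ≡ suc Y + i → ⊥
          ghost (inj₁ q) e = lin⊥ (z ∷ Y ∷ i ∷ []) (:≤ v0 v1 q ∷ :≥ (1+ v1 ⊹ v2) v0 e ∷ [])
          ghost (inj₂ q) e = lin⊥ (m ∷ Y ∷ z ∷ i ∷ []) (:≤ (1+ (v1 ⊹ v0)) v2 q ∷ :≡ v2 (1+ v1 ⊹ v3) e ∷ :≤ (1+ v3) v0 p ∷ [])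
          by : Dec (r ≡ ℓ) → ⊥
          by (yes f) = ghost vis (trans (sym S-ghost) (trans (cong S (sym f)) e))
          by (no r≢ℓ) = cases (locate y (suc m) r) (locate (suc Y) m r)
            where
            keep : interval y (suc m) r ≡ 0 → interval (suc Y) m r ≡ 0 → r ≢ y → ⊥
            keep u u′ ne = nh ne (lin≡ (δ r ∷ i ∷ Y ∷ interval y (suc m) r ∷ interval (suc Y) m r ∷ S r ∷ []) v0 (1+ v2 ⊹ v1) (:≥ (v0 ⊹ v3) (v5 ⊹ v4) (S-spec r≢ℓ) ∷ :≥ #0 v3 u ∷ :≡ v4 #0 u′ ∷ :≡ v5 (1+ v2 ⊹ v1) e ∷ []))
            high : ∀ {b} → suc b < suc m → r ≡ y + suc b → interval y (suc m) r ≡ 1 → interval (suc Y) m r ≡ 1 → ⊥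
            high {b} q f u u′ = lin⊥ (interval y (suc m) r ∷ δ r ∷ interval (suc Y) m r ∷ S r ∷ i ∷ Y ∷ r ∷ δ y ∷ y ∷ b ∷ []) (:≥ (v1 ⊹ v0) (v3 ⊹ v2) (S-spec r≢ℓ) ∷ :≥ #1 v0 u ∷ :≡ v2 #1 u′ ∷ :≡ v3 (1+ v5 ⊹ v4) e ∷ :≤ (v7 ⊹ v6) (v1 ⊹ v8) (σ-mono A {y} {r} (lin (y ∷ r ∷ b ∷ []) v0 v1 (:≥ (v0 ⊹ 1+ v2) v1 f ∷ []))) ∷ :≥ (v8 ⊹ 1+ v9) v6 f ∷ :≤ (1+ (v5 ⊹ v4)) v7 big ∷ [])
            top : r ≡ y + 0 → ∀ {b} → r ≡ suc Y + b → b < m → ⊥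
            top f {b} f′ q′ = apart P
              where
              apart : Position y m Y v → ⊥
              apart (base e _)      = lin⊥ (r ∷ y ∷ b ∷ Y ∷ []) (:≡ v0 (v1 ⊹ #0) f ∷ :≥ (1+ v3 ⊹ v2) v0 f′ ∷ :≥ v1 v3 e ∷ [])
              apart (upper _ _ w _) = lin⊥ (y ∷ r ∷ b ∷ Y ∷ m ∷ []) (:≥ (v0 ⊹ #0) v1 f ∷ :≡ v1 (1+ v3 ⊹ v2) f′ ∷ :≤ (1+ v2) v4 q′ ∷ :≤ (1+ (v3 ⊹ v4)) v0 w ∷ [])
            low : interval y (suc m) r ≡ 0 → interval (suc Y) m r ≡ 1 → ∀ {b} → r ≡ suc Y + b → b < m → r < y ⊎ y + suc m ≤ r → ⊥
            low u u′ {b} f′ q′ out = get P out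
              where
              get : Position y m Y v → r < y ⊎ y + suc m ≤ r → ⊥
              get (base e _)      (inj₁ q) = lin⊥ (r ∷ y ∷ b ∷ Y ∷ []) (:≤ (1+ v0) v1 q ∷ :≥ (1+ v3 ⊹ v2) v0 f′ ∷ :≥ v1 v3 e ∷ [])
              get (base e _)      (inj₂ q) = lin⊥ (m ∷ y ∷ r ∷ b ∷ Y ∷ []) (:≤ (v1 ⊹ 1+ v0) v2 q ∷ :≡ v2 (1+ v4 ⊹ v3) f′ ∷ :≤ (1+ v3) v0 q′ ∷ :≡ v4 v1 e ∷ [])
              get (upper h w _ _) _        = lin⊥ (interval y (suc m) r ∷ δ r ∷ interval (suc Y) m r ∷ S r ∷ i ∷ Y ∷ δ (suc Y + b) ∷ δ (Y + suc b) ∷ b ∷ v ∷ m ∷ []) (:≥ (v1 ⊹ v0) (v3 ⊹ v2) (S-spec r≢ℓ) ∷ :≥ #0 v0 u ∷ :≡ v2 #1 u′ ∷ :≡ v3 (1+ v5 ⊹ v4) e ∷ :≥ v6 v1 (cong δ f′) ∷ :≡ v7 v6 (cong δ {Y + suc b} {suc Y + b} (+-suc Y b)) ∷ :≥ (v9 ⊹ 1+ v8) v7 (h q′) ∷ :≤ (1+ (v5 ⊹ v10)) v9 w ∷ :≤ (1+ v4) v10 p ∷ [])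
            wide : ∀ {b} → r ≡ y + b → interval y (suc m) r ≡ 1 → interval (suc Y) m r ≡ 0 → ⊥
            wide {b} f u u′ = lin⊥ (interval y (suc m) r ∷ δ r ∷ interval (suc Y) m r ∷ S r ∷ i ∷ Y ∷ r ∷ δ y ∷ y ∷ b ∷ []) (:≥ (v1 ⊹ v0) (v3 ⊹ v2) (S-spec r≢ℓ) ∷ :≥ #1 v0 u ∷ :≡ v2 #0 u′ ∷ :≡ v3 (1+ v5 ⊹ v4) e ∷ :≤ (v7 ⊹ v6) (v1 ⊹ v8) (σ-mono A {y} {r} (lin (y ∷ r ∷ b ∷ []) v0 v1 (:≥ (v0 ⊹ v2) v1 f ∷ []))) ∷ :≥ (v8 ⊹ v9) v6 f ∷ :≤ (1+ (v5 ⊹ v4)) v7 big ∷ [])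
            cases : Interval y (suc m) r (interval y (suc m) r) → Interval (suc Y) m r (interval (suc Y) m r) → ⊥
            cases (inside b q f u)       (before q′ u′)      = wide f u u′
            cases (inside b q f u)       (after q′ u′)       = wide f u u′
            cases (inside zero q f u)    (inside b′ q′ f′ _) = top f f′ q′
            cases (inside (suc b) q f u) (inside _ _ _ u′)   = high q f u u′
            cases (before q u) (inside b′ q′ f′ u′) = low u u′ f′ q′ (inj₁ q)
            cases (after q u)  (inside b′ q′ f′ u′) = low u u′ f′ q′ (inj₂ q)
            cases (before q u) (before q′ u′)       = keep u u′ λ f → lin⊥ (r ∷ y ∷ []) (:≤ (1+ v0) v1 q ∷ :≥ v1 v0 f ∷ [])
            cases (before q u) (after q′ u′)        = keep u u′ λ f → lin⊥ (r ∷ y ∷ []) (:≤ (1+ v0) v1 q ∷ :≥ v1 v0 f ∷ [])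
            cases (after q u)  (before q′ u′)       = keep u u′ λ f → lin⊥ (m ∷ y ∷ r ∷ i ∷ []) (:≤ (v1 ⊹ 1+ v0) v2 q ∷ :≡ v2 v1 f ∷ :≤ (1+ v3) v0 p ∷ [])
            cases (after q u)  (after q′ u′)        = keep u u′ λ f → lin⊥ (m ∷ y ∷ r ∷ i ∷ []) (:≤ (v1 ⊹ 1+ v0) v2 q ∷ :≡ v2 v1 f ∷ :≤ (1+ v3) v0 p ∷ [])

        module _ {m′ x : ℕ} (m′≤m : m′ ≤ m) (hx : ∀ {i} → i < m′ → x + i ≢ y × δ (x + i) ≡ suc (Y + i)) where
          -- In the base position `δ y` is none of `y + 1`, ..., `y + m′`, as these values belong to
          -- the rows `x + i`, which differ from `y`.
          far : Y + m′ < δ y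
          far = get P
            where
            clash : Y ≡ y → δ y ≤ y + m′ → (∃ λ o → suc y + o ≡ δ y) → ⊥
            clash e q (o , eo) = let (ne , eq) = hx {o} (lin (o ∷ m′ ∷ δ y ∷ y ∷ []) (1+ v0) v1 (:≤ v2 (v3 ⊹ v1) q ∷ :≡ (1+ v3 ⊹ v0) v2 eo ∷ [])) in ne (σ-injective A (lin≡ (δ (x + o) ∷ δ y ∷ o ∷ Y ∷ y ∷ []) v0 v1 (:≡ v0 (1+ (v3 ⊹ v2)) eq ∷ :≡ (1+ v4 ⊹ v2) v1 eo ∷ :≡ v3 v4 e ∷ [])))
            get : Position y m Y v → Y + m′ < δ y
            get (base e _)      = ≰⇒> λ q → clash e (lin (δ y ∷ m′ ∷ y ∷ Y ∷ []) v0 (v2 ⊹ v1) (:≤ v0 (v3 ⊹ v1) q ∷ :≡ v3 v2 e ∷ [])) (m≤n⇒∃[o]m+o≡n (A.lo y))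
            get (upper _ _ p w) = lin (m′ ∷ Y ∷ δ y ∷ m ∷ y ∷ []) (1+ (v1 ⊹ v0)) v2 (:≤ (1+ (v1 ⊹ v3)) v4 p ∷ :≤ (1+ (v4 ⊹ v3)) v2 w ∷ :≤ v0 v3 m′≤m ∷ [])

          v-far : Y + m′ < v
          v-far = get P
            where
            get : Position y m Y v → Y + m′ < v
            get (base _ ev)     = lin (m′ ∷ Y ∷ v ∷ δ y ∷ []) (1+ (v1 ⊹ v0)) v2 (:≤ (1+ (v1 ⊹ v0)) v3 far ∷ :≥ (1+ v3) v2 ev ∷ [])
            get (upper _ w _ _) = lin (m′ ∷ Y ∷ v ∷ m ∷ []) (1+ (v1 ⊹ v0)) v2 (:≤ (1+ (v1 ⊹ v3)) v2 w ∷ :≤ v0 v3 m′≤m ∷ [])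

          x-< : ∀ {i} → i < m′ → x + i < Y
          x-< {i} p = ≰⇒> λ q → get q P
            where
            get : Y ≤ x + i → Position y m Y v → ⊥
            get q (base e _)      = lin⊥ (m′ ∷ Y ∷ δ y ∷ i ∷ δ (x + i) ∷ x ∷ δ Y ∷ []) (:≤ (1+ (v1 ⊹ v0)) v2 far ∷ :≤ (1+ v3) v0 p ∷ :≡ v4 (1+ (v1 ⊹ v3)) (proj₂ (hx p)) ∷ :≤ (v6 ⊹ (v5 ⊹ v3)) (v4 ⊹ v1) (σ-mono A q) ∷ :≤ v1 (v5 ⊹ v3) q ∷ :≥ v2 v6 (cong δ e) ∷ [])
            get q (upper h w _ _) = lin⊥ (m ∷ Y ∷ v ∷ m′ ∷ i ∷ δ (x + i) ∷ x ∷ δ Y ∷ δ (Y + 0) ∷ []) (:≤ (1+ (v1 ⊹ v0)) v2 w ∷ :≤ v3 v0 m′≤m ∷ :≤ (1+ v4) v3 p ∷ :≡ v5 (1+ (v1 ⊹ v4)) (proj₂ (hx p)) ∷ :≤ (v7 ⊹ (v6 ⊹ v4)) (v5 ⊹ v1) (σ-mono A q) ∷ :≤ v1 (v6 ⊹ v4) q ∷ :≥ (v2 ⊹ #0) v8 (h z≤n) ∷ :≡ v8 v7 (cong δ (+-identityʳ Y)) ∷ [])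

          at-x : ∀ {i} → i < m′ → S (x + i) ≡ suc Y + i
          at-x {i} p = lin≡ (S (x + i) ∷ i ∷ Y ∷ interval (suc Y) m (x + i) ∷ interval y (suc m) (x + i) ∷ δ (x + i) ∷ []) v0 (1+ v2 ⊹ v1) (:≡ (v0 ⊹ v3) (v5 ⊹ v4) (S-spec {x + i} (≢ℓ (lin (i ∷ x ∷ m ∷ y ∷ Y ∷ m′ ∷ []) (v1 ⊹ v0) (v3 ⊹ v2) (:≤ (1+ (v1 ⊹ v0)) v4 (x-< p) ∷ :≤ v4 v3 Y≤y ∷ :≤ (1+ v0) v5 p ∷ :≤ v5 v2 m′≤m ∷ [])))) ∷ :≥ #0 v3 (interval-before {suc Y} {m} {x + i} (lin (i ∷ x ∷ Y ∷ []) (1+ (v1 ⊹ v0)) (1+ v2) (:≤ (1+ (v1 ⊹ v0)) v2 (x-< p) ∷ []))) ∷ :≡ v4 #0 (interval-before {y} {suc m} {x + i} (lin (i ∷ x ∷ y ∷ Y ∷ []) (1+ (v1 ⊹ v0)) v2 (:≤ (1+ (v1 ⊹ v0)) v3 (x-< p) ∷ :≤ v3 v2 Y≤y ∷ []))) ∷ :≡ v5 (1+ (v2 ⊹ v1)) (proj₂ (hx p)) ∷ [])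

          -- The minus block moves from rows `Y + 1`, ... to the rows `x`, ... above them on their
          -- runners, at the price of one factor t per row.
          level-eval : ∀ {σ′} → (∀ r → σ′ r + interval x m′ r ≡ S r + interval (suc Y) m′ r) → ∀ M d → 𝕋 S M d ≡ (𝕋 σ′ M ↑ m′) d
          level-eval spec M d = 𝕋-level m′ (lin (m′ ∷ Y ∷ ℓ ∷ y ∷ m ∷ []) (1+ (v1 ⊹ v0)) v2 (:≤ v1 v3 Y≤y ∷ :≤ (1+ (v3 ⊹ v4)) v2 y+m<ℓ ∷ :≤ v0 v4 m′≤m ∷ [])) x-< at-Y (λ p → at-run (≤-trans p m′≤m)) v-far at-x
            (λ {r} le out {i} p → avoid (≤-trans p m′≤m) (lin (i ∷ Y ∷ δ y ∷ m′ ∷ []) (1+ (v1 ⊹ v0)) v2 (:≤ (1+ (v1 ⊹ v3)) v2 far ∷ :≤ (1+ v0) v3 p ∷ [])) le λ _ e → out p (σ-injective A (trans e (sym (proj₂ (hx p)))))) spec d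

        -- The first `i` rows of the minus block can still move. After that rows `Y + i` and
        -- `Y + i + 1` are tied and no row has its first root in column `Y + i + 1`, so the root set
        -- is symmetric and the term vanishes.
        stuck-zero : ∀ {i x} → i < m → (∀ {j} → j < i → x + j ≢ y × δ (x + j) ≡ suc (Y + j)) →
          (∀ r → r ≢ y → δ r ≢ suc (Y + i)) → ∀ M d → 𝕋 S M d ≡ 0ℤ
        stuck-zero {i} {x} i<m hx nh M d = trans (level-eval {i} {x} (<⇒≤ i<m) hx spec M d) (↑-zero i (λ d → 𝕋-zero symmetric d) d)
          where
          xb = x-< {i} {x} (<⇒≤ i<m) hx
          ax = at-x {i} {x} (<⇒≤ i<m) hx
          fr = far {i} {x} (<⇒≤ i<m) hx
          vf = v-far {i} {x} (<⇒≤ i<m) hx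
          σ″ : ℕ → ℕ
          σ″ r = S r + interval (suc Y) i r ∸ interval x i r
          spec : ∀ r → σ″ r + interval x i r ≡ S r + interval (suc Y) i r
          spec r = m∸n+n≡m (enough (locate x i r))
            where
            enough : Interval x i r (interval x i r) → interval x i r ≤ S r + interval (suc Y) i r
            enough (before _ u)     = ≤-trans (≤-reflexive u) z≤n
            enough (after _ u)      = ≤-trans (≤-reflexive u) z≤n
            enough (inside b q f u) = lin (interval x i r ∷ interval (suc Y) i r ∷ S r ∷ S (x + b) ∷ b ∷ Y ∷ []) v0 (v2 ⊹ v1) (:≡ v0 #1 u ∷ :≥ v3 v2 (cong S f) ∷ :≥ (1+ v5 ⊹ v4) v3 (ax q) ∷ [])
          symmetric : Symmetric σ″ (Y + i)
          symmetric = generic σ″ spec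
            where
            generic : ∀ σ″ → (∀ r → σ″ r + interval x i r ≡ S r + interval (suc Y) i r) → Symmetric σ″ (Y + i)
            generic σ″ spec = (lin (i ∷ Y ∷ ℓ ∷ y ∷ m ∷ []) (1+ (1+ (v1 ⊹ v0))) v2 (:≤ v1 v3 Y≤y ∷ :≤ (1+ (v3 ⊹ v4)) v2 y+m<ℓ ∷ :≤ (1+ v0) v4 i<m ∷ [])) , trans left (sym right) , λ {r} le e → miss r le e (locate x i r) (locate (suc Y) i r)
              where
              left : σ″ (Y + i) ≡ v + i
              left = get i refl
                where
                get : ∀ i′ → i′ ≡ i → σ″ (Y + i) ≡ v + i
                get zero    e = lin≡ (σ″ (Y + i) ∷ i ∷ v ∷ interval x i (Y + i) ∷ interval (suc Y) i (Y + i) ∷ S (Y + i) ∷ S Y ∷ []) v0 (v2 ⊹ v1) (:≡ #0 v1 e ∷ :≡ (v0 ⊹ v3) (v5 ⊹ v4) (spec (Y + i)) ∷ :≥ #0 v3 (trans (cong (λ u → interval x u (Y + i)) (sym e)) (interval-empty x (Y + i))) ∷ :≡ v4 #0 (trans (cong (λ u → interval (suc Y) u (Y + i)) (sym e)) (interval-empty (suc Y) (Y + i))) ∷ :≡ v5 v6 (cong S {Y + i} {Y} (lin≡ (i ∷ Y ∷ []) (v1 ⊹ v0) v1 (:≥ v0 #0 e ∷ []))) ∷ :≡ v6 v2 at-Y ∷ [])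
                get (suc b) e = lin≡ (σ″ (Y + i) ∷ i ∷ v ∷ b ∷ interval x i (Y + i) ∷ interval (suc Y) i (Y + i) ∷ S (Y + i) ∷ S (suc Y + b) ∷ []) v0 (v2 ⊹ v1) (:≡ (1+ v3) v1 e ∷ :≡ (v0 ⊹ v4) (v6 ⊹ v5) (spec (Y + i)) ∷ :≥ #0 v4 (interval-after {x} {i} {Y + i} (lin (i ∷ x ∷ Y ∷ b ∷ []) (v1 ⊹ v0) (v2 ⊹ v0) (:≤ (1+ (v1 ⊹ v3)) v2 (xb {b} (lin (b ∷ i ∷ []) (1+ v0) v1 (:≡ (1+ v0) v1 e ∷ []))) ∷ []))) ∷ :≡ v5 #1 (trans (cong (interval (suc Y) i) {Y + i} {suc Y + b} (lin≡ (i ∷ Y ∷ b ∷ []) (v1 ⊹ v0) (1+ v1 ⊹ v2) (:≥ v0 (1+ v2) e ∷ []))) (interval-inside (suc Y) i {b} (lin (b ∷ i ∷ []) (1+ v0) v1 (:≡ (1+ v0) v1 e ∷ [])))) ∷ :≡ v6 v7 (cong S {Y + i} {suc Y + b} (lin≡ (i ∷ Y ∷ b ∷ []) (v1 ⊹ v0) (1+ v1 ⊹ v2) (:≥ v0 (1+ v2) e ∷ []))) ∷ :≡ v7 (v2 ⊹ v3) (at-run {b} (lin (b ∷ m ∷ i ∷ []) (1+ v0) v1 (:≤ (1+ v2) v1 i<m ∷ :≡ (1+ v0) v2 e ∷ []))) ∷ [])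
              right : σ″ (suc (Y + i)) ≡ v + i
              right = lin≡ (σ″ (suc (Y + i)) ∷ i ∷ v ∷ interval x i (suc (Y + i)) ∷ interval (suc Y) i (suc (Y + i)) ∷ S (suc (Y + i)) ∷ []) v0 (v2 ⊹ v1) (:≡ (v0 ⊹ v3) (v5 ⊹ v4) (spec (suc (Y + i))) ∷ :≥ #0 v3 (xv i refl) ∷ :≡ v4 #0 (interval-after {suc Y} {i} {suc (Y + i)} ≤-refl) ∷ :≡ v5 (v2 ⊹ v1) (trans (cong S {suc (Y + i)} {suc Y + i} refl) (at-run i<m)) ∷ [])
                where
                xv : ∀ b → b ≡ i → interval x i (suc (Y + i)) ≡ 0
                xv zero e    = trans (cong (λ u → interval x u (suc (Y + i))) (sym e)) (interval-empty x _)
                xv (suc b) e = interval-after {x} {i} {suc (Y + i)} (lin (i ∷ x ∷ Y ∷ b ∷ []) (v1 ⊹ v0) (1+ (v2 ⊹ v0)) (:≤ (1+ (v1 ⊹ v3)) v2 (xb {b} (lin (b ∷ i ∷ []) (1+ v0) v1 (:≡ (1+ v0) v1 e ∷ []))) ∷ []))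
              miss : ∀ r → r ≤ ℓ → σ″ r ≡ suc (Y + i) → Interval x i r (interval x i r) → Interval (suc Y) i r (interval (suc Y) i r) → ⊥
              miss r le e = cases
                where
                same : interval x i r ≡ 0 → interval (suc Y) i r ≡ 0 → ⊥
                same u u′ = avoid i<m fr le (nh r) (lin≡ (S r ∷ i ∷ Y ∷ interval (suc Y) i r ∷ interval x i r ∷ σ″ r ∷ []) v0 (1+ v2 ⊹ v1) (:≥ (v0 ⊹ v3) (v5 ⊹ v4) (spec r) ∷ :≡ v4 #0 u ∷ :≥ #0 v3 u′ ∷ :≡ v5 (1+ (v2 ⊹ v1)) e ∷ []))
                old : ∀ {b} → b < i → r ≡ x + b → interval x i r ≡ 1 → interval (suc Y) i r ≡ 0 → ⊥
                old {b} q f u u′ = lin⊥ (interval x i r ∷ σ″ r ∷ interval (suc Y) i r ∷ S r ∷ S (x + b) ∷ b ∷ Y ∷ i ∷ []) (:≡ (v1 ⊹ v0) (v3 ⊹ v2) (spec r) ∷ :≥ #1 v0 u ∷ :≡ v2 #0 u′ ∷ :≡ v3 v4 (cong S f) ∷ :≡ v4 (1+ v6 ⊹ v5) (ax q) ∷ :≥ (1+ (v6 ⊹ v7)) v1 e ∷ :≤ (1+ v5) v7 q ∷ [])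
                new : ∀ {b} → b < i → r ≡ suc Y + b → interval x i r ≡ 0 → interval (suc Y) i r ≡ 1 → ⊥
                new {b} q′ f′ u u′ = lin⊥ (interval (suc Y) i r ∷ S r ∷ interval x i r ∷ σ″ r ∷ S (suc Y + b) ∷ b ∷ v ∷ i ∷ Y ∷ []) (:≥ (v1 ⊹ v0) (v3 ⊹ v2) (spec r) ∷ :≡ v2 #0 u ∷ :≥ #1 v0 u′ ∷ :≥ v4 v1 (cong S f′) ∷ :≥ (v6 ⊹ v5) v4 (at-run {b} (lin (b ∷ m ∷ i ∷ []) (1+ v0) v1 (:≤ (1+ v0) v2 q′ ∷ :≤ (1+ v2) v1 i<m ∷ []))) ∷ :≡ v3 (1+ (v8 ⊹ v7)) e ∷ :≤ (1+ (v8 ⊹ v7)) v6 vf ∷ [])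
                cases : Interval x i r (interval x i r) → Interval (suc Y) i r (interval (suc Y) i r) → ⊥
                cases (inside b q f u) (inside b′ q′ f′ u′) = lin⊥ (b ∷ x ∷ Y ∷ r ∷ b′ ∷ []) (:≤ (1+ (v1 ⊹ v0)) v2 (xb q) ∷ :≡ v3 (v1 ⊹ v0) f ∷ :≥ (1+ v2 ⊹ v4) v3 f′ ∷ [])
                cases (inside b q f u) (before q′ u′)       = old q f u u′
                cases (inside b q f u) (after q′ u′)        = old q f u u′
                cases (before q u) (inside b′ q′ f′ u′)     = new q′ f′ u u′
                cases (after q u)  (inside b′ q′ f′ u′)     = new q′ f′ u u′
                cases (before q u) (before q′ u′)           = same u u′
                cases (before q u) (after q′ u′)            = same u u′
                cases (after q u)  (before q′ u′)           = same u u′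
                cases (after q u)  (after q′ u′)            = same u u′

-- The value of a term in which a row has lost a root and a box.

module Values where
  open Core
  open Cover
  open Search
  open Straighten
  open Levels
  open Towers
  open Sums
  open Det
  open Expand
  open Schur
  open SchurDegree
  open Linear
  open import Data.Nat using (ℕ; zero; suc; _+_; _*_; _≤_; _<_; z≤n; s≤s)
  open import Data.Nat.Properties
  open import Data.Integer as ℤ using (ℤ; +_; -[1+_]; 0ℤ; 1ℤ) renaming (_+_ to _+ᶻ_; -_ to -ᶻ_; _-_ to _-ᶻ_)
  import Data.Integer.Properties as ℤP
  open import Data.Integer.Tactic.RingSolver using (solve-∀)
  open import Data.Fin as Fin using (Fin; toℕ)
  import Data.Fin.Properties as FinP
  open import Data.List using (List; []; _∷_)
  open import Data.List.Membership.Propositional using (_∈_)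
  open import Data.List.Relation.Unary.All as All using (All; []; _∷_)
  open import Data.Product using (_×_; _,_; proj₂; ∃)
  open import Data.Sum using (_⊎_; inj₁; inj₂; [_,_]′)
  open import Data.Empty using (⊥; ⊥-elim)
  open import Function using (_∘_)
  open import Relation.Nullary using (¬_; Dec; yes; no)
  open import Relation.Binary.Definitions using (Tri; tri<; tri≈; tri>)
  open import Relation.Binary.PropositionalEquality

  sumFℤ-differences : ∀ n (a b c : Fin n → ℤ) → sumFℤ n (λ j → a j +ᶻ (b j -ᶻ c j)) ≡ sumFℤ n a +ᶻ (sumFℤ n b -ᶻ sumFℤ n c)
  sumFℤ-differences zero    a b c = refl
  sumFℤ-differences (suc n) a b c = trans (cong (a Fin.zero +ᶻ (b Fin.zero -ᶻ c Fin.zero) +ᶻ_) (sumFℤ-differences n (a ∘ Fin.suc) (b ∘ Fin.suc) (c ∘ Fin.suc)))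
    (shuffle (a Fin.zero) (b Fin.zero) (c Fin.zero) (sumFℤ n (a ∘ Fin.suc)) (sumFℤ n (b ∘ Fin.suc)) (sumFℤ n (c ∘ Fin.suc)))
    where
    shuffle : ∀ x y z a b c → (x +ᶻ (y -ᶻ z)) +ᶻ (a +ᶻ (b -ᶻ c)) ≡ (x +ᶻ a) +ᶻ ((y +ᶻ b) -ᶻ (z +ᶻ c))
    shuffle = solve-∀

  tailSum-⊞ : ∀ n γ y i j → tailSum n (γ ⊞ (i , j)) y ≡ tailSum n γ y +ᶻ (tailSum n (unit i) y -ᶻ tailSum n (unit j) y)
  tailSum-⊞ n γ y i j = sumFℤ-differences n (λ a → γ (y + toℕ a)) (λ a → unit i (y + toℕ a)) (λ a → unit j (y + toℕ a))

  tail-outside : ∀ n {y i} → i < y ⊎ y + n ≤ i → tailSum n (unit i) y ≡ 0ℤ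
  tail-outside n {y} {i} o = sumFℤ-zero n λ j → unit-other (apart j o)
    where
    apart : ∀ j → i < y ⊎ y + n ≤ i → i ≢ y + toℕ j
    apart j (inj₁ p) e = 1+n≰n (≤-trans p (≤-trans (m≤m+n y (toℕ j)) (≤-reflexive (sym e))))
    apart j (inj₂ p) e = 1+n≰n (≤-trans (+-monoʳ-< y (FinP.toℕ<n j)) (≤-trans p (≤-reflexive e)))

  tail-inside : ∀ n y {i} → i < n → tailSum n (unit (y + i)) y ≡ 1ℤ
  tail-inside (suc n) y {zero}  p = cong₂ _+ᶻ_ (unit-same (y + 0)) (sumFℤ-zero n λ j → unit-other λ e → 0≢1+n (+-cancelˡ-≡ y 0 (suc (toℕ j)) e))
  tail-inside (suc n) y {suc i} p = trans (cong₂ _+ᶻ_ (unit-other {y + suc i} {y + 0} λ e → 0≢1+n (+-cancelˡ-≡ y 0 (suc i) (sym e)))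
    (sumFℤ-cong n λ j → cong₂ unit (+-suc y i) (+-suc y (toℕ j)))) (trans (ℤP.+-identityˡ _) (tail-inside n (suc y) {i} (≤-pred p)))

  indicator-0 : ∀ b → indicator b 0ℤ ≡ 0ℤ
  indicator-0 (+ zero)  = refl
  indicator-0 (+ suc b) = refl
  indicator-0 -[1+ b ]  = refl

  module TowerValues (k ℓ : ℕ) (η : List ℕ) where
    open TowerEval k ℓ η public

    NegativeTail : ℕ → ℕ → Weight → Set
    NegativeTail n y γ = tailSum n γ y ℤ.< 0ℤ

    -- Such roots never move weight into the rows y, ..., ℓ - 1.
    tail-closed : ∀ {σ n y} → y + n ≡ ℓ → (∀ {i} → i < ℓ → i ≤ σ i) → Closed (NegativeTail n y) (Roots σ)
    tail-closed {σ} {n} {y} e low = All.tabulate λ { {i , j} m {γ} q → subst (ℤ._< 0ℤ) (sym (tailSum-⊞ n γ y i j)) (ℤP.+-mono-<-≤ q (drop m)) }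
      where
      inside? : ∀ i → (i < y ⊎ y + n ≤ i) ⊎ (∃ λ o → i ≡ y + o × o < n)
      inside? i with ≤-<-connex y i
      ... | inj₂ p = inj₁ (inj₁ p)
      ... | inj₁ p with m≤n⇒∃[o]m+o≡n p
      ...   | o , refl with ≤-<-connex n o
      ...     | inj₁ q = inj₁ (inj₂ (+-monoʳ-≤ y q))
      ...     | inj₂ q = inj₂ (o , refl , q)
      value : ∀ i → tailSum n (unit i) y ≡ 0ℤ ⊎ tailSum n (unit i) y ≡ 1ℤ
      value i with inside? i
      ... | inj₁ p             = inj₁ (tail-outside n p)
      ... | inj₂ (o , refl , p) = inj₂ (tail-inside n y p)
      below : ∀ a b → a ≡ 0ℤ ⊎ a ≡ 1ℤ → b ≡ 0ℤ ⊎ b ≡ 1ℤ → a ≡ 0ℤ ⊎ b ≡ 1ℤ → a -ᶻ b ℤ.≤ 0ℤ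
      below _ _ _ (inj₁ refl) (inj₁ refl)           = ℤ.+≤+ z≤n
      below _ _ _ (inj₂ refl) (inj₁ refl)           = ℤ.-≤+
      below _ _ (inj₁ refl) _ (inj₂ refl)           = ℤ.-≤+
      below _ _ (inj₂ refl) _ (inj₂ refl)           = ℤ.+≤+ z≤n
      drop : ∀ {i j} → (i , j) ∈ Roots σ → tailSum n (unit i) y -ᶻ tailSum n (unit j) y ℤ.≤ 0ℤ
      drop {i} {j} m = below _ _ (value i) (value j) (by (∈-Roots⁻ {σ} m) (inside? i) (inside? j))
        where
        by : i ≤ ℓ × j < ℓ × σ i ≤ j → (i < y ⊎ y + n ≤ i) ⊎ (∃ λ o → i ≡ y + o × o < n) → (j < y ⊎ y + n ≤ j) ⊎ (∃ λ o → j ≡ y + o × o < n) →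
          tailSum n (unit i) y ≡ 0ℤ ⊎ tailSum n (unit j) y ≡ 1ℤ
        by _ (inj₁ p) _ = inj₁ (tail-outside n p)
        by _ (inj₂ _) (inj₂ (o , refl , p)) = inj₂ (tail-inside n y p)
        by (a , b , c) (inj₂ (o , f , p)) (inj₁ (inj₁ q)) = ⊥-elim (lin⊥ (σ i ∷ j ∷ o ∷ y ∷ i ∷ []) (:≤ v0 v1 c ∷ :≥ (v3 ⊹ v2) v4 f ∷ :≤ (1+ v1) v3 q ∷ :≤ v4 v0 (low {i} (lin (i ∷ ℓ ∷ o ∷ y ∷ n ∷ []) (1+ v0) v1 (:≡ v0 (v3 ⊹ v2) f ∷ :≤ (1+ v2) v4 p ∷ :≡ (v3 ⊹ v4) v1 e ∷ []))) ∷ []))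
        by (a , b , c) (inj₂ _)           (inj₁ (inj₂ q)) = ⊥-elim (lin⊥ (j ∷ ℓ ∷ n ∷ y ∷ []) (:≤ (1+ v0) v1 b ∷ :≤ (v3 ⊹ v2) v0 q ∷ :≥ v1 (v3 ⊹ v2) e ∷ []))

    G-tail : ∀ {n y} → y + n ≡ ℓ → ∀ d {γ} → NegativeTail n y γ → G d γ ≡ 0ℤ
    G-tail {n} {y} e zero {γ} q = trans (cong (indicator (γ ℓ)) (subst (λ L → D L (jacobiTrudi 0 γ toℕ) η ≡ 0ℤ) e
      (D-negative-tail y n 0 γ toℕ η (λ j → ≤-reflexive (sym (+-identityʳ (toℕ j)))) q))) (indicator-0 (γ ℓ))
    G-tail e (suc d) q = refl

    F-tail : ∀ {σ n y} → y + n ≡ ℓ → (∀ {i} → i < ℓ → i ≤ σ i) → ∀ d {γ} → NegativeTail n y γ → F σ d γ ≡ 0ℤ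
    F-tail {σ} {n} {y} e low = E-vanish (NegativeTail n y) (tail-closed {σ} {n} {y} e low) (G-tail {n} {y} e)

    module _ {δ : ℕ → ℕ} (A : Adm k ℓ δ) where
      private
        module A = Adm A

      -- Since roots and weight are both read off the offsets, one increment takes the first root
      -- and a box away from row `y`; the ghost is at `z`.
      start : ℕ → ℕ → ℕ → ℕ
      start z y = upd (upd δ ℓ z) y (suc (δ y))

      start-same : ∀ {z y} → start z y y ≡ suc (δ y)
      start-same {z} {y} = upd-same (upd δ ℓ z) y (suc (δ y))

      start-other : ∀ {z y r} → r ≢ y → r ≢ ℓ → start z y r ≡ δ r
      start-other {z} p q = trans (upd-other (upd δ ℓ z) p) (upd-other δ q)

      -- A row of length 0 cannot be shortened.
      zero-row : ∀ {z y} → y < ℓ → δ y ≡ suc k + y → ∀ M d → 𝕋 (start z y) M d ≡ 0ℤ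
      zero-row {z} {y} y<ℓ e M d = by (m≤n⇒∃[o]m+o≡n y<ℓ)
        where
        cancel : ∀ x → x -ᶻ (1ℤ +ᶻ x) ≡ -ᶻ 1ℤ
        cancel = solve-∀
        flat : ∀ {r} → y ≤ r → δ r ≡ suc k + r
        flat {r} p = (≤-antisym (lin (δ r ∷ r ∷ k ∷ []) v0 (1+ v2 ⊹ v1) (:≤ v0 (1+ v2 ⊹ v1) (A.hi r) ∷ [])) (lin (r ∷ k ∷ δ r ∷ δ y ∷ y ∷ []) (1+ v1 ⊹ v0) v2 (:≤ (v3 ⊹ v0) (v2 ⊹ v4) (σ-mono A p) ∷ :≥ (1+ v1 ⊹ v4) v3 e ∷ [])))
        low : ∀ {i} → i < ℓ → i ≤ start z y i
        low {i} p with i ≟ y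
        ... | yes refl = <⇒≤ (m<n⇒m<1+n (A.lo i))
        ... | no ne    = <⇒≤ (≤-trans (A.lo i) (≤-reflexive (sym (upd-other δ (<⇒≢ p)))))
        by : (∃ λ o → suc y + o ≡ ℓ) → 𝕋 (start z y) M d ≡ 0ℤ
        by (o , eo) = F-tail {start z y} {suc o} {y} (trans (+-suc y o) eo) low d (subst (ℤ._< 0ℤ) (sym total) ℤ.-<+)
          where
          foremost : wt (start z y) M (y + 0) ≡ -ᶻ 1ℤ
          foremost = trans (cong (wt (start z y) M) (+-identityʳ y)) (trans (wt-row (<⇒≢ y<ℓ)) (trans (cong (λ w → + (suc k + y) -ᶻ + w) (trans (start-same {z}) (cong suc e))) (cancel (+ (suc k + y)))))
          later : ∀ (j : Fin o) → wt (start z y) M (y + suc (toℕ j)) ≡ 0ℤ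
          later j = trans (wt-row r<ℓ) (trans (cong (λ w → + (suc k + (y + suc (toℕ j))) -ᶻ + w) (trans (start-other {z} above r<ℓ) (flat (m≤m+n y (suc (toℕ j)))))) (ℤP.+-inverseʳ (+ (suc k + (y + suc (toℕ j))))))
            where
            above : y + suc (toℕ j) ≢ y
            above q = 0≢1+n (sym (+-cancelˡ-≡ y (suc (toℕ j)) 0 (trans q (sym (+-identityʳ y)))))
            r<ℓ : y + suc (toℕ j) ≢ ℓ
            r<ℓ q = outside (toℕ j) (FinP.toℕ<n j) q
              where
              outside : ∀ a → a < o → y + suc a ≢ ℓ
              outside a p q = lin⊥ (a ∷ o ∷ ℓ ∷ y ∷ []) (:≤ (1+ v0) v1 p ∷ :≥ v2 (v3 ⊹ 1+ v0) q ∷ :≡ (1+ v3 ⊹ v1) v2 eo ∷ [])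
          total : tailSum (suc o) (wt (start z y) M) y ≡ -ᶻ 1ℤ
          total = cong₂ _+ᶻ_ foremost (sumFℤ-zero o later)

      abstract
        -- The plus block is [y , y + m] and the minus block [x , x + m).
        state : ℕ → ℕ → ℕ → ℕ → ℕ → ℕ
        state z y m x = upd (lam δ y m x) ℓ z

        state-def : ∀ z y m x → state z y m x ≗ upd (lam δ y m x) ℓ z
        state-def z y m x r = refl

        state-spec : ∀ z y m x {r} → r ≢ ℓ → state z y m x r + interval x m r ≡ δ r + interval y (suc m) r
        state-spec z y m x {r} ne = trans (cong (_+ interval x m r) (upd-other (lam δ y m x) ne)) (lam-spec {δ} {y} {m} {x} A.lo r)

        state-ghost : ∀ z y m x → state z y m x ℓ ≡ z
        state-ghost z y m x = upd-same (lam δ y m x) ℓ z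

      state-shift : ∀ z y m x x′ → (∀ {i} → i < m → x + i < ℓ) → (∀ {i} → i < m → x′ + i < ℓ) →
        ∀ r → state z y m x r + interval x m r ≡ state z y m x′ r + interval x′ m r
      state-shift z y m x x′ b b′ r = by (r ≟ ℓ)
        where
        off : ∀ x → (∀ {i} → i < m → x + i < ℓ) → r ≡ ℓ → interval x m r ≡ 0
        off x b e with locate x m r
        ... | before _ u     = u
        ... | after _ u      = u
        ... | inside i p f _ = ⊥-elim (lin⊥ (i ∷ x ∷ ℓ ∷ r ∷ []) (:≤ (1+ (v1 ⊹ v0)) v2 (b p) ∷ :≡ v3 (v1 ⊹ v0) f ∷ :≥ v2 v3 e ∷ []))
        by : Dec (r ≡ ℓ) → state z y m x r + interval x m r ≡ state z y m x′ r + interval x′ m r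
        by (yes e) = lin≡ (interval x m r ∷ state z y m x r ∷ interval x′ m r ∷ state z y m x′ r ∷ z ∷ []) (v1 ⊹ v0) (v3 ⊹ v2) (:≡ v0 #0 (off x b e) ∷ :≥ #0 v2 (off x′ b′ e) ∷ :≡ v1 v4 (trans (cong (state z y m x) e) (state-ghost z y m x)) ∷ :≥ v4 v3 (trans (cong (state z y m x′) e) (state-ghost z y m x′)) ∷ [])
        by (no ne) = trans (state-spec z y m x ne) (sym (state-spec z y m x′ ne))

      -- With the minus block directly after row `y` the two blocks cancel except in row `y`.
      start-state : ∀ {z y m} → y < ℓ → start z y ≗ state z y m (suc y)
      start-state {z} {y} {m} p r = by (r ≟ y) (r ≟ ℓ)
        where
        by : Dec (r ≡ y) → Dec (r ≡ ℓ) → start z y r ≡ state z y m (suc y) r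
        by (yes e) (yes f) = ⊥-elim (lin⊥ (y ∷ ℓ ∷ r ∷ []) (:≤ (1+ v0) v1 p ∷ :≡ v2 v0 e ∷ :≥ v1 v2 f ∷ []))
        by (yes e) (no ne) = lin≡ (start z y r ∷ state z y m (suc y) r ∷ interval y (suc m) r ∷ δ r ∷ interval (suc y) m r ∷ δ y ∷ []) v0 v1 (:≥ (v3 ⊹ v2) (v1 ⊹ v4) (state-spec z y m (suc y) ne) ∷ :≥ v5 v3 (cong δ e) ∷ :≥ #1 v2 (trans (cong (interval y (suc m)) e) (interval-head y m)) ∷ :≡ v4 #0 (trans (cong (interval (suc y) m) e) (interval-before {suc y} {m} {y} ≤-refl)) ∷ :≡ v0 (1+ v5) (trans (cong (start z y) e) (start-same {z} {y})) ∷ [])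
        by (no ne) (yes f) = trans (upd-other (upd δ ℓ z) ne) (trans (cong (upd δ ℓ z) f) (trans (upd-same δ ℓ z) (trans (sym (state-ghost z y m (suc y))) (cong (state z y m (suc y)) (sym f)))))
        by (no ne) (no nf) = lin≡ (start z y r ∷ state z y m (suc y) r ∷ interval y (suc m) r ∷ δ r ∷ interval (suc y) m r ∷ []) v0 v1 (:≥ (v3 ⊹ v2) (v1 ⊹ v4) (state-spec z y m (suc y) nf) ∷ :≥ v4 v2 (interval-tail {y} {m} ne) ∷ :≡ v0 v3 (start-other {z} ne nf) ∷ [])

      Reach : ℕ → ℕ → Set
      Reach z y = ∃ λ a → iterate-σ A a z ≡ y

      iterate-≥ : ∀ a z → z ≤ iterate-σ A a z
      iterate-≥ zero    z = ≤-refl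
      iterate-≥ (suc a) z = ≤-trans (iterate-≥ a z) (<⇒≤ (A.lo (iterate-σ A a z)))

      module _ {z y m : ℕ} (reach : Reach z y) (run : ∀ {i} → i ≤ m → δ (y + i) ≡ δ y + i) (y+m<ℓ : y + m < ℓ) where
        module _ {s : ℕ} (st : Steps A m y s) (w : s ≡ 0 ⊎ y + m < δ y) where
          -- Row `y` lies on the orbit of `z`. The climb is either still on this orbit or has passed
          -- row `z` itself; in the latter case the spacing of the levels puts whole blocks above
          -- row `z`.
          levels-reach : ∀ {j} → j ≤ s → Reach z (level A y j) ⊎ level A y j + m < z
          levels-reach {zero}  p = inj₁ reach
          levels-reach {suc j} p = [ at , (λ q → inj₂ (lin (m ∷ level A y (suc j) ∷ z ∷ level A y j ∷ []) (1+ (v1 ⊹ v0)) v2 (:≤ (1+ (v3 ⊹ v0)) v2 q ∷ :≤ (1+ (v1 ⊹ v0)) v3 spaced ∷ []))) ]′ (levels-reach (<⇒≤ p))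
            where
            wide : s ≡ 0 ⊎ y + m < δ y → y + m < δ y
            wide (inj₁ e) = ⊥-elim (lin⊥ (j ∷ s ∷ []) (:≤ (1+ v0) v1 p ∷ :≡ v1 #0 e ∷ []))
            wide (inj₂ q) = q
            spaced : level A y (suc j) + m < level A y j
            spaced = ladder-spaced A {m} {s} {level A y} st (wide w) p
            above : z ≡ level A y j → level A y (suc j) + m < z
            above e = lin (m ∷ level A y (suc j) ∷ z ∷ level A y j ∷ []) (1+ (v1 ⊹ v0)) v2 (:≥ v3 v2 e ∷ :≤ (1+ (v1 ⊹ v0)) v3 spaced ∷ [])
            at : Reach z (level A y j) → Reach z (level A y (suc j)) ⊎ level A y (suc j) + m < z
            at (zero , e)  = inj₂ (above e)
            at (suc a , e) = inj₁ (a , σ-injective A (trans e (sym (ladder-step A {m} {s} {level A y} st p))))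

          visible : ∀ {j} → j ≤ s → Visible z (level A y j) m
          visible p = [ (λ { (a , e) → inj₁ (≤-trans (iterate-≥ a z) (≤-reflexive e)) }) , inj₂ ]′ (levels-reach p)

          levels-≤ : ∀ {j} → j ≤ s → level A y j ≤ y
          levels-≤ = ladder-≤ A {m} {s} {level A y} st

          module At = Facts A {y} {m} {level A y s} {_} {z} {state z y m (suc (level A y s))} run y+m<ℓ (visible ≤-refl) (proj₂ (position A st w))
            (state-spec z y m (suc (level A y s))) (state-ghost z y m (suc (level A y s)))

          advance : ∀ x → (∀ {i} → i < m → x + i ≢ y × δ (x + i) ≡ suc (level A y s + i)) → ∀ M d →
            𝕋 (state z y m (suc (level A y s))) M d ≡ (𝕋 (state z y m x) M ↑ m) d
          advance x hx = At.level-eval {m} {x} ≤-refl hx (state-shift z y m x (suc (level A y s)) (λ {i} p → (lin (i ∷ x ∷ ℓ ∷ level A y s ∷ y ∷ m ∷ []) (1+ (v1 ⊹ v0)) v2 (:≤ (1+ (v1 ⊹ v0)) v3 (At.x-< {m} {x} ≤-refl hx p) ∷ :≤ v3 v4 (levels-≤ {s} ≤-refl) ∷ :≤ (1+ (v4 ⊹ v5)) v2 y+m<ℓ ∷ :≤ (1+ v0) v5 p ∷ [])))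
            (λ {i} p → (lin (i ∷ level A y s ∷ ℓ ∷ m ∷ y ∷ []) (1+ (1+ v1 ⊹ v0)) v2 (:≤ (1+ v0) v3 p ∷ :≤ v1 v4 (levels-≤ {s} ≤-refl) ∷ :≤ (1+ (v4 ⊹ v3)) v2 y+m<ℓ ∷ []))))

        -- With the row after the next level as `x`, `advance` moves the minus block from one level
        -- to the next and costs `m` factors t.
        climb-eval : ∀ s → Steps A m y s → s ≡ 0 ⊎ y + m < δ y → ∀ M d → 𝕋 (state z y m (suc y)) M d ≡ (𝕋 (state z y m (suc (level A y s))) M ↑ (s * m)) d
        climb-eval zero    st w        M d = refl
        climb-eval (suc s) st (inj₂ w) M d = trans (climb-eval s st′ (inj₂ w) M d) (trans (↑-cong (s * m) (advance st′ (inj₂ w) (suc (level A y (suc s))) hx M) d)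
          (trans (↑-+ (𝕋 (state z y m (suc (level A y (suc s)))) M) m (s * m) d) (cong (λ e → (𝕋 (state z y m (suc (level A y (suc s)))) M ↑ e) d) (+-comm (s * m) m))))
          where
          st′ : Steps A m y s
          st′ p = st (m<n⇒m<1+n p)
          hx : ∀ {i} → i < m → suc (level A y (suc s)) + i ≢ y × δ (suc (level A y (suc s)) + i) ≡ suc (level A y s + i)
          hx {i} p = (λ e → (lin⊥ (y ∷ i ∷ level A y (suc s) ∷ m ∷ level A y s ∷ []) (:≥ v0 (1+ v2 ⊹ v1) e ∷ :≤ (1+ v1) v3 p ∷ :≤ (1+ (v2 ⊹ v3)) v4 (ladder-spaced A {m} {suc s} {level A y} st w ≤-refl) ∷ :≤ v4 v0 (levels-≤ st′ (inj₂ w) {s} ≤-refl) ∷ []))) ,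
            trans (cong δ (sym (+-suc (level A y (suc s)) i))) (trans (st ≤-refl p) (+-suc (level A y s) i))

      good-m : ∀ {y m m′} → (∀ {i} → i ≤ m → δ (y + i) ≡ δ y + i) → suc (δ y + m) < δ (suc (y + m)) →
        (∀ {i} → i ≤ m′ → δ (y + i) ≡ δ y + i) → suc (δ y + m′) < δ (suc (y + m′)) → m ≡ m′
      good-m {y} {m} {m′} run stop run′ stop′ = ≤-antisym (≮⇒≥ λ p → (lin⊥ (m′ ∷ δ y ∷ δ (suc (y + m′)) ∷ δ (y + suc m′) ∷ []) (:≤ (1+ (1+ (v1 ⊹ v0))) v2 stop′ ∷ :≡ v3 (v1 ⊹ 1+ v0) (run p) ∷ :≥ v2 v3 (cong δ (+-suc y m′)) ∷ []))) (≮⇒≥ λ p → (lin⊥ (m ∷ δ y ∷ δ (suc (y + m)) ∷ δ (y + suc m) ∷ []) (:≤ (1+ (1+ (v1 ⊹ v0))) v2 stop ∷ :≡ v3 (v1 ⊹ 1+ v0) (run′ p) ∷ :≥ v2 v3 (cong δ (+-suc y m)) ∷ [])))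

      -- `σ` is injective, so there is only one way up the runner.
      tower-level : ∀ {y m t x Y} → Good k δ y m t x Y → ∀ {m′ s} → Steps A m′ y s → ∀ {j} → j ≤ t → j ≤ s → Y j ≡ level A y j
      tower-level G st {zero}  p q = Good.base G
      tower-level {y} {m} {t} {x} {Y} G {m′} {s} st {suc j} p q = σ-injective A (trans (Geometry.step₀ A G p) (trans (tower-level G st (<⇒≤ p) (<⇒≤ q)) (sym (ladder-step A {m′} {s} {level A y} st q))))

      -- A good tower would have the same `m` and the same levels as the climb. If it continued
      -- beyond level `s` or ended there, `step` or `side` would supply the missing row; it cannot
      -- end earlier, because the climb found a row above its top.
      no-good : ∀ {y m s i x} → (∀ {i} → i ≤ m → δ (y + i) ≡ δ y + i) → suc (δ y + m) < δ (suc (y + m)) → Steps A m y s → i < m →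
        (∀ r → r ≢ y → δ r ≢ suc (level A y s + i)) → ∀ {m′ t Y} → ¬ Good k δ y m′ t x Y
      no-good {y} {m} {s} {i} {x} run stop st i<m nh {m′} {t} {Y} G = by (<-cmp s t)
        where
        open Geometry A G
        m≡ : m ≡ m′
        m≡ = good-m run stop (Good.run G) (Good.stop G)
        at : s ≤ t → Y s ≡ level A y s
        at p = tower-level G st p ≤-refl
        by : Tri (s < t) (s ≡ t) (t < s) → ⊥
        by (tri< p _ _) = nh (Y (suc s) + suc i) (λ e → (lin⊥ (y ∷ i ∷ Y (suc s) ∷ m ∷ m′ ∷ Y 0 ∷ []) (:≥ v0 (v2 ⊹ 1+ v1) e ∷ :≤ (1+ v1) v3 i<m ∷ :≡ v3 v4 m≡ ∷ :≡ v5 v0 (Good.base G) ∷ :≤ (1+ (v2 ⊹ v4)) v5 (spread {0} {suc s} (s≤s z≤n) p) ∷ []))) (lin≡ (δ (Y (suc s) + suc i) ∷ i ∷ level A y s ∷ Y s ∷ []) v0 (1+ (v2 ⊹ v1)) (:≡ v0 (v3 ⊹ 1+ v1) (Good.step G p {suc i} (lin (i ∷ m′ ∷ m ∷ []) (1+ v0) v1 (:≤ (1+ v0) v2 i<m ∷ :≡ v2 v1 m≡ ∷ []))) ∷ :≡ v3 v2 (at (<⇒≤ p)) ∷ []))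
        by (tri≈ _ p _) = nh (x + i) (λ e → (lin⊥ (y ∷ i ∷ x ∷ Y t ∷ []) (:≥ v0 (v2 ⊹ v1) e ∷ :≤ (1+ (v2 ⊹ v1)) v3 (side-< {i} (lin (i ∷ m′ ∷ m ∷ []) (1+ v0) v1 (:≤ (1+ v0) v2 i<m ∷ :≡ v2 v1 m≡ ∷ []))) ∷ :≤ v3 v0 top≤y ∷ []))) (lin≡ (δ (x + i) ∷ i ∷ level A y s ∷ Y t ∷ Y s ∷ []) v0 (1+ (v2 ⊹ v1)) (:≡ v0 (1+ (v3 ⊹ v1)) (Good.side G {i} (lin (i ∷ m′ ∷ m ∷ []) (1+ v0) v1 (:≤ (1+ v0) v2 i<m ∷ :≡ v2 v1 m≡ ∷ []))) ∷ :≡ v4 v2 (at (≤-reflexive p)) ∷ :≥ v3 v4 (cong Y p) ∷ []))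
        by (tri> _ _ p) = Good.roof G (level A y (suc t)) (trans (ladder-step A {m} {s} {level A y} st p) (sym (tower-level G st ≤-refl (<⇒≤ p))))

      -- The value of the term in which row y has just lost its first root.
      data Value (z y : ℕ) : Set where
        removable : ∀ m t x → Good k δ y m t x (level A y) → (∀ M d → 𝕋 (start z y) M d ≡ (𝕋 (upd (lam δ y m x) ℓ z) M ↑ (suc t * m)) d) → Value z y
        rigid     : (∀ m t x Y → ¬ Good k δ y m t x Y) → (∀ M d → 𝕋 (start z y) M d ≡ 0ℤ) → Value z y

      -- The minus block climbs `t` levels and moves once more, onto the rows `x`, ..., hence
      -- `suc t * m`. A climb that gets stuck, like an empty row, gives 0 and admits no removal.
      evaluate : ∀ {z y} → Reach z y → y < ℓ → Value z y
      evaluate {z} {y} reach y<ℓ = [ (λ p → nonzero (≤-pred p) (run-length A (≤-pred p))) , (λ e → rigid (λ m t x Y G → (lin⊥ (δ y ∷ y ∷ k ∷ []) (:≤ v0 (v2 ⊹ v1) (Good.pos G) ∷ :≥ (1+ v2 ⊹ v1) v0 e ∷ []))) (zero-row {z} y<ℓ e)) ]′ (m≤n⇒m<n∨m≡n (A.hi y))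
        where
        nonzero : δ y ≤ k + y → (∃ λ m → (∀ {i} → i ≤ m → δ (y + i) ≡ δ y + i) × suc (δ y + m) < δ (suc (y + m))) → Value z y
        nonzero pos (m , run , stop) = by (outcome A m y)
          where
          y+m<ℓ : y + m < ℓ
          y+m<ℓ = ≰⇒> λ q → lin⊥ (m ∷ y ∷ k ∷ δ (y + m) ∷ δ y ∷ []) (:≥ (1+ v2 ⊹ (v1 ⊹ v0)) v3 (A.tail q) ∷ :≡ v3 (v4 ⊹ v0) (run {m} ≤-refl) ∷ :≤ v4 (v2 ⊹ v1) pos ∷ [])
          by : Outcome A m y → Value z y
          by (complete t x w st roof side) = removable m t x
            (record { pos = pos ; run = run ; stop = stop ; window = w ; tower = record { base = refl ; step = st ; roof = roof ; side = λ p → proj₂ (side p) } })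
            λ M d → trans (𝕋-agree (start-state {z} {y} {m} y<ℓ) d) (trans (climb-eval reach run y+m<ℓ t st (inj₂ w) M d)
              (trans (↑-cong (t * m) (advance reach run y+m<ℓ st (inj₂ w) x side M) d) (trans (↑-+ (𝕋 (state z y m x) M) m (t * m) d)
                (trans (cong (λ e → (𝕋 (state z y m x) M ↑ e) d) (+-comm (t * m) m)) (↑-cong (suc t * m) (𝕋-agree (state-def z y m x)) d)))))
          by (stuck s i x w st i<m nh prev) = rigid (λ m′ t x′ Y G → no-good {x = x′} run stop st i<m nh G)
            λ M d → trans (𝕋-agree (start-state {z} {y} {m} y<ℓ) d) (trans (climb-eval reach run y+m<ℓ s st w M d)
              (↑-zero (s * m) (At.stuck-zero reach run y+m<ℓ st w {i} {x} i<m prev nh M) d))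

-- Using up the ghost roots.

module Peel where
  open Row
  open Core
  open Search
  open Straighten
  open Values
  open Sums
  open Det
  open Expand
  open Schur
  open SchurDegree
  open Linear
  open import Data.Nat using (ℕ; zero; suc; _+_; _≤_; _<_; z≤n; s≤s)
  open import Data.Nat.Properties
  open import Data.Integer as ℤ using (ℤ; +_; -[1+_]; 0ℤ; 1ℤ) renaming (_+_ to _+ᶻ_; -_ to -ᶻ_; _-_ to _-ᶻ_)
  import Data.Integer.Properties as ℤP
  open import Data.Integer.Tactic.RingSolver using (solve-∀)
  open import Data.Fin as Fin using (Fin; toℕ)
  import Data.Fin.Properties as FinP
  open import Data.List using (List; []; _∷_; map; _++_; _∷ʳ_)
  open import Data.List.Membership.Propositional using (_∈_)
  open import Data.List.Relation.Unary.All as All using (All; []; _∷_)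
  import Data.List.Relation.Unary.Linked as Linked
  open import Data.List.Relation.Binary.Permutation.Propositional using (_↭_; ↭-trans; prep)
  open import Data.List.Relation.Binary.Permutation.Propositional.Properties using (++-comm)
  open import Data.Product using (_×_; _,_; proj₁; proj₂; ∃)
  open import Data.Sum using (_⊎_; inj₁; inj₂; [_,_]′)
  open import Data.Empty using (⊥-elim)
  open import Function using (_∘_; id)
  open import Relation.Nullary using (Dec; yes; no)
  open import Relation.Binary.PropositionalEquality

  -- Serves for weights that agree only in the rows before `ℓ`, where `Respects` does not apply.
  E-relate : ∀ {G} {_~_ : Weight → Weight → Set} → (∀ {γ γ′} α → γ ~ γ′ → (γ ⊞ α) ~ (γ′ ⊞ α)) → (∀ d {γ γ′} → γ ~ γ′ → G d γ ≡ G d γ′) →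
    ∀ Ψ d {γ γ′} → γ ~ γ′ → E G Ψ d γ ≡ E G Ψ d γ′
  E-relate s h []      d       r = h d r
  E-relate {G} {_~_} s h (α ∷ Ψ) zero    r = E-relate {G} {_~_} s h Ψ zero r
  E-relate {G} {_~_} s h (α ∷ Ψ) (suc d) r = cong₂ _+ᶻ_ (E-relate {G} {_~_} s h Ψ (suc d) r) (E-relate {G} {_~_} s h (α ∷ Ψ) d (s α r))

  E-zero : ∀ G Ψ γ → E G Ψ 0 γ ≡ G 0 γ
  E-zero G []      γ = refl
  E-zero G (α ∷ Ψ) γ = E-zero G Ψ γ

  E-low : ∀ {G} m (Q : Weight → Set) {Ψ} → Closed Q Ψ → (∀ {e} → e < m → ∀ {γ} → Q γ → G e γ ≡ 0ℤ) → ∀ {e} → e < m → ∀ {γ} → Q γ → E G Ψ e γ ≡ 0ℤ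
  E-low m Q []       h p q = h p q
  E-low m Q (c ∷ cs) h {zero}  p q = E-low m Q cs h p q
  E-low m Q (c ∷ cs) h {suc e} p q = cong₂ _+ᶻ_ (E-low m Q cs h p q) (E-low m Q (c ∷ cs) h {e} (<-trans (n<1+n e) p) (c q))

  -- If `G` starts in degree `m`, so does the whole product, and degrees can be counted from there.
  E-shift : ∀ {G} m (Q : Weight → Set) {Ψ} → Closed Q Ψ → (∀ {e} → e < m → ∀ {γ} → Q γ → G e γ ≡ 0ℤ) →
    ∀ d {γ} → Q γ → E G Ψ (d + m) γ ≡ E (λ e → G (e + m)) Ψ d γ
  E-shift m Q []       h d       q = refl
  E-shift {G} m Q (_∷_ {α} {Ψ} c cs) h zero {γ} q = trans (lowest m refl) (E-shift {G} m Q cs h zero q)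
    where
    lowest : ∀ m′ → m′ ≡ m → E G (α ∷ Ψ) m′ γ ≡ E G Ψ m′ γ
    lowest zero     e = refl
    lowest (suc m′) e = trans (cong (E G Ψ (suc m′) γ +ᶻ_) (E-low m Q (c ∷ cs) h {m′} (≤-reflexive e) (c q))) (ℤP.+-identityʳ _)
  E-shift {G} m Q (c ∷ cs) h (suc d) q = cong₂ _+ᶻ_ (E-shift {G} m Q cs h (suc d) q) (E-shift {G} m Q (c ∷ cs) h d (c q))

  indicator-+ : ∀ b x y → indicator b (x +ᶻ y) ≡ indicator b x +ᶻ indicator b y
  indicator-+ (+ zero)  x y = refl
  indicator-+ (+ suc b) x y = refl
  indicator-+ -[1+ b ]  x y = refl

  indicator-≢ : ∀ {b} a → b ≢ 0ℤ → indicator b a ≡ 0ℤ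
  indicator-≢ {+ zero}  a ne = ⊥-elim (ne refl)
  indicator-≢ {+ suc b} a ne = refl
  indicator-≢ { -[1+ b ]} a ne = refl

  less : Weight → ℕ → Weight
  less γ y x = γ x -ᶻ unit y x

  module Peeling (k ℓ : ℕ) (η : List ℕ) where
    open TowerValues k ℓ η public

    fixes-ghost : ∀ {γ i j} → i ≢ ℓ → j < ℓ → (γ ⊞ (i , j)) ℓ ≡ γ ℓ
    fixes-ghost {γ} {i} {j} p q = trans (cong₂ (λ a b → γ ℓ +ᶻ (a -ᶻ b)) (unit-other p) (unit-other (<⇒≢ q))) (ℤP.+-identityʳ (γ ℓ))

    -- Without ghost roots the entry of the ghost is invariant.
    ghost-closed : ∀ δ c → Closed (λ γ → γ ℓ ≡ c) (Roots (upd δ ℓ ℓ))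
    ghost-closed δ c = All.tabulate λ { {i , j} p {γ} q → trans (fixes-ghost {γ} (proper i j p) (column i j p)) q }
      where
      column : ∀ i j → (i , j) ∈ Roots (upd δ ℓ ℓ) → j < ℓ
      column i j p = proj₁ (proj₂ (∈-Roots⁻ {upd δ ℓ ℓ} p))
      proper : ∀ i j → (i , j) ∈ Roots (upd δ ℓ ℓ) → i ≢ ℓ
      proper i j p refl = <⇒≱ (column i j p) (≤-trans (≤-reflexive (sym (upd-same δ ℓ ℓ))) (proj₂ (proj₂ (∈-Roots⁻ {upd δ ℓ ℓ} p))))

    -- Without ghost roots the exponent of the ghost stays negative and is rejected by `indicator`.
    ghost-stuck : ∀ δ M d → 𝕋 (upd δ ℓ ℓ) (suc M) d ≡ 0ℤ
    ghost-stuck δ M d = E-vanish (λ γ → γ ℓ ≡ -[1+ M ]) (ghost-closed δ -[1+ M ]) vanish d (wt-ghost {upd δ ℓ ℓ} {suc M})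
      where
      vanish : ∀ d {γ} → γ ℓ ≡ -[1+ M ] → G d γ ≡ 0ℤ
      vanish zero    {γ} e = cong (λ b → indicator b (D ℓ (jacobiTrudi 0 γ toℕ) η)) e
      vanish (suc d) e = refl

    ghost-removes : ∀ δ z → Removes (upd δ ℓ z) (upd δ ℓ (suc z)) ℓ
    ghost-removes δ z = removes (trans (upd-same δ ℓ (suc z)) (cong suc (sym (upd-same δ ℓ z)))) (λ ne → trans (upd-other δ ne) (sym (upd-other δ ne)))

    wt-ghosts : ∀ δ z z′ M → wt (upd δ ℓ z) M ≗ wt (upd δ ℓ z′) M
    wt-ghosts δ z z′ M = wt-agree λ ne → trans (upd-other δ ne) (sym (upd-other δ ne))

    -- With M = 0 the ghost would only become positive.
    ghost-free : ∀ δ {z} → z ≤ ℓ → ∀ d → 𝕋 (upd δ ℓ z) 0 d ≡ 𝕋 (upd δ ℓ ℓ) 0 d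
    ghost-free δ {z} le = let o , e = m≤n⇒∃[o]m+o≡n le in go o z e
      where
      Positive : Weight → Set
      Positive γ = 0ℤ ℤ.< γ ℓ
      closed : ∀ σ → Closed Positive (Roots σ)
      closed σ = All.tabulate λ { {i , j} m {γ} q → step i j {γ} (proj₁ (proj₂ (∈-Roots⁻ {σ} m))) q }
        where
        step : ∀ i j {γ} → j < ℓ → Positive γ → Positive (γ ⊞ (i , j))
        step i j {γ} p q with i ≟ ℓ
        ... | no ne = subst (0ℤ ℤ.<_) (sym (fixes-ghost {γ} ne p)) q
        ... | yes refl = subst (0ℤ ℤ.<_) (sym (cong₂ (λ a b → γ ℓ +ᶻ (a -ᶻ b)) (unit-same ℓ) (unit-other (<⇒≢ p)))) (ℤP.+-mono-< q (ℤ.+<+ (s≤s z≤n)))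
      vanish : ∀ d {γ} → Positive γ → G d γ ≡ 0ℤ
      vanish zero    {γ} q = indicator-≢ (D ℓ (jacobiTrudi 0 γ toℕ) η) λ e → ℤP.<-irrefl (sym e) q
      vanish (suc d) q = refl
      go : ∀ o z → z + o ≡ ℓ → ∀ d → 𝕋 (upd δ ℓ z) 0 d ≡ 𝕋 (upd δ ℓ ℓ) 0 d
      go zero    z e d = cong (λ z → 𝕋 (upd δ ℓ z) 0 d) (trans (sym (+-identityʳ z)) e)
      go (suc o) z e d = trans (F-remove-zero (ghost-removes δ z) ≤-refl (λ d → E-vanish Positive (closed (upd δ ℓ z)) vanish d positive) d)
        (trans (F-respects (upd δ ℓ (suc z)) d (wt-ghosts δ z (suc z) 0)) (go o (suc z) (trans (sym (+-suc z o)) e) d))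
        where
        z<ℓ : z < ℓ
        z<ℓ = lin (z ∷ ℓ ∷ o ∷ []) (1+ v0) v1 (:≡ (v0 ⊹ 1+ v2) v1 e ∷ [])
        positive : Positive (wt (upd δ ℓ z) 0 ⊞ (ℓ , upd δ ℓ z ℓ))
        positive = subst (0ℤ ℤ.<_) (sym (trans (cong₂ (λ a b → wt (upd δ ℓ z) 0 ℓ +ᶻ (a -ᶻ b)) (unit-same ℓ) (trans (cong (λ i → unit i ℓ) (upd-same δ ℓ z)) (unit-other (<⇒≢ z<ℓ))))
          (cong (_+ᶻ 1ℤ) (wt-ghost {upd δ ℓ z} {0})))) (ℤ.+<+ (s≤s z≤n))

    -- The terms in which row y still has to lose a box.
    U : (ℕ → ℕ) → ℕ → ℕ → ℕ → ℕ → ℤ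
    U δ z y M d = F (upd δ ℓ z) d (less (wt (upd δ ℓ z) M) y)

    -- Using the root `(ℓ , z)` raises the exponent of the ghost by 1 and takes the box for it from
    -- row `z`.
    peel-ghost : ∀ δ {z} M → z < ℓ → ∀ d → 𝕋 (upd δ ℓ z) (suc M) d ≡ 𝕋 (upd δ ℓ (suc z)) (suc M) d +ᶻ (U δ z z M ↑ 1) d
    peel-ghost δ {z} M z<ℓ d = trans (F-remove (ghost-removes δ z) ≤-refl (≤-trans (s≤s (≤-reflexive (upd-same δ ℓ z))) z<ℓ) d (wt (upd δ ℓ z) (suc M)))
      (cong₂ _+ᶻ_ (F-respects (upd δ ℓ (suc z)) d (wt-ghosts δ z (suc z) (suc M))) (↑-cong 1 (λ d → F-respects (upd δ ℓ z) d moved) d))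
      where
      σ = upd δ ℓ z
      balance : ∀ a u → (-ᶻ (1ℤ +ᶻ a)) +ᶻ (1ℤ -ᶻ u) ≡ (-ᶻ a) -ᶻ u
      balance = solve-∀
      shift : ∀ a u → a +ᶻ (0ℤ -ᶻ u) ≡ a -ᶻ u
      shift = solve-∀
      moved : wt σ (suc M) ⊞ (ℓ , σ ℓ) ≗ less (wt σ M) z
      moved x = trans (cong (λ v → wt σ (suc M) x +ᶻ (unit ℓ x -ᶻ unit v x)) (upd-same δ ℓ z)) (by (x ≟ ℓ))
        where
        by : Dec (x ≡ ℓ) → wt σ (suc M) x +ᶻ (unit ℓ x -ᶻ unit z x) ≡ less (wt σ M) z x
        by (yes refl) = trans (cong₂ (λ a b → a +ᶻ (b -ᶻ unit z ℓ)) (wt-ghost {σ} {suc M}) (unit-same ℓ)) (trans (balance (+ M) (unit z ℓ)) (cong (_-ᶻ unit z ℓ) (sym (wt-ghost {σ} {M}))))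
        by (no ne)    = trans (cong₂ (λ a b → a +ᶻ (b -ᶻ unit z x)) (trans (wt-row ne) (sym (wt-row {σ} {M} ne))) (unit-other (ne ∘ sym))) (shift (wt σ M x) (unit z x))

    module _ {δ : ℕ → ℕ} (A : Adm k ℓ δ) {z y : ℕ} (M : ℕ) (y<ℓ : y < ℓ) where
      private
        σ = upd δ ℓ z
        y≢ℓ : y ≢ ℓ
        y≢ℓ = <⇒≢ y<ℓ
        σy : σ y ≡ δ y
        σy = upd-other δ y≢ℓ

        row-removes : Removes σ (start A z y) y
        row-removes = removes (trans (start-same A {z}) (cong suc (sym σy))) (upd-other σ)

        started : less (wt σ M) y ≗ wt (start A z y) M
        started x with x ≟ y
        ... | yes refl = trans (cong₂ _-ᶻ_ (wt-row y≢ℓ) (unit-same y)) (trans (cong (λ w → (+ (suc k + y) -ᶻ + w) -ᶻ 1ℤ) σy) (trans (shift (+ (suc k + y)) (+ δ y)) (sym (trans (wt-row y≢ℓ) (cong (λ w → + (suc k + y) -ᶻ + w) (start-same A {z}))))))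
          where
          shift : ∀ a b → (a -ᶻ b) -ᶻ 1ℤ ≡ a -ᶻ (1ℤ +ᶻ b)
          shift = solve-∀
        ... | no ne = trans (cong (λ u → wt σ M x -ᶻ u) (unit-other (ne ∘ sym))) (trans (ℤP.+-identityʳ _) same)
          where
          same : wt σ M x ≡ wt (start A z y) M x
          same with x ≟ ℓ
          ... | yes _ = refl
          ... | no _  = cong (λ w → + (suc k + x) -ᶻ + w) (sym (upd-other σ ne))

        carried : less (wt σ M) y ⊞ (y , σ y) ≗ less (wt σ M) (δ y)
        carried x = trans (cong (λ v → (wt σ M x -ᶻ unit y x) +ᶻ (unit y x -ᶻ unit v x)) σy) (telescope (wt σ M x) (unit y x) (unit (δ y) x))
          where
          telescope : ∀ a u v → (a -ᶻ u) +ᶻ (u -ᶻ v) ≡ a -ᶻ v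
          telescope = solve-∀

      -- If the root `(y , δ y)` is dropped, row `y` is shorter for good; if it is used, the missing
      -- box is passed on to row `δ y`. In this way the deficit wanders along the orbit.
      peel-row : δ y < ℓ → ∀ d → U δ z y M d ≡ 𝕋 (start A z y) M d +ᶻ (U δ z (δ y) M ↑ 1) d
      peel-row p d = trans (F-remove row-removes (<⇒≤ y<ℓ) (≤-trans (s≤s (≤-reflexive σy)) p) d (less (wt σ M) y))
        (cong₂ _+ᶻ_ (F-respects (start A z y) d started) (↑-cong 1 (λ d → F-respects σ d carried) d))

      -- Row `y` has no root in the grid that could pass the deficit on.
      peel-last : ℓ ≤ δ y → ∀ d → U δ z y M d ≡ 𝕋 (start A z y) M d
      peel-last p d = trans (E-↭ G-respects (Roots-same row-removes (≤-trans p (≤-reflexive (sym σy)))) d _) (F-respects (start A z y) d started)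

    ghost-roots : ∀ δ n z → z + n ≡ ℓ → Roots (upd δ ℓ z) ↭ lowsFrom ℓ z n ++ Roots (upd δ ℓ ℓ)
    ghost-roots δ zero    z e = Roots-agree λ {x} _ → cong (λ v → upd δ ℓ v x) (trans (sym (+-identityʳ z)) e)
    ghost-roots δ (suc n) z e = ↭-trans (Roots-remove (ghost-removes δ z) ≤-refl (≤-trans (s≤s (≤-reflexive (upd-same δ ℓ z))) (lin (z ∷ ℓ ∷ n ∷ []) (1+ v0) v1 (:≡ (v0 ⊹ 1+ v2) v1 e ∷ []))))
      (subst (λ v → (ℓ , v) ∷ Roots (upd δ ℓ (suc z)) ↭ (ℓ , z) ∷ lowsFrom ℓ (suc z) n ++ Roots (upd δ ℓ ℓ)) (sym (upd-same δ ℓ z)) (prep (ℓ , z) (ghost-roots δ n (suc z) (trans (sym (+-suc z n)) e))))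

  module _ (k ℓ : ℕ) (η : List ℕ) (m : ℕ) where
    private
      module S = Peeling k ℓ η
      module S⁺ = Peeling k ℓ (η ∷ʳ m)
      lows : List Root
      lows = lowsFrom ℓ 0 ℓ
      Ψ : Weight → ℤ
      Ψ γ = D ℓ (jacobiTrudi 0 γ toℕ) η
      H : ℕ → Weight → ℤ
      H = E (lift Ψ) lows

      -- Each ghost root brings one factor t and raises the ghost by 1, so the power of t alone
      -- tells its final exponent.
      ghost-tracks : ∀ n i → i + n ≤ ℓ → ∀ e γ → E S.G (lowsFrom ℓ i n) e γ ≡ indicator (γ ℓ +ᶻ + e) (E (lift Ψ) (lowsFrom ℓ i n) e γ)
      ghost-tracks zero    i p zero    γ = cong (λ b → indicator b (Ψ γ)) (sym (ℤP.+-identityʳ (γ ℓ)))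
      ghost-tracks zero    i p (suc e) γ = sym (indicator-0 (γ ℓ +ᶻ + suc e))
      ghost-tracks (suc n) i p zero    γ = ghost-tracks n (suc i) (≤-trans (≤-reflexive (sym (+-suc i n))) p) zero γ
      ghost-tracks (suc n) i p (suc e) γ = trans (cong₂ _+ᶻ_ (ghost-tracks n (suc i) (≤-trans (≤-reflexive (sym (+-suc i n))) p) (suc e) γ)
        (trans (ghost-tracks (suc n) i p e (γ ⊞ (ℓ , i))) (cong (λ b → indicator b (E (lift Ψ) (lowsFrom ℓ i (suc n)) e (γ ⊞ (ℓ , i)))) raised)))
        (sym (indicator-+ (γ ℓ +ᶻ + suc e) _ _))
        where
        regroup : ∀ a e → (a +ᶻ (1ℤ -ᶻ 0ℤ)) +ᶻ e ≡ a +ᶻ (1ℤ +ᶻ e)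
        regroup = solve-∀
        raised : (γ ⊞ (ℓ , i)) ℓ +ᶻ + e ≡ γ ℓ +ᶻ + suc e
        raised = trans (cong₂ (λ a b → (γ ℓ +ᶻ (a -ᶻ b)) +ᶻ + e) (unit-same ℓ) (unit-other {i} {ℓ} λ q → (lin⊥ (ℓ ∷ i ∷ n ∷ []) (:≥ v0 v1 q ∷ :≤ (v1 ⊹ 1+ v2) v0 p ∷ [])))) (regroup (γ ℓ) (+ e))

      _~_ : Weight → Weight → Set
      γ ~ γ′ = ∀ {x} → x < ℓ → γ x ≡ γ′ x

      ~-⊞ : ∀ {γ γ′} α → γ ~ γ′ → (γ ⊞ α) ~ (γ′ ⊞ α)
      ~-⊞ (i , j) r {x} p = cong (_+ᶻ (unit i x -ᶻ unit j x)) (r p)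

      Ψ-~ : ∀ d {γ γ′} → γ ~ γ′ → lift Ψ d γ ≡ lift Ψ d γ′
      Ψ-~ zero    {γ} {γ′} r = S.D-respects {γ} {γ′} λ {x} p → r p
      Ψ-~ (suc d) r = refl

      H-~ : ∀ d {γ γ′} → γ ~ γ′ → lift (H m) d γ ≡ lift (H m) d γ′
      H-~ zero    r = E-relate {lift Ψ} {_~_} ~-⊞ Ψ-~ lows m r
      H-~ (suc d) r = refl

    -- The last variable is traded for the ghost: its exponent m is the number of boxes removed by ghost roots.
    𝕋-snoc : ∀ δ d → S⁺.𝕋 (upd δ ℓ ℓ) 0 d ≡ S.𝕋 (upd δ ℓ 0) m (d + m)
    𝕋-snoc δ d = trans (E-agree {S⁺.G} {lift (H m)} (λ γ → γ ℓ ≡ 0ℤ) (S⁺.ghost-closed δ 0ℤ) left d (S⁺.wt-ghost {upd δ ℓ ℓ} {0}))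
      (trans (E-relate {lift (H m)} {_~_} ~-⊞ H-~ (S⁺.Roots (upd δ ℓ ℓ)) d rows)
      (trans (sym (E-agree (λ γ → γ ℓ ≡ -ᶻ (+ m)) (S.ghost-closed δ (-ᶻ (+ m))) right d (S.wt-ghost {upd δ ℓ 0} {m})))
      (trans (sym (E-shift {E S.G lows} m (λ γ → γ ℓ ≡ -ᶻ (+ m)) (S.ghost-closed δ (-ᶻ (+ m))) low d (S.wt-ghost {upd δ ℓ 0} {m})))
      (sym (trans (E-↭ S.G-respects (↭-trans (S.ghost-roots δ ℓ 0 refl) (++-comm lows (S.Roots (upd δ ℓ ℓ)))) (d + m) (S.wt (upd δ ℓ 0) m))
        (E-++ S.G (S.Roots (upd δ ℓ ℓ)) lows (d + m) (S.wt (upd δ ℓ 0) m)))))))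
      where
      left : ∀ d {γ} → γ ℓ ≡ 0ℤ → S⁺.G d γ ≡ lift (H m) d γ
      left zero    {γ} e = trans (cong (λ b → indicator b (D ℓ (jacobiTrudi 0 γ toℕ) (η ∷ʳ m))) e) (D-snoc ℓ ℓ 0 γ toℕ η m ≤-refl)
      left (suc d) e = refl
      rows : S⁺.wt (upd δ ℓ ℓ) 0 ~ S.wt (upd δ ℓ 0) m
      rows {x} p = trans (S⁺.wt-row {upd δ ℓ ℓ} {0} (<⇒≢ p)) (trans (cong (λ w → + (suc k + x) -ᶻ + w) (trans (upd-other δ (<⇒≢ p)) (sym (upd-other δ (<⇒≢ p))))) (sym (S.wt-row {upd δ ℓ 0} {m} (<⇒≢ p))))
      tracked : ∀ e {γ} → γ ℓ ≡ -ᶻ (+ m) → E S.G lows e γ ≡ indicator (-ᶻ (+ m) +ᶻ + e) (H e γ)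
      tracked e {γ} q = trans (ghost-tracks ℓ 0 ≤-refl e γ) (cong (λ b → indicator (b +ᶻ + e) (H e γ)) q)
      off : ∀ e → e ≢ m → -ᶻ (+ m) +ᶻ + e ≢ 0ℤ
      off e ne q = ne (ℤP.+-injective (ℤP.i-j≡0⇒i≡j (+ e) (+ m) (trans (ℤP.+-comm (+ e) (-ᶻ (+ m))) q)))
      low : ∀ {e} → e < m → ∀ {γ} → γ ℓ ≡ -ᶻ (+ m) → E S.G lows e γ ≡ 0ℤ
      low {e} p {γ} q = trans (tracked e q) (indicator-≢ (H e γ) (off e (<⇒≢ p)))
      right : ∀ d {γ} → γ ℓ ≡ -ᶻ (+ m) → E S.G lows (d + m) γ ≡ lift (H m) d γ
      right zero    {γ} q = trans (tracked m q) (cong (λ b → indicator b (H m γ)) (ℤP.+-inverseˡ (+ m)))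
      right (suc d) {γ} q = trans (tracked (suc d + m) q) (indicator-≢ (H (suc d + m) γ) (off (suc d + m) λ e → (lin⊥ (m ∷ d ∷ []) (:≡ (1+ v1 ⊹ v0) v0 e ∷ []))))

  CoreOf-≗ : ∀ {k ℓ κ σ σ′} → (∀ r → σ r ≡ σ′ r) → CoreOf k ℓ κ σ → CoreOf k ℓ κ σ′
  CoreOf-≗ {k} {ℓ} {κ} {σ} {σ′} e C = record
    { partition = CoreOf.partition C
    ; adm = record
      { mono = λ r → subst₂ _<_ (e r) (e (suc r)) (CoreOf.mono C r)
      ; lo   = λ r → subst (r <_) (e r) (CoreOf.lo C r)
      ; hi   = λ r → subst (_≤ suc k + r) (e r) (CoreOf.hi C r)
      ; tail = λ {r} p → trans (sym (e r)) (CoreOf.tail C p) }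
    ; rec = λ r → subst (λ v → row κ r + v ≡ suc k + r + row κ v) (e r) (CoreOf.rec C r) }

  empty-CoreOf : ∀ k ℓ → CoreOf k ℓ [] (λ r → suc k + r)
  empty-CoreOf k ℓ = record
    { partition = Linked.[] , []
    ; adm = record { mono = λ r → ≤-reflexive (sym (+-suc (suc k) r)) ; lo = λ r → s≤s (m≤n+m r k) ; hi = λ r → ≤-refl ; tail = λ _ → refl }
    ; rec = λ r → sym (+-identityʳ (suc k + r)) }

  sumFℤ-≥0 : ∀ n {f : Fin n → ℤ} → (∀ j → 0ℤ ℤ.≤ f j) → 0ℤ ℤ.≤ sumFℤ n f
  sumFℤ-≥0 zero    h = ℤ.+≤+ z≤n
  sumFℤ-≥0 (suc n) h = ℤP.+-mono-≤ (h Fin.zero) (sumFℤ-≥0 n (h ∘ Fin.suc))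

  sumFℤ->0 : ∀ {n} {f : Fin n → ℤ} → (∀ j → 0ℤ ℤ.≤ f j) → ∀ i → 0ℤ ℤ.< f i → 0ℤ ℤ.< sumFℤ n f
  sumFℤ->0 {suc n} h Fin.zero    p = ℤP.+-mono-<-≤ p (sumFℤ-≥0 n (h ∘ Fin.suc))
  sumFℤ->0 {suc n} h (Fin.suc i) p = ℤP.+-mono-≤-< (h Fin.zero) (sumFℤ->0 (h ∘ Fin.suc) i p)

  δ₀ : ℕ → ℤ
  δ₀ zero    = 1ℤ
  δ₀ (suc d) = 0ℤ

  module _ (k ℓ : ℕ) {κ : List ℕ} {δ : ℕ → ℕ} (C : CoreOf k ℓ κ δ) where
    open Peeling k ℓ []
    private
      module C = CoreOf C
      σ = upd δ ℓ ℓ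

      σ-row : ∀ {r} → r < ℓ → σ r ≡ δ r
      σ-row p = upd-other δ (<⇒≢ p)

    -- The weight is 0. Using a root `(i , j)` makes the sum of the rows from `j` on negative, which
    -- no other root repairs, so only the term without roots remains.
    𝕋-nil-empty : κ ≡ [] → ∀ d → 𝕋 σ 0 d ≡ δ₀ d
    𝕋-nil-empty refl = by
      where
      flat : ∀ r → δ r ≡ suc k + r
      flat = CoreOf-injective C (empty-CoreOf k ℓ)
      zeros : ∀ x → wt σ 0 x ≡ 0ℤ
      zeros x with x ≟ ℓ
      ... | yes _ = refl
      ... | no ne = trans (cong (λ w → + (suc k + x) -ᶻ + w) (trans (upd-other δ ne) (flat x))) (ℤP.+-inverseʳ (+ (suc k + x)))
      low : ∀ {i} → i < ℓ → i ≤ σ i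
      low {i} p = <⇒≤ (≤-trans (C.lo i) (≤-reflexive (sym (σ-row p))))
      later : ∀ Ψ → All (_∈ Roots σ) Ψ → ∀ d → E G Ψ (suc d) (wt σ 0) ≡ 0ℤ
      later []            _        d = refl
      later ((i , j) ∷ Ψ) (p ∷ ps) d = cong₂ _+ᶻ_ (later Ψ ps d) (vanish (∈-Roots⁻ {σ} p) (m≤n⇒∃[o]m+o≡n (<⇒≤ (proj₁ (proj₂ (∈-Roots⁻ {σ} p))))))
        where
        sub : ∀ {n} → j + n ≡ ℓ → All (λ α → ∀ {γ} → NegativeTail n j γ → NegativeTail n j (γ ⊞ α)) ((i , j) ∷ Ψ)
        sub {n} e = All.map (λ q {γ} → All.lookup (tail-closed {σ} {n} {j} e low) q {γ}) (p ∷ ps)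
        vanish : i ≤ ℓ × j < ℓ × σ i ≤ j → (∃ λ n → j + n ≡ ℓ) → E G ((i , j) ∷ Ψ) d (wt σ 0 ⊞ (i , j)) ≡ 0ℤ
        vanish (a , b , c) (n , e) = E-vanish (NegativeTail n j) (sub {n} e) (G-tail {n} {j} e) d (subst (ℤ._< 0ℤ) (sym total) ℤ.-<+)
          where
          i<j : i < j
          i<j with m≤n⇒m<n∨m≡n a
          ... | inj₁ q    = ≤-trans (C.lo i) (≤-trans (≤-reflexive (sym (σ-row q))) c)
          ... | inj₂ refl = ⊥-elim (<⇒≱ b (≤-trans (≤-reflexive (sym (upd-same δ ℓ ℓ))) c))
          total : tailSum n (wt σ 0 ⊞ (i , j)) j ≡ -ᶻ 1ℤ
          total = trans (tailSum-⊞ n (wt σ 0) j i j) (cong₂ _+ᶻ_ (sumFℤ-zero n λ a → zeros (j + toℕ a)) (cong₂ _-ᶻ_ (tail-outside n (inj₁ i<j))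
            (trans (cong (λ v → tailSum n (unit v) j) (sym (+-identityʳ j))) (tail-inside n j {0} (lin (n ∷ j ∷ ℓ ∷ []) (1+ #0) v0 (:≤ (1+ v1) v2 b ∷ :≥ v2 (v1 ⊹ v0) e ∷ []))))))
      by : ∀ d → 𝕋 σ 0 d ≡ δ₀ d
      by zero    = trans (E-zero G (Roots σ) (wt σ 0)) (trans (cong (λ b → indicator b (D ℓ (jacobiTrudi 0 (wt σ 0) toℕ) [])) (zeros ℓ)) (D-unit ℓ 0 (wt σ 0) toℕ zeros λ j → sym (+-identityʳ (toℕ j))))
      by (suc d) = later (Roots σ) (All.tabulate id) d

    -- The weight has positive total, which the roots preserve, and without variables a determinant
    -- of positive degree vanishes.
    𝕋-nil-nonempty : κ ≢ [] → ∀ d → 𝕋 σ 0 d ≡ 0ℤ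
    𝕋-nil-nonempty ne d = by (all-or-first {λ r → δ r ≡ suc k + r} {λ r → δ r < suc k + r} (λ r → [ inj₂ , inj₁ ]′ (m≤n⇒m<n∨m≡n (C.hi r))) ℓ)
      where
      flat : (∀ {r} → r < ℓ → δ r ≡ suc k + r) → ∀ r → δ r ≡ suc k + r
      flat h r = [ (λ q → h q) , (λ q → C.tail q) ]′ (<-≤-connex r ℓ)
      Positive : Weight → Set
      Positive γ = 0ℤ ℤ.< tailSum ℓ γ 0
      closed : Closed Positive (Roots σ)
      closed = All.tabulate λ { {i , j} m {γ} q → step i j {γ} (∈-Roots⁻ {σ} m) q }
        where
        step : ∀ i j {γ} → i ≤ ℓ × j < ℓ × σ i ≤ j → Positive γ → Positive (γ ⊞ (i , j))
        step i j {γ} (a , b , c) q with m≤n⇒m<n∨m≡n a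
        ... | inj₂ refl = ⊥-elim (<⇒≱ b (≤-trans (≤-reflexive (sym (upd-same δ ℓ ℓ))) c))
        ... | inj₁ p    = subst (0ℤ ℤ.<_) (sym (trans (tailSum-⊞ ℓ γ 0 i j) (trans (cong₂ (λ u v → tailSum ℓ γ 0 +ᶻ (u -ᶻ v)) (tail-inside ℓ 0 p) (tail-inside ℓ 0 b)) (ℤP.+-identityʳ _)))) q
      degree-sum : ∀ γ → degree ℓ 0 γ toℕ ≡ tailSum ℓ γ 0
      degree-sum γ = trans (sym (sumFℤ-+ ℓ (λ j → γ (toℕ j) -ᶻ + toℕ j) (λ j → + toℕ j))) (sumFℤ-cong ℓ λ j → stay (γ (toℕ j)) (+ toℕ j))
        where
        stay : ∀ a b → (a -ᶻ b) +ᶻ b ≡ a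
        stay = solve-∀
      vanish : ∀ d {γ} → Positive γ → G d γ ≡ 0ℤ
      vanish zero    {γ} q = trans (cong (indicator (γ ℓ)) (D-positive-nil ℓ 0 γ toℕ (subst (0ℤ ℤ.<_) (sym (degree-sum γ)) q))) (indicator-0 (γ ℓ))
      vanish (suc d) q = refl
      entry-≡ : ∀ {r} → r < ℓ → wt σ 0 r ≡ + (suc k + r) -ᶻ + δ r
      entry-≡ {r} p = trans (wt-row (<⇒≢ p)) (cong (λ w → + (suc k + r) -ᶻ + w) (σ-row p))
      positive : ∀ r → r < ℓ → δ r < suc k + r → Positive (wt σ 0)
      positive r p q = sumFℤ->0 (λ j → subst (0ℤ ℤ.≤_) (sym (entry-≡ (FinP.toℕ<n j))) (ℤP.i≤j⇒0≤j-i (ℤ.+≤+ (C.hi (toℕ j))))) (Fin.fromℕ< p)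
        (subst (λ v → 0ℤ ℤ.< wt σ 0 v) (sym (FinP.toℕ-fromℕ< p)) (subst (0ℤ ℤ.<_) (sym (entry-≡ p)) (gap q)))
        where
        gap : ∀ {a b} → a < b → 0ℤ ℤ.< + b -ᶻ + a
        gap {a} {b} q = subst (0ℤ ℤ.<_) (trans (sym (ℤP.⊖-≥ (<⇒≤ q))) (sym (ℤP.m-n≡m⊖n b a))) (ℤ.+<+ (m<n⇒0<n∸m q))
      by : (∀ {r} → r < ℓ → δ r ≡ suc k + r) ⊎ (∃ λ r → r < ℓ × δ r < suc k + r × (∀ {j} → j < r → δ j ≡ suc k + j)) → 𝕋 σ 0 d ≡ 0ℤ
      by (inj₁ h)               = ⊥-elim (ne (CoreOf-unique (CoreOf-≗ (flat h) C) (empty-CoreOf k ℓ)))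
      by (inj₂ (r , p , q , _)) = E-vanish Positive closed vanish d (positive r p q)

-- Enumerating the tableaux step by step.

module Count where
  open import Defs
  open Row
  open Core
  open Cover
  open Search
  open Straighten
  open Levels
  open Peel
  open MarkedCovers
  open Lascoux
  open Linear
  open import Data.Nat using (ℕ; zero; suc; _+_; _*_; _∸_; _≤_; _<_; z≤n; s≤s)
  open import Data.Nat.Properties
  open import Data.Integer using (ℤ; +_; 0ℤ) renaming (_+_ to _+ᶻ_)
  import Data.Integer.Properties as ℤP
  open import Data.List using (List; []; _∷_; map; length; reverse; _++_)
  open import Data.List.Membership.Propositional.Properties using (∈-map⁺; ∈-map⁻; ∈-++⁺ˡ; ∈-++⁺ʳ; ∈-++⁻)
  open import Data.List.Relation.Unary.Any using (here; there)
  open import Data.List.Relation.Unary.All using ([]; _∷_)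
  open import Data.List.Relation.Unary.AllPairs as AllPairs using (AllPairs)
  import Data.List.Relation.Unary.Unique.Propositional.Properties as UniqueP
  open import Data.Product using (Σ; _×_; _,_; proj₁; proj₂; ∃)
  open import Data.Sum using (_⊎_; inj₁; inj₂; [_,_]′)
  open import Data.Empty using (⊥; ⊥-elim)
  open import Function.Bundles using (Equivalence; mk⇔)
  open import Data.List.Properties using (unfold-reverse; length-++; length-map; ∷-injectiveʳ)
  open import Relation.Nullary using (¬_)
  open import Relation.Binary.PropositionalEquality

  card-none : {A : Set} {P : A → Set} → (∀ x → ¬ P x) → HasCard P 0
  card-none h = [] , AllPairs.[] , (λ x → mk⇔ (λ ()) (λ p → ⊥-elim (h x p))) , refl

  card-⇔ : {A : Set} {P Q : A → Set} {n : ℕ} → (∀ {x} → P x → Q x) → (∀ {x} → Q x → P x) → HasCard P n → HasCard Q n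
  card-⇔ to from (L , u , e , l) = L , u , (λ x → mk⇔ (λ m → to (Equivalence.to (e x) m)) (λ q → Equivalence.from (e x) (from q))) , l

  card-one : {A : Set} {P : A → Set} (a : A) → (∀ {x} → P x → x ≡ a) → P a → HasCard P 1
  card-one {A} {P} a only p = a ∷ [] , [] AllPairs.∷ AllPairs.[] , (λ x → mk⇔ (λ { (here e) → subst P (sym e) p ; (there ()) }) (λ q → here (only q))) , refl

  card-⊎ : {A : Set} {P Q : A → Set} {m n : ℕ} → (∀ {x} → P x → Q x → ⊥) → HasCard P m → HasCard Q n → HasCard (λ x → P x ⊎ Q x) (m + n)
  card-⊎ {A} {P} {Q} dis (L , u , e , l) (L′ , u′ , e′ , l′) = L ++ L′ ,
    UniqueP.++⁺ u u′ (λ { {x} (a , b) → dis (Equivalence.to (e x) a) (Equivalence.to (e′ x) b) }) ,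
    (λ x → mk⇔ (λ m → [ (λ a → inj₁ (Equivalence.to (e x) a)) , (λ b → inj₂ (Equivalence.to (e′ x) b)) ]′ (∈-++⁻ L m))
      [ (λ p → ∈-++⁺ˡ (Equivalence.from (e x) p)) , (λ q → ∈-++⁺ʳ L (Equivalence.from (e′ x) q)) ]′) ,
    trans (length-++ L) (cong₂ _+_ l l′)

  card-map : {A B : Set} {P : A → Set} {n : ℕ} (f : A → B) → (∀ {x y} → f x ≡ f y → x ≡ y) → HasCard P n → HasCard (λ y → ∃ λ x → y ≡ f x × P x) n
  card-map {A} {B} {P} f inj (L , u , e , l) = map f L , UniqueP.map⁺ inj u ,
    (λ y → mk⇔ (λ m → let x , a , q = ∈-map⁻ f m in x , q , Equivalence.to (e x) a) (λ { (x , refl , p) → ∈-map⁺ f (Equivalence.from (e x) p) })) , trans (length-map f L) l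

  -- f is the generating function, in t, of the sets P d.
  Counts : {X : Set} → (ℕ → X → Set) → (ℕ → ℤ) → Set
  Counts P f = ∀ d → ∃ λ n → HasCard (P d) n × + n ≡ f d

  module _ {X : Set} {P : ℕ → X → Set} where
    counts-none : (∀ {d x} → ¬ P d x) → Counts P (λ _ → 0ℤ)
    counts-none h d = 0 , card-none (λ x → h) , refl

    counts-⇔ : ∀ {Q f} → (∀ {d x} → P d x → Q d x) → (∀ {d x} → Q d x → P d x) → Counts P f → Counts Q f
    counts-⇔ to from c d = let n , h , e = c d in n , card-⇔ to from h , e

    counts-⊎ : ∀ {Q f g} → (∀ {d x} → P d x → Q d x → ⊥) → Counts P f → Counts Q g → Counts (λ d x → P d x ⊎ Q d x) (λ d → f d +ᶻ g d)
    counts-⊎ dis c c′ d = let n , h , e = c d ; n′ , h′ , e′ = c′ d in n + n′ , card-⊎ dis h h′ , cong₂ _+ᶻ_ e e′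

    counts-map : ∀ {Y : Set} {f} (φ : X → Y) → (∀ {x y} → φ x ≡ φ y → x ≡ y) → Counts P f → Counts (λ d y → ∃ λ x → y ≡ φ x × P d x) f
    counts-map φ inj c d = let n , h , e = c d in n , card-map φ inj h , e

    counts-shift : ∀ {f} s → Counts P f → Counts (λ d x → ∃ λ d′ → d ≡ s + d′ × P d′ x) (f ↑ s)
    counts-shift zero    c d = let n , h , e = c d in n , card-⇔ (λ p → d , refl , p) (λ { (_ , refl , p) → p }) h , e
    counts-shift (suc s) c zero    = 0 , card-none (λ { x (_ , () , _) }) , refl
    counts-shift (suc s) c (suc d) = let n , h , e = counts-shift s c d in
      n , card-⇔ (λ { (d′ , q , p) → d′ , cong suc q , p }) (λ { (d′ , q , p) → d′ , suc-injective q , p }) h , e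

  ↑-⊕ : ∀ f g m d → ((λ d → f d +ᶻ g d) ↑ m) d ≡ (f ↑ m) d +ᶻ (g ↑ m) d
  ↑-⊕ f g zero    d       = refl
  ↑-⊕ f g (suc m) zero    = refl
  ↑-⊕ f g (suc m) (suc d) = ↑-⊕ f g m d

  ↑-cancel : ∀ f m d → (f ↑ m) (d + m) ≡ f d
  ↑-cancel f zero    d = cong f (+-identityʳ d)
  ↑-cancel f (suc m) d = trans (cong (f ↑ suc m) (+-suc d m)) (↑-cancel f m d)

  ↑-swap : ∀ f m m′ d → ((f ↑ m) ↑ m′) d ≡ ((f ↑ m′) ↑ m) d
  ↑-swap f m m′ d = trans (↑-+ f m m′ d) (trans (cong (λ e → (f ↑ e) d) (+-comm m′ m)) (sym (↑-+ f m′ m d)))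

  Stack : Set
  Stack = List (ℕ × List ℕ)

  -- The strong marked tableaux ending in κ, read backwards. The block in progress still has m steps,
  -- all with marks > z; the earlier blocks, last one first, have the lengths η; the total spin is d.
  Tab : ℕ → List ℕ → ℕ → ℕ → List ℕ → ℕ → Stack → Set
  Tab k η       (suc m) z κ d [] = ⊥
  Tab k η       (suc m) z κ d ((r , κ′) ∷ st) = κ′ ≡ κ × ∃ λ z′ → r ≡ suc z′ × z ≤ z′ ×
    ∃ λ τ → MarkedCover k τ r κ × ∃ λ d′ → d ≡ coverSpin τ r κ + d′ × Tab k η m z′ τ d′ st
  Tab k []      zero    z κ d st = st ≡ [] × κ ≡ [] × d ≡ 0
  Tab k (m ∷ η) zero    z κ d st = Tab k η m 0 κ d st

  source : Stack → List ℕ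
  source []            = []
  source ((_ , κ) ∷ _) = κ

  -- A nonempty stack shows its last core, so tableaux with different last cores are different
  -- stacks; this is how alternatives are seen to be disjoint.
  Tab-source : ∀ {k} η m {z κ d} st → Tab k η m z κ d st → source st ≡ κ
  Tab-source []      zero    st       (refl , e , _) = sym e
  Tab-source (m ∷ η) zero    st       p              = Tab-source η m st p
  Tab-source η       (suc m) (_ ∷ st) (e , _)        = e

  module _ {k ℓ κ σ} (C : CoreOf k ℓ κ σ) where
    private
      module C = CoreOf C
      A : Adm k ℓ σ
      A = C.adm

    cover-length : ∀ {τ} → IsPartition τ → (∀ r → row τ r ≤ row κ r) → length τ ≤ ℓ
    cover-length {τ} p sub = ≮⇒≥ λ q → <⇒≱ (row-<length (proj₂ p) q) (≤-trans (sub ℓ) (≤-reflexive (row-≥ℓ C ≤-refl)))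

    marked-lower : ∀ {τ r} → MarkedCover k τ r κ → ∃ λ y → ∃ λ m → ∃ λ t → ∃ λ x → Σ (Good k σ y m t x (level A y)) λ G →
      τ ≡ lower C G × ∃ λ j → j ≤ t × r ≡ suc (level A y j)
    marked-lower {τ} {r} mc@((cτ , _ , sub , w) , _) = by (cover-is-lower C (proj₂ (core-CoreOf cτ (cover-length (proj₁ cτ) rows))) rows weights)
      where
      rows : ∀ r → row τ r ≤ row κ r
      rows r = sub (suc r)
      weights : weight k τ + 1 ≡ weight k κ
      weights = trans (cong (_+ 1) (weight-def k τ)) (trans w (sym (weight-def k κ)))
      by : IsLower C τ → _
      by (y , m , t , x , G , e) = y , m , t , x , G , e , lower-marked⁻ C G (subst (λ τ → MarkedCover k τ r κ) e mc)

    mark-< : ∀ {τ z} → MarkedCover k τ (suc z) κ → z < ℓ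
    mark-< {τ} {z} mc = by (marked-lower mc)
      where
      by : (∃ λ y → ∃ λ m → ∃ λ t → ∃ λ x → Σ (Good k σ y m t x (level A y)) λ G → τ ≡ lower C G × ∃ λ j → j ≤ t × suc z ≡ suc (level A y j)) → z < ℓ
      by (y , m , t , x , G , _ , j , p , e) = ≤-trans (s≤s (≤-trans (≤-reflexive (suc-injective e)) (≤-trans (Geometry.descending A G {0} {j} z≤n p) (m≤m+n y m)))) (Geometry.y+m<ℓ A G)

    -- `run` and `stop` determine `m`, and `roof` determines `t`. `side` determines `x` unless
    -- `m = 0`, when the minus interval is empty.
    lower-unique : ∀ {y m t x m′ t′ x′} (G : Good k σ y m t x (level A y)) (G′ : Good k σ y m′ t′ x′ (level A y)) →
      m ≡ m′ × t ≡ t′ × lower C G ≡ lower C G′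
    lower-unique {y} {m} {t} {x} {m′} {t′} {x′} G G′ = ms , ts , CoreOf-unique (CoreOf-≗ (agree x x′ ms sides) (lower-CoreOf C G)) (lower-CoreOf C G′)
      where
      module G = Good G
      module G′ = Good G′
      ms : m ≡ m′
      ms = ≤-antisym (≮⇒≥ λ p → (lin⊥ (m′ ∷ σ y ∷ σ (suc (y + m′)) ∷ σ (y + suc m′) ∷ []) (:≤ (1+ (1+ (v1 ⊹ v0))) v2 G′.stop ∷ :≡ v3 (v1 ⊹ 1+ v0) (G.run p) ∷ :≥ v2 v3 (cong σ (+-suc y m′)) ∷ []))) (≮⇒≥ λ p → (lin⊥ (m ∷ σ y ∷ σ (suc (y + m)) ∷ σ (y + suc m) ∷ []) (:≤ (1+ (1+ (v1 ⊹ v0))) v2 G.stop ∷ :≡ v3 (v1 ⊹ 1+ v0) (G′.run p) ∷ :≥ v2 v3 (cong σ (+-suc y m)) ∷ [])))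
      ts : t ≡ t′
      ts = ≤-antisym (≮⇒≥ λ p → G′.roof (level A y (suc t′)) (Geometry.step₀ A G p)) (≮⇒≥ λ p → G.roof (level A y (suc t)) (Geometry.step₀ A G′ p))
      sides : ∀ {i} → i < m → x + i ≡ x′ + i
      sides {i} p = σ-injective A (trans (G.side p) (trans (cong (λ t → suc (level A y t + i)) ts) (sym (G′.side (≤-trans p (≤-reflexive ms))))))
      agree : ∀ x x′ {m m′} → m ≡ m′ → (∀ {i} → i < m → x + i ≡ x′ + i) → ∀ r → lam σ y m x r ≡ lam σ y m′ x′ r
      agree x x′ {zero}  refl h r = cong (σ r + interval y 1 r ∸_) (trans (interval-empty x r) (sym (interval-empty x′ r)))
      agree x x′ {suc m} refl h r = cong (λ x → lam σ y (suc m) x r) (+-cancelʳ-≡ 0 x x′ (h (s≤s z≤n)))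

    -- The second removal raises the offset of row `y′`, the first one does not, because its plus
    -- block ends before row `σ y`.
    lower-distinct : ∀ {y m t x Y y′ m′ t′ x′ Y′} (G : Good k σ y m t x Y) (G′ : Good k σ y′ m′ t′ x′ Y′) → σ y ≤ y′ → lower C G ≢ lower C G′
    lower-distinct {y} {m} {t} {x} {Y} {y′} {m′} {t′} {x′} G G′ p e = clash (lam σ y m x) (lam σ y′ m′ x′) (lam-spec {σ} {y} {m} {x} C.lo y′) (Geometry.σ′-base A G′ (lam-spec {σ} {y′} {m′} {x′} C.lo) {0} z≤n)
      (CoreOf-injective (lower-CoreOf C G) (subst (λ τ → CoreOf k ℓ τ (lam σ y′ m′ x′)) (sym e) (lower-CoreOf C G′)) y′)
      where
      clash : ∀ (f f′ : ℕ → ℕ) → f y′ + interval x m y′ ≡ σ y′ + interval y (suc m) y′ → f′ (y′ + 0) ≡ suc (σ y′ + 0) → f y′ ≡ f′ y′ → ⊥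
      clash f f′ a b c = lin⊥ (interval x m y′ ∷ f y′ ∷ interval y (suc m) y′ ∷ σ y′ ∷ f′ (y′ + 0) ∷ f′ y′ ∷ []) (:≡ (v1 ⊹ v0) (v3 ⊹ v2) a ∷ :≥ (1+ (v3 ⊹ #0)) v4 b ∷ :≥ v5 v1 c ∷ :≡ v4 v5 (cong f′ (+-identityʳ y′)) ∷ :≡ v2 #0 (interval-after {y} {suc m} {y′} (lin (m ∷ y ∷ y′ ∷ σ y ∷ []) (v1 ⊹ 1+ v0) v2 (:≤ v3 v2 p ∷ :≤ (1+ (v1 ⊹ v0)) v3 (Good.window G) ∷ []))) ∷ [])

    -- In contrast to `iterate-σ`, `σ` is applied to the argument first, which matches the passage
    -- from `y` to `σ y` in `orbit`.
    climb : ℕ → ℕ → ℕ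
    climb zero    y = y
    climb (suc b) y = climb b (σ y)

    climb-≥ : ∀ b y → y ≤ climb b y
    climb-≥ zero    y = ≤-refl
    climb-≥ (suc b) y = ≤-trans (<⇒≤ (C.lo y)) (climb-≥ b (σ y))

    climb-level : ∀ {y m t x} (G : Good k σ y m t x (level A y)) {j} → j ≤ t → climb j (level A y j) ≡ y
    climb-level G {zero}  p = refl
    climb-level {y} G {suc j} p = trans (cong (climb j) (Geometry.step₀ A G p)) (climb-level G (<⇒≤ p))

    -- By `roof` a tower exhausts the runner above `y`, so every row from which `y` is reached is
    -- one of its levels.
    level-climb : ∀ {y m t x} (G : Good k σ y m t x (level A y)) c {w} → y ≡ climb c w → c ≤ t × level A y c ≡ w
    level-climb G zero    e = z≤n , e
    level-climb {y} {m} {t} {x} G (suc c) {w} e = by (level-climb G c e)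
      where
      by : c ≤ t × level A y c ≡ σ w → suc c ≤ t × level A y (suc c) ≡ w
      by (p , q) = [ (λ lt → lt , σ-injective A (trans (Geometry.step₀ A G lt) q)) , (λ f → ⊥-elim (Good.roof G w (trans (sym q) (cong (level A y) f)))) ]′ (m≤n⇒m<n∨m≡n p)

  -- The factor t ^ M comes from the `M` ghost roots still to be used, which do not count towards
  -- the spin; it disappears when `𝕋-snoc` exchanges the ghost for a variable.
  Claim : ℕ → ℕ → List ℕ → ℕ → ℕ → List ℕ → (ℕ → ℕ) → Set
  Claim k ℓ η M z κ δ = ∃ λ f → Counts (Tab k η M z κ) f × (∀ d → Peeling.𝕋 k ℓ (reverse η) (upd δ ℓ z) M d ≡ (f ↑ M) d)

  module Step (k ℓ : ℕ) (η : List ℕ) (M : ℕ) (ih : ∀ {τ ρ} → CoreOf k ℓ τ ρ → ∀ {z} → z ≤ ℓ → Claim k ℓ η M z τ ρ)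
    {κ : List ℕ} {δ : ℕ → ℕ} (C : CoreOf k ℓ κ δ) where
    open Peeling k ℓ (reverse η)
    private
      A : Adm k ℓ δ
      A = CoreOf.adm C

    -- The last step removes ribbons in row climb b y, with mark suc z.
    Orbit : ℕ → ℕ → ℕ → Stack → Set
    Orbit z y d st = ∃ λ st′ → st ≡ (suc z , κ) ∷ st′ × ∃ λ b → ∃ λ y′ → y′ ≡ climb C b y × ∃ λ m → ∃ λ t → ∃ λ x →
      Σ (Good k δ y′ m t x (level A y′)) λ G → ∃ λ d′ → d ≡ suc t * m + b + d′ × Tab k η M z (lower C G) d′ st′

    private
      ∷-inj : ∀ {z} {s s′ : Stack} → (suc z , κ) ∷ s ≡ (suc z , κ) ∷ s′ → s ≡ s′
      ∷-inj = ∷-injectiveʳ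

      reorder : ∀ {d} s b d′ → d ≡ s + suc b + d′ → d ≡ 1 + (s + b + d′)
      reorder {d} s b d′ e = lin≡ (d ∷ d′ ∷ b ∷ s ∷ []) v0 (#1 ⊹ (v3 ⊹ v2 ⊹ v1)) (:≡ v0 (v3 ⊹ 1+ v2 ⊹ v1) e ∷ [])

      reorder⁻ : ∀ {d e} s b d′ → d ≡ 1 + e → e ≡ s + b + d′ → d ≡ s + suc b + d′
      reorder⁻ {d} {e′} s b d′ p e = lin≡ (d ∷ d′ ∷ b ∷ s ∷ e′ ∷ []) v0 (v3 ⊹ 1+ v2 ⊹ v1) (:≡ v0 (#1 ⊹ v4) p ∷ :≡ v4 (v3 ⊹ v2 ⊹ v1) e ∷ [])

    -- The rows `y`, `δ y`, ... increase, so `ℓ` bounds the recursion. The factor t for passing from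
    -- `y` to `δ y` counts one more component below the marked one.
    orbit : ∀ {z} → z ≤ ℓ → ∀ fuel {y} → Reach A z y → y < ℓ → ℓ ≤ fuel + y → ∃ λ f → Counts (Orbit z y) f × (∀ d → U δ z y M d ≡ (f ↑ M) d)
    orbit z≤ℓ zero r y<ℓ le = ⊥-elim (<⇒≱ y<ℓ le)
    orbit {z} z≤ℓ (suc fuel) {y} reach y<ℓ le = by (evaluate A reach y<ℓ) rest
      where
      Rest : Set
      Rest = ∃ λ f → Counts (Orbit z (δ y)) f × (∀ d → U δ z y M d ≡ 𝕋 (start A z y) M d +ᶻ ((f ↑ 1) ↑ M) d)
      rest : Rest
      rest = [ (λ p → more p (orbit z≤ℓ fuel (suc (proj₁ reach) , cong δ (proj₂ reach)) p (lin (ℓ ∷ δ y ∷ fuel ∷ y ∷ []) v0 (v2 ⊹ v1) (:≤ v0 (1+ v2 ⊹ v3) le ∷ :≤ (1+ v3) v1 (CoreOf.lo C y) ∷ [])))) , last ]′ (<-≤-connex (δ y) ℓ)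
        where
        more : δ y < ℓ → (∃ λ f → Counts (Orbit z (δ y)) f × (∀ d → U δ z (δ y) M d ≡ (f ↑ M) d)) → Rest
        more p (f , c , e) = f , c , λ d → trans (peel-row A M y<ℓ p d) (cong (𝕋 (start A z y) M d +ᶻ_) (trans (↑-cong 1 e d) (↑-swap f M 1 d)))
        last : ℓ ≤ δ y → Rest
        last p = (λ _ → 0ℤ) , counts-none empty , λ d → trans (peel-last A M y<ℓ p d) (sym (trans (cong (𝕋 (start A z y) M d +ᶻ_) (↑-zero M (↑-zero 1 λ _ → refl) d)) (ℤP.+-identityʳ _)))
          where
          empty : ∀ {d st} → Orbit z (δ y) d st → ⊥
          empty (_ , _ , b , y′ , e , m , t , x , G , _) = lin⊥ (ℓ ∷ δ y ∷ climb C b (δ y) ∷ y′ ∷ m ∷ []) (:≤ v0 v1 p ∷ :≤ v1 v2 (climb-≥ C b (δ y)) ∷ :≥ v2 v3 e ∷ :≤ (1+ (v3 ⊹ v4)) v0 (Geometry.y+m<ℓ A G) ∷ [])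
      up-one : ∀ {d st} → (∃ λ d′ → d ≡ 1 + d′ × Orbit z (δ y) d′ st) → Orbit z y d st
      up-one (d₁ , p , st′ , q , b , y′ , e , m , t , x , G , d′ , e′ , tab) = st′ , q , suc b , y′ , e , m , t , x , G , d′ , reorder⁻ (suc t * m) b d′ p e′ , tab
      by : Value A z y → Rest → ∃ λ f → Counts (Orbit z y) f × (∀ d → U δ z y M d ≡ (f ↑ M) d)
      by (rigid ng zero-𝕋) (f , c , e) = f ↑ 1 , counts-⇔ up-one down (counts-shift 1 c) , λ d → trans (e d) (trans (cong (_+ᶻ ((f ↑ 1) ↑ M) d) (zero-𝕋 M d)) (ℤP.+-identityˡ _))
        where
        down : ∀ {d st} → Orbit z y d st → ∃ λ d′ → d ≡ 1 + d′ × Orbit z (δ y) d′ st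
        down (st′ , q , zero , _ , refl , m , t , x , G , _) = ⊥-elim (ng m t x _ G)
        down (st′ , q , suc b , y′ , e , m , t , x , G , d′ , e′ , tab) = suc t * m + b + d′ , reorder (suc t * m) b d′ e′ , st′ , q , b , y′ , e , m , t , x , G , d′ , refl , tab
      by (removable m t x G eval) (f , c , e) = combine (ih (lower-CoreOf C G) z≤ℓ)
        where
        s = suc t * m
        Here : ℕ → Stack → Set
        Here d st = ∃ λ st′ → st ≡ (suc z , κ) ∷ st′ × ∃ λ d′ → d ≡ s + d′ × Tab k η M z (lower C G) d′ st′
        Later : ℕ → Stack → Set
        Later d st = ∃ λ d′ → d ≡ 1 + d′ × Orbit z (δ y) d′ st
        disjoint : ∀ {d st} → Here d st → Later d st → ⊥
        disjoint (st′ , p , d′ , _ , tab) (_ , _ , st″ , p′ , b , y′ , e , m′ , t′ , x′ , G′ , d″ , _ , tab′) =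
          lower-distinct C G G′ (≤-trans (climb-≥ C b (δ y)) (≤-reflexive (sym e)))
            (trans (sym (Tab-source η M st′ tab)) (trans (cong source (∷-inj {z} (trans (sym p) p′))) (Tab-source η M st″ tab′)))
        to : ∀ {d st} → Here d st ⊎ Later d st → Orbit z y d st
        to (inj₁ (st′ , p , d′ , e , tab)) = st′ , p , 0 , y , refl , m , t , x , G , d′ , trans e (cong (_+ d′) (sym (+-identityʳ s))) , tab
        to (inj₂ l) = up-one l
        from : ∀ {d st} → Orbit z y d st → Here d st ⊎ Later d st
        from {d} (st′ , q , zero , _ , refl , m′ , t′ , x′ , G′ , d′ , e′ , tab) = inj₁ (st′ , q , d′ , same (lower-unique C G G′))
          where
          same : m ≡ m′ × t ≡ t′ × lower C G ≡ lower C G′ → d ≡ s + d′ × Tab k η M z (lower C G) d′ st′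
          same (a , b , c) = trans e′ (cong (_+ d′) (trans (+-identityʳ (suc t′ * m′)) (cong₂ (λ t m → suc t * m) (sym b) (sym a)))) , subst (λ τ → Tab k η M z τ d′ st′) (sym c) tab
        from (st′ , q , suc b , y′ , e , m , t , x , G , d′ , e′ , tab) = inj₂ (suc t * m + b + d′ , reorder (suc t * m) b d′ e′ , st′ , q , b , y′ , e , m , t , x , G , d′ , refl , tab)
        combine : Claim k ℓ η M z (lower C G) (lam δ y m x) → ∃ λ f → Counts (Orbit z y) f × (∀ d → U δ z y M d ≡ (f ↑ M) d)
        combine (g , cg , eg) = (λ d → (g ↑ s) d +ᶻ (f ↑ 1) d) ,
          counts-⇔ to from (counts-⊎ disjoint (counts-map ((suc z , κ) ∷_) (∷-inj {z}) (counts-shift s cg)) (counts-shift 1 c)) ,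
          λ d → trans (e d) (trans (cong (_+ᶻ ((f ↑ 1) ↑ M) d) (trans (eval M d) (trans (↑-cong s eg d) (↑-swap g M s d)))) (sym (↑-⊕ (g ↑ s) (f ↑ 1) M d)))

    -- Tableaux whose last mark is `suc z` belong to the ghost root `(ℓ , z)`, those with a larger
    -- one to the remaining ghost roots. At `z = ℓ` both sides vanish: marks do not exceed `ℓ`, and
    -- there is no ghost root left.
    peel : ∀ o z → z + o ≡ ℓ → Claim k ℓ η (suc M) z κ δ
    peel zero z e = (λ _ → 0ℤ) , counts-none (λ {d} {st} → empty st) ,
      λ d → trans (cong (λ z → 𝕋 (upd δ ℓ z) (suc M) d) (trans (sym (+-identityʳ z)) e)) (trans (ghost-stuck δ M d) (sym (↑-zero (suc M) (λ _ → refl) d)))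
      where
      empty : ∀ {d} st → Tab k η (suc M) z κ d st → ⊥
      empty (_ ∷ st) (_ , z′ , refl , p , τ , mc , _) = lin⊥ (ℓ ∷ z ∷ z′ ∷ []) (:≥ v0 (v1 ⊹ #0) e ∷ :≤ v1 v2 p ∷ :≤ (1+ v2) v0 (mark-< C mc) ∷ [])
    peel (suc o) z e = by (peel o (suc z) (trans (sym (+-suc z o)) e)) (orbit (<⇒≤ z<ℓ) ℓ (0 , refl) z<ℓ (m≤m+n ℓ z))
      where
      z<ℓ : z < ℓ
      z<ℓ = lin (z ∷ ℓ ∷ o ∷ []) (1+ v0) v1 (:≡ (v0 ⊹ 1+ v2) v1 e ∷ [])
      split : ∀ {d} st → Tab k η (suc M) z κ d st → Tab k η (suc M) (suc z) κ d st ⊎ Orbit z z d st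
      split {d} ((r , κ′) ∷ st) (refl , z′ , refl , p , τ , mc , d′ , e , tab) = [ (λ q → inj₁ (refl , z′ , refl , q , τ , mc , d′ , e , tab)) , (λ q → inj₂ (at q (marked-lower C mc))) ]′ (m≤n⇒m<n∨m≡n p)
        where
        at : z ≡ z′ → _ → Orbit z z d ((suc z′ , κ) ∷ st)
        at refl (y , m , t , x , G , refl , j , q , f) = st , refl , j , y , sym (trans (cong (climb C j) (suc-injective f)) (climb-level C G q)) , m , t , x , G , d′ ,
          trans e (cong (_+ d′) (trans (cong (λ r → coverSpin (lower C G) r κ) f) (lower-spin C G q))) , tab
      join : ∀ {d} st → Tab k η (suc M) (suc z) κ d st ⊎ Orbit z z d st → Tab k η (suc M) z κ d st
      join (_ ∷ st) (inj₁ (a , z′ , b , p , rest)) = a , z′ , b , <⇒≤ p , rest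
      join {d} _ (inj₂ (st , refl , j , y , f , m , t , x , G , d′ , e , tab)) = refl , z , refl , ≤-refl , lower C G , at (level-climb C G j f)
        where
        at : j ≤ t × level A y j ≡ z → MarkedCover k (lower C G) (suc z) κ × ∃ λ d′ → d ≡ coverSpin (lower C G) (suc z) κ + d′ × Tab k η M z (lower C G) d′ st
        at (q , g) = subst (λ z → MarkedCover k (lower C G) (suc z) κ) g (lower-marked C G q) , d′ ,
          trans e (cong (_+ d′) (sym (trans (cong (λ z → coverSpin (lower C G) (suc z) κ) (sym g)) (lower-spin C G q)))) , tab
      disjoint : ∀ {d} st → Tab k η (suc M) (suc z) κ d st → Orbit z z d st → ⊥
      disjoint (_ ∷ st) (_ , z′ , refl , p , _) (_ , refl , _) = <-irrefl refl p
      by : Claim k ℓ η (suc M) (suc z) κ δ → (∃ λ f → Counts (Orbit z z) f × (∀ d → U δ z z M d ≡ (f ↑ M) d)) → Claim k ℓ η (suc M) z κ δ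
      by (f , c , e₁) (g , cg , e₂) = (λ d → f d +ᶻ g d) , counts-⇔ (λ {d} {st} → join st) (λ {d} {st} → split st) (counts-⊎ (λ {d} {st} → disjoint st) c cg) ,
        λ d → trans (peel-ghost δ M z<ℓ d) (trans (cong₂ _+ᶻ_ (e₁ d) (trans (↑-cong 1 e₂ d) (↑-+ g M 1 d))) (sym (↑-⊕ f g (suc M) d)))

  -- Recursion on the blocks and on the number of steps left in the present one. When that is 0,
  -- `ghost-free` discards the ghost and `𝕋-snoc` turns the next variable into a new ghost at row 0,
  -- which leaves the marks of the new block unbounded from below.
  enumerate : ∀ {k ℓ} η M {κ δ} → CoreOf k ℓ κ δ → ∀ {z} → z ≤ ℓ → Claim k ℓ η M z κ δ
  enumerate {k} {ℓ} η (suc M) C {z} z≤ℓ = let o , e = m≤n⇒∃[o]m+o≡n z≤ℓ in Step.peel k ℓ η M (enumerate η M) C o z e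
  enumerate {k} {ℓ} (m ∷ η) zero {κ} {δ} C {z} z≤ℓ = by (enumerate η m C {0} z≤n)
    where
    by : Claim k ℓ η m 0 κ δ → Claim k ℓ (m ∷ η) zero z κ δ
    by (f , c , e) = f , c , λ d → trans (Peeling.ghost-free k ℓ (reverse (m ∷ η)) δ z≤ℓ d) (trans (cong (λ η → Peeling.𝕋 k ℓ η (upd δ ℓ ℓ) 0 d) (unfold-reverse m η))
      (trans (𝕋-snoc k ℓ (reverse η) m δ d) (trans (e (d + m)) (↑-cancel f m d))))
  enumerate {k} {ℓ} [] zero {κ} {δ} C {z} z≤ℓ = by κ C
    where
    by : ∀ κ → CoreOf k ℓ κ δ → Claim k ℓ [] zero z κ δ
    by []      C = δ₀ , single , λ d → trans (Peeling.ghost-free k ℓ [] δ z≤ℓ d) (𝕋-nil-empty k ℓ C refl d)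
      where
      single : Counts (Tab k [] zero z []) δ₀
      single zero    = 1 , card-one [] proj₁ (refl , refl , refl) , refl
      single (suc d) = 0 , card-none (λ { _ (_ , _ , ()) }) , refl
    by (a ∷ κ) C = (λ _ → 0ℤ) , counts-none (λ { (_ , () , _) }) , λ d → trans (Peeling.ghost-free k ℓ [] δ z≤ℓ d) (𝕋-nil-nonempty k ℓ C (λ ()) d)

-- The Catalan function of a partition as a value of `𝕋`.

module Catalan where
  open import Defs
  open Core
  open Straighten
  open Peel
  open Blocks using (unique-set-↭)
  open Grow using (∈-filterᵇ⁺; ∈-filterᵇ⁻)
  open Sums
  open Det
  open Expand
  open Schur
  open Linear
  open import Data.Bool using (Bool; if_then_else_; _∧_)
  open import Data.Bool.Properties using (T-∧; T?)
  open import Data.Nat using (ℕ; zero; suc; _+_; _∸_; _≤_; _<_; z≤n; s≤s; _<ᵇ_)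
  open import Data.Nat.Properties
  open import Data.Integer using (ℤ; +_; 0ℤ; 1ℤ) renaming (_+_ to _+ᶻ_; _*_ to _*ᶻ_; -_ to -ᶻ_; _-_ to _-ᶻ_)
  import Data.Integer.Properties as ℤP
  open import Data.Integer.Tactic.RingSolver using (solve-∀)
  open import Data.Fin as Fin using (Fin; toℕ; punchIn)
  import Data.Fin.Properties as FinP
  open import Data.List using (List; []; _∷_; map; upTo; cartesianProduct; allFin; tabulate)
  open import Data.List.Membership.Propositional using (_∈_)
  open import Data.List.Membership.Propositional.Properties using (∈-map⁺; ∈-map⁻; ∈-cartesianProduct⁺)
  open import Data.List.Relation.Unary.All using ([]; _∷_)
  import Data.List.Relation.Unary.Unique.Propositional.Properties as UniqueP
  open import Data.List.Relation.Binary.Permutation.Propositional using (_↭_)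
  open import Data.Product using (_×_; _,_; proj₁; proj₂; ∃)
  open import Data.Sum using (inj₁; inj₂; [_,_]′)
  open import Data.Empty using (⊥-elim)
  open import Function using (_∘_)
  open import Function.Bundles using (Equivalence)
  open import Data.List.Properties using (map-∘; map-cong)
  open import Data.List.Membership.Propositional.Properties using (∈-allFin)
  open import Relation.Nullary.Decidable using (⌊_⌋)
  open import Relation.Nullary using (yes; no)
  open import Relation.Binary.PropositionalEquality

  det-cong : ∀ n {M N : Fin n → Fin n → Ser} → (∀ i j → M i j ≈ N i j) → det n M ≈ det n N
  det-cong zero    e η = refl
  det-cong (suc n) {M} {N} e η = trans (sumFin-eval (suc n) (λ j → scaleS (altSign (toℕ j)) (M Fin.zero j ⊛ det n (λ i j′ → M (Fin.suc i) (punchIn j j′)))) η) (trans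
    (sumFℤ-cong (suc n) λ j → cong (altSign (toℕ j) *ᶻ_) (⊛-cong (e Fin.zero j) (det-cong n λ i j′ → e (Fin.suc i) (punchIn j j′)) η))
    (sym (sumFin-eval (suc n) (λ j → scaleS (altSign (toℕ j)) (N Fin.zero j ⊛ det n (λ i j′ → N (Fin.suc i) (punchIn j j′)))) η)))

  ⊞[]-at : ∀ γ n i j x → (γ ⊞[ n ] (i , j)) x ≡ γ x +ᶻ (+ n *ᶻ unit i x -ᶻ + n *ᶻ unit j x)
  ⊞[]-at γ zero    i j x = sym (trans (cong₂ (λ a b → γ x +ᶻ (a -ᶻ b)) (ℤP.*-zeroˡ (unit i x)) (ℤP.*-zeroˡ (unit j x))) (ℤP.+-identityʳ (γ x)))
  ⊞[]-at γ (suc n) i j x = trans (⊞[]-at (γ ⊞ (i , j)) n i j x) (collect (γ x) (+ n) (unit i x) (unit j x))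
    where
    collect : ∀ g n a b → (g +ᶻ (a -ᶻ b)) +ᶻ (n *ᶻ a -ᶻ n *ᶻ b) ≡ g +ᶻ ((1ℤ +ᶻ n) *ᶻ a -ᶻ (1ℤ +ᶻ n) *ᶻ b)
    collect = solve-∀

  toℕ² : ∀ {ℓ} → Fin ℓ × Fin ℓ → Root
  toℕ² (i , j) = toℕ i , toℕ j

  module _ (ℓ : ℕ) (η : List ℕ) where
    private
      X : Weight → ℤ
      X γ = D ℓ (jacobiTrudi 0 γ toℕ) η

      schur-D : ∀ {g : Fin ℓ → ℤ} {γ : Weight} → (∀ i → g i ≡ γ (toℕ i)) → schur ℓ g η ≡ X γ
      schur-D e = det-cong ℓ (λ i j ξ → cong (λ z → hS ((z +ᶻ + toℕ j) -ᶻ + toℕ i) ξ) (e i)) η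

      indicator-unit : ∀ n (i x : Fin ℓ) → (if ⌊ x Fin.≟ i ⌋ then + n else + 0) ≡ + n *ᶻ unit (toℕ i) (toℕ x)
      indicator-unit n i x with x Fin.≟ i
      ... | yes refl = sym (trans (cong (+ n *ᶻ_) (unit-same (toℕ i))) (ℤP.*-identityʳ (+ n)))
      ... | no ne    = sym (trans (cong (+ n *ᶻ_) (unit-other λ q → ne (sym (FinP.toℕ-injective q)))) (ℤP.*-zeroʳ (+ n)))

    -- `shifts` runs through the exponent of each root explicitly; this is the convolution form
    -- `E-conv` of the recursion defining `E`.
    catalanCoeff-E : ∀ Ψ d {g : Fin ℓ → ℤ} {γ : Weight} → (∀ i → g i ≡ γ (toℕ i)) → catalanCoeff ℓ Ψ g d η ≡ E (lift X) (map toℕ² Ψ) d γ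
    catalanCoeff-E [] zero    {g} {γ} e = trans (ℤP.+-identityʳ _) (schur-D {λ x → g x +ᶻ 0ℤ} {γ} λ i → trans (ℤP.+-identityʳ (g i)) (e i))
    catalanCoeff-E [] (suc d) e = refl
    catalanCoeff-E ((i , j) ∷ Ψ) d {g} {γ} e = trans (sumℤ-concatMap (λ δ → schur ℓ (λ x → g x +ᶻ δ x) η) (λ n → map (λ v x → v x +ᶻ rootVec n i j x) (shifts Ψ (d ∸ n))) (upTo (suc d)))
      (trans (cong sumℤ (map-cong inner (upTo (suc d)))) (trans (sumℤ-upTo (λ n b → E (lift X) (map toℕ² Ψ) b (γ ⊞[ n ] (toℕ i , toℕ j))) d) (sym (E-conv (lift X) (toℕ i , toℕ j) (map toℕ² Ψ) d γ))))
      where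
      move : ∀ g v r → g +ᶻ (v +ᶻ r) ≡ (g +ᶻ r) +ᶻ v
      move = solve-∀
      inner : ∀ n → sumℤ (map (λ δ → schur ℓ (λ x → g x +ᶻ δ x) η) (map (λ v x → v x +ᶻ rootVec n i j x) (shifts Ψ (d ∸ n)))) ≡ E (lift X) (map toℕ² Ψ) (d ∸ n) (γ ⊞[ n ] (toℕ i , toℕ j))
      inner n = trans (cong sumℤ (trans (sym (map-∘ (shifts Ψ (d ∸ n)))) (map-cong (λ v → det-cong ℓ (λ a b ξ → cong (λ z → hS ((z +ᶻ + toℕ b) -ᶻ + toℕ a) ξ) (move (g a) (v a) (rootVec n i j a))) η) (shifts Ψ (d ∸ n)))))
        (catalanCoeff-E Ψ (d ∸ n) {λ x → g x +ᶻ rootVec n i j x} λ x → trans (cong₂ _+ᶻ_ (e x) (cong₂ _-ᶻ_ (indicator-unit n i x) (indicator-unit n j x))) (sym (⊞[]-at γ n (toℕ i) (toℕ j) (toℕ x))))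

  part-tabulate : ∀ {ℓ} (μ : Fin ℓ → ℕ) i → part (tabulate μ) (suc (toℕ i)) ≡ μ i
  part-tabulate μ Fin.zero    = refl
  part-tabulate μ (Fin.suc i) = part-tabulate (μ ∘ Fin.suc) i

  part-tabulate-≥ : ∀ {ℓ} (μ : Fin ℓ → ℕ) {r} → ℓ ≤ r → part (tabulate μ) (suc r) ≡ 0
  part-tabulate-≥ {zero}  μ p       = refl
  part-tabulate-≥ {suc ℓ} μ (s≤s p) = part-tabulate-≥ (μ ∘ Fin.suc) p

  module _ {k ℓ : ℕ} (μ : Fin ℓ → ℕ) (par : IsParKℓ k ℓ μ) where
    private
      v : ℕ → ℕ
      v r = part (tabulate μ) (suc r)

      at : ∀ {r} → r < ℓ → ∃ λ i → toℕ i ≡ r × v r ≡ μ i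
      at p = Fin.fromℕ< p , FinP.toℕ-fromℕ< p , trans (cong v (sym (FinP.toℕ-fromℕ< p))) (part-tabulate μ (Fin.fromℕ< p))

      v≤k : ∀ r → v r ≤ k
      v≤k r = [ (λ p → let i , _ , e = at p in ≤-trans (≤-reflexive e) (proj₁ par i)) , (λ p → ≤-trans (≤-reflexive (part-tabulate-≥ μ p)) z≤n) ]′ (<-≤-connex r ℓ)

      v-antitone : ∀ r → v (suc r) ≤ v r
      v-antitone r = [ (λ p → both (at (<-trans (n<1+n r) p)) (at p)) , (λ p → ≤-trans (≤-reflexive (part-tabulate-≥ μ p)) z≤n) ]′ (<-≤-connex (suc r) ℓ)
        where
        both : (∃ λ i → toℕ i ≡ r × v r ≡ μ i) → (∃ λ i → toℕ i ≡ suc r × v (suc r) ≡ μ i) → v (suc r) ≤ v r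
        both (i , p , e) (j , q , f) = ≤-trans (≤-reflexive f) (≤-trans (proj₂ par i j (≤-trans (≤-reflexive p) (≤-trans (n≤1+n r) (≤-reflexive (sym q))))) (≤-reflexive (sym e)))

    offset : ℕ → ℕ
    offset r = suc k + r ∸ part (tabulate μ) (suc r)

    offset-spec : ∀ r → offset r + part (tabulate μ) (suc r) ≡ suc k + r
    offset-spec r = m∸n+n≡m (≤-trans (v≤k r) (≤-trans (n≤1+n k) (m≤m+n (suc k) r)))

    offset-Adm : Adm k ℓ offset
    offset-Adm = adm offset v offset-spec v≤k v-antitone (part-tabulate-≥ μ)
      where
      adm : ∀ (σ v : ℕ → ℕ) → (∀ r → σ r + v r ≡ suc k + r) → (∀ r → v r ≤ k) → (∀ r → v (suc r) ≤ v r) → (∀ {r} → ℓ ≤ r → v r ≡ 0) → Adm k ℓ σ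
      adm σ v spec le anti end = record
        { mono = λ r → lin (σ r ∷ σ (suc r) ∷ v r ∷ r ∷ k ∷ v (suc r) ∷ []) (1+ v0) v1 (:≡ (v0 ⊹ v2) (1+ v4 ⊹ v3) (spec r) ∷ :≥ (1+ v4 ⊹ 1+ v3) (v1 ⊹ v5) (spec (suc r)) ∷ :≤ v5 v2 (anti r) ∷ [])
        ; lo   = λ r → lin (r ∷ σ r ∷ k ∷ v r ∷ []) (1+ v0) v1 (:≥ (1+ v2 ⊹ v0) (v1 ⊹ v3) (spec r) ∷ :≤ v3 v2 (le r) ∷ [])
        ; hi   = λ r → lin (σ r ∷ r ∷ k ∷ v r ∷ []) v0 (1+ v2 ⊹ v1) (:≡ (v0 ⊹ v3) (1+ v2 ⊹ v1) (spec r) ∷ [])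
        ; tail = λ {r} p → (lin≡ (σ r ∷ r ∷ k ∷ v r ∷ []) v0 (1+ v2 ⊹ v1) (:≡ (v0 ⊹ v3) (1+ v2 ⊹ v1) (spec r) ∷ :≥ #0 v3 (end p) ∷ [])) }

    module _ (η : List ℕ) where
      open Peeling k ℓ η
      private
        X : Weight → ℤ
        X γ = D ℓ (jacobiTrudi 0 γ toℕ) η
        σ = upd offset ℓ ℓ

        X-respects : Respects (lift X)
        X-respects zero    {γ} {γ′} e = D-respects {γ} {γ′} λ {x} _ → e x
        X-respects (suc d) e = refl

        inΔ : Fin ℓ × Fin ℓ → Bool
        inΔ p = (toℕ (proj₁ p) <ᵇ toℕ (proj₂ p)) ∧ (((k ∸ μ (proj₁ p)) + toℕ (proj₁ p)) <ᵇ toℕ (proj₂ p))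

        offset-row : ∀ i → offset (toℕ i) ≡ suc (k ∸ μ i + toℕ i)
        offset-row i = solve-for (offset-spec (toℕ i)) (part-tabulate μ i) (m∸n+n≡m (proj₁ par i))
          where
          solve-for : ∀ {s p m q x} → s + p ≡ suc k + x → p ≡ m → q + m ≡ k → s ≡ suc (q + x)
          solve-for {s} {p} {m} {q} {x} a b c = lin≡ (s ∷ x ∷ q ∷ p ∷ k ∷ m ∷ []) v0 (1+ (v2 ⊹ v1)) (:≡ (v0 ⊹ v3) (1+ v4 ⊹ v1) a ∷ :≥ v5 v3 b ∷ :≥ v4 (v2 ⊹ v5) c ∷ [])

        -- By `offset-row` the condition `k - μ i + i < j` is `offset i ≤ j`, and it entails
        -- `i < j`. The ghost sits at `ℓ` and contributes no root.
        Δ-Roots : map toℕ² (Δk k ℓ μ) ↭ Roots σ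
        Δ-Roots = unique-set-↭ (UniqueP.map⁺ inj (UniqueP.filter⁺ (T? ∘ inΔ) (UniqueP.cartesianProduct⁺ (UniqueP.allFin⁺ ℓ) (UniqueP.allFin⁺ ℓ)))) (Roots-unique σ) to from
          where
          inj : ∀ {p q : Fin ℓ × Fin ℓ} → toℕ² p ≡ toℕ² q → p ≡ q
          inj {i , j} {a , b} e = cong₂ _,_ (FinP.toℕ-injective (cong proj₁ e)) (FinP.toℕ-injective (cong proj₂ e))
          to : ∀ {x} → x ∈ map toℕ² (Δk k ℓ μ) → x ∈ Roots σ
          to m with ∈-map⁻ toℕ² m
          ... | (i , j) , q , refl = ∈-Roots⁺ {σ} (<⇒≤ (FinP.toℕ<n i)) (FinP.toℕ<n j)
            (≤-trans (≤-reflexive (trans (upd-other offset (<⇒≢ (FinP.toℕ<n i))) (offset-row i))) (<ᵇ⇒< (k ∸ μ i + toℕ i) (toℕ j) (proj₂ (Equivalence.to (T-∧ {toℕ i <ᵇ toℕ j}) (proj₂ (∈-filterᵇ⁻ inΔ {xs = cartesianProduct (allFin ℓ) (allFin ℓ)} q))))))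
          from : ∀ {x} → x ∈ Roots σ → x ∈ map toℕ² (Δk k ℓ μ)
          from {a , b} m = by (∈-Roots⁻ {σ} m)
            where
            by : a ≤ ℓ × b < ℓ × σ a ≤ b → (a , b) ∈ map toℕ² (Δk k ℓ μ)
            by (p , q , r) with m≤n⇒m<n∨m≡n p
            ... | inj₂ refl = ⊥-elim (<⇒≱ q (≤-trans (≤-reflexive (sym (upd-same offset ℓ ℓ))) r))
            ... | inj₁ lt   = subst (_∈ map toℕ² (Δk k ℓ μ)) (cong₂ _,_ (FinP.toℕ-fromℕ< lt) (FinP.toℕ-fromℕ< q))
              (∈-map⁺ toℕ² {i , j} (∈-filterᵇ⁺ inΔ (∈-cartesianProduct⁺ (∈-allFin i) (∈-allFin j))
                (Equivalence.from (T-∧ {toℕ i <ᵇ toℕ j}) (<⇒<ᵇ (≤-trans (s≤s (m≤n+m (toℕ i) (k ∸ μ i))) far) , <⇒<ᵇ far))))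
              where
              i = Fin.fromℕ< lt
              j = Fin.fromℕ< q
              far : k ∸ μ i + toℕ i < toℕ j
              far = ≤-trans (≤-reflexive (trans (sym (offset-row i)) (trans (cong offset (FinP.toℕ-fromℕ< lt)) (sym (upd-other offset (<⇒≢ lt)))))) (≤-trans r (≤-reflexive (sym (FinP.toℕ-fromℕ< q))))

      -- With `M = 0` and no ghost roots the exponent of the ghost is always 0, so `indicator`
      -- accepts every term.
      catalanCoeff-𝕋 : ∀ d → catalanCoeff ℓ (Δk k ℓ μ) (λ i → + μ i) d η ≡ 𝕋 (upd offset ℓ ℓ) 0 d
      catalanCoeff-𝕋 d = trans (catalanCoeff-E ℓ η (Δk k ℓ μ) d {λ i → + μ i} {wt σ 0} entries) (trans (E-↭ X-respects Δ-Roots d (wt σ 0))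
        (sym (E-agree (λ γ → γ ℓ ≡ 0ℤ) (ghost-closed offset 0ℤ) ghostless d (wt-ghost {σ} {0}))))
        where
        ghostless : ∀ d {γ} → γ ℓ ≡ 0ℤ → G d γ ≡ lift X d γ
        ghostless zero    {γ} e = cong (λ b → indicator b (X γ)) e
        ghostless (suc d) e = refl
        cancel : ∀ s p → (s +ᶻ p) -ᶻ s ≡ p
        cancel = solve-∀
        entries : ∀ i → + μ i ≡ wt σ 0 (toℕ i)
        entries i = sym (trans (wt-row i≢ℓ) (trans (cong₂ (λ a b → + a -ᶻ + b) (sym (offset-spec (toℕ i))) (upd-other offset i≢ℓ)) (trans (cancel (+ offset (toℕ i)) (+ v (toℕ i))) (cong +_ (part-tabulate μ i)))))
          where
          i≢ℓ : toℕ i ≢ ℓ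
          i≢ℓ = <⇒≢ (FinP.toℕ<n i)

-- Tableaux as chains and as stacks.

module Tableaux where
  open import Defs
  open Core
  open Straighten
  open Peel
  open Count
  open Catalan
  open MarkedCovers
  open Linear
  open import Data.Bool using (T)
  open import Data.Nat using (ℕ; zero; suc; _+_; _≤_; z≤n; s≤s; _≥_)
  open import Data.Nat.Properties
  open import Data.Integer using (+_)
  open import Data.Fin using (Fin)
  open import Data.List using (List; []; _∷_; map; length; reverse; _ʳ++_; take; drop; tabulate; applyUpTo)
  open import Data.List.Relation.Unary.All using ([]; _∷_)
  open import Data.Product using (Σ; _×_; _,_; proj₁; proj₂; ∃)
  open import Function using (_∘_)
  open import Data.List.Properties using (reverse-involutive; reverse-injective; length-tabulate)
  open import Data.List.Relation.Unary.Linked as Linked using (Linked)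
  open import Data.Nat.ListAction using (sum)
  open import Data.Unit using (⊤; tt)
  open Rows using (Σ<; Σ<-cong; Σ<-+)
  open import Relation.Binary.PropositionalEquality

  part-applyUpTo : ∀ h {N} → (∀ {r} → N ≤ r → h r ≡ 0) → ∀ r → part (applyUpTo h N) (suc r) ≡ h r
  part-applyUpTo h {zero}  z r       = sym (z z≤n)
  part-applyUpTo h {suc N} z zero    = refl
  part-applyUpTo h {suc N} z (suc r) = part-applyUpTo (h ∘ suc) (λ p → z (s≤s p)) r

  part-zero : ∀ κ → part κ 0 ≡ 0
  part-zero []      = refl
  part-zero (x ∷ κ) = refl

  part-𝔭 : ∀ k κ r → part (𝔭 k κ) (suc r) ≡ pRow k κ (suc r)
  part-𝔭 k κ = part-applyUpTo (λ i → pRow k κ (suc i)) (pRow-≥length k κ)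

  part≤sum : ∀ κ r → part κ r ≤ sum κ
  part≤sum []      r             = z≤n
  part≤sum (x ∷ κ) zero          = z≤n
  part≤sum (x ∷ κ) (suc zero)    = m≤m+n x (sum κ)
  part≤sum (x ∷ κ) (suc (suc r)) = ≤-trans (part≤sum κ (suc r)) (m≤n+m (sum κ) x)

  sum-parts : ∀ κ → sum κ ≡ Σ< (length κ) (λ r → part κ (suc r))
  sum-parts []          = refl
  sum-parts (x ∷ [])    = refl
  sum-parts (x ∷ y ∷ κ) = cong (λ s → x + s) (sum-parts (y ∷ κ))

  -- A core is determined by its offset function; the sum of the two lengths serves as a common
  -- number of rows.
  core-ext : ∀ {k κ κ′} → IsCore k κ → IsCore k κ′ → (∀ r → pRow k κ (suc r) ≡ pRow k κ′ (suc r)) → κ ≡ κ′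
  core-ext {k} {κ} {κ′} c c′ e = by (core-CoreOf {ℓ = length κ + length κ′} c (m≤m+n (length κ) (length κ′))) (core-CoreOf c′ (m≤n+m (length κ′) (length κ)))
    where
    by : ∃ (CoreOf k (length κ + length κ′) κ) → ∃ (CoreOf k (length κ + length κ′) κ′) → κ ≡ κ′
    by (σ , C) (σ′ , C′) = CoreOf-unique (CoreOf-≗ (λ r → +-cancelˡ-≡ (pRow k κ′ (suc r)) (σ r) (σ′ r)
      (trans (cong (_+ σ r) (sym (e r))) (trans (pRow-CoreOf C r) (sym (pRow-CoreOf C′ r))))) C) C′

  empty-core : ∀ k → IsCore k []
  empty-core k = CoreOf-core (empty-CoreOf k 0)

  weight-zero : ∀ {k κ} → IsCore k κ → sum (𝔭 k κ) ≡ 0 → κ ≡ []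
  weight-zero {k} {κ} c e = core-ext c (empty-core k) λ r → n≤0⇒n≡0 (≤-trans (≤-reflexive (sym (part-𝔭 k κ r))) (≤-trans (part≤sum (𝔭 k κ) (suc r)) (≤-reflexive e)))

  chain-weight : ∀ {k} κ st → ChainOK k κ st → sum (𝔭 k κ) + length st ≡ sum (𝔭 k (final κ st))
  chain-weight {k} κ []             c              = +-identityʳ _
  chain-weight {k} κ ((r , κ′) ∷ st) (((_ , _ , _ , w) , _) , c) = trans (sym (+-assoc (sum (𝔭 k κ)) 1 (length st))) (trans (cong (_+ length st) w) (chain-weight κ′ st c))

  chain-source : ∀ {k} κ st → ChainOK k κ st → IsCore k κ
  chain-source κ []       c                      = c
  chain-source κ (_ ∷ st) (((c , _) , _) , _)    = c

  chain-final : ∀ {k} κ st → ChainOK k κ st → IsCore k (final κ st)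
  chain-final κ []              c       = c
  chain-final κ ((r , κ′) ∷ st) (_ , c) = chain-final κ′ st c

  Below : ℕ → List ℕ → Set
  Below b []      = ⊤
  Below b (x ∷ _) = x ≤ b

  below-cons : ∀ {b xs} → Below b xs → Linked _≥_ xs → Linked _≥_ (b ∷ xs)
  below-cons {xs = []}     p l = Linked.[-]
  below-cons {xs = x ∷ xs} p l = p Linked.∷ l

  below-head : ∀ {b xs} → Linked _≥_ (b ∷ xs) → Below b xs
  below-head Linked.[-]     = tt
  below-head (p Linked.∷ _) = p

  linked-tail : ∀ {b xs} → Linked _≥_ (b ∷ xs) → Linked _≥_ xs
  linked-tail Linked.[-]     = Linked.[]
  linked-tail (_ Linked.∷ l) = l

  marks : Stack → List ℕ
  marks = map proj₁

  Tab-weaken : ∀ {k} η m {z z₂ κ d} st → z₂ ≤ z → Tab k η m z κ d st → Tab k η m z₂ κ d st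
  Tab-weaken []      zero    st      le p = p
  Tab-weaken (m ∷ η) zero    st      le p = p
  Tab-weaken η       (suc m) (_ ∷ st) le (e , z′ , r , p , rest) = e , z′ , r , ≤-trans le p , rest

  module _ (k : ℕ) where
    -- The chain is read forwards and pushed onto the stack, hence the reversed lists. In
    -- `chain-block`, `i` steps of the present block are already on the stack and `e` are still to
    -- come.
    chain-blocks : ∀ η done {κ d} st steps → Tab k done 0 0 κ d st → ChainOK k κ steps → BlocksOK η (marks steps) → length steps ≡ sum η →
      Tab k (η ʳ++ done) 0 0 (final κ steps) (d + chainSpin κ steps) (steps ʳ++ st)
    chain-block : ∀ e i η done z {κ d} st steps → Tab k done i z κ d st → ChainOK k κ steps → Linked _≥_ (take e (marks steps)) → Below (suc z) (take e (marks steps)) →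
      BlocksOK η (drop e (marks steps)) → length steps ≡ e + sum η → Tab k (η ʳ++ (e + i ∷ done)) 0 0 (final κ steps) (d + chainSpin κ steps) (steps ʳ++ st)
    chain-blocks []      done {κ} {d} st []       tab c b len = subst (λ d → Tab k done 0 0 κ d st) (sym (+-identityʳ d)) tab
    chain-blocks (e ∷ η) done st steps tab c (l , b) len = subst (λ s → Tab k (η ʳ++ (s ∷ done)) 0 0 _ _ (steps ʳ++ st)) (+-identityʳ e)
      (chain-block e 0 η done (top (take e (marks steps))) st steps (Tab-start done tab) c l (below-top (take e (marks steps))) b len)
      where
      -- The first mark of a block is not bounded by earlier ones, so it is made its own bound; 0
      -- stands in for an empty block.
      top : List ℕ → ℕ
      top []      = 0
      top (x ∷ _) = x
      below-top : ∀ xs → Below (suc (top xs)) xs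
      below-top []      = tt
      below-top (x ∷ _) = n≤1+n x
      Tab-start : ∀ done {z κ d st} → Tab k done 0 0 κ d st → Tab k done 0 z κ d st
      Tab-start []         t = t
      Tab-start (m ∷ done) t = t
    chain-block zero    i η done z st steps tab c l p b len = chain-blocks η (i ∷ done) st steps (Tab-weaken done i st z≤n tab) c b len
    chain-block (suc e) i η done z {κ} {d} st ((suc z′ , κ′) ∷ steps) tab (mc , c) l p b len =
      subst₂ (λ s D → Tab k (η ʳ++ (s ∷ done)) 0 0 (final κ′ steps) D (steps ʳ++ ((suc z′ , κ′) ∷ st))) (+-suc e i) spins
        (chain-block e (suc i) η done z′ ((suc z′ , κ′) ∷ st) steps (refl , z′ , refl , ≤-refl , κ , mc , d , refl , Tab-weaken done i st (≤-pred p) tab) c (linked-tail l) (below-head l) b (suc-injective len))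
      where
      spins : coverSpin κ (suc z′) κ′ + d + chainSpin κ′ steps ≡ d + (coverSpin κ (suc z′) κ′ + chainSpin κ′ steps)
      spins = trans (cong (_+ chainSpin κ′ steps) (+-comm (coverSpin κ (suc z′) κ′) d)) (+-assoc d (coverSpin κ (suc z′) κ′) (chainSpin κ′ steps))
    chain-block (suc e) i η done z st ((zero , κ′) ∷ steps) tab ((_ , () , _) , c) l p b len

    IsChain : List ℕ → List ℕ → ℕ → Stack → Set
    IsChain η κ d steps = ChainOK k [] steps × length steps ≡ sum η × BlocksOK η (marks steps) × final [] steps ≡ κ × chainSpin [] steps ≡ d

    -- Pops the stack: `m` steps of the present block are still on it, and `e` have already been
    -- moved to the chain, whose next mark in this block is at most `suc z`.
    tab-chain : ∀ ηʳ m e z η {κ d} st steps → Tab k ηʳ m z κ d st → ChainOK k κ steps → Linked _≥_ (take e (marks steps)) → Below (suc z) (take e (marks steps)) →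
      BlocksOK η (drop e (marks steps)) → length steps ≡ e + sum η → IsChain (ηʳ ʳ++ (e + m ∷ η)) (final κ steps) (d + chainSpin κ steps) (st ʳ++ steps)
    tab-chain [] zero e z η st steps (refl , refl , refl) c l p b len = c , trans len (cong (_+ sum η) (sym (+-identityʳ e))) ,
      subst (λ e → BlocksOK (e ∷ η) (marks steps)) (sym (+-identityʳ e)) (l , b) , refl , refl
    tab-chain (m ∷ ηʳ) zero e z η {κ} {d} st steps tab c l p b len = subst (λ e′ → IsChain (ηʳ ʳ++ (m ∷ e′ ∷ η)) (final κ steps) (d + chainSpin κ steps) (st ʳ++ steps)) (sym (+-identityʳ e))
      (tab-chain ηʳ m 0 0 (e ∷ η) st steps tab c Linked.[] tt (l , b) len)
    tab-chain ηʳ (suc m) e z η {d = d} ((_ , κ) ∷ st) steps (refl , z′ , refl , le , τ , mc , d′ , refl , tab) c l p b len =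
      subst₂ (λ s D → IsChain (ηʳ ʳ++ (s ∷ η)) (final κ steps) D (st ʳ++ ((suc z′ , κ) ∷ steps))) (sym (+-suc e m)) spins
        (tab-chain ηʳ m (suc e) z′ η st ((suc z′ , κ) ∷ steps) tab (mc , c) (below-cons (raise (take e (marks steps)) p) l) ≤-refl b (cong suc len))
      where
      raise : ∀ xs → Below (suc z) xs → Below (suc z′) xs
      raise []       q = tt
      raise (x ∷ xs) q = ≤-trans q (s≤s le)
      spins : d′ + (coverSpin τ (suc z′) κ + chainSpin κ steps) ≡ coverSpin τ (suc z′) κ + d′ + chainSpin κ steps
      spins = trans (sym (+-assoc d′ (coverSpin τ (suc z′) κ) (chainSpin κ steps))) (cong (_+ chainSpin κ steps) (+-comm d′ (coverSpin τ (suc z′) κ)))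

  module _ {k ℓ : ℕ} (μ : Fin ℓ → ℕ) (par : IsParKℓ k ℓ μ) {κ : List ℕ} (C : CoreOf k ℓ κ (offset μ par)) (η : List ℕ) (d : ℕ) where
    private
      core-parts : ∀ r → pRow k κ (suc r) ≡ part (tabulate μ) (suc r)
      core-parts r = +-cancelʳ-≡ (offset μ par r) (pRow k κ (suc r)) (part (tabulate μ) (suc r)) (trans (pRow-CoreOf C r) (trans (sym (offset-spec μ par r)) (+-comm (offset μ par r) _)))

      core-weight : sum (𝔭 k κ) ≡ sum (tabulate μ)
      core-weight = trans (sym (weight-def k κ)) (+-cancelʳ-≡ (Σ< ℓ (offset μ par)) (weight k κ) (sum (tabulate μ)) (trans (weight-Σ C) (sym
        (trans (cong (_+ Σ< ℓ (offset μ par)) (trans (sum-parts (tabulate μ)) (cong (λ n → Σ< n (λ r → part (tabulate μ) (suc r))) (length-tabulate μ))))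
          (trans (sym (Σ<-+ ℓ (λ r → part (tabulate μ) (suc r)) (offset μ par))) (Σ<-cong ℓ λ r → trans (+-comm _ (offset μ par r)) (offset-spec μ par r)))))))

      Result : Stack → Set
      Result = Tab k (reverse η) 0 ℓ κ d

      re-zero : ∀ ηʳ {z z′ κ d st} → Tab k ηʳ 0 z κ d st → Tab k ηʳ 0 z′ κ d st
      re-zero []       t = t
      re-zero (m ∷ ηʳ) t = t

    term-tab : ∀ {T} → KSchurTerm k (tabulate μ) η d T → ∃ λ st → T ≡ ([] , reverse st) × Result st
    term-tab {κ₀ , steps} (total , (c , len , b , parts) , sp) = reverse steps , cong₂ _,_ source≡ (sym (reverse-involutive steps)) ,
      re-zero (reverse η) (subst₂ (λ κ d → Tab k (reverse η) 0 0 κ d (reverse steps)) target sp (chain-blocks k η [] [] steps (refl , source≡ , refl) c b len))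
      where
      target : final κ₀ steps ≡ κ
      target = core-ext (chain-final κ₀ steps c) (CoreOf-core C) λ r → trans (sym (part-𝔭 k (final κ₀ steps) r)) (trans (parts (suc r)) (sym (core-parts r)))
      -- The number of steps equals the size of the final core, so the initial core has size 0.
      source≡ : κ₀ ≡ []
      source≡ = weight-zero (chain-source κ₀ steps c) (+-cancelʳ-≡ (length steps) (sum (𝔭 k κ₀)) 0 (trans (chain-weight κ₀ steps c) (trans (cong (λ κ → sum (𝔭 k κ)) target) (trans core-weight (trans (sym total) (sym len))))))

    tab-term : ∀ {T} → (∃ λ st → T ≡ ([] , reverse st) × Result st) → KSchurTerm k (tabulate μ) η d T
    tab-term (st , refl , tab) = by (subst (λ η → IsChain k η κ d (reverse st)) (reverse-involutive η) (chained (reverse η) tab))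
      where
      chained : ∀ ηʳ → Tab k ηʳ 0 ℓ κ d st → IsChain k (reverse ηʳ) κ d (reverse st)
      chained []       (refl , refl , refl) = empty-core k , refl , tt , refl , refl
      chained (m ∷ ηʳ) t = subst (λ d → IsChain k (ηʳ ʳ++ (m ∷ [])) κ d (reverse st)) (+-identityʳ d) (tab-chain k ηʳ m 0 0 [] st [] t (CoreOf-core C) Linked.[] tt tt refl)
      by : IsChain k η κ d (reverse st) → KSchurTerm k (tabulate μ) η d ([] , reverse st)
      by (c , len , b , target , sp) = trans (sym len) (trans (chain-weight [] (reverse st) c) (trans (cong (λ κ → sum (𝔭 k κ)) target) core-weight)) ,
        (c , len , b , parts) , sp
        where
        parts : ∀ r → part (𝔭 k (final [] (reverse st))) r ≡ part (tabulate μ) r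
        parts zero    = trans (part-zero (𝔭 k (final [] (reverse st)))) (sym (part-zero (tabulate μ)))
        parts (suc r) = trans (cong (λ κ → part (𝔭 k κ) (suc r)) target) (trans (part-𝔭 k κ r) (core-parts r))

-- Comparison of the two coefficients.

open import Defs
open import Data.Nat using (ℕ; _≤_)
open import Data.Integer using (+_)
open import Data.Fin using (Fin)
open import Data.List using (List; tabulate)
open import Data.Product using (Σ; _×_)
open import Relation.Binary.PropositionalEquality using (_≡_)
open Catalan using (offset; offset-Adm; catalanCoeff-𝕋)
open Core using (CoreOf; CoreOf-exists)
open Count using (card-⇔; card-map; enumerate)
open Peel using (module Peeling)
open Straighten using (upd)
open Tableaux using (tab-term; term-tab)
open import Data.List using ([]; reverse)
open import Data.List.Properties using (reverse-involutive; reverse-injective)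
open import Data.Nat.Properties using (≤-refl)
open import Data.Product using (∃; _,_; proj₁; proj₂)
open import Relation.Binary.PropositionalEquality using (cong; sym; trans)

theorem2p4 : (k ℓ : ℕ) → 1 ≤ k → 1 ≤ ℓ → (μ : Fin ℓ → ℕ) → IsParKℓ k ℓ μ →
  (η : List ℕ) (d : ℕ) →
  Σ ℕ (λ n → HasCard (KSchurTerm k (tabulate μ) η d) n ×
              (+ n ≡ catalanCoeff ℓ (Δk k ℓ μ) (λ i → + μ i) d η))
theorem2p4 k ℓ _ _ μ par η d = by (CoreOf-exists ℓ (offset-Adm μ par))
  where
  by : (∃ λ κ → CoreOf k ℓ κ (offset μ par)) → _
  by (κ , C) = n , card-⇔ (tab-term μ par C η d) (term-tab μ par C η d) (card-map (λ st → [] , reverse st) (λ e → reverse-injective (cong proj₂ e)) card) ,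
    trans value (trans (sym (series d)) (trans (cong (λ η → Peeling.𝕋 k ℓ η (upd (offset μ par) ℓ ℓ) 0 d) (reverse-involutive η)) (sym (catalanCoeff-𝕋 μ par η d))))
    where
    -- Stacks list the blocks last one first, hence `reverse η`. No step of a block is pending, and
    -- the ghost is at `ℓ`, where it has no roots.
    claim = enumerate (reverse η) 0 C {ℓ} ≤-refl
    series = proj₂ (proj₂ claim)
    n = proj₁ (proj₁ (proj₂ claim) d)
    card = proj₁ (proj₂ (proj₁ (proj₂ claim) d))
    value = proj₂ (proj₂ (proj₁ (proj₂ claim) d))
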